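{- Let $p$ be a prime, $s \ge 1$, and $q=p^s$. Let $m$ and $\ell$ be positive integers. For each integer $r$ with $0 \le r \le m$, there exists a $(v,k_r,\lambda_r,\mu_r)$ partial difference set $D_r$ in the elementary abelian $p$-group $G=\mathbb{Z}_p^{sm(2\ell+1)}$, where \begin{align*} v &= q^{m(2\ell+1)},\\ k_r &= \frac{(q^r-1)(q^{m\ell}-1)(q^{m(\ell+1)}-1)}{q^m-1} + q^{m\ell}-1,\\ \lambda_r &= \frac{(q^r-1)(q^{m(\ell+1)}-1)}{q^m-1}\Big(\frac{(q^r-1)(q^{m\ell}-1)}{q^m-1}-1\Big) + q^{m\ell}-2,\\ \mu_r &= \frac{(q^r-1)(q^{m\ell}-1)}{q^m-1}\Big(\frac{(q^r-1)(q^{m(\ell+1)}-1)}{q^m-1}+1\Big). \end{align*} Consequently, the Cayley graph $\mathrm{Cay}(G,D_r)$ is a $(v,k_r,\lambda_r,\mu_r)$ strongly regular graph.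
   Context: Let $G$ be an additively written finite group of order $v$. A subset $D\subseteq G$ with $|D|=k$ and $0_G\notin D$ is a $(v,k,\lambda,\mu)$ partial difference set (PDS) if the differences $g-h$ with $g,h\in D$, $g\neq h$, represent each element of $D$ exactly $\lambda$ times and each nonidentity element of $G\setminus D$ exactly $\mu$ times. For $D\subseteq G$ with $0_G\notin D$ and $D=-D$, the Cayley graph $\mathrm{Cay}(G,D)$ has vertex set $G$, with $g,h$ adjacent iff $g-h\in D$. A $(v,k,\lambda,\mu)$ strongly regular graph is a $k$-regular simple graph on $v$ vertices in which any two adjacent vertices have exactly $\lambda$ common neighbours and any two distinct non-adjacent vertices have exactly $\mu$ common neighbours. -}

module Defs where

open import Data.Nat using (ℕ; zero; suc; _+_; _*_; _∸_; _^_)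
open import Data.Nat.DivMod using (_/_; _mod_)
open import Data.Fin using (Fin; toℕ)
import Data.Fin.Properties as FinP
open import Data.Vec using (Vec; []; _∷_; zipWith; map; replicate)
import Data.Vec.Properties as VecP
open import Data.Vec.Relation.Unary.All using (All)
open import Data.List using (List; []; _∷_; concatMap; allFin; length)
import Data.List as L
open import Data.Bool using (Bool; true; false; if_then_else_; _∧_; not)
open import Data.Product using (_×_; _,_)
open import Relation.Nullary using (¬_; does)
open import Relation.Binary.PropositionalEquality using (_≡_; _≢_)

-- Arithmetic: floor division with the convention x /' 0 = 0.
-- (Only ever used with a nonzero divisor q^m - 1, where the division is exact.)

_/'_ : ℕ → ℕ → ℕ
x /' zero  = zero
x /' suc d = x / suc d

addMod : ∀ {p} → Fin p → Fin p → Fin p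
addMod {suc k} a b = (toℕ a + toℕ b) mod suc k

negMod : ∀ {p} → Fin p → Fin p
negMod {suc k} a = (suc k ∸ toℕ a) mod suc k

G : ℕ → ℕ → Set
G p n = Vec (Fin p) n

_⊕_ : ∀ {p n} → G p n → G p n → G p n
_⊕_ = zipWith addMod

⊖_ : ∀ {p n} → G p n → G p n
⊖_ = map negMod

_⊖_ : ∀ {p n} → G p n → G p n → G p n
g ⊖ h = g ⊕ (⊖ h)

IsZero : ∀ {p n} → G p n → Set
IsZero x = All (λ a → toℕ a ≡ 0) x

elems : ∀ p n → List (G p n)
elems p zero    = [] ∷ []
elems p (suc n) = concatMap (λ x → L.map (x ∷_) (elems p n)) (allFin p)

_==_ : ∀ {p n} → G p n → G p n → Bool
g == h = does (VecP.≡-dec FinP._≟_ g h)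

countB : ∀ {A : Set} → (A → Bool) → List A → ℕ
countB P []       = 0
countB P (x ∷ xs) = if P x then suc (countB P xs) else countB P xs

Subset : ℕ → ℕ → Set
Subset p n = G p n → Bool

card : ∀ {p n} → Subset p n → ℕ
card {p} {n} D = countB D (elems p n)

diffCount : ∀ {p n} → Subset p n → G p n → ℕ
diffCount {p} {n} D x =
  countB (λ gh → let g = Data.Product.proj₁ gh ; h = Data.Product.proj₂ gh in
                 D g ∧ D h ∧ not (g == h) ∧ ((g ⊖ h) == x))
         (L.cartesianProduct (elems p n) (elems p n))
  where import Data.Product

record IsPDS {p n : ℕ} (D : Subset p n) (v k lam mu : ℕ) : Set where
  field
    order     : length (elems p n) ≡ v
    zero∉D    : ∀ x → IsZero x → D x ≡ false
    size      : card D ≡ k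
    inD       : ∀ x → D x ≡ true → diffCount D x ≡ lam
    notInD    : ∀ x → ¬ IsZero x → D x ≡ false → diffCount D x ≡ mu

Symmetric : ∀ {p n} → Subset p n → Set
Symmetric D = ∀ x → D (⊖ x) ≡ D x

record IsSRG {p n : ℕ} (adj : G p n → G p n → Bool) (v k lam mu : ℕ) : Set where
  field
    order      : length (elems p n) ≡ v
    irreflexive : ∀ x → adj x x ≡ false
    symmetric  : ∀ x y → adj x y ≡ adj y x
    regular    : ∀ x → countB (adj x) (elems p n) ≡ k
    adjCommon  : ∀ x y → adj x y ≡ true →
                 countB (λ z → adj x z ∧ adj y z) (elems p n) ≡ lam
    nonadjCommon : ∀ x y → x ≢ y → adj x y ≡ false →
                 countB (λ z → adj x z ∧ adj y z) (elems p n) ≡ mu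

Cay : ∀ {p n} → Subset p n → G p n → G p n → Bool
Cay D g h = D (g ⊖ h)

vR : (q m ℓ : ℕ) → ℕ
vR q m ℓ = q ^ (m * (2 * ℓ + 1))

kR : (q m ℓ r : ℕ) → ℕ
kR q m ℓ r = ((q ^ r ∸ 1) * (q ^ (m * ℓ) ∸ 1) * (q ^ (m * (ℓ + 1)) ∸ 1)) /' (q ^ m ∸ 1)
             + (q ^ (m * ℓ) ∸ 1)

λR : (q m ℓ r : ℕ) → ℕ
λR q m ℓ r = (((q ^ r ∸ 1) * (q ^ (m * (ℓ + 1)) ∸ 1)) /' (q ^ m ∸ 1))
             * ((((q ^ r ∸ 1) * (q ^ (m * ℓ) ∸ 1)) /' (q ^ m ∸ 1)) ∸ 1)
             + (q ^ (m * ℓ) ∸ 2)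

μR : (q m ℓ r : ℕ) → ℕ
μR q m ℓ r = (((q ^ r ∸ 1) * (q ^ (m * ℓ) ∸ 1)) /' (q ^ m ∸ 1))
             * ((((q ^ r ∸ 1) * (q ^ (m * (ℓ + 1)) ∸ 1)) /' (q ^ m ∸ 1)) + 1)

module Submission where

-- Let K = 𝔽_Q with Q = q^m, let L and E be its extensions of degrees ℓ and ℓ + 1, and let R ⊆ K be
-- an 𝔽_p-subspace of order q^r.  The difference set is
--   D = {(x , y) ∈ L × E : x ≠ 0, N(y)/N(x) ∈ R}.
-- It is stable under 𝔽_p*, so its eigenvalues can be computed with the integer-valued sum e of all
-- nontrivial characters of 𝔽_p.  Expanding the indicator of R over its annihilator, an eigenvalue
-- becomes a sum over τ of the sums Σ e(Tr(αx) + Tr(βy) + τ N(y)/N(x)).  These collapse thanks to the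
-- Hasse–Davenport relation between the degrees ℓ and ℓ + 1, used in counting form: for b ≠ 0,
--   #{y ∈ E : Tr y = a, N y = b} + #{(x , t) ∈ L × K : Tr x + t = a, N(x) t = b}
-- does not depend on a and b.  That in turn is Newton's identity for the monic polynomials over K
-- (unique factorisation in K[X]), which also shows that irreducible polynomials of every degree,
-- and hence K, L and E, exist.  Nontrivial characters take just two values on D.

-- The usual tools here are complex Gauss sums. Integers suffice because on a function stable under
-- 𝔽_p* the nonzero multiples of a character all give the same Fourier coefficient: summing against
-- e yields p - 1 times that coefficient, and the factor p - 1 cancels. D is stable because
-- N(y)/N(x) is homogeneous of degree (ℓ + 1) - ℓ = 1, and consecutive degrees are also what lets
-- the Hasse-Davenport relation trade a sum over L × K for one over E. R enters only through its
-- annihilator, a space of order T with Tσ = Q and σ = q^r, so every character sum arrives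
-- multiplied by T. At a generic point all τ ≠ 0 contribute equally, except for the one solution of
-- an equation N(-1) = τδ; whether the annihilator contains it decides between the two eigenvalues.
-- Both satisfy θ² = (λ - μ)θ + (k - μ), and the value at the trivial character gives the size of D.
-- The extreme cases show the shape of D: r = 0 leaves the nonzero elements of L × 0, and r = m
-- gives all pairs with x ≠ 0.

open import Algebra.Bundles using (CommutativeRing)

-- Polynomial identities with integer coefficients in an arbitrary commutative ring.

module IntegerSolver {c ℓ} (R : CommutativeRing c ℓ) where
  open import Data.Nat as ℕ using (ℕ; zero; suc)
  open import Data.Integer as ℤ using (ℤ; +_; -[1+_]; _⊖_)
  import Data.Integer.Properties as ℤₚ
  open import Data.Maybe using (Maybe; just; nothing)
  open import Relation.Nullary using (yes; no)
  import Relation.Binary.PropositionalEquality as ≡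
  open import Algebra.Solver.Ring.AlmostCommutativeRing
  open CommutativeRing R
  open import Algebra.Properties.Ring ring
  open import Algebra.Properties.AbelianGroup +-abelianGroup using (⁻¹-∙-comm; ⁻¹-involutive; ε⁻¹≈ε)
  open import Algebra.Properties.Semiring.Mult.TCOptimised semiring using (_×_; 1+×; ×-homo-+; ×1-homo-*)
  open import Relation.Binary.Reasoning.Setoid setoid

  ⟦_⟧ᶻ : ℤ → Carrier
  ⟦ + n ⟧ᶻ      = n × 1#
  ⟦ -[1+ n ] ⟧ᶻ = - (suc n × 1#)

  neg-hom : ∀ z → ⟦ ℤ.- z ⟧ᶻ ≈ - ⟦ z ⟧ᶻ
  neg-hom (+ zero)  = sym ε⁻¹≈ε
  neg-hom (+ suc n) = refl
  neg-hom -[1+ n ]  = sym (⁻¹-involutive _)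

  ⊖-hom : ∀ m n → ⟦ m ⊖ n ⟧ᶻ ≈ m × 1# - n × 1#
  ⊖-hom m zero = sym (trans (+-congˡ ε⁻¹≈ε) (+-identityʳ _))
  ⊖-hom zero (suc n) = sym (+-identityˡ _)
  ⊖-hom (suc m) (suc n) = begin
    ⟦ suc m ⊖ suc n ⟧ᶻ                       ≡⟨ ≡.cong ⟦_⟧ᶻ (ℤₚ.[1+m]⊖[1+n]≡m⊖n m n) ⟩
    ⟦ m ⊖ n ⟧ᶻ                               ≈⟨ ⊖-hom m n ⟩
    m × 1# - n × 1#                          ≈⟨ +-congʳ (+-identityʳ _) ⟨
    m × 1# + 0# - n × 1#                     ≈⟨ +-congʳ (+-congˡ (-‿inverseʳ 1#)) ⟨
    m × 1# + (1# - 1#) - n × 1#              ≈⟨ +-congʳ (+-assoc _ _ _) ⟨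
    m × 1# + 1# - 1# - n × 1#                ≈⟨ +-assoc _ _ _ ⟩
    m × 1# + 1# + (- 1# - n × 1#)            ≈⟨ +-cong (+-comm _ _) (⁻¹-∙-comm _ _) ⟩
    1# + m × 1# - (1# + n × 1#)              ≈⟨ +-cong (1+× m 1#) (-‿cong (1+× n 1#)) ⟨
    suc m × 1# - suc n × 1# ∎

  +-hom : ∀ x y → ⟦ x ℤ.+ y ⟧ᶻ ≈ ⟦ x ⟧ᶻ + ⟦ y ⟧ᶻ
  +-hom (+ m)    (+ n)    = ×-homo-+ 1# m n
  +-hom (+ m)    -[1+ n ] = ⊖-hom m (suc n)
  +-hom -[1+ m ] (+ n)    = trans (⊖-hom n (suc m)) (+-comm _ _)
  +-hom -[1+ m ] -[1+ n ] = begin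
    - (suc (suc (m ℕ.+ n)) × 1#)       ≡⟨ ≡.cong (λ k → - (suc k × 1#)) (ℕₚ.+-suc m n) ⟨
    - ((suc m ℕ.+ suc n) × 1#)         ≈⟨ -‿cong (×-homo-+ 1# (suc m) (suc n)) ⟩
    - (suc m × 1# + suc n × 1#)        ≈⟨ ⁻¹-∙-comm _ _ ⟨
    - (suc m × 1#) - suc n × 1# ∎
    where import Data.Nat.Properties as ℕₚ

  pos-*-hom : ∀ m y → ⟦ + m ℤ.* y ⟧ᶻ ≈ ⟦ + m ⟧ᶻ * ⟦ y ⟧ᶻ
  pos-*-hom m (+ n) = begin
    ⟦ + m ℤ.* + n ⟧ᶻ   ≡⟨ ≡.cong ⟦_⟧ᶻ (ℤₚ.pos-* m n) ⟨
    (m ℕ.* n) × 1#     ≈⟨ ×1-homo-* m n ⟩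
    m × 1# * n × 1# ∎
  pos-*-hom m -[1+ n ] = begin
    ⟦ + m ℤ.* -[1+ n ] ⟧ᶻ         ≡⟨ ≡.cong ⟦_⟧ᶻ (ℤₚ.neg-distribʳ-* (+ m) (+ suc n)) ⟨
    ⟦ ℤ.- (+ m ℤ.* + suc n) ⟧ᶻ    ≈⟨ neg-hom (+ m ℤ.* + suc n) ⟩
    - ⟦ + m ℤ.* + suc n ⟧ᶻ        ≈⟨ -‿cong (pos-*-hom m (+ suc n)) ⟩
    - (m × 1# * suc n × 1#)       ≈⟨ -‿distribʳ-* _ _ ⟩
    m × 1# * - (suc n × 1#) ∎

  *-hom : ∀ x y → ⟦ x ℤ.* y ⟧ᶻ ≈ ⟦ x ⟧ᶻ * ⟦ y ⟧ᶻ
  *-hom (+ m)    y = pos-*-hom m y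
  *-hom -[1+ m ] y = begin
    ⟦ -[1+ m ] ℤ.* y ⟧ᶻ           ≡⟨ ≡.cong ⟦_⟧ᶻ (ℤₚ.neg-distribˡ-* (+ suc m) y) ⟨
    ⟦ ℤ.- (+ suc m ℤ.* y) ⟧ᶻ      ≈⟨ neg-hom (+ suc m ℤ.* y) ⟩
    - ⟦ + suc m ℤ.* y ⟧ᶻ          ≈⟨ -‿cong (pos-*-hom (suc m) y) ⟩
    - (suc m × 1# * ⟦ y ⟧ᶻ)       ≈⟨ -‿distribˡ-* _ _ ⟩
    - (suc m × 1#) * ⟦ y ⟧ᶻ ∎

  private
    homomorphism : ℤ.+-*-rawRing -Raw-AlmostCommutative⟶ fromCommutativeRing R
    homomorphism = record
      { ⟦_⟧    = ⟦_⟧ᶻ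
      ; +-homo = +-hom
      ; *-homo = *-hom
      ; -‿homo = neg-hom
      ; 0-homo = refl
      ; 1-homo = refl
      }

    coeff≟ : ∀ x y → Maybe (⟦ x ⟧ᶻ ≈ ⟦ y ⟧ᶻ)
    coeff≟ x y with x ℤ.≟ y
    ... | yes ≡.refl = just refl
    ... | no _       = nothing

  open import Algebra.Solver.Ring ℤ.+-*-rawRing (fromCommutativeRing R) homomorphism coeff≟ public
    using (solve; _:=_; _:+_; _:*_; _:-_; :-_; con)

open import Level using (0ℓ)
open import Data.Nat as ℕ using (ℕ; zero; suc; z≤n; s≤s)
import Data.Nat.Properties as ℕₚ
open import Data.Nat.Induction using (<-wellFounded)
open import Data.Nat.Primality using (Prime; ¬prime[0]; prime⇒nonTrivial)
import Data.Nat.Tactic.RingSolver as ℕ-Solver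
open import Data.Integer as ℤ using (ℤ; 0ℤ; 1ℤ)
import Data.Integer.Properties as ℤₚ
import Data.Integer.Tactic.RingSolver as ℤ-Solver
open import Data.Fin as Fin using (Fin; toℕ)
import Data.Fin.Properties as Finₚ
open import Data.List as List using (List; []; _∷_; length; filter; downFrom; applyDownFrom; allFin; cartesianProduct; cartesianProductWith)
import Data.List.Properties as Listₚ
open import Data.List.Membership.Propositional using (_∈_; find; lose)
open import Data.List.Membership.Propositional.Properties using (∈-map⁺; ∈-map⁻; ∈-filter⁺; ∈-filter⁻; ∈-allFin; ∈-downFrom⁺; ∈-cartesianProduct⁺; ∈-cartesianProductWith⁺; ∈-cartesianProductWith⁻)
open import Data.List.Membership.Propositional.Properties.WithK using (unique∧set⇒bag)
open import Data.List.Relation.Unary.Any using (Any; any?; here; there)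
open import Data.List.Relation.Unary.All as All using (All; []; _∷_; all?)
import Data.List.Relation.Unary.All.Properties as Allₚ
open import Data.List.Relation.Unary.AllPairs using ([]; _∷_)
open import Data.List.Relation.Unary.Unique.Propositional using (Unique)
import Data.List.Relation.Unary.Unique.Propositional.Properties as Uniqueₚ
open import Data.List.Relation.Binary.Permutation.Propositional as Perm using (_↭_)
open import Data.List.Relation.Binary.BagAndSetEquality using (∼bag⇒↭)
open import Data.Vec as Vec using (Vec; []; _∷_; toList; zipWith; replicate)
import Data.Vec.Properties as Vecₚ
open import Data.Bool using (Bool; true; false; _∧_; not)
open import Data.Product using (Σ; ∃; _×_; _,_; proj₁; proj₂)
open import Data.Product.Properties using (≡-dec)
open import Data.Sum using (_⊎_; inj₁; inj₂)
open import Data.Empty using (⊥-elim)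
open import Function using (_∘_; mk⇔)
open import Induction.WellFounded using (Acc; acc)
open import Relation.Nullary using (¬_; Dec; yes; no; does)
open import Relation.Nullary.Decidable using (_×-dec_; ¬?; map′; decidable-stable; dec-true; dec-false)
open import Relation.Binary using (DecidableEquality)
open import Relation.Binary.PropositionalEquality hiding ([_]; setoid)
open import Algebra.Structures using (IsAbelianGroup; IsCommutativeRing)

-- Finite integer sums, Iverson brackets and counting.

module FiniteSums where
  open import Data.Integer using (+_; _+_; _*_; -_; _-_; _≤_)
  open import Data.Integer.Tactic.RingSolver using (solve-∀)
  open import Data.List using (_++_; map)

  private variable
    A B C : Set
    P R : Set

  ∑ : List A → (A → ℤ) → ℤ
  ∑ []       f = 0ℤ
  ∑ (x ∷ xs) f = f x + ∑ xs f

  ∑-cong : (xs : List A) {f g : A → ℤ} → (∀ x → f x ≡ g x) → ∑ xs f ≡ ∑ xs g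
  ∑-cong []       e = refl
  ∑-cong (x ∷ xs) e = cong₂ _+_ (e x) (∑-cong xs e)

  ∑-zero : (xs : List A) {f : A → ℤ} → (∀ x → f x ≡ 0ℤ) → ∑ xs f ≡ 0ℤ
  ∑-zero []       e = refl
  ∑-zero (x ∷ xs) e = cong₂ _+_ (e x) (∑-zero xs e)

  ∑-+ : (xs : List A) (f g : A → ℤ) → ∑ xs (λ x → f x + g x) ≡ ∑ xs f + ∑ xs g
  ∑-+ []       f g = refl
  ∑-+ (x ∷ xs) f g rewrite ∑-+ xs f g = lem (f x) (g x) (∑ xs f) (∑ xs g)
    where
    lem : ∀ a b c d → a + b + (c + d) ≡ a + c + (b + d)
    lem = solve-∀

  ∑-*ˡ : (c : ℤ) (xs : List A) (f : A → ℤ) → ∑ xs (λ x → c * f x) ≡ c * ∑ xs f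
  ∑-*ˡ c []       f = sym (ℤₚ.*-zeroʳ c)
  ∑-*ˡ c (x ∷ xs) f rewrite ∑-*ˡ c xs f = sym (ℤₚ.*-distribˡ-+ c (f x) (∑ xs f))

  ∑-*ʳ : (c : ℤ) (xs : List A) (f : A → ℤ) → ∑ xs (λ x → f x * c) ≡ ∑ xs f * c
  ∑-*ʳ c xs f = trans (∑-cong xs (λ x → ℤₚ.*-comm (f x) c))
                      (trans (∑-*ˡ c xs f) (ℤₚ.*-comm c (∑ xs f)))

  ∑-neg : (xs : List A) (f : A → ℤ) → ∑ xs (λ x → - f x) ≡ - ∑ xs f
  ∑-neg []       f = refl
  ∑-neg (x ∷ xs) f rewrite ∑-neg xs f = sym (ℤₚ.neg-distrib-+ (f x) (∑ xs f))

  ∑-- : (xs : List A) (f g : A → ℤ) → ∑ xs (λ x → f x - g x) ≡ ∑ xs f - ∑ xs g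
  ∑-- xs f g = trans (∑-+ xs f (λ x → - g x)) (cong (λ z → ∑ xs f + z) (∑-neg xs g))

  ∑-swap : (xs : List A) (ys : List B) (f : A → B → ℤ) →
           ∑ xs (λ x → ∑ ys (f x)) ≡ ∑ ys (λ y → ∑ xs (λ x → f x y))
  ∑-swap []       ys f = sym (∑-zero ys (λ _ → refl))
  ∑-swap (x ∷ xs) ys f = trans (cong (λ z → ∑ ys (f x) + z) (∑-swap xs ys f))
                               (sym (∑-+ ys (f x) (λ y → ∑ xs (λ x → f x y))))

  ∑-const : (xs : List A) (c : ℤ) → ∑ xs (λ _ → c) ≡ + length xs * c
  ∑-const []       c = sym (ℤₚ.*-zeroˡ c)
  ∑-const (x ∷ xs) c rewrite ∑-const xs c = sym (ℤₚ.suc-* (+ length xs) c)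

  ∑-1 : (xs : List A) → ∑ xs (λ _ → 1ℤ) ≡ + length xs
  ∑-1 xs = trans (∑-const xs 1ℤ) (ℤₚ.*-identityʳ _)

  ∑-map : (g : A → B) (xs : List A) (f : B → ℤ) → ∑ (map g xs) f ≡ ∑ xs (f ∘ g)
  ∑-map g []       f = refl
  ∑-map g (x ∷ xs) f = cong (λ z → f (g x) + z) (∑-map g xs f)

  ∑-++ : (xs ys : List A) (f : A → ℤ) → ∑ (xs ++ ys) f ≡ ∑ xs f + ∑ ys f
  ∑-++ []       ys f = sym (ℤₚ.+-identityˡ _)
  ∑-++ (x ∷ xs) ys f rewrite ∑-++ xs ys f = sym (ℤₚ.+-assoc (f x) (∑ xs f) (∑ ys f))

  ∑-cartesianProduct : (xs : List A) (ys : List B) (f : A × B → ℤ) →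
                       ∑ (cartesianProduct xs ys) f ≡ ∑ xs (λ x → ∑ ys (λ y → f (x , y)))
  ∑-cartesianProduct []       ys f = refl
  ∑-cartesianProduct (x ∷ xs) ys f =
    trans (∑-++ (map (x ,_) ys) _ f)
          (cong₂ _+_ (∑-map (x ,_) ys f) (∑-cartesianProduct xs ys f))

  ∑-↭ : {xs ys : List A} (f : A → ℤ) → xs ↭ ys → ∑ xs f ≡ ∑ ys f
  ∑-↭ f Perm.refl          = refl
  ∑-↭ f (Perm.prep x p)    = cong (λ z → f x + z) (∑-↭ f p)
  ∑-↭ f (Perm.swap {xs} {ys} x y p) rewrite ∑-↭ f p = lem (f x) (f y) (∑ ys f)
    where
    lem : ∀ a b c → a + (b + c) ≡ b + (a + c)
    lem = solve-∀
  ∑-↭ f (Perm.trans p q)   = trans (∑-↭ f p) (∑-↭ f q)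

  ∑-≤ : (xs : List A) {f g : A → ℤ} → (∀ x → f x ≤ g x) → ∑ xs f ≤ ∑ xs g
  ∑-≤ []       e = ℤₚ.≤-refl
  ∑-≤ (x ∷ xs) e = ℤₚ.+-mono-≤ (e x) (∑-≤ xs e)

  ≤-sum-tight : ∀ {a b c d} → a ≤ b → c ≤ d → a + c ≡ b + d → a ≡ b × c ≡ d
  ≤-sum-tight {a} {b} {c} {d} p q e =
    ℤₚ.≤-antisym p (cancel c (subst₂ _≤_ (ℤₚ.+-comm b c) (ℤₚ.+-comm a c) b+c≤a+c)) ,
    ℤₚ.≤-antisym q (cancel a a+d≤a+c)
    where
    neg-+-cancel : ∀ x y → - x + (x + y) ≡ y
    neg-+-cancel = solve-∀
    cancel : ∀ x {y z} → x + y ≤ x + z → y ≤ z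
    cancel x {y} {z} l =
      subst₂ _≤_ (neg-+-cancel x y) (neg-+-cancel x z) (ℤₚ.+-monoʳ-≤ (- x) l)
    b+c≤a+c : b + c ≤ a + c
    b+c≤a+c = ℤₚ.≤-trans (ℤₚ.+-monoʳ-≤ b q) (ℤₚ.≤-reflexive (sym e))
    a+d≤a+c : a + d ≤ a + c
    a+d≤a+c = ℤₚ.≤-trans (ℤₚ.+-monoˡ-≤ d p) (ℤₚ.≤-reflexive (sym e))

  -- This turns upper bounds from root counting into exact counts. In `norm-fibre` and
  -- `∑-charPoly-Λ` each term is bounded by a degree and the two totals are computed independently,
  -- so no single bound can be strict.
  ∑-≤-tight : (xs : List A) {f g : A → ℤ} → (∀ x → f x ≤ g x) → ∑ xs f ≡ ∑ xs g →
              ∀ {x} → x ∈ xs → f x ≡ g x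
  ∑-≤-tight (x ∷ xs) {f} {g} le e (here refl) = proj₁ (≤-sum-tight (le x) (∑-≤ xs le) e)
  ∑-≤-tight (x ∷ xs) {f} {g} le e (there m)   =
    ∑-≤-tight xs le (proj₂ (≤-sum-tight (le x) (∑-≤ xs le) e)) m

  ∑-cong∈ : (xs : List A) {f g : A → ℤ} → (∀ {x} → x ∈ xs → f x ≡ g x) → ∑ xs f ≡ ∑ xs g
  ∑-cong∈ []       e = refl
  ∑-cong∈ (x ∷ xs) e = cong₂ _+_ (e (here refl)) (∑-cong∈ xs (e ∘ there))

  -- Iverson bracket. Counting is done by sums of these in ℤ, where sums can be exchanged and terms
  -- subtracted, and is converted to lengths of filtered lists only for root counting.
  𝟙 : Dec P → ℤ
  𝟙 (yes _) = 1ℤ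
  𝟙 (no _)  = 0ℤ

  𝟙-yes : (d : Dec P) → P → 𝟙 d ≡ 1ℤ
  𝟙-yes (yes _) p = refl
  𝟙-yes (no ¬p) p = ⊥-elim (¬p p)

  𝟙-no : (d : Dec P) → ¬ P → 𝟙 d ≡ 0ℤ
  𝟙-no (yes p) ¬p = ⊥-elim (¬p p)
  𝟙-no (no _)  ¬p = refl

  𝟙-no-* : (d : Dec P) → ¬ P → ∀ x → 𝟙 d * x ≡ 0ℤ
  𝟙-no-* d ¬p x = trans (cong (_* x) (𝟙-no d ¬p)) (ℤₚ.*-zeroˡ x)

  𝟙-yes-* : (d : Dec P) → P → ∀ x → 𝟙 d * x ≡ x
  𝟙-yes-* d p x = trans (cong (_* x) (𝟙-yes d p)) (ℤₚ.*-identityˡ x)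

  𝟙-cong : (d : Dec P) (e : Dec R) → (P → R) → (R → P) → 𝟙 d ≡ 𝟙 e
  𝟙-cong (yes p) e f g = sym (𝟙-yes e (f p))
  𝟙-cong (no ¬p) e f g = sym (𝟙-no e (¬p ∘ g))

  𝟙-× : (d : Dec P) (e : Dec R) → 𝟙 (d ×-dec e) ≡ 𝟙 d * 𝟙 e
  𝟙-× (yes p) (yes q) = refl
  𝟙-× (yes p) (no ¬q) = refl
  𝟙-× (no ¬p) (yes q) = refl
  𝟙-× (no ¬p) (no ¬q) = refl

  𝟙-¬ : (d : Dec P) → 𝟙 (¬? d) ≡ 1ℤ - 𝟙 d
  𝟙-¬ (yes _) = refl
  𝟙-¬ (no _)  = refl

  0≤𝟙 : (d : Dec P) → 0ℤ ≤ 𝟙 d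
  0≤𝟙 (yes _) = Data.Integer.+≤+ ℕ.z≤n
  0≤𝟙 (no _)  = ℤₚ.≤-refl

  𝟙-*-cong : (d : Dec P) {x y : ℤ} → (P → x ≡ y) → 𝟙 d * x ≡ 𝟙 d * y
  𝟙-*-cong (yes p) e = cong (1ℤ *_) (e p)
  𝟙-*-cong (no _) {x} {y} e = trans (ℤₚ.*-zeroˡ x) (sym (ℤₚ.*-zeroˡ y))

  ∑-𝟙-length : {P : A → Set} (P? : ∀ x → Dec (P x)) (xs : List A) →
               ∑ xs (λ x → 𝟙 (P? x)) ≡ + length (filter P? xs)
  ∑-𝟙-length P? []       = refl
  ∑-𝟙-length P? (x ∷ xs) with P? x
  ... | yes _ rewrite ∑-𝟙-length P? xs = refl
  ... | no  _ rewrite ∑-𝟙-length P? xs = ℤₚ.+-identityˡ _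

  record Finite (A : Set) : Set where
    infix 4 _≟_
    field
      enum     : List A
      unique   : Unique enum
      complete : ∀ a → a ∈ enum
      _≟_      : DecidableEquality A

  open Finite public using (enum; unique; complete)

  ∑-δ-list : (_≟_ : DecidableEquality A) {c : A} (xs : List A) → Unique xs → c ∈ xs → (f : A → ℤ) →
             ∑ xs (λ x → 𝟙 (x ≟ c) * f x) ≡ f c
  ∑-δ-list {A} _≟_ {c} (x ∷ xs) (q ∷ u) (here refl) f =
    trans (cong₂ _+_ (trans (cong (_* f x) (𝟙-yes (x ≟ x) refl)) (ℤₚ.*-identityˡ (f x))) (none xs q))
          (ℤₚ.+-identityʳ _)
    where
    none : (xs : List A) → All (c ≢_) xs → ∑ xs (λ x → 𝟙 (x ≟ c) * f x) ≡ 0ℤ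
    none []       _        = refl
    none (x ∷ xs) (q ∷ qs) = cong₂ _+_ (cong (_* f x) (𝟙-no (x ≟ c) (q ∘ sym))) (none xs qs)
  ∑-δ-list _≟_ {c} (x ∷ xs) (q ∷ u) (there m) f =
    trans (cong₂ _+_ (cong (_* f x) (𝟙-no (x ≟ c) λ { refl → All.lookup q m refl })) (∑-δ-list _≟_ xs u m f))
          (ℤₚ.+-identityˡ _)

  ∑-δ : (F : Finite A) (c : A) (f : A → ℤ) →
        ∑ (enum F) (λ x → 𝟙 (Finite._≟_ F x c) * f x) ≡ f c
  ∑-δ F c = ∑-δ-list (Finite._≟_ F) (enum F) (unique F) (complete F c)

  ∑-δ₁ : (F : Finite A) (c : A) → ∑ (enum F) (λ x → 𝟙 (Finite._≟_ F x c)) ≡ 1ℤ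
  ∑-δ₁ F c = trans (∑-cong (enum F) (λ x → sym (ℤₚ.*-identityʳ _))) (∑-δ F c (λ _ → 1ℤ))

  ∑-point : (F : Finite A) (c : A) (f : A → ℤ) → (∀ x → x ≢ c → f x ≡ 0ℤ) → ∑ (enum F) f ≡ f c
  ∑-point F c f z = trans (∑-cong (enum F) step) (∑-δ F c f)
    where
    step : ∀ x → f x ≡ 𝟙 (Finite._≟_ F x c) * f x
    step x with Finite._≟_ F x c
    ... | yes _ = sym (ℤₚ.*-identityˡ (f x))
    ... | no ne = z x ne

  fibres : (F : Finite B) (xs : List A) (g : A → B) (f : B → ℤ) →
           ∑ xs (f ∘ g) ≡ ∑ (enum F) (λ b → ∑ xs (λ a → 𝟙 (Finite._≟_ F (g a) b)) * f b)
  fibres F xs g f = begin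
    ∑ xs (f ∘ g)
      ≡⟨ ∑-cong xs (λ a → sym (point a)) ⟩
    ∑ xs (λ a → ∑ (enum F) (λ b → 𝟙 (g a ≟ b) * f b))
      ≡⟨ ∑-swap xs (enum F) _ ⟩
    ∑ (enum F) (λ b → ∑ xs (λ a → 𝟙 (g a ≟ b) * f b))
      ≡⟨ ∑-cong (enum F) (λ b → ∑-*ʳ (f b) xs _) ⟩
    ∑ (enum F) (λ b → ∑ xs (λ a → 𝟙 (g a ≟ b)) * f b) ∎
    where
    open ≡-Reasoning
    _≟_ = Finite._≟_ F
    point : ∀ a → ∑ (enum F) (λ b → 𝟙 (g a ≟ b) * f b) ≡ f (g a)
    point a = trans (∑-point F (g a) _ (λ b ne → cong (_* f b) (𝟙-no (g a ≟ b) (ne ∘ sym))))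
      (trans (cong (_* f (g a)) (𝟙-yes (g a ≟ g a) refl)) (ℤₚ.*-identityˡ _))

  -- Two lists without repetitions that have the same members are equal as bags, hence permutations
  -- of each other. Every reindexing of a sum rests on this.
  bijection⇒↭ : (F : Finite A) (G : Finite B) (f : A → B) (g : B → A) →
                (∀ a → g (f a) ≡ a) → (∀ b → f (g b) ≡ b) → map f (enum F) ↭ enum G
  bijection⇒↭ F G f g gf fg = ∼bag⇒↭ (unique∧set⇒bag
    (Uniqueₚ.map⁺ (λ {x} {y} e → trans (sym (gf x)) (trans (cong g e) (gf y))) (unique F))
    (unique G)
    (λ {b} → mk⇔ (λ _ → complete G b)
        (λ _ → subst (_∈ map f (enum F)) (fg b) (∈-map⁺ f (complete F (g b))))))

  ∑-bij : (F : Finite A) (G : Finite B) (f : A → B) (g : B → A) →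
          (∀ a → g (f a) ≡ a) → (∀ b → f (g b) ≡ b) → (h : B → ℤ) →
          ∑ (enum F) (h ∘ f) ≡ ∑ (enum G) h
  ∑-bij F G f g gf fg h = trans (sym (∑-map f (enum F) h)) (∑-↭ h (bijection⇒↭ F G f g gf fg))

  ∑-reindex : (F : Finite A) (f g : A → A) → (∀ a → g (f a) ≡ a) → (∀ a → f (g a) ≡ a) →
              (h : A → ℤ) → ∑ (enum F) (h ∘ f) ≡ ∑ (enum F) h
  ∑-reindex F = ∑-bij F F

  finite-× : Finite A → Finite B → Finite (A × B)
  finite-× F G = record
    { enum     = cartesianProduct (enum F) (enum G)
    ; unique   = Uniqueₚ.cartesianProduct⁺ (unique F) (unique G)
    ; complete = λ (a , b) → ∈-cartesianProduct⁺ (complete F a) (complete G b)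
    ; _≟_      = ≡-dec (Finite._≟_ F) (Finite._≟_ G)
    }

  ∑-cartesianProductWith : (h : A → B → C) (xs : List A) (ys : List B) (f : C → ℤ) →
                           ∑ (cartesianProductWith h xs ys) f ≡ ∑ xs (λ x → ∑ ys (λ y → f (h x y)))
  ∑-cartesianProductWith h []       ys f = refl
  ∑-cartesianProductWith h (x ∷ xs) ys f =
    trans (∑-++ (map (h x) ys) _ f)
          (cong₂ _+_ (∑-map (h x) ys f) (∑-cartesianProductWith h xs ys f))

  length-cartesianProductWith : (h : A → B → C) (xs : List A) (ys : List B) →
                                length (cartesianProductWith h xs ys) ≡ length xs ℕ.* length ys
  length-cartesianProductWith h []       ys = refl
  length-cartesianProductWith h (x ∷ xs) ys =
    trans (Listₚ.length-++ (map (h x) ys))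
          (cong₂ ℕ._+_ (Listₚ.length-map (h x) ys) (length-cartesianProductWith h xs ys))

  finite-Vec : Finite A → ∀ n → Finite (Vec A n)
  finite-Vec F zero = record
    { enum = [] ∷ [] ; unique = [] ∷ [] ; complete = λ { [] → here refl } ; _≟_ = Vecₚ.≡-dec (Finite._≟_ F) }
  finite-Vec F (suc n) = record
    { enum     = cartesianProductWith _∷_ (enum F) (enum (finite-Vec F n))
    ; unique   = Uniqueₚ.cartesianProductWith⁺ _∷_ Vecₚ.∷-injective (unique F) (unique (finite-Vec F n))
    ; complete = λ { (x ∷ xs) → ∈-cartesianProductWith⁺ _∷_ (complete F x) (complete (finite-Vec F n) xs) }
    ; _≟_      = Vecₚ.≡-dec (Finite._≟_ F)
    }

  length-finite-Vec : (F : Finite A) → ∀ n → length (enum (finite-Vec F n)) ≡ length (enum F) ℕ.^ n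
  length-finite-Vec F zero    = refl
  length-finite-Vec F (suc n) =
    trans (length-cartesianProductWith _∷_ (enum F) _) (cong (length (enum F) ℕ.*_) (length-finite-Vec F n))

  -- Both sides are the sum of f over 0, ..., n. `multiplicity-same` uses it to move the chain of
  -- powers of P by one.
  ∑-downFrom-shift : ∀ n (f : ℕ → ℤ) → ∑ (downFrom n) f + f n ≡ f 0 + ∑ (downFrom n) (f ∘ suc)
  ∑-downFrom-shift zero    f = ℤₚ.+-comm 0ℤ (f 0)
  ∑-downFrom-shift (suc n) f = begin
    f n + ∑ (downFrom n) f + f (suc n)              ≡⟨ cong (_+ f (suc n)) (ℤₚ.+-comm (f n) _) ⟩
    ∑ (downFrom n) f + f n + f (suc n)              ≡⟨ cong (_+ f (suc n)) (∑-downFrom-shift n f) ⟩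
    f 0 + ∑ (downFrom n) (f ∘ suc) + f (suc n)      ≡⟨ lem (f 0) (∑ (downFrom n) (f ∘ suc)) (f (suc n)) ⟩
    f 0 + (f (suc n) + ∑ (downFrom n) (f ∘ suc)) ∎
    where
    open ≡-Reasoning
    lem : ∀ a b c → a + b + c ≡ a + (c + b)
    lem = solve-∀

  ∑-downFrom-cong : ∀ n {f g : ℕ → ℤ} → (∀ k → k ℕ.< n → f k ≡ g k) → ∑ (downFrom n) f ≡ ∑ (downFrom n) g
  ∑-downFrom-cong zero    e = refl
  ∑-downFrom-cong (suc n) e = cong₂ _+_ (e n (ℕₚ.n<1+n n)) (∑-downFrom-cong n (λ k l → e k (ℕₚ.m<n⇒m<1+n l)))

  ∑-downFrom-δ : ∀ {n c} → c ℕ.< n → (f : ℕ → ℤ) → ∑ (downFrom n) (λ k → 𝟙 (k ℕₚ.≟ c) * f k) ≡ f c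
  ∑-downFrom-δ {n} c<n = ∑-δ-list ℕₚ._≟_ (downFrom n) (Uniqueₚ.downFrom⁺ n) (∈-downFrom⁺ c<n)

  0≤∑ : (xs : List A) {f : A → ℤ} → (∀ x → 0ℤ ≤ f x) → 0ℤ ≤ ∑ xs f
  0≤∑ xs {f} p = subst (_≤ ∑ xs f) (∑-zero xs (λ _ → refl)) (∑-≤ xs p)

  0≤* : ∀ {a b} → 0ℤ ≤ a → 0ℤ ≤ b → 0ℤ ≤ a * b
  0≤* {+ m} {+ n} _ _ = subst (0ℤ ≤_) (ℤₚ.pos-* m n) (Data.Integer.+≤+ ℕ.z≤n)

  term≤∑ : (xs : List A) {f : A → ℤ} → (∀ x → 0ℤ ≤ f x) → ∀ {x} → x ∈ xs → f x ≤ ∑ xs f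
  term≤∑ (x ∷ xs) {f} p (here refl) = subst (_≤ f x + ∑ xs f) (ℤₚ.+-identityʳ (f x)) (ℤₚ.+-monoʳ-≤ (f x) (0≤∑ xs p))
  term≤∑ (y ∷ xs) {f} p {x} (there m) = ℤₚ.≤-trans (term≤∑ xs p m)
    (subst (_≤ f y + ∑ xs f) (ℤₚ.+-identityˡ _) (ℤₚ.+-monoˡ-≤ (∑ xs f) (p y)))

  ∑∈-≤ : (xs : List A) {f g : A → ℤ} → (∀ {x} → x ∈ xs → f x ≤ g x) → ∑ xs f ≤ ∑ xs g
  ∑∈-≤ []       p = ℤₚ.≤-refl
  ∑∈-≤ (x ∷ xs) p = ℤₚ.+-mono-≤ (p (here refl)) (∑∈-≤ xs (p ∘ there))

open FiniteSums

-- Finite fields: Fermat's theorem and bounds on the number of roots.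

module FiniteFields where
  open import Data.List using (map)

  record FiniteField : Set₁ where
    infixl 6 _+_
    infixl 7 _*_
    infix  8 -_
    field
      Carrier           : Set
      _+_ _*_           : Carrier → Carrier → Carrier
      -_                : Carrier → Carrier
      0# 1#             : Carrier
      isCommutativeRing : IsCommutativeRing _≡_ _+_ _*_ -_ 0# 1#
      finite            : Finite Carrier
      inv               : Carrier → Carrier
      inverseʳ          : ∀ x → x ≢ 0# → x * inv x ≡ 1#
      1≢0               : 1# ≢ 0#

    commutativeRing : CommutativeRing _ _
    commutativeRing = record { isCommutativeRing = isCommutativeRing }

    open IsCommutativeRing isCommutativeRing public
      using (+-assoc; +-comm; +-identityˡ; +-identityʳ; -‿inverseʳ; -‿inverseˡ;
             *-assoc; *-comm; *-identityˡ; *-identityʳ; zeroˡ; zeroʳ; distribˡ; distribʳ)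

    open Finite finite public using (_≟_)

    order : ℕ
    order = length (enum finite)

    infixr 8 _^_
    _^_ : Carrier → ℕ → Carrier
    x ^ zero  = 1#
    x ^ suc n = x * x ^ n

  module FieldProperties (K : FiniteField) where
    open FiniteField K
    open IntegerSolver commutativeRing using (solve; _:=_; _:+_; _:*_; :-_; con)

    x*y≡0 : ∀ {x y} → x * y ≡ 0# → x ≢ 0# → y ≡ 0#
    x*y≡0 {x} {y} e x≢0 = begin
      y                ≡⟨ sym (*-identityˡ y) ⟩
      1# * y           ≡⟨ cong (_* y) (sym (inverseʳ x x≢0)) ⟩
      x * inv x * y    ≡⟨ lem x (inv x) y ⟩
      inv x * (x * y)  ≡⟨ cong (inv x *_) e ⟩
      inv x * 0#       ≡⟨ zeroʳ _ ⟩
      0#               ∎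
      where
      open ≡-Reasoning
      lem : ∀ a b c → a * b * c ≡ b * (a * c)
      lem = solve 3 (λ a b c → a :* b :* c := b :* (a :* c)) refl

    *-≢0 : ∀ {x y} → x ≢ 0# → y ≢ 0# → x * y ≢ 0#
    *-≢0 x≢0 y≢0 e = y≢0 (x*y≡0 e x≢0)

    inverseˡ : ∀ x → x ≢ 0# → inv x * x ≡ 1#
    inverseˡ x x≢0 = trans (*-comm (inv x) x) (inverseʳ x x≢0)

    inv-≢0 : ∀ {x} → x ≢ 0# → inv x ≢ 0#
    inv-≢0 {x} x≢0 e = 1≢0 (trans (sym (inverseʳ x x≢0)) (trans (cong (x *_) e) (zeroʳ x)))

    inv-*-cancel : ∀ {x} → x ≢ 0# → ∀ y → inv x * (x * y) ≡ y
    inv-*-cancel {x} x≢0 y = trans (sym (*-assoc _ _ _)) (trans (cong (_* y) (inverseˡ x x≢0)) (*-identityˡ y))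

    *-inv-cancel : ∀ {x} → x ≢ 0# → ∀ y → x * (inv x * y) ≡ y
    *-inv-cancel {x} x≢0 y = trans (sym (*-assoc _ _ _)) (trans (cong (_* y) (inverseʳ x x≢0)) (*-identityˡ y))

    *-cancelˡ : ∀ {x} → x ≢ 0# → ∀ {y z} → x * y ≡ x * z → y ≡ z
    *-cancelˡ {x} x≢0 {y} {z} e =
      trans (sym (inv-*-cancel x≢0 y)) (trans (cong (inv x *_) e) (inv-*-cancel x≢0 z))

    x-y≡0 : ∀ {x y} → x + - y ≡ 0# → x ≡ y
    x-y≡0 {x} {y} e = trans (lem x y) (trans (cong (_+ y) e) (+-identityˡ y))
      where
      lem : ∀ x y → x ≡ x + - y + y
      lem = solve 2 (λ x y → x := x :+ :- y :+ y) refl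

    +-cancelˡ : ∀ x {y z} → x + y ≡ x + z → y ≡ z
    +-cancelˡ x {y} {z} e = trans (lem x y) (trans (cong (- x +_) e) (sym (lem x z)))
      where
      lem : ∀ x y → y ≡ - x + (x + y)
      lem = solve 2 (λ x y → y := :- x :+ (x :+ y)) refl

    ^-+ : ∀ x m n → x ^ (m ℕ.+ n) ≡ x ^ m * x ^ n
    ^-+ x zero    n = sym (*-identityˡ _)
    ^-+ x (suc m) n = trans (cong (x *_) (^-+ x m n)) (sym (*-assoc _ _ _))

    ^-* : ∀ x m n → x ^ (n ℕ.* m) ≡ (x ^ m) ^ n
    ^-* x m zero    = refl
    ^-* x m (suc n) = trans (^-+ x m (n ℕ.* m)) (cong (x ^ m *_) (^-* x m n))

    1^ : ∀ n → 1# ^ n ≡ 1#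
    1^ zero    = refl
    1^ (suc n) = trans (*-identityˡ _) (1^ n)

    *-^ : ∀ x y n → (x * y) ^ n ≡ x ^ n * y ^ n
    *-^ x y zero    = sym (*-identityˡ _)
    *-^ x y (suc n) = trans (cong (x * y *_) (*-^ x y n)) (lem x y (x ^ n) (y ^ n))
      where
      lem : ∀ a b c d → a * b * (c * d) ≡ a * c * (b * d)
      lem = solve 4 (λ a b c d → a :* b :* (c :* d) := a :* c :* (b :* d)) refl

    ^-≢0 : ∀ {x} → x ≢ 0# → ∀ n → x ^ n ≢ 0#
    ^-≢0 x≢0 zero    = 1≢0
    ^-≢0 x≢0 (suc n) = *-≢0 x≢0 (^-≢0 x≢0 n)

    nonzero? : ∀ x → Dec (x ≢ 0#)
    nonzero? x = ¬? (x ≟ 0#)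

    nonzeros : List Carrier
    nonzeros = filter nonzero? (enum finite)

    ∑-nonzero : (f : Carrier → ℤ.ℤ) →
      ∑ (enum finite) (λ x → 𝟙 (nonzero? x) ℤ.* f x) ≡ ∑ (enum finite) f ℤ.- f 0#
    ∑-nonzero f = begin
      ∑ E (λ x → 𝟙 (nonzero? x) ℤ.* f x)           ≡⟨ ∑-cong E (λ x → cong (ℤ._* f x) (𝟙-¬ (x ≟ 0#))) ⟩
      ∑ E (λ x → (ℤ.1ℤ ℤ.- 𝟙 (x ≟ 0#)) ℤ.* f x)   ≡⟨ ∑-cong E (λ x → lem (𝟙 (x ≟ 0#)) (f x)) ⟩
      ∑ E (λ x → f x ℤ.- 𝟙 (x ≟ 0#) ℤ.* f x)      ≡⟨ ∑-- E f _ ⟩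
      ∑ E f ℤ.- ∑ E (λ x → 𝟙 (x ≟ 0#) ℤ.* f x)    ≡⟨ cong (λ z → ∑ E f ℤ.- z) (∑-δ finite 0# f) ⟩
      ∑ E f ℤ.- f 0# ∎
      where
      open ≡-Reasoning
      open import Data.Integer.Tactic.RingSolver using () renaming (solve-∀ to solveℤ)
      E = enum finite
      lem : ∀ a b → (ℤ.1ℤ ℤ.- a) ℤ.* b ≡ b ℤ.- a ℤ.* b
      lem = solveℤ

    order≡1+nonzeros : order ≡ suc (length nonzeros)
    order≡1+nonzeros = ℤₚ.+-injective (begin
      ℤ.+ order                                         ≡⟨ sym (∑-1 E) ⟩
      ∑ E (λ _ → ℤ.1ℤ)                                 ≡⟨ lem _ ⟩
      ℤ.1ℤ ℤ.+ (∑ E (λ _ → ℤ.1ℤ) ℤ.- ℤ.1ℤ)             ≡⟨ cong (ℤ._+_ ℤ.1ℤ) (sym (∑-nonzero _)) ⟩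
      ℤ.1ℤ ℤ.+ ∑ E (λ x → 𝟙 (nonzero? x) ℤ.* ℤ.1ℤ)    ≡⟨ cong (ℤ._+_ ℤ.1ℤ) (∑-cong E (λ x → ℤₚ.*-identityʳ _)) ⟩
      ℤ.1ℤ ℤ.+ ∑ E (λ x → 𝟙 (nonzero? x))             ≡⟨ cong (ℤ._+_ ℤ.1ℤ) (∑-𝟙-length nonzero? E) ⟩
      ℤ.+ suc (length nonzeros) ∎)
      where
      open ≡-Reasoning
      open import Data.Integer.Tactic.RingSolver using () renaming (solve-∀ to solveℤ)
      E = enum finite
      lem : ∀ a → a ≡ ℤ.1ℤ ℤ.+ (a ℤ.- ℤ.1ℤ)
      lem = solveℤ

    product : List Carrier → Carrier
    product []       = 1#
    product (x ∷ xs) = x * product xs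

    product-↭ : ∀ {xs ys} → xs ↭ ys → product xs ≡ product ys
    product-↭ Perm.refl        = refl
    product-↭ (Perm.prep x p)  = cong (x *_) (product-↭ p)
    product-↭ (Perm.swap {xs} {ys} x y p) =
      trans (cong (λ z → x * (y * z)) (product-↭ p)) (lem x y (product ys))
      where
      lem : ∀ a b c → a * (b * c) ≡ b * (a * c)
      lem = solve 3 (λ a b c → a :* (b :* c) := b :* (a :* c)) refl
    product-↭ (Perm.trans p q) = trans (product-↭ p) (product-↭ q)

    product-scale : ∀ c xs → product (map (c *_) xs) ≡ c ^ length xs * product xs
    product-scale c []       = sym (*-identityˡ _)
    product-scale c (x ∷ xs) = trans (cong (c * x *_) (product-scale c xs)) (lem c x (c ^ length xs) (product xs))
      where
      lem : ∀ a b c d → a * b * (c * d) ≡ a * c * (b * d)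
      lem = solve 4 (λ a b c d → a :* b :* (c :* d) := a :* c :* (b :* d)) refl

    product-≢0 : ∀ {xs} → All (_≢ 0#) xs → product xs ≢ 0#
    product-≢0 []       = 1≢0
    product-≢0 (p ∷ ps) = *-≢0 p (product-≢0 ps)

    -- For x ≠ 0 multiplication by x permutes the nonzero elements. Comparing the products over both
    -- arrangements and cancelling gives x^(order - 1) = 1.
    fermat : ∀ x → x ^ order ≡ x
    fermat x rewrite order≡1+nonzeros with x ≟ 0#
    ... | yes refl = zeroˡ _
    ... | no x≢0   = trans (cong (x *_) x^n≡1) (*-identityʳ x)
      where
      member⇒≢0 : ∀ {z} → z ∈ nonzeros → z ≢ 0#
      member⇒≢0 m = proj₂ (∈-filter⁻ nonzero? {xs = enum finite} m)
      permuted : map (x *_) nonzeros ↭ nonzeros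
      permuted = ∼bag⇒↭ (unique∧set⇒bag
        (Uniqueₚ.map⁺ (*-cancelˡ x≢0) (Uniqueₚ.filter⁺ nonzero? (unique finite)))
        (Uniqueₚ.filter⁺ nonzero? (unique finite))
        (λ {z} → mk⇔
          (λ m → let (y , y∈ , e) = ∈-map⁻ (x *_) m in
                 ∈-filter⁺ nonzero? (complete finite z) (λ z≡0 → *-≢0 x≢0 (member⇒≢0 y∈) (trans (sym e) z≡0)))
          (λ m → subst (_∈ map (x *_) nonzeros) (*-inv-cancel x≢0 z)
            (∈-map⁺ (x *_) (∈-filter⁺ nonzero? (complete finite _) (*-≢0 (inv-≢0 x≢0) (member⇒≢0 m)))))))
      x^n≡1 : x ^ length nonzeros ≡ 1#
      x^n≡1 = *-cancelˡ (product-≢0 (Allₚ.all-filter nonzero? (enum finite)))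
        (trans (*-comm _ _) (trans (sym (product-scale x nonzeros))
          (trans (product-↭ permuted) (sym (*-identityʳ _)))))

    -- f is a polynomial function of degree at most d whose coefficient at degree d is c.
    PolyFun : Carrier → ℕ → (Carrier → Carrier) → Set
    PolyFun c zero    f = ∀ x → f x ≡ c
    PolyFun c (suc d) f = ∃ λ a → ∃ λ g → PolyFun c d g × (∀ x → f x ≡ a + x * g x)

    pf-cong : ∀ {c} d {f g} → (∀ x → f x ≡ g x) → PolyFun c d f → PolyFun c d g
    pf-cong zero    e p               = λ x → trans (sym (e x)) (p x)
    pf-cong (suc d) e (a , h , p , q) = a , h , p , λ x → trans (sym (e x)) (q x)

    pf-lead : ∀ {c c′} d {f} → c ≡ c′ → PolyFun c d f → PolyFun c′ d f
    pf-lead d refl p = p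

    pf-+ : ∀ {c c′} d {f g} → PolyFun c d f → PolyFun c′ d g → PolyFun (c + c′) d (λ x → f x + g x)
    pf-+ zero    p q = λ x → cong₂ _+_ (p x) (q x)
    pf-+ (suc d) (a , f , p , e) (b , g , q , e′) =
      a + b , (λ x → f x + g x) , pf-+ d p q , λ x → trans (cong₂ _+_ (e x) (e′ x)) (lem a b x (f x) (g x))
      where
      lem : ∀ a b x f g → a + x * f + (b + x * g) ≡ a + b + x * (f + g)
      lem = solve 5 (λ a b x f g → a :+ x :* f :+ (b :+ x :* g) := a :+ b :+ x :* (f :+ g)) refl

    pf-scale : ∀ {c} b d {f} → PolyFun c d f → PolyFun (b * c) d (λ x → b * f x)
    pf-scale b zero    p = λ x → cong (b *_) (p x)
    pf-scale b (suc d) (a , f , p , e) =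
      b * a , (λ x → b * f x) , pf-scale b d p , λ x → trans (cong (b *_) (e x)) (lem b a x (f x))
      where
      lem : ∀ b a x f → b * (a + x * f) ≡ b * a + x * (b * f)
      lem = solve 4 (λ b a x f → b :* (a :+ x :* f) := b :* a :+ x :* (b :* f)) refl

    pf-raise : ∀ {c} d {f} → PolyFun c d f → PolyFun 0# (suc d) f
    pf-raise {c} zero    p = c , (λ _ → 0#) , (λ _ → refl) , λ x → trans (p x) (lem c x)
      where
      lem : ∀ c x → c ≡ c + x * 0#
      lem = solve 2 (λ c x → c := c :+ x :* con ℤ.0ℤ) refl
    pf-raise (suc d) (a , f , p , e) = a , f , pf-raise d p , e

    -- The coefficient recorded at the top degree may be 0. This is how a function of smaller degree
    -- is raised to the degree of the other summand before `pf-+` applies.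
    pf-raise< : ∀ {c d n f} → d ℕ.< n → PolyFun c d f → PolyFun 0# n f
    pf-raise< {d = d} {suc n} (ℕ.s≤s d≤n) p with ℕₚ.m≤n⇒m<n∨m≡n d≤n
    ... | inj₁ d<n  = pf-raise n (pf-raise< d<n p)
    ... | inj₂ refl = pf-raise d p

    pf-shift : ∀ {c} d {f} → PolyFun c d f → PolyFun c (suc d) (λ x → x * f x)
    pf-shift d {f} p = 0# , f , p , λ x → sym (+-identityˡ _)

    pf-* : ∀ {c c′} d e {f g} → PolyFun c d f → PolyFun c′ e g → PolyFun (c * c′) (d ℕ.+ e) (λ x → f x * g x)
    pf-* {c} zero e {f} {g} p q = pf-cong e (λ x → cong (_* g x) (sym (p x))) (pf-scale c e q)
    pf-* {c} {c′} (suc d) e {f} {g} (a , h , p , eq) q =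
      pf-lead (suc d ℕ.+ e) (+-identityˡ _) (pf-cong (suc d ℕ.+ e) (λ x → sym (trans (cong (_* g x) (eq x)) (lem a x (h x) (g x))))
        (pf-+ (suc d ℕ.+ e)
          (pf-raise< (ℕ.s≤s (ℕₚ.m≤n+m e d)) (pf-scale a e q))
          (pf-shift (d ℕ.+ e) (pf-* d e p q))))
      where
      lem : ∀ a x h g → (a + x * h) * g ≡ a * g + x * (h * g)
      lem = solve 4 (λ a x h g → (a :+ x :* h) :* g := a :* g :+ x :* (h :* g)) refl

    pf-id : PolyFun 1# 1 (λ x → x)
    pf-id = 0# , (λ _ → 1#) , (λ _ → refl) , λ x → trans (sym (*-identityʳ x)) (sym (+-identityˡ _))

    pf-^ : ∀ {d f} → PolyFun 1# d f → ∀ n → PolyFun 1# (n ℕ.* d) (λ x → f x ^ n)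
    pf-^ p zero = λ x → refl
    pf-^ {d} p (suc n) = pf-lead (d ℕ.+ n ℕ.* d) (*-identityˡ 1#) (pf-* d (n ℕ.* d) p (pf-^ p n))

    pf-pow : ∀ n → PolyFun 1# n (_^ n)
    pf-pow n = subst (λ d → PolyFun 1# d (_^ n)) (ℕₚ.*-identityʳ n) (pf-^ pf-id n)

    -- Horner's scheme for division by X - r. The quotient keeps the leading coefficient, which is
    -- why the root bounds can be proved by induction on the degree alone.
    pf-divide : ∀ {c} d {f} → PolyFun c (suc d) f → ∀ r →
                ∃ λ g → PolyFun c d g × (∀ x → f x ≡ f r + (x + - r) * g x)
    pf-divide {c} zero {f} (a , g , p , e) r = g , p , λ x →
      trans (e x) (trans (lem a x r (g x)) (cong (_+ (x + - r) * g x)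
        (trans (cong (λ z → a + r * z) (trans (p x) (sym (p r)))) (sym (e r)))))
      where
      lem : ∀ a x r g → a + x * g ≡ a + r * g + (x + - r) * g
      lem = solve 4 (λ a x r g → a :+ x :* g := a :+ r :* g :+ (x :+ :- r) :* g) refl
    pf-divide {c} (suc d) {f} (a , h , p , e) r with pf-divide d p r
    ... | g , q , e′ = (λ x → h r + x * g x) , (h r , g , q , λ x → refl) , λ x →
      trans (e x) (trans (cong (λ z → a + x * z) (e′ x)) (trans (lem a x r (h r) (g x))
        (cong (_+ (x + - r) * (h r + x * g x)) (sym (e r)))))
      where
      lem : ∀ a x r h g → a + x * (h + (x + - r) * g) ≡ a + r * h + (x + - r) * (h + x * g)
      lem = solve 5 (λ a x r h g → a :+ x :* (h :+ (x :+ :- r) :* g) := a :+ r :* h :+ (x :+ :- r) :* (h :+ x :* g)) refl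

    private
      quotient-roots : ∀ {f g : Carrier → Carrier} {r rs} → (∀ x → f x ≡ f r + (x + - r) * g x) →
                       f r ≡ 0# → All (r ≢_) rs → All (λ x → f x ≡ 0#) rs → All (λ x → g x ≡ 0#) rs
      quotient-roots e fr []       []       = []
      quotient-roots {f} {g} {r} e fr (n ∷ ns) (_∷_ {x = x} z zs) =
        x*y≡0 (trans (sym (+-identityˡ _)) (trans (cong (_+ (x + - r) * g x) (sym fr)) (trans (sym (e x)) z)))
              (λ z → n (sym (x-y≡0 z)))
        ∷ quotient-roots e fr ns zs

    roots-≤ : ∀ {c} d {f} → c ≢ 0# → PolyFun c d f → ∀ {rs} → Unique rs → All (λ x → f x ≡ 0#) rs → length rs ℕ.≤ d
    roots-≤ d       c≢0 p []      []       = ℕ.z≤n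
    roots-≤ zero    c≢0 p (_ ∷ _) (_∷_ {x = x} z _) = ⊥-elim (c≢0 (trans (sym (p x)) z))
    roots-≤ (suc d) c≢0 p (n ∷ u) (_∷_ {x = x} z zs) with pf-divide d p x
    ... | g , q , e = ℕ.s≤s (roots-≤ d c≢0 q u (quotient-roots e z n zs))

    -- Each root splits off a linear factor. Once all of them are used, degree 0 is reached and only
    -- the recorded leading coefficient is left, which is 0.
    many-roots⇒0 : ∀ {f} {rs} → PolyFun 0# (length rs) f → Unique rs → All (λ x → f x ≡ 0#) rs → ∀ x → f x ≡ 0#
    many-roots⇒0 {rs = []} p _ _ = p
    many-roots⇒0 {f} {r ∷ rs} p (n ∷ u) (z ∷ zs) x with pf-divide (length rs) p r
    ... | g , q , e = trans (e x) (trans (cong₂ _+_ z (cong ((x + - r) *_)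
            (many-roots⇒0 q u (quotient-roots e z n zs) x))) (trans (+-identityˡ _) (zeroʳ _)))

    count-roots-≤ : ∀ {c} d {f} → c ≢ 0# → PolyFun c d f →
                    ∑ (enum finite) (λ x → 𝟙 (f x ≟ 0#)) ℤ.≤ ℤ.+ d
    count-roots-≤ d {f} c≢0 p = subst (ℤ._≤ ℤ.+ d) (sym (∑-𝟙-length root? (enum finite)))
      (ℤ.+≤+ (roots-≤ d c≢0 p (Uniqueₚ.filter⁺ root? (unique finite)) (Allₚ.all-filter root? (enum finite))))
      where
      root? : ∀ x → Dec (f x ≡ 0#)
      root? x = f x ≟ 0#

open FiniteFields

-- Monic polynomials as coefficient lists: product, division and evaluation.

module Polynomials where
  open import Data.Nat using (_≤_)
  open import Data.List using (_∷ʳ_; map)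
  import Relation.Binary.PropositionalEquality as ≡

  -- The list [a₀, …, aₙ₋₁] stands both for a₀ + … + aₙ₋₁Xⁿ⁻¹ (evaluated by ev) and for the
  -- monic polynomial a₀ + … + aₙ₋₁Xⁿ⁻¹ + Xⁿ (evaluated by evM).
  module Lists (K : FiniteField) where
    open FiniteField K
    open FieldProperties K

    Poly : Set
    Poly = List Carrier

    scale : Carrier → Poly → Poly
    scale c = map (c *_)

    full : Poly → Poly
    full f = f ∷ʳ 1#

    -- The first list is read as an ordinary polynomial, the second as a monic one. The clause
    -- returning the empty list is a default value; `mulM-fits` shows that multiplication never
    -- reaches it.
    addM : Poly → Poly → Poly
    addM []      g       = g
    addM (a ∷ f) []      = []
    addM (a ∷ f) (b ∷ g) = a + b ∷ addM f g

    -- (a + X f) g = a g + X (f g). The summand a g is not monic, so `full` first makes the leading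
    -- 1 of g explicit.
    mulM : Poly → Poly → Poly
    mulM []      g = g
    mulM (a ∷ f) g = addM (scale a (full g)) (0# ∷ mulM f g)

    powM : Poly → ℕ → Poly
    powM f zero    = []
    powM f (suc n) = mulM f (powM f n)

    length-addM : ∀ f g → length f ≤ length g → length (addM f g) ≡ length g
    length-addM []      g       _       = refl
    length-addM (a ∷ f) (b ∷ g) (s≤s l) = cong suc (length-addM f g l)

    length-scale-full : ∀ a g → length (scale a (full g)) ≡ suc (length g)
    length-scale-full a g = trans (Listₚ.length-map (a *_) (full g)) (trans (Listₚ.length-++ g) (ℕₚ.+-comm (length g) 1))

    length-mulM : ∀ f g → length (mulM f g) ≡ length f ℕ.+ length g

    mulM-fits : ∀ a f g → length (scale a (full g)) ≤ suc (length (mulM f g))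
    mulM-fits a f g = ≡.subst₂ _≤_ (sym (length-scale-full a g)) (cong suc (sym (length-mulM f g)))
                       (s≤s (ℕₚ.m≤n+m _ (length f)))

    length-mulM []      g = refl
    length-mulM (a ∷ f) g = trans (length-addM (scale a (full g)) (0# ∷ mulM f g) (mulM-fits a f g)) (cong suc (length-mulM f g))

    length-powM : ∀ f n → length (powM f n) ≡ n ℕ.* length f
    length-powM f zero    = refl
    length-powM f (suc n) = trans (length-mulM f (powM f n)) (cong (length f ℕ.+_) (length-powM f n))

    -- The vector has one entry more than a remainder modulo f. The number t is its top entry, and
    -- subtracting t times the monic polynomial f removes that entry.
    reduce : (f : Poly) → Vec Carrier (suc (length f)) → Carrier × Vec Carrier (length f)
    reduce []      (t ∷ []) = t , []
    reduce (b ∷ f) (x ∷ l) with reduce f l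
    ... | t , r = t , x + - (t * b) ∷ r

    subM : (h f : Poly) → length f ≡ length h → Vec Carrier (length f)
    subM h       []      _ = []
    subM (a ∷ h) (b ∷ f) e = a + - b ∷ subM h f (ℕₚ.suc-injective e)

    -- The quotient of monic polynomials is again monic, so it fits the same encoding. If the
    -- degrees agree it is 1. Otherwise h = q f + r for the tail gives a + X h = X q f + (a + X r),
    -- and `reduce` on the last bracket supplies both the constant term of the new quotient and the
    -- new remainder.
    divM : (h f : Poly) → length f ≤ length h → Poly × Vec Carrier (length f)
    divM []      []      _ = [] , []
    divM (a ∷ h) f l with ℕₚ.m≤n⇒m<n∨m≡n l
    ... | inj₂ e = [] , subM (a ∷ h) f e
    ... | inj₁ (s≤s l′) with divM h f l′
    ...   | q , r = proj₁ (reduce f (a ∷ r)) ∷ q , proj₂ (reduce f (a ∷ r))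

    length-divM : ∀ h f l → length (proj₁ (divM h f l)) ℕ.+ length f ≡ length h
    length-divM []      []      _ = refl
    length-divM (a ∷ h) f l with ℕₚ.m≤n⇒m<n∨m≡n l
    ... | inj₂ e        = e
    ... | inj₁ (s≤s l′) = cong suc (length-divM h f l′)

  -- The target is any commutative ring because the same polynomials get evaluated in formal power
  -- series, in K[X]/(P) and in field extensions of K.
  record Hom (K : FiniteField) (R : CommutativeRing 0ℓ 0ℓ) : Set where
    private
      module K = FiniteField K
      module R = CommutativeRing R
    field
      ι     : K.Carrier → R.Carrier
      +-hom : ∀ a b → ι (a K.+ b) R.≈ ι a R.+ ι b
      *-hom : ∀ a b → ι (a K.* b) R.≈ ι a R.* ι b
      1-hom : ι K.1# R.≈ R.1#
      0-hom : ι K.0# R.≈ R.0#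

    neg-hom : ∀ a → ι (K.- a) R.≈ R.- ι a
    neg-hom a = inverseʳ-unique (ι a) (ι (K.- a))
      (R.trans (R.sym (+-hom a (K.- a))) (R.trans (R.reflexive (cong ι (K.-‿inverseʳ a))) 0-hom))
      where open import Algebra.Properties.Group R.+-group using (inverseʳ-unique)

  module Evaluation {K : FiniteField} {R : CommutativeRing 0ℓ 0ℓ} (φ : Hom K R) where
    private module K = FiniteField K
    open Hom φ
    open Lists K
    open CommutativeRing R hiding (refl; trans; sym) renaming (Carrier to A)
    private module R = CommutativeRing R
    open IntegerSolver R using (solve; _:=_; _:+_; _:*_; :-_; con)
    open import Relation.Binary.Reasoning.Setoid setoid

    ev : Poly → A → A
    ev []      z = 0#
    ev (a ∷ f) z = ι a + z * ev f z

    evM : Poly → A → A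
    evM []      z = 1#
    evM (a ∷ f) z = ι a + z * evM f z

    ev-full : ∀ f z → ev (full f) z ≈ evM f z
    ev-full []      z = R.trans (+-cong 1-hom (zeroʳ z)) (+-identityʳ 1#)
    ev-full (a ∷ f) z = +-congˡ (*-congˡ (ev-full f z))

    ev-scale : ∀ c f z → ev (scale c f) z ≈ ι c * ev f z
    ev-scale c []      z = R.sym (zeroʳ _)
    ev-scale c (a ∷ f) z = R.trans (+-cong (*-hom c a) (*-congˡ (ev-scale c f z)))
      (lem (ι c) (ι a) z (ev f z))
      where
      lem : ∀ c a z f → c * a + z * (c * f) ≈ c * (a + z * f)
      lem = solve 4 (λ c a z f → c :* a :+ z :* (c :* f) := c :* (a :+ z :* f)) R.refl

    evM-addM : ∀ f g z → length f ≤ length g → evM (addM f g) z ≈ ev f z + evM g z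
    evM-addM []      g       z _       = R.sym (+-identityˡ _)
    evM-addM (a ∷ f) (b ∷ g) z (s≤s l) = R.trans (+-cong (+-hom a b) (*-congˡ (evM-addM f g z l)))
      (lem (ι a) (ι b) z (ev f z) (evM g z))
      where
      lem : ∀ a b z f g → a + b + z * (f + g) ≈ a + z * f + (b + z * g)
      lem = solve 5 (λ a b z f g → a :+ b :+ z :* (f :+ g) := a :+ z :* f :+ (b :+ z :* g)) R.refl

    evM-mulM : ∀ f g z → evM (mulM f g) z ≈ evM f z * evM g z
    evM-mulM []      g z = R.sym (*-identityˡ _)
    evM-mulM (a ∷ f) g z = begin
      evM (addM (scale a (full g)) (K.0# ∷ mulM f g)) z
        ≈⟨ evM-addM (scale a (full g)) (K.0# ∷ mulM f g) z (mulM-fits a f g) ⟩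
      ev (scale a (full g)) z + (ι K.0# + z * evM (mulM f g) z)
        ≈⟨ +-cong (R.trans (ev-scale a (full g) z) (*-congˡ (ev-full g z)))
                  (+-cong 0-hom (*-congˡ (evM-mulM f g z))) ⟩
      ι a * evM g z + (0# + z * (evM f z * evM g z))
        ≈⟨ lem (ι a) z (evM f z) (evM g z) ⟩
      (ι a + z * evM f z) * evM g z ∎
      where
      lem : ∀ a z f g → a * g + (0# + z * (f * g)) ≈ (a + z * f) * g
      lem = solve 4 (λ a z f g → a :* g :+ (con ℤ.0ℤ :+ z :* (f :* g)) := (a :+ z :* f) :* g) R.refl

    ev-reduce : ∀ f l z → ev (toList l) z ≈
                ι (proj₁ (reduce f l)) * evM f z + ev (toList (proj₂ (reduce f l))) z
    ev-reduce []      (t ∷ []) z = lem (ι t) z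
      where
      lem : ∀ t z → t + z * 0# ≈ t * 1# + 0#
      lem = solve 2 (λ t z → t :+ z :* con ℤ.0ℤ := t :* con ℤ.1ℤ :+ con ℤ.0ℤ) R.refl
    ev-reduce (b ∷ f) (x ∷ l) z with reduce f l | ev-reduce f l z
    ... | t , r | ih = begin
      ι x + z * ev (toList l) z
        ≈⟨ +-congˡ (*-congˡ ih) ⟩
      ι x + z * (ι t * evM f z + ev (toList r) z)
        ≈⟨ lem (ι x) z (ι t) (evM f z) (ev (toList r) z) (ι b) ⟩
      ι t * (ι b + z * evM f z) + (ι x + - (ι t * ι b) + z * ev (toList r) z)
        ≈⟨ +-congˡ (+-congʳ (+-congˡ (-‿cong (*-hom t b)))) ⟨
      ι t * (ι b + z * evM f z) + (ι x + - ι (t K.* b) + z * ev (toList r) z)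
        ≈⟨ +-congˡ (+-congʳ (+-congˡ (neg-hom (t K.* b)))) ⟨
      ι t * (ι b + z * evM f z) + (ι x + ι (K.- (t K.* b)) + z * ev (toList r) z)
        ≈⟨ +-congˡ (+-congʳ (+-hom x (K.- (t K.* b)))) ⟨
      ι t * (ι b + z * evM f z) + (ι (x K.+ K.- (t K.* b)) + z * ev (toList r) z) ∎
      where
      lem : ∀ x z t f r b → x + z * (t * f + r) ≈ t * (b + z * f) + (x + - (t * b) + z * r)
      lem = solve 6 (λ x z t f r b → x :+ z :* (t :* f :+ r) := t :* (b :+ z :* f) :+ (x :+ :- (t :* b) :+ z :* r)) R.refl

    ev-subM : ∀ h f e z → evM h z ≈ evM f z + ev (toList (subM h f e)) z
    ev-subM []      []      e z = R.sym (+-identityʳ _)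
    ev-subM (a ∷ h) (b ∷ f) e z = begin
      ι a + z * evM h z
        ≈⟨ +-congˡ (*-congˡ (ev-subM h f (ℕₚ.suc-injective e) z)) ⟩
      ι a + z * (evM f z + ev (toList s) z)
        ≈⟨ lem (ι a) z (evM f z) (ev (toList s) z) (ι b) ⟩
      ι b + z * evM f z + (ι a + - ι b + z * ev (toList s) z)
        ≈⟨ +-congˡ (+-congʳ (R.trans (+-hom a (K.- b)) (+-congˡ (neg-hom b)))) ⟨
      ι b + z * evM f z + (ι (a K.+ K.- b) + z * ev (toList s) z) ∎
      where
      s = subM h f (ℕₚ.suc-injective e)
      lem : ∀ a z f s b → a + z * (f + s) ≈ b + z * f + (a + - b + z * s)
      lem = solve 5 (λ a z f s b → a :+ z :* (f :+ s) := b :+ z :* f :+ (a :+ :- b :+ z :* s)) R.refl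

    ev-divM : ∀ h f l z → evM h z ≈
              evM (proj₁ (divM h f l)) z * evM f z + ev (toList (proj₂ (divM h f l))) z
    ev-divM []      []      _ z = R.sym (R.trans (+-identityʳ _) (*-identityʳ 1#))
    ev-divM (a ∷ h) f l z with ℕₚ.m≤n⇒m<n∨m≡n l
    ... | inj₂ e        = R.trans (ev-subM (a ∷ h) f e z) (+-congʳ (R.sym (*-identityˡ _)))
    ... | inj₁ (s≤s l′) with divM h f l′ | ev-divM h f l′ z
    ...   | q , r | ih = begin
      ι a + z * evM h z
        ≈⟨ +-congˡ (*-congˡ ih) ⟩
      ι a + z * (evM q z * evM f z + ev (toList r) z)
        ≈⟨ lem₁ (ι a) z (evM q z) (evM f z) (ev (toList r) z) ⟩
      z * (evM q z * evM f z) + ev (toList (a ∷ r)) z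
        ≈⟨ +-congˡ (ev-reduce f (a ∷ r) z) ⟩
      z * (evM q z * evM f z) + (ι t * evM f z + ev (toList s) z)
        ≈⟨ lem₂ z (evM q z) (evM f z) (ι t) (ev (toList s) z) ⟩
      (ι t + z * evM q z) * evM f z + ev (toList s) z ∎
      where
      t = proj₁ (reduce f (a ∷ r))
      s = proj₂ (reduce f (a ∷ r))
      lem₁ : ∀ a z q f r → a + z * (q * f + r) ≈ z * (q * f) + (a + z * r)
      lem₁ = solve 5 (λ a z q f r → a :+ z :* (q :* f :+ r) := z :* (q :* f) :+ (a :+ z :* r)) R.refl
      lem₂ : ∀ z q f t s → z * (q * f) + (t * f + s) ≈ (t + z * q) * f + s
      lem₂ = solve 5 (λ z q f t s → z :* (q :* f) :+ (t :* f :+ s) := (t :+ z :* q) :* f :+ s) R.refl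

  -- Formal power series over K, the ring in which polynomial identities are checked.

  module PowerSeries (K : FiniteField) where
    open FiniteField K
    open FieldProperties K
    open IntegerSolver commutativeRing using (solve; _:=_; _:+_; _:*_; :-_; con)
    open ≡.≡-Reasoning

    Series : Set
    Series = ℕ → Carrier

    infix 4 _≈ˢ_
    infixl 6 _+ˢ_
    infixl 7 _*ˢ_ _·ˢ_

    _≈ˢ_ : Series → Series → Set
    f ≈ˢ g = ∀ n → f n ≡ g n

    tail : Series → Series
    tail f n = f (suc n)

    const : Carrier → Series
    const a zero    = a
    const a (suc n) = 0#

    X : Series
    X zero    = 0#
    X (suc n) = const 1# n

    -- The Cauchy product in the recursive form (f 0 + X · tail f) g, which lets the ring laws be
    -- proved by induction on the index instead of by manipulating double sums.
    _+ˢ_ _*ˢ_ : Series → Series → Series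
    (f +ˢ g) n = f n + g n
    (f *ˢ g) zero    = f zero * g zero
    (f *ˢ g) (suc n) = f zero * g (suc n) + (tail f *ˢ g) n

    -ˢ_ : Series → Series
    (-ˢ f) n = - f n

    _·ˢ_ : Carrier → Series → Series
    (a ·ˢ f) n = a * f n

    *ˢ-cong : ∀ {f f′ g g′} → f ≈ˢ f′ → g ≈ˢ g′ → f *ˢ g ≈ˢ f′ *ˢ g′
    *ˢ-cong p q zero    = cong₂ _*_ (p 0) (q 0)
    *ˢ-cong p q (suc n) = cong₂ _+_ (cong₂ _*_ (p 0) (q (suc n))) (*ˢ-cong (λ k → p (suc k)) q n)

    *ˢ-zeroˡ : ∀ f g → (∀ n → f n ≡ 0#) → ∀ n → (f *ˢ g) n ≡ 0#
    *ˢ-zeroˡ f g z zero    = trans (cong (_* g 0) (z 0)) (zeroˡ _)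
    *ˢ-zeroˡ f g z (suc n) = trans (cong₂ _+_ (trans (cong (_* g (suc n)) (z 0)) (zeroˡ _))
      (*ˢ-zeroˡ (tail f) g (λ k → z (suc k)) n)) (+-identityˡ 0#)

    const-*ˢ : ∀ a g → const a *ˢ g ≈ˢ a ·ˢ g
    const-*ˢ a g zero    = refl
    const-*ˢ a g (suc n) = trans (cong (a * g (suc n) +_) (*ˢ-zeroˡ (tail (const a)) g (λ _ → refl) n)) (+-identityʳ _)

    X-*ˢ-zero : ∀ f → (X *ˢ f) 0 ≡ 0#
    X-*ˢ-zero f = zeroˡ _

    X-*ˢ-suc : ∀ f n → (X *ˢ f) (suc n) ≡ f n
    X-*ˢ-suc f n = trans (cong₂ _+_ (zeroˡ _) (trans (const-*ˢ 1# f n) (*-identityˡ _))) (+-identityˡ _)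

    *ˢ-distribʳ : ∀ h f g → (f +ˢ g) *ˢ h ≈ˢ f *ˢ h +ˢ g *ˢ h
    *ˢ-distribʳ h f g zero    = distribʳ _ _ _
    *ˢ-distribʳ h f g (suc n) = trans (cong ((f 0 + g 0) * h (suc n) +_) (*ˢ-distribʳ h (tail f) (tail g) n))
      (lem (f 0) (g 0) (h (suc n)) ((tail f *ˢ h) n) ((tail g *ˢ h) n))
      where
      lem : ∀ a b c d e → (a + b) * c + (d + e) ≡ a * c + d + (b * c + e)
      lem = solve 5 (λ a b c d e → (a :+ b) :* c :+ (d :+ e) := a :* c :+ d :+ (b :* c :+ e)) refl

    ·ˢ-*ˢ : ∀ a f g → (a ·ˢ f) *ˢ g ≈ˢ a ·ˢ (f *ˢ g)
    ·ˢ-*ˢ a f g zero    = *-assoc _ _ _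
    ·ˢ-*ˢ a f g (suc n) = trans (cong (a * f 0 * g (suc n) +_) (·ˢ-*ˢ a (tail f) g n))
      (lem a (f 0) (g (suc n)) ((tail f *ˢ g) n))
      where
      lem : ∀ a b c d → a * b * c + a * d ≡ a * (b * c + d)
      lem = solve 4 (λ a b c d → a :* b :* c :+ a :* d := a :* (b :* c :+ d)) refl

    *ˢ-suc′ : ∀ f g n → (f *ˢ g) (suc n) ≡ f (suc n) * g 0 + (f *ˢ tail g) n
    *ˢ-suc′ f g zero    = +-comm _ _
    *ˢ-suc′ f g (suc n) = trans (cong (f 0 * g (suc (suc n)) +_) (*ˢ-suc′ (tail f) g n))
      (lem (f 0 * g (suc (suc n))) (f (suc (suc n)) * g 0) ((tail f *ˢ tail g) n))
      where
      lem : ∀ a b c → a + (b + c) ≡ b + (a + c)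
      lem = solve 3 (λ a b c → a :+ (b :+ c) := b :+ (a :+ c)) refl

    *ˢ-comm : ∀ f g → f *ˢ g ≈ˢ g *ˢ f
    *ˢ-comm f g zero    = *-comm _ _
    *ˢ-comm f g (suc n) = trans (cong₂ _+_ (*-comm (f 0) (g (suc n))) (*ˢ-comm (tail f) g n)) (sym (*ˢ-suc′ g f n))

    *ˢ-assoc : ∀ f g h → (f *ˢ g) *ˢ h ≈ˢ f *ˢ (g *ˢ h)
    *ˢ-assoc f g h zero    = *-assoc _ _ _
    *ˢ-assoc f g h (suc n) = begin
      f 0 * g 0 * h (suc n) + ((f 0 ·ˢ tail g +ˢ tail f *ˢ g) *ˢ h) n
        ≡⟨ cong (f 0 * g 0 * h (suc n) +_) (*ˢ-distribʳ h (f 0 ·ˢ tail g) (tail f *ˢ g) n) ⟩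
      f 0 * g 0 * h (suc n) + (((f 0 ·ˢ tail g) *ˢ h) n + ((tail f *ˢ g) *ˢ h) n)
        ≡⟨ cong (f 0 * g 0 * h (suc n) +_) (cong₂ _+_ (·ˢ-*ˢ (f 0) (tail g) h n) (*ˢ-assoc (tail f) g h n)) ⟩
      f 0 * g 0 * h (suc n) + (f 0 * (tail g *ˢ h) n + (tail f *ˢ (g *ˢ h)) n)
        ≡⟨ lem (f 0) (g 0) (h (suc n)) ((tail g *ˢ h) n) ((tail f *ˢ (g *ˢ h)) n) ⟩
      f 0 * (g 0 * h (suc n) + (tail g *ˢ h) n) + (tail f *ˢ (g *ˢ h)) n ∎
      where
      lem : ∀ a b c d e → a * b * c + (a * d + e) ≡ a * (b * c + d) + e
      lem = solve 5 (λ a b c d e → a :* b :* c :+ (a :* d :+ e) := a :* (b :* c :+ d) :+ e) refl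

    one-*ˢ : ∀ f → const 1# *ˢ f ≈ˢ f
    one-*ˢ f n = trans (const-*ˢ 1# f n) (*-identityˡ _)

    series : CommutativeRing 0ℓ 0ℓ
    series = record
      { Carrier = Series ; _≈_ = _≈ˢ_ ; _+_ = _+ˢ_ ; _*_ = _*ˢ_ ; -_ = -ˢ_ ; 0# = λ _ → 0# ; 1# = const 1#
      ; isCommutativeRing = record
        { isRing = record
          { +-isAbelianGroup = record
            { isGroup = record
              { isMonoid = record
                { isSemigroup = record
                  { isMagma = record
                    { isEquivalence = record
                      { refl = λ n → refl ; sym = λ p n → sym (p n) ; trans = λ p q n → trans (p n) (q n) }
                    ; ∙-cong = λ p q n → cong₂ _+_ (p n) (q n) }
                  ; assoc = λ f g h n → +-assoc _ _ _ }
                ; identity = (λ f n → +-identityˡ _) , (λ f n → +-identityʳ _) }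
              ; inverse = (λ f n → -‿inverseˡ _) , (λ f n → -‿inverseʳ _)
              ; ⁻¹-cong = λ p n → cong -_ (p n) }
            ; comm = λ f g n → +-comm _ _ }
          ; *-cong = *ˢ-cong
          ; *-assoc = *ˢ-assoc
          ; *-identity = one-*ˢ , (λ f n → trans (*ˢ-comm f (const 1#) n) (one-*ˢ f n))
          ; distrib = (λ h f g n → trans (*ˢ-comm h (f +ˢ g) n) (trans (*ˢ-distribʳ h f g n)
                         (cong₂ _+_ (*ˢ-comm f h n) (*ˢ-comm g h n))))
                    , *ˢ-distribʳ }
        ; *-comm = *ˢ-comm } }

    constants : Hom K series
    constants = record
      { ι = const
      ; +-hom = λ { a b zero → refl ; a b (suc n) → sym (+-identityˡ 0#) }
      ; *-hom = λ { a b zero → refl ; a b (suc n) → sym (trans (const-*ˢ a (const b) (suc n)) (zeroʳ a)) }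
      ; 1-hom = λ n → refl
      ; 0-hom = λ { zero → refl ; (suc n) → refl }
      }

  -- Monic polynomials form a cancellative commutative monoid.

  module MonicMonoid (K : FiniteField) where
    open FiniteField K
    open FieldProperties K
    open Lists K
    open PowerSeries K
    open Evaluation constants
    private module S = CommutativeRing series
    open IntegerSolver series using (solve; _:=_; _:+_; _:*_; :-_; con)
    open import Relation.Binary.Reasoning.Setoid S.setoid

    ev-zero : ∀ a f → (const a +ˢ X *ˢ f) 0 ≡ a
    ev-zero a f = trans (cong (a +_) (X-*ˢ-zero f)) (+-identityʳ a)

    ev-suc : ∀ a f n → (const a +ˢ X *ˢ f) (suc n) ≡ f n
    ev-suc a f n = trans (cong (0# +_) (X-*ˢ-suc f n)) (+-identityˡ _)

    cons-injective : ∀ {a b f g} → const a +ˢ X *ˢ f ≈ˢ const b +ˢ X *ˢ g → a ≡ b × f ≈ˢ g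
    cons-injective {a} {b} {f} {g} e =
      trans (sym (ev-zero a f)) (trans (e 0) (ev-zero b g)) ,
      λ n → trans (sym (ev-suc a f n)) (trans (e (suc n)) (ev-suc b g n))

    evM≢0 : ∀ f → ¬ (∀ n → evM f X n ≡ 0#)
    evM≢0 []      e = 1≢0 (e 0)
    evM≢0 (a ∷ f) e = evM≢0 f (λ n → trans (sym (ev-suc a (evM f X) n)) (e (suc n)))

    -- Coefficients are read off one at a time. If one list ends first, the other's remaining monic
    -- part would be the zero series, against `evM≢0`. The laws of the power series ring thereby
    -- pass to lists.
    evM-injective : ∀ f g → evM f X ≈ˢ evM g X → f ≡ g
    evM-injective []      []      e = refl
    evM-injective []      (b ∷ g) e = ⊥-elim (evM≢0 g (λ n → trans (sym (ev-suc b (evM g X) n)) (sym (e (suc n)))))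
    evM-injective (a ∷ f) []      e = ⊥-elim (evM≢0 f (λ n → trans (sym (ev-suc a (evM f X) n)) (e (suc n))))
    evM-injective (a ∷ f) (b ∷ g) e with cons-injective e
    ... | refl , e′ = cong (a ∷_) (evM-injective f g e′)

    mulM-comm : ∀ f g → mulM f g ≡ mulM g f
    mulM-comm f g = evM-injective _ _ (begin
      evM (mulM f g) X      ≈⟨ evM-mulM f g X ⟩
      evM f X *ˢ evM g X    ≈⟨ S.*-comm (evM f X) (evM g X) ⟩
      evM g X *ˢ evM f X    ≈⟨ evM-mulM g f X ⟨
      evM (mulM g f) X ∎)

    mulM-assoc : ∀ f g h → mulM (mulM f g) h ≡ mulM f (mulM g h)
    mulM-assoc f g h = evM-injective _ _ (begin
      evM (mulM (mulM f g) h) X            ≈⟨ evM-mulM (mulM f g) h X ⟩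
      evM (mulM f g) X *ˢ evM h X          ≈⟨ S.*-congʳ {evM h X} (evM-mulM f g X) ⟩
      evM f X *ˢ evM g X *ˢ evM h X        ≈⟨ S.*-assoc (evM f X) (evM g X) (evM h X) ⟩
      evM f X *ˢ (evM g X *ˢ evM h X)      ≈⟨ S.*-congˡ {evM f X} (evM-mulM g h X) ⟨
      evM f X *ˢ evM (mulM g h) X          ≈⟨ evM-mulM f (mulM g h) X ⟨
      evM (mulM f (mulM g h)) X ∎)

    mulM-identityʳ : ∀ f → mulM f [] ≡ f
    mulM-identityʳ f = mulM-comm f []

    powM-+ : ∀ f m n → powM f (m ℕ.+ n) ≡ mulM (powM f m) (powM f n)
    powM-+ f zero    n = refl
    powM-+ f (suc m) n = trans (cong (mulM f) (powM-+ f m n)) (sym (mulM-assoc f _ _))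

    -- Factors X are stripped until the constant term a is nonzero. From then on a · s 0 = 0 forces
    -- s 0 = 0, and the same argument applies to the tail of s.
    evM-*ˢ-regular : ∀ f s → evM f X *ˢ s ≈ˢ (λ _ → 0#) → s ≈ˢ (λ _ → 0#)
    evM-*ˢ-regular [] s e n = trans (sym (one-*ˢ s n)) (e n)
    evM-*ˢ-regular (a ∷ f) s e with a ≟ 0#
    ... | yes refl = evM-*ˢ-regular f s λ n →
            trans (sym (X-*ˢ-suc (evM f X *ˢ s) n)) (trans (sym (*ˢ-assoc X (evM f X) s (suc n)))
              (trans (sym (*ˢ-cong {g = s} drop0 (λ _ → refl) (suc n))) (e (suc n))))
      where
      drop0 : const 0# +ˢ X *ˢ evM f X ≈ˢ X *ˢ evM f X
      drop0 zero    = +-identityˡ _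
      drop0 (suc n) = +-identityˡ _
    ... | no a≢0 = λ n → go n s e
      where
      h = const a +ˢ X *ˢ evM f X
      go : ∀ n s → h *ˢ s ≈ˢ (λ _ → 0#) → s n ≡ 0#
      head0 : ∀ s → h *ˢ s ≈ˢ (λ _ → 0#) → s 0 ≡ 0#
      head0 s e = x*y≡0 (trans (cong (_* s 0) (sym (ev-zero a (evM f X)))) (e 0)) a≢0
      go zero    s e = head0 s e
      go (suc n) s e = go n (tail s) (λ k → trans (sym (+-identityˡ _))
        (trans (cong (_+ (h *ˢ tail s) k) (sym (trans (cong (h (suc k) *_) (head0 s e)) (zeroʳ _))))
          (trans (sym (*ˢ-suc′ h s k)) (e (suc k)))))

    mulM-cancelˡ : ∀ f {g h} → mulM f g ≡ mulM f h → g ≡ h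
    mulM-cancelˡ f {g} {h} e = evM-injective g h λ n → x-y≡0 (evM-*ˢ-regular f (evM g X +ˢ -ˢ evM h X) eq n)
      where
      lem : ∀ f g h → f *ˢ (g +ˢ -ˢ h) ≈ˢ f *ˢ g +ˢ -ˢ (f *ˢ h)
      lem = solve 3 (λ f g h → f :* (g :+ :- h) := f :* g :+ :- (f :* h)) (λ _ → refl)
      eq : evM f X *ˢ (evM g X +ˢ -ˢ evM h X) ≈ˢ (λ _ → 0#)
      eq n = trans (lem (evM f X) (evM g X) (evM h X) n)
        (trans (cong₂ (λ u v → u + - v) (sym (evM-mulM f g X n)) (sym (evM-mulM f h X n)))
          (trans (cong (λ w → evM w X n + - evM (mulM f h) X n) e) (-‿inverseʳ _)))

open Polynomials

-- The field K[X]/(P) for an irreducible polynomial P.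

module QuotientFields where
  open import Data.Nat using (_≤_; _<_)

  module VecSpace (K : FiniteField) (n : ℕ) where
    open FiniteField K
    open FieldProperties K

    infixl 6 _+ᵛ_
    infixl 7 _·ᵛ_

    V : Set
    V = Vec Carrier n

    _+ᵛ_ : V → V → V
    _+ᵛ_ = zipWith _+_

    -ᵛ_ : V → V
    -ᵛ_ = Vec.map (-_)

    0ᵛ : V
    0ᵛ = replicate n 0#

    _·ᵛ_ : Carrier → V → V
    c ·ᵛ v = Vec.map (c *_) v

    isAbelianGroup : IsAbelianGroup _≡_ _+ᵛ_ 0ᵛ -ᵛ_
    isAbelianGroup = record
      { isGroup = record
        { isMonoid = record
          { isSemigroup = record
            { isMagma = record { isEquivalence = isEquivalence ; ∙-cong = cong₂ _+ᵛ_ }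
            ; assoc = Vecₚ.zipWith-assoc +-assoc }
          ; identity = Vecₚ.zipWith-identityˡ +-identityˡ , Vecₚ.zipWith-identityʳ +-identityʳ }
        ; inverse = Vecₚ.zipWith-inverseˡ -‿inverseˡ , Vecₚ.zipWith-inverseʳ -‿inverseʳ
        ; ⁻¹-cong = cong (-ᵛ_) }
      ; comm = Vecₚ.zipWith-comm +-comm }

    open IsAbelianGroup isAbelianGroup public
      renaming (assoc to +ᵛ-assoc; comm to +ᵛ-comm; identityˡ to +ᵛ-identityˡ; identityʳ to +ᵛ-identityʳ;
                inverseˡ to +ᵛ-inverseˡ; inverseʳ to +ᵛ-inverseʳ) using ()

    +ᵛ-interchange : ∀ a b c d → (a +ᵛ b) +ᵛ (c +ᵛ d) ≡ (a +ᵛ c) +ᵛ (b +ᵛ d)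
    +ᵛ-interchange a b c d = trans (+ᵛ-assoc a b _) (trans (cong (a +ᵛ_)
      (trans (sym (+ᵛ-assoc b c d)) (trans (cong (_+ᵛ d) (+ᵛ-comm b c)) (+ᵛ-assoc c b d))))
      (sym (+ᵛ-assoc a c _)))

  ·ᵛ-+ᵛ : ∀ K {n} c (u v : VecSpace.V K n) →
          let open VecSpace K n in c ·ᵛ (u +ᵛ v) ≡ c ·ᵛ u +ᵛ c ·ᵛ v
  ·ᵛ-+ᵛ K c []      []      = refl
  ·ᵛ-+ᵛ K c (x ∷ u) (y ∷ v) = cong₂ _∷_ (FiniteField.distribˡ K c x y) (·ᵛ-+ᵛ K c u v)

  ·ᵛ-· : ∀ K {n} a b (u : VecSpace.V K n) →
         let open VecSpace K n in let open FiniteField K in a ·ᵛ (b ·ᵛ u) ≡ (a * b) ·ᵛ u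
  ·ᵛ-· K a b []      = refl
  ·ᵛ-· K a b (x ∷ u) = cong₂ _∷_ (sym (FiniteField.*-assoc K a b x)) (·ᵛ-· K a b u)

  +-·ᵛ : ∀ K {n} a b (u : VecSpace.V K n) →
         let open VecSpace K n in let open FiniteField K in (a + b) ·ᵛ u ≡ a ·ᵛ u +ᵛ b ·ᵛ u
  +-·ᵛ K a b []      = refl
  +-·ᵛ K a b (x ∷ u) = cong₂ _∷_ (FiniteField.distribʳ K x a b) (+-·ᵛ K a b u)

  ·ᵛ-0 : ∀ K n c → let open VecSpace K n in c ·ᵛ 0ᵛ ≡ 0ᵛ
  ·ᵛ-0 K zero    c = refl
  ·ᵛ-0 K (suc n) c = cong₂ _∷_ (FiniteField.zeroʳ K c) (·ᵛ-0 K n c)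

  1-·ᵛ : ∀ K {n} (u : VecSpace.V K n) → let open VecSpace K n in let open FiniteField K in 1# ·ᵛ u ≡ u
  1-·ᵛ K []      = refl
  1-·ᵛ K (x ∷ u) = cong₂ _∷_ (FiniteField.*-identityˡ K x) (1-·ᵛ K u)

  0-·ᵛ : ∀ K {n} (u : VecSpace.V K n) → let open VecSpace K n in let open FiniteField K in 0# ·ᵛ u ≡ 0ᵛ
  0-·ᵛ K []      = refl
  0-·ᵛ K (x ∷ u) = cong₂ _∷_ (FiniteField.zeroˡ K x) (0-·ᵛ K u)

  module _ (K : FiniteField) where
    open FiniteField K
    open FieldProperties K
    open Lists K

    record Irreducible (P : Poly) : Set where
      field
        nonconstant : 1 ≤ length P
        no-factors  : ∀ f g → mulM f g ≡ P → f ≡ [] ⊎ g ≡ []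

    Allzero : Poly → Set
    Allzero = All (_≡ 0#)

    ev-allzero : ∀ {R} (φ : Hom K R) {f} → Allzero f → ∀ z →
                 CommutativeRing._≈_ R (Evaluation.ev φ f z) (CommutativeRing.0# R)
    ev-allzero {R} φ []         z = CommutativeRing.refl R
    ev-allzero {R} φ (refl ∷ p) z = R.trans (R.+-cong (Hom.0-hom φ) (R.trans (R.*-congˡ (ev-allzero φ p z)) (R.zeroʳ z))) (R.+-identityˡ R.0#)
      where module R = CommutativeRing R

    -- A coefficient list may end in zeros, so its degree is not visible; this splits off the
    -- leading coefficient. The equation is asserted in every ring at once because it is evaluated
    -- both in K[X]/(P) and in extensions of K. The strict inequality of lengths is the degree drop
    -- that drives Euclid's algorithm.
    Normalised : Poly → Set₁
    Normalised f = Allzero f ⊎ ∃ λ c → ∃ λ g → c ≢ 0# × length g < length f ×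
      (∀ {R} (φ : Hom K R) z → let open Evaluation φ in let open CommutativeRing R renaming (_*_ to _*ᴿ_) in
         ev f z ≈ Hom.ι φ c *ᴿ evM g z)

    normalise : ∀ f → Normalised f
    normalise [] = inj₁ []
    normalise (a ∷ f) with normalise f
    ... | inj₂ (c , g , c≢0 , l , e) = inj₂ (c , inv c * a ∷ g , c≢0 , s≤s l , λ {R} φ z → step {R} φ z)
      where
      step : ∀ {R} (φ : Hom K R) z → let open Evaluation φ in let open CommutativeRing R renaming (_*_ to _*ᴿ_) in
             ev (a ∷ f) z ≈ Hom.ι φ c *ᴿ evM (inv c * a ∷ g) z
      step {R} φ z = begin
        ι a +ᴿ z *ᴿ ev f z                            ≈⟨ +-cong (reflexive (cong ι (sym (*-inv-cancel c≢0 a)))) (*-congˡ (e φ z)) ⟩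
        ι (c * (inv c * a)) +ᴿ z *ᴿ (ι c *ᴿ evM g z)  ≈⟨ +-congʳ (*-hom c _) ⟩
        ι c *ᴿ ι (inv c * a) +ᴿ z *ᴿ (ι c *ᴿ evM g z) ≈⟨ lem (ι c) (ι (inv c * a)) z (evM g z) ⟩
        ι c *ᴿ (ι (inv c * a) +ᴿ z *ᴿ evM g z) ∎
        where
        open Hom φ
        open Evaluation φ
        open CommutativeRing R using (setoid; +-cong; +-congʳ; *-congˡ; reflexive; _≈_)
          renaming (_+_ to _+ᴿ_; _*_ to _*ᴿ_; refl to reflᴿ)
        open IntegerSolver R using (solve; _:=_; _:+_; _:*_)
        open import Relation.Binary.Reasoning.Setoid setoid
        lem : ∀ c a z g → c *ᴿ a +ᴿ z *ᴿ (c *ᴿ g) ≈ c *ᴿ (a +ᴿ z *ᴿ g)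
        lem = solve 4 (λ c a z g → c :* a :+ z :* (c :* g) := c :* (a :+ z :* g)) reflᴿ
    ... | inj₁ f≡0 with a ≟ 0#
    ...   | yes a≡0 = inj₁ (a≡0 ∷ f≡0)
    ...   | no a≢0  = inj₂ (a , [] , a≢0 , s≤s z≤n , λ {R} φ z → step {R} φ z)
      where
      step : ∀ {R} (φ : Hom K R) z → let open Evaluation φ in let open CommutativeRing R renaming (_*_ to _*ᴿ_) in
             ev (a ∷ f) z ≈ Hom.ι φ a *ᴿ evM [] z
      step {R} φ z = R.trans (R.+-congˡ (R.trans (R.*-congˡ (ev-allzero φ f≡0 z)) (R.zeroʳ z)))
                             (R.trans (R.+-identityʳ _) (R.sym (R.*-identityʳ _)))
        where module R = CommutativeRing R

    padTo : ∀ n → Poly → Vec Carrier n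
    padTo zero    f       = []
    padTo (suc n) []      = 0# ∷ padTo n []
    padTo (suc n) (a ∷ f) = a ∷ padTo n f

    padTo-[] : ∀ n → padTo n [] ≡ replicate n 0#
    padTo-[] zero    = refl
    padTo-[] (suc n) = cong (0# ∷_) (padTo-[] n)

    padTo-toList : ∀ {n} (u : Vec Carrier n) → padTo n (toList u) ≡ u
    padTo-toList []      = refl
    padTo-toList (x ∷ u) = cong (x ∷_) (padTo-toList u)

    private
      open IntegerSolver commutativeRing using (solve; _:=_; _:+_; _:*_; :-_; con)

      x-0b : ∀ x b → x + - (0# * b) ≡ x
      x-0b = solve 2 (λ x b → x :+ :- (con ℤ.0ℤ :* b) := x) refl

    -- A polynomial of degree below that of `Q` is its own remainder: its top entry is 0, so nothing
    -- is subtracted.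
    reduce-padTo : ∀ Q f → length f ≤ length Q →
                   reduce Q (padTo (suc (length Q)) f) ≡ (0# , padTo (length Q) f)
    reduce-padTo []      []      _       = refl
    reduce-padTo (b ∷ Q) []      _       rewrite reduce-padTo Q [] z≤n = cong (λ x → 0# , x ∷ padTo (length Q) []) (x-0b 0# b)
    reduce-padTo (b ∷ Q) (a ∷ f) (s≤s l) rewrite reduce-padTo Q f l = cong (λ x → 0# , x ∷ padTo (length Q) f) (x-0b a b)

    reduce-+ : ∀ Q u v → let open VecSpace K in
      reduce Q (_+ᵛ_ _ u v) ≡
        (proj₁ (reduce Q u) + proj₁ (reduce Q v) , _+ᵛ_ _ (proj₂ (reduce Q u)) (proj₂ (reduce Q v)))
    reduce-+ []      (x ∷ []) (y ∷ []) = refl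
    reduce-+ (b ∷ Q) (x ∷ u)  (y ∷ v)  rewrite reduce-+ Q u v =
      cong (λ z → proj₁ (reduce Q u) + proj₁ (reduce Q v) , z ∷ zipWith _+_ (proj₂ (reduce Q u)) (proj₂ (reduce Q v)))
           (lem x y (proj₁ (reduce Q u)) (proj₁ (reduce Q v)) b)
      where
      lem : ∀ x y s t b → x + y + - ((s + t) * b) ≡ x + - (s * b) + (y + - (t * b))
      lem = solve 5 (λ x y s t b → x :+ y :+ :- ((s :+ t) :* b) := x :+ :- (s :* b) :+ (y :+ :- (t :* b))) refl

    reduce-· : ∀ Q c u → let open VecSpace K in
      reduce Q (_·ᵛ_ _ c u) ≡ (c * proj₁ (reduce Q u) , _·ᵛ_ _ c (proj₂ (reduce Q u)))
    reduce-· []      c (x ∷ []) = refl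
    reduce-· (b ∷ Q) c (x ∷ u)  rewrite reduce-· Q c u =
      cong (λ z → c * proj₁ (reduce Q u) , z ∷ Vec.map (c *_) (proj₂ (reduce Q u)))
           (lem c x (proj₁ (reduce Q u)) b)
      where
      lem : ∀ c x t b → c * x + - (c * t * b) ≡ c * (x + - (t * b))
      lem = solve 4 (λ c x t b → c :* x :+ :- (c :* t :* b) := c :* (x :+ :- (t :* b))) refl

    topVec : (Q : Poly) → Vec Carrier (suc (length Q))
    topVec []      = 1# ∷ []
    topVec (b ∷ Q) = 0# ∷ topVec Q

    reduce-topVec : (Q : Poly) → proj₁ (reduce Q (topVec Q)) ≡ 1#
    reduce-topVec []      = refl
    reduce-topVec (b ∷ Q) = reduce-topVec Q

    -- The power X^n with n the degree of Q, presented as X · u. In this form its reduction is one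
    -- application of the companion operator; a positive degree is what allows a factor X to be
    -- split off.
    topVec′ : (Q : Poly) → 1 ≤ length Q → ∃ λ u → proj₁ (reduce Q (0# ∷ u)) ≡ 1#
    topVec′ (b ∷ Q) _ = topVec Q , reduce-topVec Q

    -- Checked on power series, where a zero remainder drops out of `ev-divM`; `evM-injective`
    -- brings the equation back to lists.
    exact-division : ∀ h f l → Allzero (toList (proj₂ (divM h f l))) → mulM (proj₁ (divM h f l)) f ≡ h
    exact-division h f l r≡0 = MonicMonoid.evM-injective K _ _ λ k →
      trans (S.evM-mulM q f X k) (trans (sym (+-identityʳ _)) (trans
        (cong (PowerSeries._*ˢ_ K (S.evM q X) (S.evM f X) k +_) (sym (ev-allzero (PowerSeries.constants K) r≡0 X k)))
        (sym (S.ev-divM h f l X k))))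
      where
      module S = Evaluation (PowerSeries.constants K)
      X = PowerSeries.X K
      q = proj₁ (divM h f l)

  -- K[X]/(P) is Kⁿ with the companion operator C of P as multiplication by X; the product of
  -- u and v is u(C) v.  All operators f(C) commute and u(C) e₀ = u, which yields the ring laws.
  module QuotientRing (K : FiniteField) (P : List (FiniteField.Carrier K)) (nonconstant : 1 ≤ length P) where
    open FiniteField K
    open FieldProperties K
    open Lists K
    open VecSpace K (length P) public

    private
      n = length P

    C : V → V
    C u = proj₂ (reduce P (0# ∷ u))

    C-+ : ∀ u v → C (u +ᵛ v) ≡ C u +ᵛ C v
    C-+ u v = trans (cong (λ x → proj₂ (reduce P (x ∷ (u +ᵛ v)))) (sym (+-identityˡ 0#)))
                    (cong proj₂ (reduce-+ K P (0# ∷ u) (0# ∷ v)))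

    C-· : ∀ c u → C (c ·ᵛ u) ≡ c ·ᵛ C u
    C-· c u = trans (cong (λ x → proj₂ (reduce P (x ∷ (c ·ᵛ u)))) (sym (zeroʳ c)))
                    (cong proj₂ (reduce-· K P c (0# ∷ u)))

    C-0 : C 0ᵛ ≡ 0ᵛ
    C-0 = trans (cong C (sym (·ᵛ-0 K n 0#))) (trans (C-· 0# 0ᵛ) (0-·ᵛ K (C 0ᵛ)))

    act : Poly → V → V
    act []      v = 0ᵛ
    act (a ∷ f) v = a ·ᵛ v +ᵛ C (act f v)

    act-+ : ∀ f u v → act f (u +ᵛ v) ≡ act f u +ᵛ act f v
    act-+ []      u v = sym (+ᵛ-identityˡ 0ᵛ)
    act-+ (a ∷ f) u v = trans (cong₂ _+ᵛ_ (·ᵛ-+ᵛ K a u v) (trans (cong C (act-+ f u v)) (C-+ _ _)))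
                              (+ᵛ-interchange _ _ _ _)

    act-· : ∀ f c v → act f (c ·ᵛ v) ≡ c ·ᵛ act f v
    act-· []      c v = sym (·ᵛ-0 K n c)
    act-· (a ∷ f) c v = trans (cong₂ _+ᵛ_ swap (trans (cong C (act-· f c v)) (C-· c _))) (sym (·ᵛ-+ᵛ K c _ _))
      where
      swap : a ·ᵛ (c ·ᵛ v) ≡ c ·ᵛ (a ·ᵛ v)
      swap = trans (·ᵛ-· K a c v) (trans (cong (_·ᵛ v) (*-comm a c)) (sym (·ᵛ-· K c a v)))

    act-C : ∀ f v → act f (C v) ≡ C (act f v)
    act-C []      v = sym C-0
    act-C (a ∷ f) v = trans (cong₂ _+ᵛ_ (sym (C-· a v)) (cong C (act-C f v))) (sym (C-+ _ _))

    act-0 : ∀ f → act f 0ᵛ ≡ 0ᵛ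
    act-0 []      = refl
    act-0 (a ∷ f) = trans (cong₂ _+ᵛ_ (·ᵛ-0 K n a) (trans (cong C (act-0 f)) C-0)) (+ᵛ-identityˡ 0ᵛ)

    act-comm : ∀ f g v → act f (act g v) ≡ act g (act f v)
    act-comm f []      v = act-0 f
    act-comm f (b ∷ g) v = trans (act-+ f _ _) (cong₂ _+ᵛ_ (act-· f b v) (trans (act-C f _) (cong C (act-comm f g v))))

    e₀ : V
    e₀ = padTo K n (1# ∷ [])

    private
      head-step : ∀ m a f → VecSpace._+ᵛ_ K m (VecSpace._·ᵛ_ K m a (padTo K m (1# ∷ []))) (padTo K m (0# ∷ f)) ≡ padTo K m (a ∷ f)
      head-step zero    a f = refl
      head-step (suc m) a f = cong₂ _∷_ (trans (+-identityʳ _) (*-identityʳ a))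
        (trans (cong (λ v → zipWith _+_ v (padTo K m f)) (trans (cong (Vec.map (a *_)) (padTo-[] K m)) (·ᵛ-0 K m a)))
               (Vecₚ.zipWith-identityˡ +-identityˡ _))

    act-e₀ : ∀ f → length f ≤ n → act f e₀ ≡ padTo K n f
    act-e₀ []      l = sym (padTo-[] K n)
    act-e₀ (a ∷ f) l = trans (cong (λ v → a ·ᵛ e₀ +ᵛ v)
        (trans (cong C (act-e₀ f (ℕₚ.<⇒≤ l))) (cong proj₂ (reduce-padTo K P (0# ∷ f) l))))
      (head-step n a f)

    act-toList : ∀ u → act (toList u) e₀ ≡ u
    act-toList u = trans (act-e₀ (toList u) (ℕₚ.≤-reflexive (Vecₚ.length-toList u))) (padTo-toList K u)

    infixl 7 _*ᵛ_
    _*ᵛ_ : V → V → V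
    u *ᵛ v = act (toList u) v

    *ᵛ-comm : ∀ u v → u *ᵛ v ≡ v *ᵛ u
    *ᵛ-comm u v = begin
      act (toList u) v                      ≡⟨ cong (act (toList u)) (act-toList v) ⟨
      act (toList u) (act (toList v) e₀)    ≡⟨ act-comm (toList u) (toList v) e₀ ⟩
      act (toList v) (act (toList u) e₀)    ≡⟨ cong (act (toList v)) (act-toList u) ⟩
      act (toList v) u ∎
      where open ≡-Reasoning

    *ᵛ-assoc : ∀ u v w → u *ᵛ v *ᵛ w ≡ u *ᵛ (v *ᵛ w)
    *ᵛ-assoc u v w = begin
      u *ᵛ v *ᵛ w                            ≡⟨ *ᵛ-comm (u *ᵛ v) w ⟩
      act (toList w) (act (toList u) v)      ≡⟨ act-comm (toList w) (toList u) v ⟩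
      act (toList u) (w *ᵛ v)                ≡⟨ cong (act (toList u)) (*ᵛ-comm w v) ⟩
      u *ᵛ (v *ᵛ w) ∎
      where open ≡-Reasoning

    *ᵛ-identityʳ : ∀ u → u *ᵛ e₀ ≡ u
    *ᵛ-identityʳ = act-toList

    *ᵛ-distribˡ : ∀ u v w → u *ᵛ (v +ᵛ w) ≡ u *ᵛ v +ᵛ u *ᵛ w
    *ᵛ-distribˡ u v w = act-+ (toList u) v w

    quotientRing : CommutativeRing 0ℓ 0ℓ
    quotientRing = record
      { Carrier = V ; _≈_ = _≡_ ; _+_ = _+ᵛ_ ; _*_ = _*ᵛ_ ; -_ = -ᵛ_ ; 0# = 0ᵛ ; 1# = e₀
      ; isCommutativeRing = record
        { isRing = record
          { +-isAbelianGroup = isAbelianGroup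
          ; *-cong = cong₂ _*ᵛ_
          ; *-assoc = *ᵛ-assoc
          ; *-identity = (λ u → trans (*ᵛ-comm e₀ u) (*ᵛ-identityʳ u)) , *ᵛ-identityʳ
          ; distrib = *ᵛ-distribˡ , λ w u v → trans (*ᵛ-comm (u +ᵛ v) w)
              (trans (*ᵛ-distribˡ w u v) (cong₂ _+ᵛ_ (*ᵛ-comm w u) (*ᵛ-comm w v))) }
        ; *-comm = *ᵛ-comm } }

    scalars : Hom K quotientRing
    scalars = record
      { ι     = _·ᵛ e₀
      ; +-hom = λ a b → +-·ᵛ K a b e₀
      ; *-hom = λ a b → sym (trans (act-· (toList (a ·ᵛ e₀)) b e₀) (trans (cong (b ·ᵛ_) (act-toList (a ·ᵛ e₀)))
                          (trans (·ᵛ-· K b a e₀) (cong (_·ᵛ e₀) (*-comm b a)))))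
      ; 1-hom = 1-·ᵛ K e₀
      ; 0-hom = 0-·ᵛ K e₀
      }

    open Evaluation scalars public

    θ : V
    θ = C e₀

    θ-*ᵛ : ∀ w → θ *ᵛ w ≡ C w
    θ-*ᵛ w = trans (*ᵛ-comm θ w) (trans (act-C (toList w) e₀) (cong C (act-toList w)))

    ev-θ : ∀ f → ev f θ ≡ act f e₀
    ev-θ []      = refl
    ev-θ (a ∷ f) = cong (λ v → a ·ᵛ e₀ +ᵛ v) (trans (θ-*ᵛ (ev f θ)) (cong C (ev-θ f)))

    -- Every element is its own coefficient vector evaluated at the class θ of X, so statements
    -- about elements become statements about polynomials of degree below that of P.
    ev-toList : ∀ u → ev (toList u) θ ≡ u
    ev-toList u = trans (ev-θ (toList u)) (act-toList u)

  module QuotientField (K : FiniteField) (P : List (FiniteField.Carrier K)) (irreducible : Irreducible K P) where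
    open FiniteField K using (0#; 1#; _≟_; finite; order; Carrier; 1≢0)
    open FieldProperties K using (inverseˡ)
    open Lists K
    open Irreducible irreducible
    open QuotientRing K P nonconstant public
    private
      module E = CommutativeRing quotientRing
      module φ = Hom scalars
    open IntegerSolver quotientRing using (solve; _:=_; _:+_; _:*_; :-_; con)

    -- X^n is evaluated at θ in two ways. As X · u it gives C u, which is its remainder modulo P; by
    -- `ev-reduce`, with top coefficient 1, it gives P(θ) plus that same remainder.
    P-θ : evM P θ ≡ 0ᵛ
    P-θ with topVec′ K P nonconstant
    ... | u , t≡1 = trans (lem (evM P θ) (C u)) (trans (cong (E._+ E.- C u) division) (E.-‿inverseʳ _))
      where
      lem : ∀ a b → a ≡ a E.+ b E.+ E.- b
      lem = solve 2 (λ a b → a := a :+ b :+ :- b) refl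
      root-of : ev (toList (0# ∷ u)) θ ≡ C u
      root-of = trans (cong (λ v → v E.+ θ E.* ev (toList u) θ) φ.0-hom)
        (trans (E.+-identityˡ _) (trans (cong (θ E.*_) (ev-toList u)) (θ-*ᵛ u)))
      division : evM P θ E.+ C u ≡ C u
      division = trans (cong₂ E._+_ (sym (trans (cong (λ t → φ.ι t E.* evM P θ) t≡1)
          (trans (cong (E._* evM P θ) φ.1-hom) (E.*-identityˡ _)))) (sym (ev-toList (C u))))
        (trans (sym (ev-reduce P (0# ∷ u) θ)) root-of)

    Invertible : V → Set
    Invertible x = ∃ λ y → x *ᵛ y ≡ e₀

    ι-invertible : ∀ {c} → c ≢ 0# → ∀ {x} → Invertible x → Invertible (φ.ι c *ᵛ x)
    ι-invertible {c} c≢0 {x} (y , e) = φ.ι (inv c) *ᵛ y , (begin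
      φ.ι c *ᵛ x *ᵛ (φ.ι (inv c) *ᵛ y)      ≡⟨ lem (φ.ι c) x (φ.ι (inv c)) y ⟩
      φ.ι c *ᵛ φ.ι (inv c) *ᵛ (x *ᵛ y)      ≡⟨ cong₂ _*ᵛ_ (sym (φ.*-hom c (inv c))) e ⟩
      φ.ι (FiniteField._*_ K c (inv c)) *ᵛ e₀ ≡⟨ cong (λ t → φ.ι t *ᵛ e₀) (FiniteField.inverseʳ K c c≢0) ⟩
      φ.ι 1# *ᵛ e₀                           ≡⟨ cong (_*ᵛ e₀) φ.1-hom ⟩
      e₀ *ᵛ e₀                               ≡⟨ *ᵛ-identityʳ e₀ ⟩
      e₀ ∎)
      where
      open ≡-Reasoning
      open FiniteField K using (inv)
      lem : ∀ c x d y → c *ᵛ x *ᵛ (d *ᵛ y) ≡ c *ᵛ d *ᵛ (x *ᵛ y)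
      lem = solve 4 (λ c x d y → c :* x :* (d :* y) := c :* d :* (x :* y)) refl

    -- Meant for a division P = q f + r: at θ it becomes q(θ) f(θ) = - r(θ), and invertibility
    -- passes from the remainder to f.
    factor-invertible : ∀ {x y : V} z → Invertible z → x *ᵛ y ≡ -ᵛ z → Invertible y
    factor-invertible {x} {y} z (w , e) xy = E.- (x *ᵛ w) , trans (lem x y w)
      (trans (cong (λ t → E.- (t *ᵛ w)) xy) (trans (lem′ z w) e))
      where
      lem : ∀ x y w → y *ᵛ (-ᵛ (x *ᵛ w)) ≡ -ᵛ (x *ᵛ y *ᵛ w)
      lem = solve 3 (λ x y w → y :* (:- (x :* w)) := :- (x :* y :* w)) refl
      lem′ : ∀ z w → -ᵛ ((-ᵛ z) *ᵛ w) ≡ z *ᵛ w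
      lem′ = solve 2 (λ z w → :- ((:- z) :* w) := z :* w) refl

    -- Dividing P by f leaves a remainder of smaller degree: the Euclidean algorithm, one step at a time.
    evM-invertible : ∀ f → length f < length P → Invertible (evM f θ)
    evM-invertible f l = go f (<-wellFounded (length f)) l
      where
      go : ∀ f → Acc _<_ (length f) → length f < length P → Invertible (evM f θ)
      go []      _         _ = e₀ , *ᵛ-identityʳ e₀
      go f@(_ ∷ _) (acc rs) l
        with divM P f (ℕₚ.<⇒≤ l) | length-divM P f (ℕₚ.<⇒≤ l)
           | ev-divM P f (ℕₚ.<⇒≤ l) θ | exact-division K P f (ℕₚ.<⇒≤ l)
      ... | q , r | len | eθ | exact with normalise K (toList r)
      ...   | inj₂ (c , g , c≢0 , g<r , e) =
        factor-invertible {evM q θ} {evM f θ} (ev (toList r) θ) (subst Invertible (sym (e scalars θ)) (ι-invertible c≢0 (go g (rs g<f) (ℕₚ.<-trans g<f l))))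
          (trans (lem (evM q θ *ᵛ evM f θ) (ev (toList r) θ)) (cong (E._+ (-ᵛ ev (toList r) θ)) (trans (sym eθ) P-θ)) ■ E.+-identityˡ _)
        where
        infixr 4 _■_
        _■_ : ∀ {a b c : V} → a ≡ b → b ≡ c → a ≡ c
        _■_ = trans
        g<f : length g < length f
        g<f = subst (length g <_) (Vecₚ.length-toList r) g<r
        lem : ∀ a b → a ≡ a E.+ b E.+ E.- b
        lem = solve 2 (λ a b → a := a :+ b :+ :- b) refl
      ...   | inj₁ r≡0 with no-factors q f (exact r≡0)
      ...     | inj₁ refl = ⊥-elim (ℕₚ.<⇒≢ l len)
      ...     | inj₂ ()

    allzero⇒0 : ∀ {n} (u : Vec Carrier n) → Allzero K (toList u) → u ≡ replicate n 0#
    allzero⇒0 []      []       = refl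
    allzero⇒0 (x ∷ u) (e ∷ es) = cong₂ _∷_ e (allzero⇒0 u es)

    invertible : ∀ x → x ≢ 0ᵛ → Invertible x
    invertible x x≢0 with normalise K (toList x)
    ... | inj₁ z = ⊥-elim (x≢0 (allzero⇒0 x z))
    ... | inj₂ (c , g , c≢0 , l , e) = subst Invertible (trans (sym (e scalars θ)) (ev-toList x))
            (ι-invertible c≢0 (evM-invertible g (subst (length g <_) (Vecₚ.length-toList x) l)))

    e₀≢0 : e₀ ≢ 0ᵛ
    e₀≢0 with length P | nonconstant
    ... | suc m | _ = λ e → 1≢0 (cong Vec.head e)

    private
      finiteV : Finite V
      finiteV = finite-Vec finite (length P)

      inverse : V → V
      inverse x with Finite._≟_ finiteV x 0ᵛ
      ... | yes _  = 0ᵛ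
      ... | no x≢0 = proj₁ (invertible x x≢0)

      inverse-correct : ∀ x → x ≢ 0ᵛ → x *ᵛ inverse x ≡ e₀
      inverse-correct x x≢0 with Finite._≟_ finiteV x 0ᵛ
      ... | yes x≡0 = ⊥-elim (x≢0 x≡0)
      ... | no x≢0′ = proj₂ (invertible x x≢0′)

    field′ : FiniteField
    field′ = record
      { isCommutativeRing = E.isCommutativeRing
      ; finite            = finiteV
      ; inv               = inverse
      ; inverseʳ          = inverse-correct
      ; 1≢0               = e₀≢0
      }

    order-field′ : FiniteField.order field′ ≡ order ℕ.^ length P
    order-field′ = length-finite-Vec finite (length P)

    evM-≢0 : ∀ f → length f < length P → evM f θ ≢ 0ᵛ
    evM-≢0 f l e with evM-invertible f l
    ... | y , xy = e₀≢0 (trans (sym xy) (trans (cong (_*ᵛ y) e) (E.zeroˡ y)))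

    -- A monic polynomial of degree below that of P is invertible at θ, hence not a root. For larger
    -- degree the remainder modulo P vanishes at θ, and by `ev-toList` the remainder is that value.
    root⇒divides : ∀ h → evM h θ ≡ 0ᵛ → ∃ λ q → mulM P q ≡ h
    root⇒divides h h≡0 with ℕₚ.≤-<-connex (length P) (length h)
    ... | inj₂ l = ⊥-elim (evM-≢0 h l h≡0)
    ... | inj₁ l with divM h P l | ev-divM h P l θ | exact-division K h P l
    ...   | q , r | eθ | exact = q , trans (MonicMonoid.mulM-comm K P q) (exact r-zero)
      where
      r≡0 : r ≡ 0ᵛ
      r≡0 = trans (sym (ev-toList r)) (trans (sym (E.+-identityˡ _)) (trans (cong (E._+ ev (toList r) θ)
        (sym (trans (cong (evM q θ *ᵛ_) P-θ) (E.zeroʳ (evM q θ))))) (trans (sym eθ) h≡0)))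
      zeros : ∀ m → Allzero K (toList (replicate m 0#))
      zeros zero    = []
      zeros (suc m) = refl ∷ zeros m
      r-zero : Allzero K (toList r)
      r-zero = subst (λ v → Allzero K (toList v)) (sym r≡0) (zeros (length P))

    divides⇒root : ∀ {h} q → mulM P q ≡ h → evM h θ ≡ 0ᵛ
    divides⇒root q refl = trans (evM-mulM P q θ) (trans (cong (_*ᵛ evM q θ) P-θ) (E.zeroˡ (evM q θ)))

open QuotientFields

-- Unique factorisation in K[X] and Newton's identity.

module Factorisation (K : FiniteField) where
  open import Data.Nat using (_≤_; _<_; _∸_)
  open import Data.Integer using (+_)
  open import Data.Integer.Tactic.RingSolver using (solve-∀)

  open FiniteField K using (Carrier; _≟_; finite; order)
  open Lists K public
  open MonicMonoid K public

  infix 4 _≟ₚ_ _∣ₚ_ _∣ₚ?_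

  _≟ₚ_ : DecidableEquality Poly
  _≟ₚ_ = Listₚ.≡-dec _≟_

  monics : ℕ → List Poly
  monics zero    = [] ∷ []
  monics (suc n) = cartesianProductWith _∷_ (enum finite) (monics n)

  ∈-monics⁺ : ∀ f → f ∈ monics (length f)
  ∈-monics⁺ []      = here refl
  ∈-monics⁺ (a ∷ f) = ∈-cartesianProductWith⁺ _∷_ (complete finite a) (∈-monics⁺ f)

  ∈-monics⁻ : ∀ n {f} → f ∈ monics n → length f ≡ n
  ∈-monics⁻ zero    (here refl) = refl
  ∈-monics⁻ (suc n) m with ∈-cartesianProductWith⁻ _∷_ (enum finite) (monics n) m
  ... | a , f , _ , f∈ , refl = cong suc (∈-monics⁻ n f∈)

  length⇒∈ : ∀ {n f} → length f ≡ n → f ∈ monics n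
  length⇒∈ {f = f} refl = ∈-monics⁺ f

  monics-unique : ∀ n → Unique (monics n)
  monics-unique zero    = [] ∷ []
  monics-unique (suc n) = Uniqueₚ.cartesianProductWith⁺ _∷_ Listₚ.∷-injective (unique finite) (monics-unique n)

  length-monics : ∀ n → length (monics n) ≡ order ℕ.^ n
  length-monics zero    = refl
  length-monics (suc n) = trans (length-cartesianProductWith _∷_ (enum finite) (monics n)) (cong (order ℕ.*_) (length-monics n))

  ∑-monics-δ : ∀ n {c} → length c ≡ n → (f : Poly → ℤ) → ∑ (monics n) (λ x → 𝟙 (x ≟ₚ c) ℤ.* f x) ≡ f c
  ∑-monics-δ n e = ∑-δ-list _≟ₚ_ (monics n) (monics-unique n) (length⇒∈ e)

  _∣ₚ_ : Poly → Poly → Set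
  f ∣ₚ h = ∃ λ g → mulM f g ≡ h

  ∣ₚ⇒length≤ : ∀ {f h} → f ∣ₚ h → length f ≤ length h
  ∣ₚ⇒length≤ {f} (g , refl) = subst (length f ≤_) (sym (length-mulM f g)) (ℕₚ.m≤m+n _ _)

  cofactor-length : ∀ {f h} ((g , _) : f ∣ₚ h) → length g ≡ length h ∸ length f
  cofactor-length {f} (g , refl) = sym (trans (cong (_∸ length f) (length-mulM f g)) (ℕₚ.m+n∸m≡n (length f) (length g)))

  _∣ₚ?_ : ∀ f h → Dec (f ∣ₚ h)
  f ∣ₚ? h = map′ (λ a → let (g , _ , e) = find a in g , e)
                 (λ d → lose (length⇒∈ (cofactor-length {f} {h} d)) (proj₂ d))
                 (any? (λ g → mulM f g ≟ₚ h) (monics (length h ∸ length f)))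

  HasFactor : Poly → Set
  HasFactor h = ∃ λ d → d < length h × (1 ≤ d × Any (_∣ₚ h) (monics d))

  hasFactor? : ∀ h → Dec (HasFactor h)
  hasFactor? h = ℕₚ.anyUpTo? (λ d → (1 ℕ.≤? d) ×-dec any? (_∣ₚ? h) (monics d)) (length h)

  hasFactor⇒ : ∀ {h} → HasFactor h → ∃ λ f → ∃ λ g → mulM f g ≡ h × 1 ≤ length f × 1 ≤ length g
  hasFactor⇒ {h} (d , d<n , 1≤d , a) with find a
  ... | f , f∈ , g , e with ∈-monics⁻ d f∈
  ... | refl = f , g , e , 1≤d , subst (1 ≤_) (sym (cofactor-length {f} {h} (g , e))) (ℕₚ.m<n⇒0<n∸m d<n)

  ⇒hasFactor : ∀ {h} f g → mulM f g ≡ h → 1 ≤ length f → 1 ≤ length g → HasFactor h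
  ⇒hasFactor {h} f g refl 1≤f 1≤g =
    length f ,
    subst (length f <_) (sym (length-mulM f g)) (ℕₚ.m<m+n (length f) 1≤g) ,
    1≤f , lose (∈-monics⁺ f) (g , refl)

  no-factor⇒irreducible : ∀ {h} → 1 ≤ length h → ¬ HasFactor h → Irreducible K h
  no-factor⇒irreducible l ¬hf = record
    { nonconstant = l
    ; no-factors  = λ { [] g e → inj₁ refl ; (a ∷ f) [] e → inj₂ refl
                      ; (a ∷ f) (b ∷ g) e → ⊥-elim (¬hf (⇒hasFactor (a ∷ f) (b ∷ g) e (s≤s z≤n) (s≤s z≤n))) } }

  irreducible? : ∀ h → Dec (Irreducible K h)
  irreducible? h with 1 ℕ.≤? length h | hasFactor? h
  ... | no l  | _      = no λ i → l (Irreducible.nonconstant i)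
  ... | yes _ | yes hf = no λ i → contradict i (hasFactor⇒ hf)
    where
    contradict : Irreducible K h → ¬ (∃ λ f → ∃ λ g → mulM f g ≡ h × 1 ≤ length f × 1 ≤ length g)
    contradict i (f , g , e , 1≤f , 1≤g) with Irreducible.no-factors i f g e
    contradict i (f , g , e , () , 1≤g) | inj₁ refl
    contradict i (f , g , e , 1≤f , ()) | inj₂ refl
  ... | yes l | no ¬hf = yes (no-factor⇒irreducible l ¬hf)

  irreducible-factor : ∀ h → 1 ≤ length h → ∃ λ P → ∃ λ g → Irreducible K P × mulM P g ≡ h
  irreducible-factor h l = go h (<-wellFounded (length h)) l
    where
    go : ∀ h → Acc _<_ (length h) → 1 ≤ length h → ∃ λ P → ∃ λ g → Irreducible K P × mulM P g ≡ h
    go h (acc rs) l with irreducible? h | hasFactor? h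
    ... | yes i | _      = h , [] , i , mulM-identityʳ h
    ... | no ¬i | no ¬hf = ⊥-elim (¬i (no-factor⇒irreducible l ¬hf))
    ... | no ¬i | yes hf with hasFactor⇒ hf
    ... | f , g , refl , 1≤f , 1≤g with go f (rs (subst (length f <_) (sym (length-mulM f g)) (ℕₚ.m<m+n (length f) 1≤g))) 1≤f
    ... | P , f′ , i , refl = P , mulM f′ g , i , sym (mulM-assoc P f′ g)

  ∣ₚ-mulM : ∀ {f h} g → f ∣ₚ h → f ∣ₚ mulM h g
  ∣ₚ-mulM {f} g (k , refl) = mulM k g , sym (mulM-assoc f k g)

  -- K[X]/(P) has no zero divisors, and divisibility by P means vanishing at θ.
  euclid : ∀ {P} f g → Irreducible K P → P ∣ₚ mulM f g → P ∣ₚ f ⊎ P ∣ₚ g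
  euclid {P} f g i (q , e) = go (F._≟_ (evM f θ) 0ᵛ)
    where
    open QuotientField K P i
    module F = FiniteField field′
    go : Dec (evM f θ ≡ 0ᵛ) → P ∣ₚ f ⊎ P ∣ₚ g
    go (yes z)  = inj₁ (root⇒divides f z)
    go (no f≢0) = inj₂ (root⇒divides g (FieldProperties.x*y≡0 field′
      (trans (sym (evM-mulM f g θ)) (divides⇒root q e)) f≢0))

  irreducible-∣ : ∀ {P P′} → Irreducible K P → Irreducible K P′ → P ∣ₚ P′ → P ≡ P′
  irreducible-∣ {P} i i′ (g , e) with Irreducible.no-factors i′ P g e
  irreducible-∣ {P} i i′ (g , e) | inj₁ refl with Irreducible.nonconstant i
  ... | ()
  irreducible-∣ {P} i i′ (g , e) | inj₂ refl = trans (sym (mulM-identityʳ P)) e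

  -- Induction on the exponent: P divides P₀ h but, being a different irreducible polynomial, not
  -- P₀, so it divides h. One factor P is then cancelled on both sides.
  powM-∣-other : ∀ {P P₀} → Irreducible K P → Irreducible K P₀ → P ≢ P₀ →
                 ∀ k h → powM P k ∣ₚ mulM P₀ h → powM P k ∣ₚ h
  powM-∣-other i i₀ ne zero    h _       = h , refl
  powM-∣-other {P} {P₀} i i₀ ne (suc k) h (g , e)
    with euclid P₀ h i (mulM (powM P k) g , trans (sym (mulM-assoc P (powM P k) g)) e)
  ... | inj₁ d = ⊥-elim (ne (irreducible-∣ i i₀ d))
  ... | inj₂ (h′ , refl) with powM-∣-other i i₀ ne k h′ (g , mulM-cancelˡ P (begin
          mulM P (mulM (powM P k) g)   ≡⟨ mulM-assoc P (powM P k) g ⟨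
          mulM (mulM P (powM P k)) g   ≡⟨ e ⟩
          mulM P₀ (mulM P h′)          ≡⟨ mulM-assoc P₀ P h′ ⟨
          mulM (mulM P₀ P) h′          ≡⟨ cong (λ f → mulM f h′) (mulM-comm P₀ P) ⟩
          mulM (mulM P P₀) h′          ≡⟨ mulM-assoc P P₀ h′ ⟩
          mulM P (mulM P₀ h′) ∎))
    where open ≡-Reasoning
  ... | g′ , refl = g′ , mulM-assoc P (powM P k) g′

  powM-∣-lift : ∀ P₀ {f h} → f ∣ₚ h → f ∣ₚ mulM P₀ h
  powM-∣-lift P₀ {f} {h} d = subst (f ∣ₚ_) (mulM-comm h P₀) (∣ₚ-mulM {f} P₀ d)

  powM-∣-same : ∀ P k h → powM P (suc k) ∣ₚ mulM P h → powM P k ∣ₚ h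
  powM-∣-same P k h (g , e) = g , mulM-cancelˡ P (trans (sym (mulM-assoc P (powM P k) g)) e)

  -- The P-adic valuation of h for irreducible P, once N is at least the degree of h. As a sum of
  -- divisibility indicators it can be exchanged with a sum over h.
  multiplicity : ℕ → Poly → Poly → ℤ
  multiplicity N P h = ∑ (downFrom N) (λ k → 𝟙 (powM P (suc k) ∣ₚ? h))

  multiplicity-other : ∀ N {P P₀} → Irreducible K P → Irreducible K P₀ → P ≢ P₀ → ∀ h →
                       multiplicity N P (mulM P₀ h) ≡ multiplicity N P h
  multiplicity-other N {P} {P₀} i i₀ ne h = ∑-cong (downFrom N) λ k →
    𝟙-cong (powM P (suc k) ∣ₚ? mulM P₀ h) (powM P (suc k) ∣ₚ? h) (powM-∣-other i i₀ ne (suc k) h) (powM-∣-lift P₀ {powM P (suc k)})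

  n≤length-powM : ∀ {P} → Irreducible K P → ∀ n → n ≤ length (powM P n)
  n≤length-powM {P} i n = subst₂ _≤_ (ℕₚ.*-identityʳ n) (sym (length-powM P n)) (ℕₚ.*-monoʳ-≤ n (Irreducible.nonconstant i))

  -- Cancelling P moves the conditions P^(k+1) ∣ P h to P^k ∣ h. This gains the exponent 0, which
  -- always divides, and loses the exponent N, where the degree of P^N exceeds that of h.
  multiplicity-same : ∀ N {P} → Irreducible K P → ∀ h → length h < N →
                      multiplicity N P (mulM P h) ≡ 1ℤ ℤ.+ multiplicity N P h
  multiplicity-same N {P} i h l = begin
    ∑ (downFrom N) (λ k → 𝟙 (powM P (suc k) ∣ₚ? mulM P h))
      ≡⟨ ∑-cong (downFrom N) (λ k → 𝟙-cong (powM P (suc k) ∣ₚ? mulM P h) (powM P k ∣ₚ? h)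
           (powM-∣-same P k h) (λ { (g , refl) → g , mulM-assoc P (powM P k) g })) ⟩
    ∑ (downFrom N) f                       ≡⟨ ℤₚ.+-identityʳ _ ⟨
    ∑ (downFrom N) f ℤ.+ 0ℤ                ≡⟨ cong (λ z → ∑ (downFrom N) f ℤ.+ z) (sym fN≡0) ⟩
    ∑ (downFrom N) f ℤ.+ f N               ≡⟨ ∑-downFrom-shift N f ⟩
    f 0 ℤ.+ ∑ (downFrom N) (f ∘ suc)       ≡⟨ cong (ℤ._+ ∑ (downFrom N) (f ∘ suc)) (𝟙-yes (powM P 0 ∣ₚ? h) (h , refl)) ⟩
    1ℤ ℤ.+ ∑ (downFrom N) (f ∘ suc) ∎
    where
    open ≡-Reasoning
    f : ℕ → ℤ
    f k = 𝟙 (powM P k ∣ₚ? h)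
    fN≡0 : f N ≡ 0ℤ
    fN≡0 = 𝟙-no (powM P N ∣ₚ? h) (λ d → ℕₚ.<⇒≱ l (ℕₚ.≤-trans (n≤length-powM i N) (∣ₚ⇒length≤ {powM P N} {h} d)))

  -- All monic polynomials of degrees 1 to N; the index d stands for degree d + 1. N is a cut-off
  -- above all degrees that occur, kept fixed so that sums of different degrees can be compared.
  ∑Mon : ℕ → (Poly → ℤ) → ℤ
  ∑Mon N f = ∑ (downFrom N) (λ d → ∑ (monics (suc d)) f)

  ∑Mon-cong : ∀ N {f g} → (∀ P → f P ≡ g P) → ∑Mon N f ≡ ∑Mon N g
  ∑Mon-cong N e = ∑-cong (downFrom N) (λ d → ∑-cong (monics (suc d)) e)

  ∑Mon-+ : ∀ N f g → ∑Mon N (λ P → f P ℤ.+ g P) ≡ ∑Mon N f ℤ.+ ∑Mon N g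
  ∑Mon-+ N f g = trans (∑-cong (downFrom N) (λ d → ∑-+ (monics (suc d)) f g)) (∑-+ (downFrom N) _ _)

  ∑Mon-*ʳ : ∀ N c f → ∑Mon N (λ P → f P ℤ.* c) ≡ ∑Mon N f ℤ.* c
  ∑Mon-*ʳ N c f = trans (∑-cong (downFrom N) (λ d → ∑-*ʳ c (monics (suc d)) f)) (∑-*ʳ c (downFrom N) _)

  ∑Mon-swap : ∀ {A : Set} N (xs : List A) (f : A → Poly → ℤ) →
              ∑ xs (λ x → ∑Mon N (f x)) ≡ ∑Mon N (λ P → ∑ xs (λ x → f x P))
  ∑Mon-swap N xs f = trans (∑-swap xs (downFrom N) _)
    (∑-cong (downFrom N) λ d → ∑-swap xs (monics (suc d)) f)

  ∑Mon-δ : ∀ N {c} → 1 ≤ length c → length c ≤ N → (f : Poly → ℤ) →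
           ∑Mon N (λ P → 𝟙 (P ≟ₚ c) ℤ.* f P) ≡ f c
  ∑Mon-δ N {c@(_ ∷ c′)} _ c≤N f = trans (∑-cong (downFrom N) step) (∑-downFrom-δ c≤N (λ _ → f c))
    where
    step : ∀ d → ∑ (monics (suc d)) (λ P → 𝟙 (P ≟ₚ c) ℤ.* f P) ≡ 𝟙 (d ℕₚ.≟ length c′) ℤ.* f c
    step d with d ℕₚ.≟ length c′
    ... | yes refl = trans (∑-monics-δ (suc (length c′)) refl f) (sym (ℤₚ.*-identityˡ (f c)))
    ... | no ne    = trans (∑-cong∈ (monics (suc d)) (λ {P} m → cong (ℤ._* f P) (𝟙-no (P ≟ₚ c)
                       λ { refl → ne (sym (ℕₚ.suc-injective (∈-monics⁻ (suc d) m))) })))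
                       (trans (∑-zero (monics (suc d)) (λ P → ℤₚ.*-zeroˡ (f P))) (sym (ℤₚ.*-zeroˡ (f c))))

  -- Unique factorisation in K[X], in the only form needed.
  factor-degree : ∀ N h → length h ≤ N →
    ∑Mon N (λ P → 𝟙 (irreducible? P) ℤ.* (+ length P ℤ.* multiplicity N P h)) ≡ + length h
  factor-degree N h l = go h (<-wellFounded (length h)) l
    where
    term : Poly → Poly → ℤ
    term h P = 𝟙 (irreducible? P) ℤ.* (+ length P ℤ.* multiplicity N P h)
    go : ∀ h → Acc _<_ (length h) → length h ≤ N → ∑Mon N (term h) ≡ + length h
    go [] _ _ = trans (∑Mon-cong N vanish) (∑-zero (downFrom N) (λ d → ∑-zero (monics (suc d)) (λ _ → refl)))
      where
      vanish : ∀ P → term [] P ≡ 0ℤ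
      vanish P = trans (𝟙-*-cong (irreducible? P) {y = 0ℤ} λ i →
        trans (cong (λ z → + length P ℤ.* z) (∑-zero (downFrom N) λ k →
          𝟙-no (powM P (suc k) ∣ₚ? []) λ d → ℕₚ.<⇒≱ (ℕₚ.≤-trans (s≤s z≤n) (n≤length-powM i (suc k))) (∣ₚ⇒length≤ {powM P (suc k)} {[]} d)))
          (ℤₚ.*-zeroʳ (+ length P))) (ℤₚ.*-zeroʳ (𝟙 (irreducible? P)))
    go h@(_ ∷ _) (acc rs) l with irreducible-factor h (s≤s z≤n)
    ... | P₀ , g , i₀ , e = begin
      ∑Mon N (term h)
        ≡⟨ ∑Mon-cong N split ⟩
      ∑Mon N (λ P → term g P ℤ.+ 𝟙 (P ≟ₚ P₀) ℤ.* + length P)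
        ≡⟨ ∑Mon-+ N (term g) _ ⟩
      ∑Mon N (term g) ℤ.+ ∑Mon N (λ P → 𝟙 (P ≟ₚ P₀) ℤ.* + length P)
        ≡⟨ cong₂ ℤ._+_ (go g (rs g<h) (ℕₚ.≤-trans (ℕₚ.<⇒≤ g<h) l))
                       (∑Mon-δ N (Irreducible.nonconstant i₀) (ℕₚ.≤-trans (∣ₚ⇒length≤ {P₀} {h} (g , e)) l) (λ P → + length P)) ⟩
      + length g ℤ.+ + length P₀
        ≡⟨ cong +_ (trans (ℕₚ.+-comm (length g) (length P₀)) len) ⟩
      + length h ∎
      where
      open ≡-Reasoning
      len : length P₀ ℕ.+ length g ≡ length h
      len = trans (sym (length-mulM P₀ g)) (cong length e)
      g<h : length g < length h
      g<h = subst (length g <_) len (ℕₚ.m<n+m (length g) (Irreducible.nonconstant i₀))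
      lem : ∀ c a m → c ℤ.* (a ℤ.* (1ℤ ℤ.+ m)) ≡ c ℤ.* (a ℤ.* m) ℤ.+ c ℤ.* a
      lem = solve-∀
      split : ∀ P → term h P ≡ term g P ℤ.+ 𝟙 (P ≟ₚ P₀) ℤ.* + length P
      split P with P ≟ₚ P₀
      ... | yes refl = trans (cong (λ h → term h P) (sym e))
        (trans (cong (λ m → 𝟙 (irreducible? P) ℤ.* (+ length P ℤ.* m)) (multiplicity-same N i₀ g (ℕₚ.<-≤-trans g<h l)))
          (trans (lem (𝟙 (irreducible? P)) (+ length P) (multiplicity N P g))
            (cong (λ z → term g P ℤ.+ z ℤ.* + length P) (𝟙-yes (irreducible? P) i₀))))
      ... | no ne = trans (cong (λ h → term h P) (sym e))
        (trans (𝟙-*-cong (irreducible? P) (λ i → cong (λ m → + length P ℤ.* m) (multiplicity-other N i i₀ ne g)))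
          (sym (trans (cong (λ z → term g P ℤ.+ z) (ℤₚ.*-zeroˡ (+ length P))) (ℤₚ.+-identityʳ _))))

  -- The von Mangoldt sum over the prime powers of degree i.
  Λ : ℕ → ℕ → (Poly → ℤ) → ℤ
  Λ N i ψ = ∑Mon N λ P → 𝟙 (irreducible? P) ℤ.* (+ length P ℤ.*
              ∑ (downFrom N) (λ k → 𝟙 (suc k ℕ.* length P ℕₚ.≟ i) ℤ.* ψ (powM P (suc k))))

  -- By cancellation a cofactor is unique, so counting cofactors of the right degree gives 0 or 1.
  𝟙-∣ₚ : ∀ f h → 𝟙 (f ∣ₚ? h) ≡ ∑ (monics (length h ∸ length f)) (λ g → 𝟙 (h ≟ₚ mulM f g))
  𝟙-∣ₚ f h with f ∣ₚ? h
  ... | no ¬d        = sym (∑-zero (monics (length h ∸ length f)) (λ g → 𝟙-no (h ≟ₚ mulM f g) (λ e → ¬d (g , sym e))))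
  ... | yes (g₀ , e) = sym (trans (∑-cong (monics (length h ∸ length f)) λ g → trans
          (𝟙-cong (h ≟ₚ mulM f g) (g ≟ₚ g₀) (λ e′ → mulM-cancelˡ f (trans (sym e′) (sym e))) (λ { refl → sym e }))
          (sym (ℤₚ.*-identityʳ _)))
        (∑-monics-δ _ (cofactor-length {f} {h} (g₀ , e)) (λ _ → 1ℤ)))

  -- The multiples h = f g of degree n are parametrised by g. The sum over i has at most one nonzero
  -- term, at i + 1 = deg f; this shape covers deg f > n as well and puts the degree of f into a
  -- summation index.
  ∑-multiples : ∀ n f (φ : Poly → ℤ) → 1 ≤ length f →
    ∑ (monics n) (λ h → 𝟙 (f ∣ₚ? h) ℤ.* φ h) ≡
    ∑ (downFrom n) (λ i → 𝟙 (length f ℕₚ.≟ suc i) ℤ.* ∑ (monics (n ∸ suc i)) (λ g → φ (mulM f g)))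
  ∑-multiples n f@(_ ∷ f′) φ _ with length f ℕ.≤? n
  ... | no f≰n = trans
    (trans (∑-cong∈ (monics n) (λ {h} m → trans (cong (ℤ._* φ h) (𝟙-no (f ∣ₚ? h)
       λ d → f≰n (subst (length f ≤_) (∈-monics⁻ n m) (∣ₚ⇒length≤ {f} {h} d)))) (ℤₚ.*-zeroˡ (φ h))))
       (∑-zero (monics n) (λ _ → refl)))
    (sym (trans (∑-downFrom-cong n λ i i<n → trans (cong (ℤ._* ∑ (monics (n ∸ suc i)) (λ g → φ (mulM f g)))
       (𝟙-no (length f ℕₚ.≟ suc i) λ e → f≰n (subst (_≤ n) (sym e) i<n))) (ℤₚ.*-zeroˡ (∑ (monics (n ∸ suc i)) (λ g → φ (mulM f g)))))
       (∑-zero (downFrom n) (λ _ → refl))))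
  ... | yes f≤n = begin
    ∑ (monics n) (λ h → 𝟙 (f ∣ₚ? h) ℤ.* φ h)
      ≡⟨ ∑-cong∈ (monics n) (λ {h} m → cong (ℤ._* φ h) (trans (𝟙-∣ₚ f h)
           (cong (λ k → ∑ (monics (k ∸ length f)) (λ g → 𝟙 (h ≟ₚ mulM f g))) (∈-monics⁻ n m)))) ⟩
    ∑ (monics n) (λ h → ∑ G (λ g → 𝟙 (h ≟ₚ mulM f g)) ℤ.* φ h)
      ≡⟨ ∑-cong (monics n) (λ h → sym (∑-*ʳ (φ h) G _)) ⟩
    ∑ (monics n) (λ h → ∑ G (λ g → 𝟙 (h ≟ₚ mulM f g) ℤ.* φ h))
      ≡⟨ ∑-swap (monics n) G _ ⟩
    ∑ G (λ g → ∑ (monics n) (λ h → 𝟙 (h ≟ₚ mulM f g) ℤ.* φ h))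
      ≡⟨ ∑-cong∈ G (λ {g} m → ∑-monics-δ n (trans (length-mulM f g)
           (trans (cong (length f ℕ.+_) (∈-monics⁻ _ m)) (ℕₚ.m+[n∸m]≡n f≤n))) φ) ⟩
    ∑ G (λ g → φ (mulM f g))
      ≡⟨ ∑-downFrom-δ f≤n (λ i → ∑ (monics (n ∸ suc i)) (λ g → φ (mulM f g))) ⟨
    ∑ (downFrom n) (λ i → 𝟙 (i ℕₚ.≟ length f′) ℤ.* ∑ (monics (n ∸ suc i)) (λ g → φ (mulM f g)))
      ≡⟨ ∑-cong (downFrom n) (λ i → cong (ℤ._* ∑ (monics (n ∸ suc i)) (λ g → φ (mulM f g))) (𝟙-cong (i ℕₚ.≟ length f′) (length f ℕₚ.≟ suc i)
           (λ e → cong suc (sym e)) (λ e → sym (ℕₚ.suc-injective e)))) ⟩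
    ∑ (downFrom n) (λ i → 𝟙 (length f ℕₚ.≟ suc i) ℤ.* ∑ (monics (n ∸ suc i)) (λ g → φ (mulM f g))) ∎
    where
    open ≡-Reasoning
    G = monics (n ∸ length f)

  -- The logarithmic derivative of a generating series, in sums: n = deg h is the sum of deg P over
  -- the prime powers P^k dividing h. Exchanging the sums and writing h = P^k g collects the terms
  -- by the degree i + 1 of P^k.
  newton : ∀ N n (φ : Poly → ℤ) → n ≤ N →
    + n ℤ.* ∑ (monics n) φ ≡
    ∑ (downFrom n) (λ i → Λ N (suc i) (λ f → ∑ (monics (n ∸ suc i)) (λ g → φ (mulM f g))))
  newton N n φ n≤N = begin
    + n ℤ.* ∑ (monics n) φ
      ≡⟨ ∑-*ˡ (+ n) (monics n) φ ⟨
    ∑ (monics n) (λ h → + n ℤ.* φ h)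
      ≡⟨ ∑-cong∈ (monics n) (λ {h} m → cong (ℤ._* φ h) (sym (trans
           (factor-degree N h (subst (_≤ N) (sym (∈-monics⁻ n m)) n≤N)) (cong +_ (∈-monics⁻ n m))))) ⟩
    ∑ (monics n) (λ h → ∑Mon N (λ P → w P ℤ.* (len P ℤ.* multiplicity N P h)) ℤ.* φ h)
      ≡⟨ ∑-cong (monics n) (λ h → sym (∑Mon-*ʳ N (φ h) _)) ⟩
    ∑ (monics n) (λ h → ∑Mon N (λ P → w P ℤ.* (len P ℤ.* multiplicity N P h) ℤ.* φ h))
      ≡⟨ ∑Mon-swap N (monics n) _ ⟩
    ∑Mon N (λ P → ∑ (monics n) (λ h → w P ℤ.* (len P ℤ.* multiplicity N P h) ℤ.* φ h))
      ≡⟨ ∑Mon-cong N (λ P → trans (∑-cong (monics n) (λ h → lem₁ (w P) (len P) (multiplicity N P h) (φ h)))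
           (trans (∑-*ˡ (w P) (monics n) _) (cong (w P ℤ.*_) (∑-*ˡ (len P) (monics n) _)))) ⟩
    ∑Mon N (λ P → w P ℤ.* (len P ℤ.* ∑ (monics n) (λ h → multiplicity N P h ℤ.* φ h)))
      ≡⟨ ∑Mon-cong N (λ P → 𝟙-*-cong (irreducible? P) (λ i → cong (len P ℤ.*_) (inner P i))) ⟩
    ∑Mon N (λ P → w P ℤ.* (len P ℤ.* ∑ (downFrom n) (λ i → ∑ (downFrom N) (λ k → t P i k))))
      ≡⟨ ∑Mon-cong N (λ P → trans (cong (w P ℤ.*_) (sym (∑-*ˡ (len P) (downFrom n) _))) (sym (∑-*ˡ (w P) (downFrom n) _))) ⟩
    ∑Mon N (λ P → ∑ (downFrom n) (λ i → w P ℤ.* (len P ℤ.* ∑ (downFrom N) (λ k → t P i k))))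
      ≡⟨ ∑Mon-swap N (downFrom n) _ ⟨
    ∑ (downFrom n) (λ i → Λ N (suc i) (ψ i)) ∎
    where
    open ≡-Reasoning
    w : Poly → ℤ
    w P = 𝟙 (irreducible? P)
    len : Poly → ℤ
    len P = + length P
    ψ : ℕ → Poly → ℤ
    ψ i f = ∑ (monics (n ∸ suc i)) (λ g → φ (mulM f g))
    t : Poly → ℕ → ℕ → ℤ
    t P i k = 𝟙 (suc k ℕ.* length P ℕₚ.≟ suc i) ℤ.* ψ i (powM P (suc k))
    lem₁ : ∀ a b c d → a ℤ.* (b ℤ.* c) ℤ.* d ≡ a ℤ.* (b ℤ.* (c ℤ.* d))
    lem₁ = solve-∀
    inner : ∀ P → Irreducible K P → ∑ (monics n) (λ h → multiplicity N P h ℤ.* φ h) ≡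
                                    ∑ (downFrom n) (λ i → ∑ (downFrom N) (λ k → t P i k))
    inner P irr = begin
      ∑ (monics n) (λ h → multiplicity N P h ℤ.* φ h)
        ≡⟨ ∑-cong (monics n) (λ h → sym (∑-*ʳ (φ h) (downFrom N) _)) ⟩
      ∑ (monics n) (λ h → ∑ (downFrom N) (λ k → 𝟙 (powM P (suc k) ∣ₚ? h) ℤ.* φ h))
        ≡⟨ ∑-swap (monics n) (downFrom N) _ ⟩
      ∑ (downFrom N) (λ k → ∑ (monics n) (λ h → 𝟙 (powM P (suc k) ∣ₚ? h) ℤ.* φ h))
        ≡⟨ ∑-cong (downFrom N) (λ k → ∑-multiples n (powM P (suc k)) φ (ℕₚ.≤-trans (s≤s z≤n) (n≤length-powM irr (suc k)))) ⟩
      ∑ (downFrom N) (λ k → ∑ (downFrom n) (λ i → 𝟙 (length (powM P (suc k)) ℕₚ.≟ suc i) ℤ.* ψ i (powM P (suc k))))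
        ≡⟨ ∑-cong (downFrom N) (λ k → ∑-cong (downFrom n) λ i →
             cong (λ l → 𝟙 (l ℕₚ.≟ suc i) ℤ.* ψ i (powM P (suc k))) (length-powM P (suc k))) ⟩
      ∑ (downFrom N) (λ k → ∑ (downFrom n) (λ i → t P i k))
        ≡⟨ ∑-swap (downFrom N) (downFrom n) _ ⟩
      ∑ (downFrom n) (λ i → ∑ (downFrom N) (λ k → t P i k)) ∎

  Λ-cong : ∀ N i {ψ χ} → (∀ f → length f ≡ i → ψ f ≡ χ f) → Λ N i ψ ≡ Λ N i χ
  Λ-cong N i e = ∑Mon-cong N λ P → cong (λ z → 𝟙 (irreducible? P) ℤ.* (+ length P ℤ.* z))
    (∑-cong (downFrom N) λ k → 𝟙-*-cong (suc k ℕ.* length P ℕₚ.≟ i) λ l → e _ (trans (length-powM P (suc k)) l))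

  Λ-*ʳ : ∀ N i ψ c → Λ N i (λ f → ψ f ℤ.* c) ≡ Λ N i ψ ℤ.* c
  Λ-*ʳ N i ψ c = trans (∑Mon-cong N λ P → trans
      (cong (λ z → 𝟙 (irreducible? P) ℤ.* (+ length P ℤ.* z))
        (trans (∑-cong (downFrom N) λ k → sym (ℤₚ.*-assoc (𝟙 (suc k ℕ.* length P ℕₚ.≟ i)) _ c)) (∑-*ʳ c (downFrom N) _)))
      (lem (𝟙 (irreducible? P)) (+ length P) _ c))
    (∑Mon-*ʳ N c _)
    where
    lem : ∀ w l s c → w ℤ.* (l ℤ.* (s ℤ.* c)) ≡ w ℤ.* (l ℤ.* s) ℤ.* c
    lem = solve-∀

  ∑-monics-const : ∀ n c → ∑ (monics n) (λ _ → c) ≡ + (order ℕ.^ n) ℤ.* c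
  ∑-monics-const n c = trans (∑-const (monics n) c) (cong (λ l → + l ℤ.* c) (length-monics n))

  -- Gauss's formula q^n = ∑ d · #(irreducibles of degree d) over d ∣ n, where q is the order of K.
  -- In `newton` for the constant 1 each of the n - 1 terms of smaller index equals q^n by
  -- induction; subtracting them from n q^n leaves q^n for the last.
  Λ-one : ∀ N i → 1 ≤ i → i ≤ N → Λ N i (λ _ → 1ℤ) ≡ + (order ℕ.^ i)
  Λ-one N i 1≤i i≤N = go i (<-wellFounded i) 1≤i i≤N
    where
    go : ∀ i → Acc _<_ i → 1 ≤ i → i ≤ N → Λ N i (λ _ → 1ℤ) ≡ + (order ℕ.^ i)
    go n@(suc m) (acc rs) _ n≤N = solve-for (begin
      + n ℤ.* q n
        ≡⟨ cong (+ n ℤ.*_) (trans (∑-monics-const n 1ℤ) (ℤₚ.*-identityʳ _)) ⟨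
      + n ℤ.* ∑ (monics n) (λ _ → 1ℤ)
        ≡⟨ newton N n (λ _ → 1ℤ) n≤N ⟩
      ∑ (downFrom n) (λ i → Λ N (suc i) (λ _ → ∑ (monics (n ∸ suc i)) (λ _ → 1ℤ)))
        ≡⟨ ∑-cong (downFrom n) (λ i → trans (Λ-cong N (suc i) (λ _ _ → trans (∑-monics-const (n ∸ suc i) 1ℤ) (ℤₚ.*-comm (q (n ∸ suc i)) 1ℤ)))
                                            (Λ-*ʳ N (suc i) (λ _ → 1ℤ) (q (n ∸ suc i)))) ⟩
      Λ N n (λ _ → 1ℤ) ℤ.* q (m ∸ m) ℤ.+ ∑ (downFrom m) (λ i → Λ N (suc i) (λ _ → 1ℤ) ℤ.* q (n ∸ suc i))
        ≡⟨ cong₂ ℤ._+_ (cong (λ k → Λ N n (λ _ → 1ℤ) ℤ.* q k) (ℕₚ.n∸n≡0 m))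
             (trans (∑-downFrom-cong m λ i i<m → trans
                 (cong (ℤ._* q (n ∸ suc i)) (go (suc i) (rs (s≤s i<m)) (s≤s z≤n) (ℕₚ.≤-trans (s≤s (ℕₚ.<⇒≤ i<m)) n≤N)))
                 (trans (sym (ℤₚ.pos-* (order ℕ.^ suc i) (order ℕ.^ (n ∸ suc i))))
                        (cong +_ (trans (sym (ℕₚ.^-distribˡ-+-* order (suc i) (n ∸ suc i))) (cong (order ℕ.^_) (ℕₚ.m+[n∸m]≡n (ℕₚ.m≤n⇒m≤1+n i<m)))))))
               (trans (∑-const (downFrom m) (q n)) (cong (λ l → + l ℤ.* q n) (Listₚ.length-downFrom m)))) ⟩
      Λ N n (λ _ → 1ℤ) ℤ.* 1ℤ ℤ.+ + m ℤ.* q n ∎)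
      where
      open ≡-Reasoning
      q : ℕ → ℤ
      q k = + (order ℕ.^ k)
      solve-for : + n ℤ.* q n ≡ Λ N n (λ _ → 1ℤ) ℤ.* 1ℤ ℤ.+ + m ℤ.* q n → Λ N n (λ _ → 1ℤ) ≡ q n
      solve-for e = trans (lem₁ (Λ N n (λ _ → 1ℤ)) (+ m ℤ.* q n)) (trans (cong (ℤ._- + m ℤ.* q n) (sym e))
                      (trans (cong (ℤ._- + m ℤ.* q n) (ℤₚ.suc-* (+ m) (q n))) (lem₂ (q n) (+ m ℤ.* q n))))
        where
        lem₁ : ∀ a b → a ≡ a ℤ.* 1ℤ ℤ.+ b ℤ.- b
        lem₁ = solve-∀
        lem₂ : ∀ a b → a ℤ.+ b ℤ.- b ≡ a
        lem₂ = solve-∀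

  exponent-unique : ∀ d k k′ → suc k ℕ.* suc d ≡ suc k′ ℕ.* suc d → k ≡ k′
  exponent-unique d k k′ e = ℕₚ.suc-injective (ℕₚ.*-cancelʳ-≡ (suc k) (suc k′) (suc d) e)

  exponents≤1 : ∀ N d n → ∑ (downFrom N) (λ k → 𝟙 (suc k ℕ.* suc d ℕₚ.≟ n)) ℤ.≤ 1ℤ
  exponents≤1 zero    d n = ℤ.+≤+ z≤n
  exponents≤1 (suc N) d n with suc N ℕ.* suc d ℕₚ.≟ n
  ... | no ne    = subst (ℤ._≤ 1ℤ) (sym (ℤₚ.+-identityˡ _)) (exponents≤1 N d n)
  ... | yes refl = ℤₚ.≤-reflexive (cong (λ z → 1ℤ ℤ.+ z) (trans (∑-downFrom-cong N {g = λ _ → 0ℤ} (λ k k<N →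
      𝟙-no (suc k ℕ.* suc d ℕₚ.≟ suc N ℕ.* suc d) (λ e → ℕₚ.<⇒≢ k<N (exponent-unique d k N e)))) (∑-zero (downFrom N) (λ _ → refl))))

  2≤order : 2 ≤ order
  2≤order = go (complete finite (FiniteField.0# K)) (complete finite (FiniteField.1# K))
    where
    nonempty : ∀ {x} {xs : List Carrier} → x ∈ xs → 1 ≤ length xs
    nonempty (here _)  = s≤s z≤n
    nonempty (there _) = s≤s z≤n
    go : ∀ {xs} → FiniteField.0# K ∈ xs → FiniteField.1# K ∈ xs → 2 ≤ length xs
    go (here p)  (here q)  = ⊥-elim (FiniteField.1≢0 K (trans q (sym p)))
    go (here _)  (there q) = s≤s (nonempty q)
    go (there p) (here _)  = s≤s (nonempty p)
    go (there p) (there q) = ℕₚ.m≤n⇒m≤1+n (go p q)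

  geometric< : ∀ m → ∑ (downFrom m) (λ d → + (order ℕ.^ suc d)) ℤ.< + (order ℕ.^ suc m)
  geometric< zero    = ℤ.+<+ (ℕₚ.<-≤-trans (s≤s z≤n) (subst (2 ≤_) (sym (ℕₚ.*-identityʳ order)) 2≤order))
  geometric< (suc m) = ℤₚ.<-≤-trans (ℤₚ.+-monoʳ-< (+ (order ℕ.^ suc m)) (geometric< m))
    (ℤ.+≤+ (subst (ℕ._≤ order ℕ.^ suc (suc m)) (cong (order ℕ.^ suc m ℕ.+_) (ℕₚ.+-identityʳ _)) (ℕₚ.*-monoˡ-≤ (order ℕ.^ suc m) 2≤order)))

  -- Without an irreducible polynomial of degree n the whole sum Λ(n) = q^n, with q the order of K,
  -- would come from degrees d < n. Degree d contributes at most d per irreducible, hence at most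
  -- Λ(d) = q^d, and q + ... + q^(n-1) < q^n.
  irreducible-exists : ∀ n → 1 ≤ n → ∃ λ P → Irreducible K P × length P ≡ n
  irreducible-exists n@(suc m) _ with any? irreducible? (monics n)
  ... | yes a = let (P , P∈ , i) = find a in P , i , ∈-monics⁻ n P∈
  ... | no ¬a = ⊥-elim (ℤₚ.<-irrefl refl (ℤₚ.≤-<-trans upper (geometric< m)))
    where
    open ℤₚ.≤-Reasoning
    -- `T` is the contribution of P to Λ(n); `W` replaces the number of fitting exponents, which is
    -- at most 1, by 1.
    T : Poly → ℤ
    T P = 𝟙 (irreducible? P) ℤ.* (+ length P ℤ.* ∑ (downFrom n) (λ k → 𝟙 (suc k ℕ.* length P ℕₚ.≟ n) ℤ.* 1ℤ))
    W : Poly → ℤ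
    W P = 𝟙 (irreducible? P) ℤ.* (+ length P ℤ.* 1ℤ)
    T≤W : ∀ d → ∑ (monics (suc d)) T ℤ.≤ ∑ (monics (suc d)) W
    T≤W d = ∑∈-≤ (monics (suc d)) λ {P} m → bound P (∈-monics⁻ (suc d) m)
      where
      bound : ∀ P → length P ≡ suc d → T P ℤ.≤ W P
      bound P l with irreducible? P
      ... | no _  = ℤₚ.≤-refl
      ... | yes _ = ℤₚ.*-monoˡ-≤-nonNeg 1ℤ (ℤₚ.*-monoˡ-≤-nonNeg (+ length P)
            (subst (ℤ._≤ 1ℤ) (∑-cong (downFrom n) (λ k → trans (cong (λ l → 𝟙 (suc k ℕ.* l ℕₚ.≟ n)) (sym l)) (sym (ℤₚ.*-identityʳ _)))) (exponents≤1 n d n)))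
    W≤Λ : ∀ d → suc d ≤ n → ∑ (monics (suc d)) W ℤ.≤ + (order ℕ.^ suc d)
    W≤Λ d d<n = begin
      ∑ (monics (suc d)) W
        ≤⟨ ∑-≤′ ⟩
      ∑ (monics (suc d)) S
        ≤⟨ term≤∑ (downFrom n) {λ e → ∑ (monics (suc e)) S} (λ e → 0≤∑ (monics (suc e)) 0≤S) (∈-downFrom⁺ d<n) ⟩
      Λ n (suc d) (λ _ → 1ℤ)
        ≡⟨ Λ-one n (suc d) (s≤s z≤n) d<n ⟩
      + (order ℕ.^ suc d) ∎
      where
      I : Poly → ℕ → ℤ
      I P k = 𝟙 (suc k ℕ.* length P ℕₚ.≟ suc d) ℤ.* 1ℤ
      0≤I : ∀ P k → 0ℤ ℤ.≤ I P k
      0≤I P k = 0≤* (0≤𝟙 (suc k ℕ.* length P ℕₚ.≟ suc d)) (ℤ.+≤+ z≤n)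
      S : Poly → ℤ
      S P = 𝟙 (irreducible? P) ℤ.* (+ length P ℤ.* ∑ (downFrom n) (I P))
      0≤S : ∀ P → 0ℤ ℤ.≤ S P
      0≤S P = 0≤* (0≤𝟙 (irreducible? P)) (0≤* {+ length P} (ℤ.+≤+ z≤n) (0≤∑ (downFrom n) (0≤I P)))
      bound : ∀ P → length P ≡ suc d → W P ℤ.≤ S P
      bound P l with irreducible? P
      ... | no _  = ℤₚ.≤-refl
      ... | yes _ = ℤₚ.*-monoˡ-≤-nonNeg 1ℤ (ℤₚ.*-monoˡ-≤-nonNeg (+ length P)
            (subst (ℤ._≤ ∑ (downFrom n) (I P)) (cong (ℤ._* 1ℤ) (𝟙-yes (1 ℕ.* length P ℕₚ.≟ suc d) (trans (ℕₚ.*-identityˡ _) l)))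
              (term≤∑ (downFrom n) (0≤I P) {0} (∈-downFrom⁺ (s≤s z≤n)))))
      ∑-≤′ : ∑ (monics (suc d)) W ℤ.≤ ∑ (monics (suc d)) S
      ∑-≤′ = ∑∈-≤ (monics (suc d)) λ {P} m → bound P (∈-monics⁻ (suc d) m)
    top≡0 : ∑ (monics n) T ≡ 0ℤ
    top≡0 = trans (∑-cong∈ (monics n) (λ {P} m → 𝟙-no-* (irreducible? P) (λ i → ¬a (lose m i)) _))
                  (∑-zero (monics n) (λ _ → refl))
    ∑-downFrom-≤ : ∀ m {f g : ℕ → ℤ} → (∀ k → k < m → f k ℤ.≤ g k) → ∑ (downFrom m) f ℤ.≤ ∑ (downFrom m) g
    ∑-downFrom-≤ zero    p = ℤₚ.≤-refl
    ∑-downFrom-≤ (suc m) p = ℤₚ.+-mono-≤ (p m (ℕₚ.n<1+n m)) (∑-downFrom-≤ m (λ k l → p k (ℕₚ.m<n⇒m<1+n l)))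
    upper : + (order ℕ.^ n) ℤ.≤ ∑ (downFrom m) (λ d → + (order ℕ.^ suc d))
    upper = begin
      + (order ℕ.^ n)                                           ≡⟨ Λ-one n n (s≤s z≤n) ℕₚ.≤-refl ⟨
      ∑ (monics n) T ℤ.+ ∑ (downFrom m) (λ d → ∑ (monics (suc d)) T) ≡⟨ cong (ℤ._+ ∑ (downFrom m) (λ d → ∑ (monics (suc d)) T)) top≡0 ⟩
      0ℤ ℤ.+ ∑ (downFrom m) (λ d → ∑ (monics (suc d)) T)        ≡⟨ ℤₚ.+-identityˡ _ ⟩
      ∑ (downFrom m) (λ d → ∑ (monics (suc d)) T)
        ≤⟨ ∑-downFrom-≤ m (λ d d<m → ℤₚ.≤-trans (T≤W d) (W≤Λ d (ℕₚ.<⇒≤ (s≤s d<m)))) ⟩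
      ∑ (downFrom m) (λ d → + (order ℕ.^ suc d)) ∎

-- Frobenius, conjugates and characteristic polynomials.

module Conjugates where
  open import Data.Nat using (_≤_; _<_; _∸_)
  open import Data.Nat.DivMod using (_%_; _/_; m≡m%n+[m/n]*n; m%n<n)
  open import Data.List using (map)

  module Coefficients (K : FiniteField) where
    open FiniteField K
    open FieldProperties K
    open Lists K
    open IntegerSolver commutativeRing using (solve; _:=_; _:+_; _:*_; con)

    -- For the polynomial 1 the value is 1 here and 0 for `subleading`. With these values the first
    -- coefficient is multiplicative and the second additive on all monic polynomials.
    constant : Poly → Carrier
    constant []      = 1#
    constant (a ∷ f) = a

    subleading : Poly → Carrier
    subleading []          = 0#
    subleading (a ∷ [])    = a
    subleading (_ ∷ b ∷ f) = subleading (b ∷ f)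

    constant-mulM : ∀ f g → constant (mulM f g) ≡ constant f * constant g
    constant-mulM []      g       = sym (*-identityˡ _)
    constant-mulM (a ∷ f) []      = +-identityʳ _
    constant-mulM (a ∷ f) (b ∷ g) = +-identityʳ _

    subleading-addM : ∀ f g → length f < length g → subleading (addM f g) ≡ subleading g
    subleading-addM []          g               _             = refl
    subleading-addM (a ∷ [])    (b ∷ [])        (s≤s ())
    subleading-addM (a ∷ [])    (b ∷ c ∷ g)     _             = refl
    subleading-addM (a ∷ b ∷ f) (c ∷ d ∷ g)     (s≤s l)       = subleading-addM (b ∷ f) (d ∷ g) l

    subleading-cons0 : ∀ f → subleading (0# ∷ f) ≡ subleading f
    subleading-cons0 []      = refl
    subleading-cons0 (a ∷ f) = refl

    subleading-linear : ∀ a x g → subleading (addM (scale a (full g)) (x ∷ g)) ≡ a + subleading (x ∷ g)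
    subleading-linear a x []      = cong (_+ x) (*-identityʳ a)
    subleading-linear a x (b ∷ g) = trans (cons _ (scale-full-nonempty a g)) (subleading-linear a b g)
      where
      scale-full-nonempty : ∀ a g → ∃ λ y → ∃ λ h → addM (scale a (full g)) (b ∷ g) ≡ y ∷ h
      scale-full-nonempty a []      = _ , _ , refl
      scale-full-nonempty a (c ∷ g) = _ , _ , refl
      cons : ∀ y {f} → (∃ λ z → ∃ λ h → f ≡ z ∷ h) → subleading (y ∷ f) ≡ subleading f
      cons y (_ , _ , refl) = refl

    subleading-mulM : ∀ f g → subleading (mulM f g) ≡ subleading f + subleading g
    subleading-mulM []          g = sym (+-identityˡ _)
    subleading-mulM (a ∷ [])    g = trans (subleading-linear a 0# g) (cong (a +_) (subleading-cons0 g))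
    subleading-mulM (a ∷ b ∷ f) g = begin
      subleading (addM (scale a (full g)) (0# ∷ mulM (b ∷ f) g))
        ≡⟨ subleading-addM (scale a (full g)) (0# ∷ mulM (b ∷ f) g) (subst₂ _<_ (sym (length-scale-full a g)) (cong suc (sym (length-mulM (b ∷ f) g)))
             (s≤s (s≤s (ℕₚ.m≤n+m (length g) (length f))))) ⟩
      subleading (0# ∷ mulM (b ∷ f) g)        ≡⟨ subleading-cons0 (mulM (b ∷ f) g) ⟩
      subleading (mulM (b ∷ f) g)             ≡⟨ subleading-mulM (b ∷ f) g ⟩
      subleading (b ∷ f) + subleading g ∎
      where open ≡-Reasoning

  module MapHom {K E : FiniteField} (φ : Hom K (FiniteField.commutativeRing E)) where
    private
      module K = FiniteField K
      module E = FiniteField E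
      module LK = Lists K
      module LE = Lists E
      module CK = Coefficients K
      module CE = Coefficients E
    open Hom φ
    open FieldProperties

    map-addM : ∀ f g → map ι (LK.addM f g) ≡ LE.addM (map ι f) (map ι g)
    map-addM []      g       = refl
    map-addM (a ∷ f) []      = refl
    map-addM (a ∷ f) (b ∷ g) = cong₂ _∷_ (+-hom a b) (map-addM f g)

    map-scale-full : ∀ a g → map ι (LK.scale a (LK.full g)) ≡ LE.scale (ι a) (LE.full (map ι g))
    map-scale-full a []      = cong (_∷ []) (trans (*-hom a K.1#) (cong (ι a E.*_) 1-hom))
    map-scale-full a (b ∷ g) = cong₂ _∷_ (*-hom a b) (map-scale-full a g)

    map-mulM : ∀ f g → map ι (LK.mulM f g) ≡ LE.mulM (map ι f) (map ι g)
    map-mulM []      g = refl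
    map-mulM (a ∷ f) g = trans (map-addM (LK.scale a (LK.full g)) (K.0# ∷ LK.mulM f g)) (cong₂ LE.addM (map-scale-full a g) (cong₂ _∷_ 0-hom (map-mulM f g)))

    map-powM : ∀ f k → map ι (LK.powM f k) ≡ LE.powM (map ι f) k
    map-powM f zero    = refl
    map-powM f (suc k) = trans (map-mulM f _) (cong (LE.mulM (map ι f)) (map-powM f k))

    constant-map : ∀ f → CE.constant (map ι f) ≡ ι (CK.constant f)
    constant-map []      = sym 1-hom
    constant-map (a ∷ f) = refl

    subleading-map : ∀ f → CE.subleading (map ι f) ≡ ι (CK.subleading f)
    subleading-map []          = sym 0-hom
    subleading-map (a ∷ [])    = refl
    subleading-map (a ∷ b ∷ f) = subleading-map (b ∷ f)

    ι-^ : ∀ a n → ι (a K.^ n) ≡ ι a E.^ n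
    ι-^ a zero    = 1-hom
    ι-^ a (suc n) = trans (*-hom a _) (cong (ι a E.*_) (ι-^ a n))

    ι-≢0 : ∀ {a} → a ≢ K.0# → ι a ≢ E.0#
    ι-≢0 {a} a≢0 e = E.1≢0 (begin
      E.1#                 ≡⟨ 1-hom ⟨
      ι K.1#               ≡⟨ cong ι (K.inverseʳ a a≢0) ⟨
      ι (a K.* K.inv a)    ≡⟨ *-hom a _ ⟩
      ι a E.* ι (K.inv a)  ≡⟨ cong (E._* ι (K.inv a)) e ⟩
      E.0# E.* ι (K.inv a) ≡⟨ E.zeroˡ _ ⟩
      E.0# ∎)
      where open ≡-Reasoning

    ι-injective : ∀ {a b} → ι a ≡ ι b → a ≡ b
    ι-injective {a} {b} e with (a K.+ K.- b) K.≟ K.0#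
    ... | yes z = x-y≡0 K z
    ... | no nz = ⊥-elim (ι-≢0 nz (trans (+-hom a _) (trans (cong₂ E._+_ e (neg-hom b)) (E.-‿inverseʳ (ι b)))))

    open Evaluation φ using (ev; evM)

    pf-evM : ∀ f → PolyFun E E.1# (length f) (evM f)
    pf-evM []      = λ _ → refl
    pf-evM (a ∷ f) = ι a , evM f , pf-evM f , λ _ → refl

  idHom : (E : FiniteField) → Hom E (FiniteField.commutativeRing E)
  idHom E = record { ι = λ x → x ; +-hom = λ _ _ → refl ; *-hom = λ _ _ → refl ; 1-hom = refl ; 0-hom = refl }

  least : {P : ℕ → Set} → (∀ k → Dec (P k)) → ∀ n → P n → ∃ λ j → j ≤ n × P j × (∀ i → i < j → ¬ P i)
  least P? zero    p = 0 , z≤n , p , λ _ ()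
  least P? (suc n) p with P? 0
  ... | yes p₀ = 0 , z≤n , p₀ , λ _ ()
  ... | no ¬p₀ with least (λ k → P? (suc k)) n p
  ... | j , j≤n , pj , min = suc j , s≤s j≤n , pj , λ { zero _ → ¬p₀ ; (suc i) (s≤s l) → min i l }

  module FieldExtension (K E : FiniteField) (φ : Hom K (FiniteField.commutativeRing E)) (n : ℕ) (1≤n : 1 ≤ n)
    (order-E : FiniteField.order E ≡ FiniteField.order K ℕ.^ n) where

    private
      module K where
        open FiniteField K public
        open FieldProperties K public
        open Factorisation K public
        open Coefficients K public
      module LE = Lists E
      module CE = Coefficients E
      module ME = MonicMonoid E
      q = K.order
    open FiniteField E
    open FieldProperties E
    open IntegerSolver commutativeRing using (solve; _:=_; _:+_; _:*_; :-_; con)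
    open Hom φ public
    open MapHom {K} {E} φ
    open Evaluation φ

    frob : Carrier → Carrier
    frob x = x ^ q

    private
      0<q : 0 < q
      0<q = ℕₚ.<⇒≤ K.2≤order

    frob-* : ∀ x y → frob (x * y) ≡ frob x * frob y
    frob-* x y = *-^ x y q

    frob-0 : frob 0# ≡ 0#
    frob-0 with q | 0<q
    ... | suc q′ | _ = zeroˡ _

    frob-1 : frob 1# ≡ 1#
    frob-1 = 1^ q

    frob-ι : ∀ c → frob (ι c) ≡ ι c
    frob-ι c = trans (sym (ι-^ c q)) (cong ι (K.fermat c))

    scalars-unique : Unique (map ι (enum K.finite))
    scalars-unique = Uniqueₚ.map⁺ ι-injective (unique K.finite)

    -- (x + 1)^q − (x^q + 1) has degree below q and vanishes on the q scalars.
    frob-+1 : ∀ x → frob (x + 1#) ≡ frob x + 1#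
    frob-+1 x = x-y≡0 (many-roots⇒0 pf scalars-unique (Allₚ.map⁺ (All.universal vanish _)) x)
      where
      f : Carrier → Carrier
      f x = frob (x + 1#) + - (frob x + 1#)
      shifted : PolyFun 1# q (λ x → frob (x + 1#))
      shifted = subst (λ d → PolyFun 1# d (λ x → frob (x + 1#))) (ℕₚ.*-identityʳ q)
        (pf-^ {1} (1# , (λ _ → 1#) , (λ _ → refl) , λ x → trans (+-comm x 1#) (cong (1# +_) (sym (*-identityʳ x)))) q)
      pf : PolyFun 0# (length (map ι (enum K.finite))) f
      pf = subst (λ d → PolyFun 0# d f) (sym (Listₚ.length-map ι (enum K.finite)))
        (pf-cong q (λ x → eq (frob (x + 1#)) (frob x))
          (pf-lead q (lead≡0) (pf-+ q shifted (pf-scale (- 1#) q (pf-+ q (pf-pow q) (pf-raise< 0<q (λ (x : Carrier) → refl {x = 1#})))))))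
        where
        lead≡0 : 1# + - 1# * (1# + 0#) ≡ 0#
        lead≡0 = trans (cong (λ z → 1# + - 1# * z) (+-identityʳ 1#)) (trans (cong (1# +_) (*-identityʳ (- 1#))) (-‿inverseʳ 1#))
        eq : ∀ a b → a + - 1# * (b + 1#) ≡ a + - (b + 1#)
        eq = solve 2 (λ a b → a :+ :- con ℤ.1ℤ :* (b :+ con ℤ.1ℤ) := a :+ :- (b :+ con ℤ.1ℤ)) refl
      vanish : ∀ c → f (ι c) ≡ 0#
      vanish c = trans (cong₂ (λ u v → u + - v)
          (trans (cong frob (trans (cong (ι c +_) (sym 1-hom)) (sym (+-hom c K.1#)))) (trans (frob-ι _) (trans (+-hom c K.1#) (cong (ι c +_) 1-hom))))
          (cong (_+ 1#) (frob-ι c))) (-‿inverseʳ _)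

    -- Writing x + y = y (x/y + 1) reduces additivity to adding 1, since the Frobenius map is
    -- multiplicative.
    frob-+ : ∀ x y → frob (x + y) ≡ frob x + frob y
    frob-+ x y with y ≟ 0#
    ... | yes refl = trans (cong frob (+-identityʳ x)) (sym (trans (cong (frob x +_) frob-0) (+-identityʳ _)))
    ... | no y≢0 = begin
      frob (x + y)                       ≡⟨ cong frob factor ⟩
      frob (y * (inv y * x + 1#))        ≡⟨ frob-* y _ ⟩
      frob y * frob (inv y * x + 1#)     ≡⟨ cong (frob y *_) (frob-+1 _) ⟩
      frob y * (frob (inv y * x) + 1#)   ≡⟨ distribˡ _ _ _ ⟩
      frob y * frob (inv y * x) + frob y * 1# ≡⟨ cong₂ _+_ (trans (sym (frob-* y _)) (cong frob (*-inv-cancel y≢0 x))) (*-identityʳ _) ⟩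
      frob x + frob y ∎
      where
      open ≡-Reasoning
      factor : x + y ≡ y * (inv y * x + 1#)
      factor = sym (trans (distribˡ _ _ _) (cong₂ _+_ (*-inv-cancel y≢0 x) (*-identityʳ y)))

    frobHom : Hom E commutativeRing
    frobHom = record { ι = frob ; +-hom = frob-+ ; *-hom = frob-* ; 1-hom = frob-1 ; 0-hom = frob-0 }

    module F = MapHom {E} {E} frobHom

    frob-neg : ∀ x → frob (- x) ≡ - frob x
    frob-neg = Hom.neg-hom frobHom

    Fr : ℕ → Carrier → Carrier
    Fr zero    y = y
    Fr (suc i) y = frob (Fr i y)

    Fr-frob : ∀ i y → Fr i (frob y) ≡ frob (Fr i y)
    Fr-frob zero    y = refl
    Fr-frob (suc i) y = cong frob (Fr-frob i y)

    Fr-∘ : ∀ i j y → Fr (i ℕ.+ j) y ≡ Fr i (Fr j y)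
    Fr-∘ zero    j y = refl
    Fr-∘ (suc i) j y = cong frob (Fr-∘ i j y)

    Fr-^ : ∀ i y → Fr i y ≡ y ^ (q ℕ.^ i)
    Fr-^ zero    y = sym (*-identityʳ y)
    Fr-^ (suc i) y = trans (cong frob (Fr-^ i y)) (sym (^-* y (q ℕ.^ i) q))

    Fr-n : ∀ y → Fr n y ≡ y
    Fr-n y = trans (Fr-^ n y) (trans (cong (y ^_) (sym order-E)) (fermat y))

    Fr-injective : ∀ i {x y} → Fr i x ≡ Fr i y → x ≡ y
    Fr-injective zero    e = e
    Fr-injective (suc i) e = Fr-injective i (F.ι-injective e)

    Fr-+ : ∀ i x y → Fr i (x + y) ≡ Fr i x + Fr i y
    Fr-+ zero    x y = refl
    Fr-+ (suc i) x y = trans (cong frob (Fr-+ i x y)) (frob-+ _ _)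

    Fr-* : ∀ i x y → Fr i (x * y) ≡ Fr i x * Fr i y
    Fr-* zero    x y = refl
    Fr-* (suc i) x y = trans (cong frob (Fr-* i x y)) (frob-* _ _)

    Fr-ι : ∀ i c → Fr i (ι c) ≡ ι c
    Fr-ι zero    c = refl
    Fr-ι (suc i) c = trans (cong frob (Fr-ι i c)) (frob-ι c)

    Fr-neg : ∀ i x → Fr i (- x) ≡ - Fr i x
    Fr-neg zero    x = refl
    Fr-neg (suc i) x = trans (cong frob (Fr-neg i x)) (frob-neg _)

    -- The polynomial x^q - x has degree q and the q scalars are already roots, so a further fixed
    -- element would be a root too many.
    fixed⇒scalar : ∀ z → frob z ≡ z → ∃ λ c → ι c ≡ z
    fixed⇒scalar z fz with any? (λ c → ι c ≟ z) (enum K.finite)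
    ... | yes a = let (c , _ , e) = find a in c , e
    ... | no ¬a = ⊥-elim (ℕₚ.<-irrefl refl (subst (λ l → suc l ≤ q) (Listₚ.length-map ι (enum K.finite))
        (roots-≤ q {f} (λ e → 1≢0 (trans (sym lead) e)) pf (fresh ∷ scalars-unique)
          (root z fz ∷ Allₚ.map⁺ (All.universal (λ c → root (ι c) (frob-ι c)) _)))))
      where
      f : Carrier → Carrier
      f x = frob x + - 1# * x
      lead : 1# + 0# ≡ 1#
      lead = +-identityʳ 1#
      pf : PolyFun (1# + 0#) q f
      pf = pf-+ q (pf-pow q) (pf-raise< K.2≤order (pf-scale (- 1#) 1 pf-id))
      root : ∀ x → frob x ≡ x → f x ≡ 0#
      root x e = trans (cong (_+ - 1# * x) e) (lem x)
        where
        lem : ∀ x → x + - 1# * x ≡ 0#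
        lem = solve 1 (λ x → x :+ :- con ℤ.1ℤ :* x := con ℤ.0ℤ) refl
      fresh : All (z ≢_) (map ι (enum K.finite))
      fresh = Allₚ.map⁺ (All.tabulate λ {c} m e → ¬a (lose m (sym e)))

    conjugates : ℕ → Carrier → List Carrier
    conjugates j y = applyDownFrom (λ i → - Fr i y) j

    -- The product of X + Fr i y over i < j.  Using X + Fr i y rather than X − Fr i y makes its
    -- subleading and constant coefficients the trace and norm of y without signs when j = n.
    orbit : ℕ → Carrier → LE.Poly
    orbit zero    y = []
    orbit (suc j) y = LE.mulM (Fr j y ∷ []) (orbit j y)

    length-orbit : ∀ j y → length (orbit j y) ≡ j
    length-orbit zero    y = refl
    length-orbit (suc j) y = trans (LE.length-mulM (Fr j y ∷ []) (orbit j y)) (cong suc (length-orbit j y))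

    orbit-+ : ∀ j m {y} → Fr m y ≡ y → orbit (j ℕ.+ m) y ≡ LE.mulM (orbit j y) (orbit m y)
    orbit-+ zero    m e = refl
    orbit-+ (suc j) m {y} e = trans (cong₂ (λ z f → LE.mulM (z ∷ []) f) (trans (Fr-∘ j m y) (cong (Fr j) e)) (orbit-+ j m e))
                                (sym (ME.mulM-assoc (Fr j y ∷ []) (orbit j y) (orbit m y)))

    Fr-period : ∀ j {y} → Fr j y ≡ y → ∀ k → Fr (k ℕ.* j) y ≡ y
    Fr-period j e zero    = refl
    Fr-period j {y} e (suc k) = trans (Fr-∘ j (k ℕ.* j) y) (trans (cong (Fr j) (Fr-period j e k)) e)

    -- If y returns after j steps, the conjugates repeat in blocks of length j, and so do the linear
    -- factors.
    orbit-period : ∀ j {y} → Fr j y ≡ y → ∀ k → orbit (k ℕ.* j) y ≡ LE.powM (orbit j y) k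
    orbit-period j e zero    = refl
    orbit-period j {y} e (suc k) = trans (orbit-+ j (k ℕ.* j) (Fr-period j e k)) (cong (LE.mulM (orbit j y)) (orbit-period j e k))

    -- Frobenius moves the factors with indices 0, ..., j - 1 to the indices 1, ..., j. Multiplying
    -- each side by the factor that it lacks states this without division; when y has period j both
    -- extra factors agree and cancel.
    map-frob-orbit : ∀ j y → LE.mulM (map frob (orbit j y)) (y ∷ []) ≡ LE.mulM (Fr j y ∷ []) (orbit j y)
    map-frob-orbit zero    y = sym (ME.mulM-identityʳ (y ∷ []))
    map-frob-orbit (suc j) y = trans (cong (λ f → LE.mulM f (y ∷ [])) (F.map-mulM (Fr j y ∷ []) (orbit j y)))
      (trans (ME.mulM-assoc (Fr (suc j) y ∷ []) (map frob (orbit j y)) (y ∷ [])) (cong (LE.mulM (Fr (suc j) y ∷ [])) (map-frob-orbit j y)))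

    orbit-fixed : ∀ j {y} → Fr j y ≡ y → map frob (orbit j y) ≡ orbit j y
    orbit-fixed j {y} e = ME.mulM-cancelˡ (y ∷ []) (trans (ME.mulM-comm (y ∷ []) _)
      (trans (map-frob-orbit j y) (cong (λ z → LE.mulM (z ∷ []) (orbit j y)) e)))

    descend : ∀ f → map frob f ≡ f → ∃ λ g → map ι g ≡ f
    descend []      _ = [] , refl
    descend (a ∷ f) e with fixed⇒scalar a (Listₚ.∷-injectiveˡ e) | descend f (Listₚ.∷-injectiveʳ e)
    ... | c , refl | g , refl = c ∷ g , refl

    private module Id = Evaluation (idHom E)

    evM-map : ∀ f z → evM f z ≡ Id.evM (map ι f) z
    evM-map []      z = refl
    evM-map (a ∷ f) z = cong (λ w → ι a + z * w) (evM-map f z)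

    orbit-root : ∀ j y → Id.evM (orbit (suc j) y) (- y) ≡ 0#
    orbit-root zero    y = trans (Id.evM-mulM (y ∷ []) [] (- y)) (lem y)
      where
      lem : ∀ y → (y + - y * 1#) * 1# ≡ 0#
      lem = solve 1 (λ y → (y :+ :- y :* con ℤ.1ℤ) :* con ℤ.1ℤ := con ℤ.0ℤ) refl
    orbit-root (suc j) y = trans (Id.evM-mulM (Fr (suc j) y ∷ []) (orbit (suc j) y) (- y))
      (trans (cong (Id.evM (Fr (suc j) y ∷ []) (- y) *_) (orbit-root j y)) (zeroʳ _))

    frob-evM : ∀ f z → frob (evM f z) ≡ evM f (frob z)
    frob-evM []      z = frob-1
    frob-evM (a ∷ f) z = trans (frob-+ _ _) (cong₂ _+_ (frob-ι a) (trans (frob-* _ _) (cong (frob z *_) (frob-evM f z))))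

    root-Fr : ∀ f y → evM f (- y) ≡ 0# → ∀ i → evM f (- Fr i y) ≡ 0#
    root-Fr f y e zero    = e
    root-Fr f y e (suc i) = trans (cong (evM f) (sym (frob-neg _)))
      (trans (sym (frob-evM f _)) (trans (cong frob (root-Fr f y e i)) frob-0))

    -- P is the minimal polynomial of - y, the sign coming from the convention for `orbit`. Its
    -- degree is the period of y under Frobenius, and `suc k` is n divided by that degree; storing k
    -- keeps the exponent positive.
    record MinimalPolynomial (y : Carrier) : Set where
      field
        P           : K.Poly
        k           : ℕ
        irreducible : Irreducible K P
        root        : evM P (- y) ≡ 0#
        degree      : suc k ℕ.* length P ≡ n
        power       : map ι (K.powM P (suc k)) ≡ orbit n y
        minimal     : ∀ {R} → Irreducible K R → evM R (- y) ≡ 0# → R ≡ P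

    private
      empty : ∀ (f : K.Poly) → length f ≡ 0 → f ≡ []
      empty [] _ = refl

      neg-injective : ∀ {a b} → - a ≡ - b → a ≡ b
      neg-injective {a} {b} e = trans (lem a) (trans (cong -_ e) (sym (lem b)))
        where
        lem : ∀ a → a ≡ - - a
        lem = solve 1 (λ a → a := :- (:- a)) refl

    module Period (y : Carrier) (j₀ : ℕ) (Fr-j : Fr (suc j₀) y ≡ y) (no-smaller : ∀ i → i < j₀ → ¬ Fr (suc i) y ≡ y) where

      private
        j : ℕ
        j = suc j₀

      -- Both n and the multiples of j fix y, hence so does the remainder of n modulo j. A nonzero
      -- remainder would be a period smaller than the least one.
      n%j≡0 : n % j ≡ 0
      n%j≡0 with n % j in eq | m%n<n n j
      ... | zero  | _ = refl
      ... | suc r | s≤s l = ⊥-elim (no-smaller r l (begin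
        Fr (suc r) y                        ≡⟨ cong (Fr (suc r)) (Fr-period j Fr-j (n / j)) ⟨
        Fr (suc r) (Fr (n / j ℕ.* j) y)     ≡⟨ Fr-∘ (suc r) (n / j ℕ.* j) y ⟨
        Fr (suc r ℕ.+ n / j ℕ.* j) y        ≡⟨ cong (λ r → Fr (r ℕ.+ n / j ℕ.* j) y) eq ⟨
        Fr (n % j ℕ.+ n / j ℕ.* j) y        ≡⟨ cong (λ m → Fr m y) (m≡m%n+[m/n]*n n j) ⟨
        Fr n y                              ≡⟨ Fr-n y ⟩
        y ∎))
        where open ≡-Reasoning

      exponent : ∃ λ k → n ≡ suc k ℕ.* j
      exponent = positive (n / j) (trans (m≡m%n+[m/n]*n n j) (cong (ℕ._+ n / j ℕ.* j) n%j≡0))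
        where
        positive : ∀ c → n ≡ c ℕ.* j → ∃ λ k → n ≡ suc k ℕ.* j
        positive zero    e = ⊥-elim (ℕₚ.<⇒≢ 1≤n (sym e))
        positive (suc k) e = k , e

      conj-unique : Unique (conjugates j y)
      conj-unique = Uniqueₚ.applyDownFrom⁺₁ (λ i → - Fr i y) j distinct
        where
        not-fixed : ∀ i → 0 < i → i < j → ¬ Fr i y ≡ y
        not-fixed (suc i) _ (s≤s l) = no-smaller i l
        distinct : ∀ {i i′} → i′ < i → i < j → - Fr i y ≢ - Fr i′ y
        distinct {i} {i′} l i<j e = not-fixed (i ∸ i′) (ℕₚ.m<n⇒0<n∸m l) (ℕₚ.≤-<-trans (ℕₚ.m∸n≤m i i′) i<j)
          (Fr-injective i′ (trans (sym (Fr-∘ i′ (i ∸ i′) y))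
            (trans (cong (λ m → Fr m y) (ℕₚ.m+[n∸m]≡n (ℕₚ.<⇒≤ l))) (neg-injective e))))

      -- Since f has coefficients in K, its roots are stable under Frobenius. The j conjugates of -
      -- y are distinct, as j is the least period, so f has at least j roots.
      degree≥ : ∀ f → evM f (- y) ≡ 0# → j ≤ length f
      degree≥ f e = subst (_≤ length f) (Listₚ.length-applyDownFrom (λ i → - Fr i y) j)
        (roots-≤ (length f) 1≢0 (pf-evM f) conj-unique (Allₚ.applyDownFrom⁺₂ (λ i → - Fr i y) j (root-Fr f y e)))

      module Descent (P : K.Poly) (descends : map ι P ≡ orbit j y) where

        length-P : length P ≡ j
        length-P = trans (sym (Listₚ.length-map ι P)) (trans (cong length descends) (length-orbit j y))

        power : ∀ k → n ≡ suc k ℕ.* j → map ι (K.powM P (suc k)) ≡ orbit n y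
        power k e = trans (map-powM P (suc k)) (trans (cong (λ f → LE.powM f (suc k)) descends)
          (trans (sym (orbit-period j Fr-j (suc k))) (cong (λ m → orbit m y) (sym e))))

        root : evM P (- y) ≡ 0#
        root = trans (evM-map P (- y)) (trans (cong (λ f → Id.evM f (- y)) descends) (orbit-root j₀ y))

        -- One factor of P vanishes at - y and therefore has the full degree j by `degree≥`, which
        -- leaves degree 0 for the other.
        irreducible : Irreducible K P
        irreducible = record
          { nonconstant = subst (1 ≤_) (sym length-P) (s≤s z≤n)
          ; no-factors  = λ f g e → split f g e (evM f (- y) ≟ 0#) }
          where
          lengths : ∀ f g → K.mulM f g ≡ P → length f ℕ.+ length g ≡ j
          lengths f g e = trans (sym (K.length-mulM f g)) (trans (cong length e) length-P)
          split : ∀ f g → K.mulM f g ≡ P → Dec (evM f (- y) ≡ 0#) → f ≡ [] ⊎ g ≡ []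
          split f g e (yes z) = inj₂ (empty g (ℕₚ.n≤0⇒n≡0 (ℕₚ.+-cancelˡ-≤ j (length g) 0
            (ℕₚ.≤-trans (ℕₚ.+-monoˡ-≤ (length g) (degree≥ f z)) (ℕₚ.≤-reflexive (trans (lengths f g e) (sym (ℕₚ.+-identityʳ j))))))))
          split f g e (no nz) = inj₁ (empty f (ℕₚ.n≤0⇒n≡0 (ℕₚ.+-cancelʳ-≤ j (length f) 0
            (ℕₚ.≤-trans (ℕₚ.+-monoʳ-≤ (length f) (degree≥ g g-root)) (ℕₚ.≤-reflexive (lengths f g e))))))
            where
            g-root : evM g (- y) ≡ 0#
            g-root = x*y≡0 (trans (sym (evM-mulM f g (- y))) (trans (cong (λ h → evM h (- y)) e) root)) nz

        -- The remainder of R modulo P vanishes at - y and has degree below j; by `degree≥` it must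
        -- be zero, so P divides R, and irreducible polynomials that divide one another are equal.
        minimal : ∀ {R} → Irreducible K R → evM R (- y) ≡ 0# → R ≡ P
        minimal {R} i e = sym (K.irreducible-∣ irreducible i (divides (subst (_≤ length R) (sym length-P) (degree≥ R e))))
          where
          divides : length P ≤ length R → P K.∣ₚ R
          divides l = finish (normalise K (toList rem))
            where
            quo = proj₁ (K.divM R P l)
            rem = proj₂ (K.divM R P l)
            finish : QuotientFields.Normalised K (toList rem) → P K.∣ₚ R
            finish (inj₁ z) = quo , trans (K.mulM-comm P quo) (exact-division K R P l z)
            finish (inj₂ (c , g , c≢0 , g<r , eq)) =
              ⊥-elim (ℕₚ.<⇒≱ (subst (length g <_) (trans (Vecₚ.length-toList rem) length-P) g<r) (degree≥ g (x*y≡0 (begin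
                ι c * evM g (- y)                               ≡⟨ eq φ (- y) ⟨
                ev (toList rem) (- y)                           ≡⟨ +-identityˡ _ ⟨
                0# + ev (toList rem) (- y)                      ≡⟨ cong (_+ ev (toList rem) (- y)) (trans (cong (evM quo (- y) *_) root) (zeroʳ _)) ⟨
                evM quo (- y) * evM P (- y) + ev (toList rem) (- y) ≡⟨ ev-divM R P l (- y) ⟨
                evM R (- y)                                     ≡⟨ e ⟩
                0# ∎) (ι-≢0 c≢0))))
              where open ≡-Reasoning

        minimalPolynomial : (∃ λ k → n ≡ suc k ℕ.* j) → MinimalPolynomial y
        minimalPolynomial (k , e) = record
          { P = P ; k = k ; irreducible = irreducible ; root = root
          ; degree = trans (cong (suc k ℕ.*_) length-P) (sym e) ; power = power k e ; minimal = minimal }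

      from-descent : (∃ λ P → map ι P ≡ orbit j y) → MinimalPolynomial y
      from-descent (P , descends) = Descent.minimalPolynomial P descends exponent

    private
      from-period : ∀ y → (∃ λ j → j ≤ n ∸ 1 × Fr (suc j) y ≡ y × (∀ i → i < j → ¬ Fr (suc i) y ≡ y)) → MinimalPolynomial y
      from-period y (j , _ , Fr-j , no-smaller) =
        Period.from-descent y j Fr-j no-smaller (descend (orbit (suc j) y) (orbit-fixed (suc j) Fr-j))

    abstract
      minimalPolynomial : ∀ y → MinimalPolynomial y
      minimalPolynomial y = from-period y (least (λ i → Fr (suc i) y ≟ y) (n ∸ 1)
        (trans (cong (λ m → Fr m y) (ℕₚ.m+[n∸m]≡n 1≤n)) (Fr-n y)))

    charPoly : Carrier → K.Poly
    charPoly y = K.powM (MinimalPolynomial.P M) (suc (MinimalPolynomial.k M))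
      where M = minimalPolynomial y

    rootCount : K.Poly → ℤ
    rootCount P = ∑ (enum finite) (λ y → 𝟙 (evM P (- y) ≟ 0#))

    rootCount-≤ : ∀ P → rootCount P ℤ.≤ ℤ.+ length P
    rootCount-≤ P = subst (ℤ._≤ ℤ.+ length P) (sym (∑-reindex finite -_ -_ neg-neg neg-neg (λ z → 𝟙 (evM P z ≟ 0#))))
                          (count-roots-≤ (length P) 1≢0 (pf-evM P))
      where
      neg-neg : ∀ a → - - a ≡ a
      neg-neg = solve 1 (λ a → :- (:- a) := a) refl

    private
      t : ℕ → (K.Poly → ℤ) → K.Poly → ℤ
      t N ψ P = ∑ (downFrom N) (λ k → 𝟙 (suc k ℕ.* length P ℕₚ.≟ n) ℤ.* ψ (K.powM P (suc k)))

      -- Exactly one irreducible polynomial vanishes at - y, and exactly one of its powers has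
      -- degree n, so one term survives. The shape is that of `Λ` with the degree of P replaced by
      -- an indicator of a root, ready to be summed over y.
      charPoly-as-sum : ∀ N ψ y → n ≤ N →
        ψ (charPoly y) ≡ K.∑Mon N (λ P → 𝟙 (K.irreducible? P) ℤ.* (𝟙 (evM P (- y) ≟ 0#) ℤ.* t N ψ P))
      charPoly-as-sum N ψ y n≤N = sym (begin
        K.∑Mon N (λ R → 𝟙 (K.irreducible? R) ℤ.* (𝟙 (evM R (- y) ≟ 0#) ℤ.* t N ψ R))
          ≡⟨ K.∑Mon-cong N select ⟩
        K.∑Mon N (λ R → 𝟙 (R K.≟ₚ P) ℤ.* t N ψ R)
          ≡⟨ K.∑Mon-δ N nonconstant (ℕₚ.≤-trans (ℕₚ.m≤m+n (length P) _) (ℕₚ.≤-trans (ℕₚ.≤-reflexive degree) n≤N)) (t N ψ) ⟩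
        t N ψ P
          ≡⟨ ∑-cong (downFrom N) (λ i → cong (ℤ._* ψ (K.powM P (suc i))) (𝟙-cong (suc i ℕ.* length P ℕₚ.≟ n) (i ℕₚ.≟ k) (same i) λ { refl → degree })) ⟩
        ∑ (downFrom N) (λ i → 𝟙 (i ℕₚ.≟ k) ℤ.* ψ (K.powM P (suc i)))
          ≡⟨ ∑-downFrom-δ k<N (λ i → ψ (K.powM P (suc i))) ⟩
        ψ (charPoly y) ∎)
        where
        open ≡-Reasoning
        open MinimalPolynomial (minimalPolynomial y)
        open Irreducible irreducible
        k<N : k < N
        k<N = ℕₚ.≤-trans (subst₂ _≤_ (ℕₚ.*-identityʳ (suc k)) degree (ℕₚ.*-monoʳ-≤ (suc k) nonconstant)) n≤N
        same : ∀ i → suc i ℕ.* length P ≡ n → i ≡ k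
        same i e with length P | nonconstant | degree
        ... | suc d | _ | deg = K.exponent-unique d i k (trans e (sym deg))
        select : ∀ R → 𝟙 (K.irreducible? R) ℤ.* (𝟙 (evM R (- y) ≟ 0#) ℤ.* t N ψ R) ≡ 𝟙 (R K.≟ₚ P) ℤ.* t N ψ R
        select R with R K.≟ₚ P
        ... | yes refl = trans (𝟙-yes-* (K.irreducible? R) irreducible _)
                           (trans (𝟙-yes-* (evM R (- y) ≟ 0#) root _) (sym (ℤₚ.*-identityˡ _)))
        ... | no ne = trans (𝟙-*-cong (K.irreducible? R) {y = 0ℤ} λ i →
                        𝟙-no-* (evM R (- y) ≟ 0#) (λ z → ne (minimal i z)) (t N ψ R))
                      (trans (ℤₚ.*-zeroʳ (𝟙 (K.irreducible? R))) (sym (ℤₚ.*-zeroˡ (t N ψ R))))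

      ∑-charPoly : ∀ N ψ → n ≤ N → ∑ (enum finite) (λ y → ψ (charPoly y)) ≡
                   K.∑Mon N (λ P → 𝟙 (K.irreducible? P) ℤ.* (rootCount P ℤ.* t N ψ P))
      ∑-charPoly N ψ n≤N = begin
        ∑ (enum finite) (λ y → ψ (charPoly y))
          ≡⟨ ∑-cong (enum finite) (λ y → charPoly-as-sum N ψ y n≤N) ⟩
        ∑ (enum finite) (λ y → K.∑Mon N (λ P → 𝟙 (K.irreducible? P) ℤ.* (𝟙 (evM P (- y) ≟ 0#) ℤ.* t N ψ P)))
          ≡⟨ K.∑Mon-swap N (enum finite) _ ⟩
        K.∑Mon N (λ P → ∑ (enum finite) (λ y → 𝟙 (K.irreducible? P) ℤ.* (𝟙 (evM P (- y) ≟ 0#) ℤ.* t N ψ P)))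
          ≡⟨ K.∑Mon-cong N (λ P → trans (∑-*ˡ (𝟙 (K.irreducible? P)) (enum finite) _)
               (cong (𝟙 (K.irreducible? P) ℤ.*_) (∑-*ʳ (t N ψ P) (enum finite) _))) ⟩
        K.∑Mon N (λ P → 𝟙 (K.irreducible? P) ℤ.* (rootCount P ℤ.* t N ψ P)) ∎
        where open ≡-Reasoning

    -- Each term for ψ = 1 is at most its counterpart in Λ N n 1, and both sums equal order E,
    -- so every irreducible polynomial of degree dividing n splits in E.
    ∑-charPoly-Λ : ∀ N ψ → n ≤ N → ∑ (enum finite) (λ y → ψ (charPoly y)) ≡ K.Λ N n ψ
    ∑-charPoly-Λ N ψ n≤N = trans (∑-charPoly N ψ n≤N)
      (∑-cong∈ (downFrom N) λ {d} d∈ → ∑-cong∈ (K.monics (suc d)) λ {P} P∈ → term P (tight d∈ P∈))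
      where
      one : K.Poly → ℤ
      one _ = 1ℤ
      lhs rhs : K.Poly → ℤ
      lhs P = 𝟙 (K.irreducible? P) ℤ.* (rootCount P ℤ.* t N one P)
      rhs P = 𝟙 (K.irreducible? P) ℤ.* (ℤ.+ length P ℤ.* t N one P)
      0≤t : ∀ P → 0ℤ ℤ.≤ t N one P
      0≤t P = 0≤∑ (downFrom N) (λ k → 0≤* (0≤𝟙 (suc k ℕ.* length P ℕₚ.≟ n)) (ℤ.+≤+ z≤n))
      *-mono-nonNeg : ∀ {a b} c → 0ℤ ℤ.≤ c → a ℤ.≤ b → a ℤ.* c ℤ.≤ b ℤ.* c
      *-mono-nonNeg (ℤ.+ c) _ l = ℤₚ.*-monoʳ-≤-nonNeg (ℤ.+ c) l
      lhs≤rhs : ∀ P → lhs P ℤ.≤ rhs P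
      lhs≤rhs P = subst₂ ℤ._≤_ (ℤₚ.*-comm _ (𝟙 (K.irreducible? P))) (ℤₚ.*-comm _ (𝟙 (K.irreducible? P)))
        (*-mono-nonNeg (𝟙 (K.irreducible? P)) (0≤𝟙 (K.irreducible? P)) (*-mono-nonNeg (t N one P) (0≤t P) (rootCount-≤ P)))
      total : K.∑Mon N lhs ≡ K.∑Mon N rhs
      total = trans (sym (∑-charPoly N one n≤N)) (trans (∑-1 (enum finite))
        (trans (cong ℤ.+_ order-E) (sym (K.Λ-one N n 1≤n n≤N))))
      tight : ∀ {d P} → d ∈ downFrom N → P ∈ K.monics (suc d) → lhs P ≡ rhs P
      tight {d} d∈ P∈ = ∑-≤-tight (K.monics (suc d)) lhs≤rhs
        (∑-≤-tight (downFrom N) (λ d → ∑-≤ (K.monics (suc d)) lhs≤rhs) total d∈) P∈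
      cancel : ∀ {a b c} → 1ℤ ℤ.≤ c → a ℤ.* c ≡ b ℤ.* c → a ≡ b
      cancel {a} {b} {ℤ.+ suc c} _ e = ℤₚ.*-cancelʳ-≡ a b (ℤ.+ suc c) e
      cancel {a} {b} {ℤ.+ zero} (ℤ.+≤+ ()) e
      term : ∀ P → lhs P ≡ rhs P → 𝟙 (K.irreducible? P) ℤ.* (rootCount P ℤ.* t N ψ P) ≡
                                   𝟙 (K.irreducible? P) ℤ.* (ℤ.+ length P ℤ.* t N ψ P)
      term P e with K.irreducible? P
      ... | no _  = refl
      ... | yes i = cong (1ℤ ℤ.*_) (trans (sym (∑-*ˡ (rootCount P) (downFrom N) _)) (trans
        (∑-cong∈ (downFrom N) λ {k} k∈ → trans (assoc′ (rootCount P) (I k) _)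
          (trans (𝟙-*-cong (D k) (λ deg → cong (ℤ._* ψ (K.powM P (suc k))) (equal k k∈ deg)))
                 (sym (assoc′ (ℤ.+ length P) (I k) _))))
        (∑-*ˡ (ℤ.+ length P) (downFrom N) _)))
        where
        D : ∀ k → Dec (suc k ℕ.* length P ≡ n)
        D k = suc k ℕ.* length P ℕₚ.≟ n
        I : ℕ → ℤ
        I k = 𝟙 (D k)
        assoc′ : ∀ a b c → a ℤ.* (b ℤ.* c) ≡ b ℤ.* (a ℤ.* c)
        assoc′ a b c = trans (sym (ℤₚ.*-assoc a b c)) (trans (cong (ℤ._* c) (ℤₚ.*-comm a b)) (ℤₚ.*-assoc b a c))
        -- The exponent k at hand makes the common factor `t N one P` at least 1, so it can be
        -- cancelled from the equality obtained for the constant 1.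
        equal : ∀ k → k ∈ downFrom N → suc k ℕ.* length P ≡ n → rootCount P ≡ ℤ.+ length P
        equal k k∈ deg = cancel
          (subst (ℤ._≤ t N one P) (cong (ℤ._* 1ℤ) (𝟙-yes (D k) deg))
            (term≤∑ (downFrom N) {λ k → I k ℤ.* 1ℤ} (λ k → 0≤* (0≤𝟙 (D k)) (ℤ.+≤+ z≤n)) k∈))
          (trans (sym (ℤₚ.*-identityˡ _)) (trans e (ℤₚ.*-identityˡ _)))

open Conjugates

-- Norm, trace and the relation between consecutive degrees.

module NormAndTrace where
  open import Data.Nat using (_≤_; _∸_)

  -- 1 + q + ... + q^(n-1) = (q^n - 1)/(q - 1): the exponent of the norm map and the size of its
  -- fibres over nonzero elements.
  geo : ℕ → ℕ → ℕ
  geo q zero    = 0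
  geo q (suc n) = q ℕ.^ n ℕ.+ geo q n

  geo-suc : ∀ q n → geo q (suc n) ≡ 1 ℕ.+ q ℕ.* geo q n
  geo-suc q zero    = cong suc (sym (ℕₚ.*-zeroʳ q))
  geo-suc q (suc n) = begin
    q ℕ.* q ℕ.^ n ℕ.+ geo q (suc n)               ≡⟨ cong (q ℕ.* q ℕ.^ n ℕ.+_) (geo-suc q n) ⟩
    q ℕ.* q ℕ.^ n ℕ.+ suc (q ℕ.* geo q n)         ≡⟨ ℕₚ.+-suc _ _ ⟩
    suc (q ℕ.* q ℕ.^ n ℕ.+ q ℕ.* geo q n)         ≡⟨ cong suc (sym (ℕₚ.*-distribˡ-+ q (q ℕ.^ n) (geo q n))) ⟩
    1 ℕ.+ q ℕ.* geo q (suc n) ∎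
    where open ≡-Reasoning

  geo-closed : ∀ q n → suc q ℕ.^ n ≡ 1 ℕ.+ q ℕ.* geo (suc q) n
  geo-closed q zero    = cong suc (sym (ℕₚ.*-zeroʳ q))
  geo-closed q (suc n) = begin
    Q ℕ.+ q ℕ.* Q                                  ≡⟨ ℕₚ.+-comm Q (q ℕ.* Q) ⟩
    q ℕ.* Q ℕ.+ Q                                  ≡⟨ cong (q ℕ.* Q ℕ.+_) (geo-closed q n) ⟩
    q ℕ.* Q ℕ.+ suc (q ℕ.* geo (suc q) n)          ≡⟨ ℕₚ.+-suc _ _ ⟩
    suc (q ℕ.* Q ℕ.+ q ℕ.* geo (suc q) n)          ≡⟨ cong suc (sym (ℕₚ.*-distribˡ-+ q Q _)) ⟩
    1 ℕ.+ q ℕ.* geo (suc q) (suc n) ∎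
    where
    open ≡-Reasoning
    Q = suc q ℕ.^ n

  module NormTrace (K E : FiniteField) (φ : Hom K (FiniteField.commutativeRing E)) (n : ℕ) (1≤n : 1 ≤ n)
    (order-E : FiniteField.order E ≡ FiniteField.order K ℕ.^ n) where

    private
      module K where
        open FiniteField K public
        open FieldProperties K public
        open Factorisation K public
        open Coefficients K public
      module CE = Coefficients E
      q = K.order
    open FiniteField E
    open FieldProperties E
    open IntegerSolver commutativeRing using (solve; _:=_; _:+_; _:*_; :-_; con)
    open FieldExtension K E φ n 1≤n order-E
    open MapHom {K} {E} φ

    -- Taken as coefficients of the characteristic polynomial, they lie in K from the start and can
    -- be counted with `Λ`. The familiar sums and products of conjugates are recovered in `ι-trace`
    -- and `ι-norm′`.
    trace norm : Carrier → K.Carrier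
    trace y = K.subleading (charPoly y)
    norm  y = K.constant (charPoly y)

    conjugateSum conjugateProduct : ℕ → Carrier → Carrier
    conjugateSum zero    y = 0#
    conjugateSum (suc j) y = Fr j y + conjugateSum j y
    conjugateProduct zero    y = 1#
    conjugateProduct (suc j) y = Fr j y * conjugateProduct j y

    ι-trace : ∀ y → ι (trace y) ≡ conjugateSum n y
    ι-trace y = trans (sym (subleading-map (charPoly y)))
      (trans (cong CE.subleading (MinimalPolynomial.power (minimalPolynomial y))) (go n))
      where
      go : ∀ j → CE.subleading (orbit j y) ≡ conjugateSum j y
      go zero    = refl
      go (suc j) = trans (CE.subleading-mulM (Fr j y ∷ []) (orbit j y)) (cong (Fr j y +_) (go j))

    ι-norm′ : ∀ y → ι (norm y) ≡ conjugateProduct n y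
    ι-norm′ y = trans (sym (constant-map (charPoly y)))
      (trans (cong CE.constant (MinimalPolynomial.power (minimalPolynomial y))) (go n))
      where
      go : ∀ j → CE.constant (orbit j y) ≡ conjugateProduct j y
      go zero    = refl
      go (suc j) = trans (CE.constant-mulM (Fr j y ∷ []) (orbit j y)) (cong (Fr j y *_) (go j))

    ι-norm : ∀ y → ι (norm y) ≡ y ^ geo q n
    ι-norm y = trans (ι-norm′ y) (go n)
      where
      go : ∀ j → conjugateProduct j y ≡ y ^ geo q j
      go zero    = refl
      go (suc j) = trans (cong₂ _*_ (Fr-^ j y) (go j)) (sym (^-+ y (q ℕ.^ j) (geo q j)))

    trace-+ : ∀ x y → trace (x + y) ≡ trace x K.+ trace y
    trace-+ x y = ι-injective (trans (ι-trace (x + y)) (trans (go n)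
      (trans (sym (cong₂ _+_ (ι-trace x) (ι-trace y))) (sym (+-hom _ _)))))
      where
      lem : ∀ a b c d → a + b + (c + d) ≡ a + c + (b + d)
      lem = solve 4 (λ a b c d → a :+ b :+ (c :+ d) := a :+ c :+ (b :+ d)) refl
      go : ∀ j → conjugateSum j (x + y) ≡ conjugateSum j x + conjugateSum j y
      go zero    = sym (+-identityˡ 0#)
      go (suc j) = trans (cong₂ _+_ (Fr-+ j x y) (go j)) (lem _ _ _ _)

    trace-ι* : ∀ c y → trace (ι c * y) ≡ c K.* trace y
    trace-ι* c y = ι-injective (trans (ι-trace (ι c * y)) (trans (go n)
      (trans (cong (ι c *_) (sym (ι-trace y))) (sym (*-hom _ _)))))
      where
      go : ∀ j → conjugateSum j (ι c * y) ≡ ι c * conjugateSum j y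
      go zero    = sym (zeroʳ _)
      go (suc j) = trans (cong₂ _+_ (trans (Fr-* j (ι c) y) (cong (_* Fr j y) (Fr-ι j c))) (go j)) (sym (distribˡ _ _ _))

    norm-* : ∀ x y → norm (x * y) ≡ norm x K.* norm y
    norm-* x y = ι-injective (trans (ι-norm (x * y)) (trans (*-^ x y (geo q n))
      (trans (sym (cong₂ _*_ (ι-norm x) (ι-norm y))) (sym (*-hom _ _)))))

    norm-ι : ∀ c → norm (ι c) ≡ c K.^ n
    norm-ι c = ι-injective (trans (ι-norm′ (ι c)) (trans (go n) (sym (ι-^ c n))))
      where
      go : ∀ j → conjugateProduct j (ι c) ≡ ι c ^ j
      go zero    = refl
      go (suc j) = cong₂ _*_ (Fr-ι j c) (go j)

    1≤geo : 1 ≤ geo q n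
    1≤geo = go n 1≤n
      where
      go : ∀ n → 1 ≤ n → 1 ≤ geo q n
      go (suc m) _ = subst (1 ≤_) (sym (geo-suc q m)) (s≤s z≤n)

    norm-0 : norm 0# ≡ K.0#
    norm-0 = ι-injective (trans (ι-norm 0#) (trans (go (geo q n) 1≤geo) (sym 0-hom)))
      where
      go : ∀ m → 1 ≤ m → 0# ^ m ≡ 0#
      go (suc m) _ = zeroˡ _

    norm-≢0 : ∀ {y} → y ≢ 0# → norm y ≢ K.0#
    norm-≢0 {y} y≢0 e = ^-≢0 y≢0 (geo q n) (trans (sym (ι-norm y)) (trans (cong ι e) 0-hom))

    ∑-trace-norm : ∀ N (F : K.Carrier → K.Carrier → ℤ) → n ≤ N →
      ∑ (enum finite) (λ y → F (trace y) (norm y)) ≡ K.Λ N n (λ f → F (K.subleading f) (K.constant f))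
    ∑-trace-norm N F = ∑-charPoly-Λ N (λ f → F (K.subleading f) (K.constant f))

    -- After embedding K in E, the trace is a monic polynomial function of degree q^(n-1), too small
    -- to vanish on all q^n elements.
    trace-nonzero : ∃ λ y → trace y ≢ K.0#
    trace-nonzero with any? (λ y → ¬? (trace y K.≟ K.0#)) (enum finite)
    ... | yes a = let (y , _ , ne) = find a in y , ne
    ... | no ¬a = ⊥-elim (contradiction n 1≤n order-E
        (λ y → trans (sym (ι-trace y)) (trans (cong ι (decidable-stable (trace y K.≟ K.0#) λ ne → ¬a (lose (complete finite y) ne))) 0-hom)))
      where
      pf : ∀ j → PolyFun 1# (q ℕ.^ j) (conjugateSum (suc j))
      pf-below : ∀ j → PolyFun 0# (q ℕ.^ j) (conjugateSum j)
      pf j = pf-lead (q ℕ.^ j) (+-identityʳ 1#) (pf-+ (q ℕ.^ j) (pf-cong (q ℕ.^ j) (λ y → sym (Fr-^ j y)) (pf-pow (q ℕ.^ j))) (pf-below j))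
      pf-below zero    = 0# , (λ _ → 0#) , (λ _ → refl) , λ x → sym (trans (+-identityˡ _) (zeroʳ x))
      pf-below (suc j) = pf-raise< (ℕₚ.^-monoʳ-< q K.2≤order (ℕₚ.n<1+n j)) (pf j)
      contradiction : ∀ n → 1 ≤ n → order ≡ q ℕ.^ n → ¬ (∀ y → conjugateSum n y ≡ 0#)
      contradiction (suc j) _ e z = ℕₚ.<⇒≱ (ℕₚ.^-monoʳ-< q K.2≤order (ℕₚ.n<1+n j))
        (subst (_≤ q ℕ.^ j) e (roots-≤ (q ℕ.^ j) 1≢0 (pf j) (unique finite) (All.universal z (enum finite))))

    private
      fibre : K.Carrier → ℤ
      fibre c = ∑ (enum finite) (λ y → 𝟙 (norm y K.≟ c))

      fibre-≤ : ∀ c → fibre c ℤ.≤ ℤ.+ geo q n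
      fibre-≤ c = subst (ℤ._≤ ℤ.+ geo q n) (∑-cong (enum finite) (λ y → 𝟙-cong (f y ≟ 0#) (norm y K.≟ c)
          (λ e → ι-injective (trans (ι-norm y) (x-y≡0 e)))
          (λ e → trans (cong (_+ - ι c) (trans (sym (ι-norm y)) (cong ι e))) (-‿inverseʳ _))))
        (count-roots-≤ (geo q n) (λ e → 1≢0 (trans (sym (+-identityʳ 1#)) e)) pf)
        where
        f : Carrier → Carrier
        f y = y ^ geo q n + - ι c
        pf : PolyFun (1# + 0#) (geo q n) f
        pf = pf-+ (geo q n) (pf-pow (geo q n)) (pf-raise< 1≤geo (λ (x : Carrier) → refl {x = - ι c}))

      fibre-total : ∑ (enum K.finite) (λ c → 𝟙 (K.nonzero? c) ℤ.* fibre c) ≡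
                    ∑ (enum K.finite) (λ c → 𝟙 (K.nonzero? c) ℤ.* ℤ.+ geo q n)
      fibre-total = begin
        ∑ (enum K.finite) (λ c → 𝟙 (K.nonzero? c) ℤ.* fibre c)
          ≡⟨ ∑-cong (enum K.finite) (λ c → ℤₚ.*-comm (𝟙 (K.nonzero? c)) (fibre c)) ⟩
        ∑ (enum K.finite) (λ c → fibre c ℤ.* 𝟙 (K.nonzero? c))
          ≡⟨ fibres K.finite (enum finite) norm (λ c → 𝟙 (K.nonzero? c)) ⟨
        ∑ (enum finite) (λ y → 𝟙 (K.nonzero? (norm y)))
          ≡⟨ ∑-cong (enum finite) (λ y → trans (𝟙-cong (K.nonzero? (norm y)) (nonzero? y)
               (λ ne e → ne (trans (cong norm e) norm-0)) norm-≢0) (sym (ℤₚ.*-identityʳ _))) ⟩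
        ∑ (enum finite) (λ y → 𝟙 (nonzero? y) ℤ.* 1ℤ)
          ≡⟨ ∑-nonzero (λ _ → 1ℤ) ⟩
        ∑ (enum finite) (λ _ → 1ℤ) ℤ.- 1ℤ
          ≡⟨ cong (ℤ._- 1ℤ) (trans (∑-1 (enum finite)) (cong ℤ.+_ order-E)) ⟩
        ℤ.+ (q ℕ.^ n) ℤ.- 1ℤ
          ≡⟨ count q refl ⟩
        (ℤ.+ q ℤ.- 1ℤ) ℤ.* ℤ.+ geo q n
          ≡⟨ cong (λ z → (z ℤ.- 1ℤ) ℤ.* ℤ.+ geo q n) (∑-1 (enum K.finite)) ⟨
        (∑ (enum K.finite) (λ _ → 1ℤ) ℤ.- 1ℤ) ℤ.* ℤ.+ geo q n
          ≡⟨ cong (ℤ._* ℤ.+ geo q n) (K.∑-nonzero (λ _ → 1ℤ)) ⟨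
        ∑ (enum K.finite) (λ c → 𝟙 (K.nonzero? c) ℤ.* 1ℤ) ℤ.* ℤ.+ geo q n
          ≡⟨ ∑-*ʳ (ℤ.+ geo q n) (enum K.finite) _ ⟨
        ∑ (enum K.finite) (λ c → 𝟙 (K.nonzero? c) ℤ.* 1ℤ ℤ.* ℤ.+ geo q n)
          ≡⟨ ∑-cong (enum K.finite) (λ c → cong (ℤ._* ℤ.+ geo q n) (ℤₚ.*-identityʳ (𝟙 (K.nonzero? c)))) ⟩
        ∑ (enum K.finite) (λ c → 𝟙 (K.nonzero? c) ℤ.* ℤ.+ geo q n) ∎
        where
        open ≡-Reasoning
        count : ∀ m → m ≡ q → ℤ.+ (m ℕ.^ n) ℤ.- 1ℤ ≡ (ℤ.+ m ℤ.- 1ℤ) ℤ.* ℤ.+ geo m n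
        count zero    e = ⊥-elim (ℕₚ.<⇒≢ (ℕₚ.<⇒≤ K.2≤order) e)
        count (suc m) _ = trans (cong (λ z → ℤ.+ z ℤ.- 1ℤ) (geo-closed m n)) (ℤₚ.pos-* m (geo (suc m) n))

    -- The norm is the power map with exponent (q^n - 1)/(q - 1), so no fibre has more than that
    -- many elements. The q - 1 fibres over nonzero elements share q^n - 1 elements, which forces
    -- every one of them to be full.
    norm-fibre : ∀ {c} → c ≢ K.0# → ∑ (enum finite) (λ y → 𝟙 (norm y K.≟ c)) ≡ ℤ.+ geo q n
    norm-fibre {c} c≢0 = trans (sym (ℤₚ.*-identityˡ _)) (trans (cong (ℤ._* fibre c) (sym (𝟙-yes (K.nonzero? c) c≢0)))
      (trans (∑-≤-tight (enum K.finite) term fibre-total (complete K.finite c)) (𝟙-yes-* (K.nonzero? c) c≢0 _)))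
      where
      term : ∀ c → 𝟙 (K.nonzero? c) ℤ.* fibre c ℤ.≤ 𝟙 (K.nonzero? c) ℤ.* ℤ.+ geo q n
      term c with K.nonzero? c
      ... | yes _ = ℤₚ.*-monoˡ-≤-nonNeg 1ℤ (fibre-≤ c)
      ... | no _  = ℤₚ.≤-refl

    ∑-nonzero-norm : ∀ (G : K.Carrier → ℤ) → ∑ (enum finite) (λ y → 𝟙 (nonzero? y) ℤ.* G (norm y)) ≡
                     ℤ.+ geo q n ℤ.* ∑ (enum K.finite) (λ c → 𝟙 (K.nonzero? c) ℤ.* G c)
    ∑-nonzero-norm G = begin
      ∑ (enum finite) (λ y → 𝟙 (nonzero? y) ℤ.* G (norm y))
        ≡⟨ ∑-cong (enum finite) (λ y → cong (ℤ._* G (norm y)) (𝟙-cong (nonzero? y) (K.nonzero? (norm y)) norm-≢0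
             (λ ne eq → ne (trans (cong norm eq) norm-0)))) ⟩
      ∑ (enum finite) (λ y → 𝟙 (K.nonzero? (norm y)) ℤ.* G (norm y))
        ≡⟨ fibres K.finite (enum finite) norm (λ c → 𝟙 (K.nonzero? c) ℤ.* G c) ⟩
      ∑ (enum K.finite) (λ c → fibre c ℤ.* (𝟙 (K.nonzero? c) ℤ.* G c))
        ≡⟨ ∑-cong (enum K.finite) (λ c → trans (lem (fibre c) (𝟙 (K.nonzero? c)) (G c))
             (trans (𝟙-*-cong (K.nonzero? c) (λ c≢0 → cong (ℤ._* G c) (norm-fibre c≢0)))
               (sym (lem (ℤ.+ geo q n) (𝟙 (K.nonzero? c)) (G c))))) ⟩
      ∑ (enum K.finite) (λ c → ℤ.+ geo q n ℤ.* (𝟙 (K.nonzero? c) ℤ.* G c))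
        ≡⟨ ∑-*ˡ (ℤ.+ geo q n) (enum K.finite) _ ⟩
      ℤ.+ geo q n ℤ.* ∑ (enum K.finite) (λ c → 𝟙 (K.nonzero? c) ℤ.* G c) ∎
      where
      open ≡-Reasoning
      lem : ∀ a b c → a ℤ.* (b ℤ.* c) ≡ b ℤ.* (a ℤ.* c)
      lem = ℤ-Solver.solve-∀

  module Uniform (K : FiniteField) where
    open FiniteField K
    open FieldProperties K
    open Factorisation K
    open Coefficients K
    open ≡-Reasoning

    ∑-shift : ∀ s a → ∑ (enum finite) (λ x → 𝟙 (s + x ≟ a)) ≡ 1ℤ
    ∑-shift s a = trans (∑-cong (enum finite) λ x → 𝟙-cong (s + x ≟ a) (x ≟ - s + a)
        (λ e → trans (lem s x) (cong (- s +_) e)) (λ e → trans (cong (s +_) e) (lem′ s a)))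
      (∑-δ₁ finite (- s + a))
      where
      open IntegerSolver commutativeRing using (solve; _:=_; _:+_; :-_)
      lem : ∀ s x → x ≡ - s + (s + x)
      lem = solve 2 (λ s x → x := :- s :+ (s :+ x)) refl
      lem′ : ∀ s a → s + (- s + a) ≡ a
      lem′ = solve 2 (λ s a → s :+ (:- s :+ a) := a) refl

    ∑-scale : ∀ c {b} → b ≢ 0# → ∑ (enum finite) (λ x → 𝟙 (c * x ≟ b)) ≡ 𝟙 (nonzero? c)
    ∑-scale c {b} b≢0 with c ≟ 0#
    ... | yes refl = ∑-zero (enum finite) (λ x → 𝟙-no (0# * x ≟ b) (λ e → b≢0 (trans (sym e) (zeroˡ x))))
    ... | no c≢0   = trans (∑-cong (enum finite) λ x → 𝟙-cong (c * x ≟ b) (x ≟ inv c * b)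
        (λ e → trans (sym (inv-*-cancel c≢0 x)) (cong (inv c *_) e)) (λ e → trans (cong (c *_) e) (*-inv-cancel c≢0 b)))
      (∑-δ₁ finite (inv c * b))

    nonempty-subleading : ∀ m x {h} → h ∈ monics (suc m) → subleading (x ∷ h) ≡ subleading h
    nonempty-subleading m x {h} h∈ with h | ∈-monics⁻ (suc m) h∈
    ... | _ ∷ _ | _ = refl

    ∑-subleading : ∀ m s a → ∑ (monics (suc m)) (λ h → 𝟙 (s + subleading h ≟ a)) ≡ ℤ.+ (order ℕ.^ m)
    ∑-subleading zero s a = trans (∑-cartesianProductWith _∷_ (enum finite) (monics 0) _)
      (trans (∑-cong (enum finite) (λ x → ℤₚ.+-identityʳ _)) (∑-shift s a))
    ∑-subleading (suc m) s a = begin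
      ∑ (monics (suc (suc m))) (λ h → 𝟙 (s + subleading h ≟ a))
        ≡⟨ ∑-cartesianProductWith _∷_ (enum finite) (monics (suc m)) _ ⟩
      ∑ (enum finite) (λ x → ∑ (monics (suc m)) (λ h → 𝟙 (s + subleading (x ∷ h) ≟ a)))
        ≡⟨ ∑-cong (enum finite) (λ x → trans (∑-cong∈ (monics (suc m)) (λ {h} h∈ →
             cong (λ z → 𝟙 (s + z ≟ a)) (nonempty-subleading m x h∈))) (∑-subleading m s a)) ⟩
      ∑ (enum finite) (λ _ → ℤ.+ (order ℕ.^ m))
        ≡⟨ ∑-const (enum finite) _ ⟩
      ℤ.+ order ℤ.* ℤ.+ (order ℕ.^ m)
        ≡⟨ ℤₚ.pos-* order _ ⟨
      ℤ.+ (order ℕ.^ suc m) ∎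

    -- From degree 2 on, the constant and the subleading coefficients are different coordinates.
    -- Each condition fixes one of them and m coefficients stay free; for c = 0 nothing satisfies
    -- the second condition, since b ≠ 0.
    ∑-uniform : ∀ m s c a {b} → b ≢ 0# →
      ∑ (monics (suc (suc m))) (λ g → 𝟙 (s + subleading g ≟ a) ℤ.* 𝟙 (c * constant g ≟ b)) ≡
      𝟙 (nonzero? c) ℤ.* ℤ.+ (order ℕ.^ m)
    ∑-uniform m s c a {b} b≢0 = begin
      ∑ (monics (suc (suc m))) (λ g → 𝟙 (s + subleading g ≟ a) ℤ.* 𝟙 (c * constant g ≟ b))
        ≡⟨ ∑-cartesianProductWith _∷_ (enum finite) (monics (suc m)) _ ⟩
      ∑ (enum finite) (λ x → ∑ (monics (suc m)) (λ h → 𝟙 (s + subleading (x ∷ h) ≟ a) ℤ.* 𝟙 (c * x ≟ b)))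
        ≡⟨ ∑-cong (enum finite) (λ x → trans (∑-*ʳ (𝟙 (c * x ≟ b)) (monics (suc m)) _)
             (cong (ℤ._* 𝟙 (c * x ≟ b)) (trans (∑-cong∈ (monics (suc m)) (λ {h} h∈ →
               cong (λ z → 𝟙 (s + z ≟ a)) (nonempty-subleading m x h∈))) (∑-subleading m s a)))) ⟩
      ∑ (enum finite) (λ x → ℤ.+ (order ℕ.^ m) ℤ.* 𝟙 (c * x ≟ b))
        ≡⟨ ∑-*ˡ (ℤ.+ (order ℕ.^ m)) (enum finite) _ ⟩
      ℤ.+ (order ℕ.^ m) ℤ.* ∑ (enum finite) (λ x → 𝟙 (c * x ≟ b))
        ≡⟨ cong (ℤ.+ (order ℕ.^ m) ℤ.*_) (∑-scale c b≢0) ⟩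
      ℤ.+ (order ℕ.^ m) ℤ.* 𝟙 (nonzero? c)
        ≡⟨ ℤₚ.*-comm (ℤ.+ (order ℕ.^ m)) _ ⟩
      𝟙 (nonzero? c) ℤ.* ℤ.+ (order ℕ.^ m) ∎

  -- A counting form of the Hasse–Davenport relation between degrees ℓ and ℓ + 1.  In Newton's identity
  -- for n = ℓ + 1 the terms of index below ℓ do not depend on the prescribed trace a and norm b ≠ 0.
  module HasseDavenport (K L E : FiniteField) (φ : Hom K (FiniteField.commutativeRing L)) (χ : Hom K (FiniteField.commutativeRing E))
    (ℓ′ : ℕ) (order-L : FiniteField.order L ≡ FiniteField.order K ℕ.^ suc ℓ′)
    (order-E : FiniteField.order E ≡ FiniteField.order K ℕ.^ suc (suc ℓ′)) where

    open FiniteField K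
    open FieldProperties K
    open Factorisation K
    open Coefficients K
    open Uniform K
    private
      n = suc (suc ℓ′)
      module L = NormTrace K L φ (suc ℓ′) (s≤s z≤n) order-L
      module E = NormTrace K E χ n (s≤s z≤n) order-E
      enumL = enum (FiniteField.finite L)
      enumE = enum (FiniteField.finite E)
      rest : ℤ
      rest = ∑ (downFrom ℓ′) (λ i → Λ n (suc i) (λ f → 𝟙 (nonzero? (constant f)) ℤ.* ℤ.+ (order ℕ.^ (ℓ′ ∸ suc i))))

    total : ℤ
    total = ℤ.+ n ℤ.* ℤ.+ (order ℕ.^ ℓ′) ℤ.- rest

    -- Summed against a nontrivial additive character of a and a multiplicative character of b, the
    -- constant disappears and the relation reads G_E + G_L G_K = 0 for the Gauss sums of the three
    -- fields.
    hasse-davenport : ∀ a {b} → b ≢ 0# →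
      ∑ enumE (λ y → 𝟙 (E.trace y ≟ a) ℤ.* 𝟙 (E.norm y ≟ b)) ℤ.+
      ∑ enumL (λ x → ∑ (enum finite) (λ t → 𝟙 (L.trace x + t ≟ a) ℤ.* 𝟙 (L.norm x * t ≟ b))) ≡ total
    hasse-davenport a {b} b≢0 = solve-for (begin
      ℤ.+ n ℤ.* ℤ.+ (order ℕ.^ ℓ′)
        ≡⟨ cong (ℤ.+ n ℤ.*_) count-all ⟨
      ℤ.+ n ℤ.* ∑ (monics n) F
        ≡⟨ newton n n F ℕₚ.≤-refl ⟩
      ∑ (downFrom n) (λ i → Λ n (suc i) (λ f → ∑ (monics (n ∸ suc i)) (λ g → F (mulM f g))))
        ≡⟨ cong₂ ℤ._+_ top (cong₂ ℤ._+_ second lower) ⟩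
      SE ℤ.+ (SL ℤ.+ rest) ∎)
      where
      open ≡-Reasoning
      F : Poly → ℤ
      F h = 𝟙 (subleading h ≟ a) ℤ.* 𝟙 (constant h ≟ b)
      SE SL : ℤ
      SE = ∑ enumE (λ y → 𝟙 (E.trace y ≟ a) ℤ.* 𝟙 (E.norm y ≟ b))
      SL = ∑ enumL (λ x → ∑ (enum finite) (λ t → 𝟙 (L.trace x + t ≟ a) ℤ.* 𝟙 (L.norm x * t ≟ b)))
      solve-for : ℤ.+ n ℤ.* ℤ.+ (order ℕ.^ ℓ′) ≡ SE ℤ.+ (SL ℤ.+ rest) → SE ℤ.+ SL ≡ total
      solve-for e = trans (lem SE SL rest) (cong (ℤ._- rest) (sym e))
        where
        lem : ∀ a b c → a ℤ.+ b ≡ a ℤ.+ (b ℤ.+ c) ℤ.- c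
        lem = ℤ-Solver.solve-∀
      F-mulM : ∀ f g → F (mulM f g) ≡ 𝟙 (subleading f + subleading g ≟ a) ℤ.* 𝟙 (constant f * constant g ≟ b)
      F-mulM f g = cong₂ (λ u v → 𝟙 (u ≟ a) ℤ.* 𝟙 (v ≟ b)) (subleading-mulM f g) (constant-mulM f g)
      count-all : ∑ (monics n) F ≡ ℤ.+ (order ℕ.^ ℓ′)
      count-all = trans (∑-cong (monics n) (λ g → cong₂ (λ u v → 𝟙 (u ≟ a) ℤ.* 𝟙 (v ≟ b)) (sym (+-identityˡ _)) (sym (*-identityˡ _))))
        (trans (∑-uniform ℓ′ 0# 1# a b≢0) (𝟙-yes-* (nonzero? 1#) 1≢0 _))
      -- Here the cofactor g is 1, and prime powers of degree n = ℓ + 1 are weighted exactly as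
      -- characteristic polynomials of elements of E.
      top : Λ n n (λ f → ∑ (monics (n ∸ n)) (λ g → F (mulM f g))) ≡ SE
      top = trans (Λ-cong n n (λ f _ → trans (cong (λ k → ∑ (monics k) (λ g → F (mulM f g))) (ℕₚ.n∸n≡0 n))
          (trans (ℤₚ.+-identityʳ _) (cong F (mulM-identityʳ f)))))
        (sym (E.∑-trace-norm n (λ u v → 𝟙 (u ≟ a) ℤ.* 𝟙 (v ≟ b)) ℕₚ.≤-refl))
      -- The cofactor is linear, g = X + t. It adds t to the trace and multiplies the norm by t,
      -- while the prime powers of degree ℓ come from elements of L.
      second : Λ n (suc ℓ′) (λ f → ∑ (monics (n ∸ suc ℓ′)) (λ g → F (mulM f g))) ≡ SL
      second = trans (Λ-cong n (suc ℓ′) (λ f _ → trans (cong (λ k → ∑ (monics k) (λ g → F (mulM f g))) (ℕₚ.m+n∸n≡m 1 (suc ℓ′)))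
          (trans (∑-cartesianProductWith _∷_ (enum finite) (monics 0) _)
            (∑-cong (enum finite) λ t → trans (ℤₚ.+-identityʳ _) (F-mulM f (t ∷ []))))))
        (sym (L.∑-trace-norm n (λ u v → ∑ (enum finite) (λ t → 𝟙 (u + t ≟ a) ℤ.* 𝟙 (v * t ≟ b))) (ℕₚ.n≤1+n _)))
      -- The cofactor has degree at least 2, so its two outer coefficients meet any prescribed trace
      -- and norm equally often.
      lower : ∑ (downFrom ℓ′) (λ i → Λ n (suc i) (λ f → ∑ (monics (n ∸ suc i)) (λ g → F (mulM f g)))) ≡ rest
      lower = ∑-downFrom-cong ℓ′ λ i i<ℓ′ → Λ-cong n (suc i) λ f _ →
        trans (cong (λ k → ∑ (monics k) (λ g → F (mulM f g))) (ℕₚ.+-∸-assoc 2 i<ℓ′))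
          (trans (∑-cong (monics (2 ℕ.+ (ℓ′ ∸ suc i))) (F-mulM f))
            (∑-uniform (ℓ′ ∸ suc i) (subleading f) (constant f) a b≢0))

open NormAndTrace

-- The prime field with p elements.

module PrimeFields where
  open import Data.Nat using (_∸_)
  open import Data.Nat.DivMod using (_%_; _mod_; %-distribˡ-+; %-distribˡ-*; m%n%n≡m%n; m<n⇒m%n≡m; n%n≡0; m*n%n≡0; [m+kn]%n≡m%n)
  open import Data.Nat.Coprimality using (prime⇒coprime; coprime-Bézout)
  import Data.Nat.Coprimality as Coprimality
  open import Data.Nat.GCD using (module Bézout)
  open import Data.Fin using (zero; suc)
  open import Defs using (addMod; negMod)

  toℕ-mod : ∀ m n → toℕ (m mod suc n) ≡ m % suc n
  toℕ-mod m n = Finₚ.toℕ-fromℕ< _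

  finite-Fin : ∀ n → Finite (Fin n)
  finite-Fin n = record { enum = allFin n ; unique = Uniqueₚ.allFin⁺ n ; complete = ∈-allFin ; _≟_ = Finₚ._≟_ }

  module ℤ/ (p′ : ℕ) (1<p : 1 ℕ.< suc p′) where
    private
      p = suc p′

    infixl 6 _+_
    infixl 7 _*_
    infix  8 -_

    -- Addition and negation are the operations of the theorem's group itself, so that vectors over
    -- this field with their addition are that group, without any transport.
    _+_ _*_ : Fin p → Fin p → Fin p
    _+_ = addMod
    a * b = (toℕ a ℕ.* toℕ b) mod p

    -_ : Fin p → Fin p
    -_ = negMod

    0# 1# : Fin p
    0# = zero
    1# = 1 mod p

    small : ∀ (a : Fin p) → toℕ a % p ≡ toℕ a
    small a = m<n⇒m%n≡m (Finₚ.toℕ<n a)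

    %-+ˡ : ∀ m n → (m % p ℕ.+ n) % p ≡ (m ℕ.+ n) % p
    %-+ˡ m n = trans (%-distribˡ-+ (m % p) n p) (trans (cong (λ k → (k ℕ.+ n % p) % p) (m%n%n≡m%n m p)) (sym (%-distribˡ-+ m n p)))

    %-+ʳ : ∀ m n → (m ℕ.+ n % p) % p ≡ (m ℕ.+ n) % p
    %-+ʳ m n = trans (cong (_% p) (ℕₚ.+-comm m (n % p))) (trans (%-+ˡ n m) (cong (_% p) (ℕₚ.+-comm n m)))

    %-*ˡ : ∀ m n → (m % p ℕ.* n) % p ≡ (m ℕ.* n) % p
    %-*ˡ m n = trans (%-distribˡ-* (m % p) n p) (trans (cong (λ k → (k ℕ.* (n % p)) % p) (m%n%n≡m%n m p)) (sym (%-distribˡ-* m n p)))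

    %-*ʳ : ∀ m n → (m ℕ.* (n % p)) % p ≡ (m ℕ.* n) % p
    %-*ʳ m n = trans (cong (_% p) (ℕₚ.*-comm m (n % p))) (trans (%-*ˡ n m) (cong (_% p) (ℕₚ.*-comm n m)))

    ≡-via : ∀ {a b : Fin p} → toℕ a ≡ toℕ b → a ≡ b
    ≡-via = Finₚ.toℕ-injective

    toℕ-+ : ∀ a b → toℕ (a + b) ≡ (toℕ a ℕ.+ toℕ b) % p
    toℕ-+ a b = toℕ-mod (toℕ a ℕ.+ toℕ b) p′

    toℕ-* : ∀ a b → toℕ (a * b) ≡ (toℕ a ℕ.* toℕ b) % p
    toℕ-* a b = toℕ-mod (toℕ a ℕ.* toℕ b) p′

    +-comm : ∀ a b → a + b ≡ b + a
    +-comm a b = cong (_mod p) (ℕₚ.+-comm (toℕ a) (toℕ b))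

    *-comm : ∀ a b → a * b ≡ b * a
    *-comm a b = cong (_mod p) (ℕₚ.*-comm (toℕ a) (toℕ b))

    +-assoc : ∀ a b c → (a + b) + c ≡ a + (b + c)
    +-assoc a b c = ≡-via (begin
      toℕ ((a + b) + c)                          ≡⟨ toℕ-+ (a + b) c ⟩
      (toℕ (a + b) ℕ.+ toℕ c) % p                ≡⟨ cong (λ k → (k ℕ.+ toℕ c) % p) (toℕ-+ a b) ⟩
      ((toℕ a ℕ.+ toℕ b) % p ℕ.+ toℕ c) % p      ≡⟨ %-+ˡ (toℕ a ℕ.+ toℕ b) (toℕ c) ⟩
      (toℕ a ℕ.+ toℕ b ℕ.+ toℕ c) % p            ≡⟨ cong (_% p) (ℕₚ.+-assoc (toℕ a) (toℕ b) (toℕ c)) ⟩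
      (toℕ a ℕ.+ (toℕ b ℕ.+ toℕ c)) % p          ≡⟨ %-+ʳ (toℕ a) (toℕ b ℕ.+ toℕ c) ⟨
      (toℕ a ℕ.+ (toℕ b ℕ.+ toℕ c) % p) % p      ≡⟨ cong (λ k → (toℕ a ℕ.+ k) % p) (toℕ-+ b c) ⟨
      (toℕ a ℕ.+ toℕ (b + c)) % p                ≡⟨ toℕ-+ a (b + c) ⟨
      toℕ (a + (b + c)) ∎)
      where open ≡-Reasoning

    *-assoc : ∀ a b c → (a * b) * c ≡ a * (b * c)
    *-assoc a b c = ≡-via (begin
      toℕ ((a * b) * c)                          ≡⟨ toℕ-* (a * b) c ⟩
      (toℕ (a * b) ℕ.* toℕ c) % p                ≡⟨ cong (λ k → (k ℕ.* toℕ c) % p) (toℕ-* a b) ⟩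
      ((toℕ a ℕ.* toℕ b) % p ℕ.* toℕ c) % p      ≡⟨ %-*ˡ (toℕ a ℕ.* toℕ b) (toℕ c) ⟩
      (toℕ a ℕ.* toℕ b ℕ.* toℕ c) % p            ≡⟨ cong (_% p) (ℕₚ.*-assoc (toℕ a) (toℕ b) (toℕ c)) ⟩
      (toℕ a ℕ.* (toℕ b ℕ.* toℕ c)) % p          ≡⟨ %-*ʳ (toℕ a) (toℕ b ℕ.* toℕ c) ⟨
      (toℕ a ℕ.* ((toℕ b ℕ.* toℕ c) % p)) % p    ≡⟨ cong (λ k → (toℕ a ℕ.* k) % p) (toℕ-* b c) ⟨
      (toℕ a ℕ.* toℕ (b * c)) % p                ≡⟨ toℕ-* a (b * c) ⟨
      toℕ (a * (b * c)) ∎)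
      where open ≡-Reasoning

    *-distribˡ : ∀ a b c → a * (b + c) ≡ (a * b) + (a * c)
    *-distribˡ a b c = ≡-via (begin
      toℕ (a * (b + c))                          ≡⟨ toℕ-* a (b + c) ⟩
      (toℕ a ℕ.* toℕ (b + c)) % p                ≡⟨ cong (λ k → (toℕ a ℕ.* k) % p) (toℕ-+ b c) ⟩
      (toℕ a ℕ.* ((toℕ b ℕ.+ toℕ c) % p)) % p    ≡⟨ %-*ʳ (toℕ a) (toℕ b ℕ.+ toℕ c) ⟩
      (toℕ a ℕ.* (toℕ b ℕ.+ toℕ c)) % p          ≡⟨ cong (_% p) (ℕₚ.*-distribˡ-+ (toℕ a) (toℕ b) (toℕ c)) ⟩
      (ab ℕ.+ ac) % p                            ≡⟨ %-distribˡ-+ ab ac p ⟩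
      (ab % p ℕ.+ ac % p) % p                    ≡⟨ cong₂ (λ k l → (k ℕ.+ l) % p) (toℕ-* a b) (toℕ-* a c) ⟨
      (toℕ (a * b) ℕ.+ toℕ (a * c)) % p          ≡⟨ toℕ-+ (a * b) (a * c) ⟨
      toℕ ((a * b) + (a * c)) ∎)
      where
      open ≡-Reasoning
      ab = toℕ a ℕ.* toℕ b
      ac = toℕ a ℕ.* toℕ c

    +-identityˡ : ∀ a → 0# + a ≡ a
    +-identityˡ a = ≡-via (trans (toℕ-+ 0# a) (small a))

    toℕ-1 : toℕ 1# ≡ 1
    toℕ-1 = trans (toℕ-mod 1 p′) (m<n⇒m%n≡m 1<p)

    *-identityˡ : ∀ a → 1# * a ≡ a
    *-identityˡ a = ≡-via (trans (toℕ-* 1# a) (trans (cong (λ k → (k ℕ.* toℕ a) % p) toℕ-1)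
      (trans (cong (_% p) (ℕₚ.*-identityˡ (toℕ a))) (small a))))

    -‿inverseʳ : ∀ a → a + (- a) ≡ 0#
    -‿inverseʳ a = ≡-via (begin
      toℕ (a + (- a))                        ≡⟨ toℕ-+ a (- a) ⟩
      (toℕ a ℕ.+ toℕ (- a)) % p              ≡⟨ cong (λ k → (toℕ a ℕ.+ k) % p) (toℕ-mod (p ∸ toℕ a) p′) ⟩
      (toℕ a ℕ.+ (p ∸ toℕ a) % p) % p        ≡⟨ %-+ʳ (toℕ a) (p ∸ toℕ a) ⟩
      (toℕ a ℕ.+ (p ∸ toℕ a)) % p            ≡⟨ cong (_% p) (ℕₚ.m+[n∸m]≡n (ℕₚ.<⇒≤ (Finₚ.toℕ<n a))) ⟩
      p % p                                  ≡⟨ n%n≡0 p ⟩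
      0 ∎)
      where open ≡-Reasoning

    isCommutativeRing : IsCommutativeRing _≡_ _+_ _*_ -_ 0# 1#
    isCommutativeRing = record
      { isRing = record
        { +-isAbelianGroup = record
          { isGroup = record
            { isMonoid = record
              { isSemigroup = record
                { isMagma = record { isEquivalence = isEquivalence ; ∙-cong = cong₂ _+_ }
                ; assoc = +-assoc }
              ; identity = +-identityˡ , λ a → trans (+-comm a 0#) (+-identityˡ a) }
            ; inverse = (λ a → trans (+-comm (- a) a) (-‿inverseʳ a)) , -‿inverseʳ
            ; ⁻¹-cong = cong -_ }
          ; comm = +-comm }
        ; *-cong = cong₂ _*_
        ; *-assoc = *-assoc
        ; *-identity = *-identityˡ , λ a → trans (*-comm a 1#) (*-identityˡ a)
        ; distrib = *-distribˡ , λ a b c → trans (*-comm (b + c) a) (trans (*-distribˡ a b c) (cong₂ _+_ (*-comm a b) (*-comm a c))) }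
      ; *-comm = *-comm }

    commutativeRing : CommutativeRing _ _
    commutativeRing = record { isCommutativeRing = isCommutativeRing }

    1≢0 : 1# ≢ 0#
    1≢0 e = ℕₚ.1+n≢0 {0} (trans (sym toℕ-1) (cong toℕ e))

    toℕ≢0 : ∀ {a : Fin p} → a ≢ 0# → toℕ a ≢ 0
    toℕ≢0 a≢0 e = a≢0 (≡-via e)

    module _ (p-prime : Prime p) where
      unit : ∀ a → a ≢ 0# → ∃ λ b → a * b ≡ 1#
      unit a a≢0 = from (coprime-Bézout (Coprimality.sym (prime⇒coprime p-prime {{ℕ.≢-nonZero (toℕ≢0 a≢0)}} (Finₚ.toℕ<n a))))
        where
        from : Bézout.Identity 1 (toℕ a) p → ∃ λ b → a * b ≡ 1#
        from (Bézout.+- x y e) = x mod p , ≡-via (begin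
          toℕ (a * (x mod p))                 ≡⟨ toℕ-* a (x mod p) ⟩
          (toℕ a ℕ.* toℕ (x mod p)) % p       ≡⟨ cong (λ k → (toℕ a ℕ.* k) % p) (toℕ-mod x p′) ⟩
          (toℕ a ℕ.* (x % p)) % p             ≡⟨ %-*ʳ (toℕ a) x ⟩
          (toℕ a ℕ.* x) % p                   ≡⟨ cong (_% p) (trans (ℕₚ.*-comm (toℕ a) x) (sym e)) ⟩
          (1 ℕ.+ y ℕ.* p) % p                 ≡⟨ [m+kn]%n≡m%n 1 y p ⟩
          1 % p                               ≡⟨ toℕ-mod 1 p′ ⟨
          toℕ 1# ∎)
          where open ≡-Reasoning
        -- In this case 1 + x a is a multiple of p, so a x = - 1 and the inverse is - x.
        from (Bézout.-+ x y e) = - (x mod p) , trans (lem a (x mod p)) (trans (cong (λ z → - z + 1#) 1+ax≡0) refl-step)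
          where
          open IntegerSolver commutativeRing using (solve; _:=_; _:+_; _:*_; :-_; con)
          open import Data.Integer using (1ℤ; 0ℤ)
          lem : ∀ a x → a * (- x) ≡ (- (1# + (a * x))) + 1#
          lem = solve 2 (λ a x → a :* (:- x) := (:- (con 1ℤ :+ (a :* x))) :+ con 1ℤ) refl
          refl-step : (- 0#) + 1# ≡ 1#
          refl-step = solve 0 ((:- con 0ℤ) :+ con 1ℤ := con 1ℤ) refl
          1+ax≡0 : 1# + (a * (x mod p)) ≡ 0#
          1+ax≡0 = ≡-via (begin
            toℕ (1# + (a * (x mod p)))                  ≡⟨ toℕ-+ 1# (a * (x mod p)) ⟩
            (toℕ 1# ℕ.+ toℕ (a * (x mod p))) % p        ≡⟨ cong₂ (λ k l → (k ℕ.+ l) % p) toℕ-1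
                                                             (trans (toℕ-* a (x mod p)) (trans (cong (λ k → (toℕ a ℕ.* k) % p) (toℕ-mod x p′)) (%-*ʳ (toℕ a) x))) ⟩
            (1 ℕ.+ (toℕ a ℕ.* x) % p) % p               ≡⟨ %-+ʳ 1 (toℕ a ℕ.* x) ⟩
            (1 ℕ.+ toℕ a ℕ.* x) % p                     ≡⟨ cong (_% p) (trans (cong (1 ℕ.+_) (ℕₚ.*-comm (toℕ a) x)) e) ⟩
            (y ℕ.* p) % p                               ≡⟨ m*n%n≡0 y p ⟩
            0 ∎)
            where open ≡-Reasoning

      private
        inverse : Fin p → Fin p
        inverse a with a Finₚ.≟ 0#
        ... | yes _  = 0#
        ... | no a≢0 = proj₁ (unit a a≢0)

        inverse-correct : ∀ a → a ≢ 0# → a * inverse a ≡ 1#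
        inverse-correct a a≢0 with a Finₚ.≟ 0#
        ... | yes a≡0 = ⊥-elim (a≢0 a≡0)
        ... | no a≢0′ = proj₂ (unit a a≢0′)

      primeField : FiniteField
      primeField = record
        { isCommutativeRing = isCommutativeRing
        ; finite = finite-Fin p
        ; inv = inverse
        ; inverseʳ = inverse-correct
        ; 1≢0 = 1≢0
        }

      order-primeField : FiniteField.order primeField ≡ p
      order-primeField = Listₚ.length-tabulate (λ x → x)

open PrimeFields

-- Polynomial identities between the parameters and the eigenvalues.

module ParameterIdentities where
  open import Data.Integer using (_+_; _*_; _-_; +_)
  open import Data.Integer.Tactic.RingSolver using (solve-∀)

  -- T is the order of the annihilated subspace, σ = q^r, T σ the order of K, a = (|L| − 1)/(|K| − 1).
  module Parameters (T σ a : ℤ) where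
    -- `X` is |L|, so TσX is |E|, and `b` is (|E| - 1)/(|K| - 1). `θ₁` and `θ₂` are the eigenvalues
    -- away from the trivial character.
    X b k lam mu θ₁ θ₂ : ℤ
    X   = 1ℤ + (T * σ - 1ℤ) * a
    b   = 1ℤ + T * σ * a
    k   = (X - 1ℤ) * (1ℤ + (σ - 1ℤ) * b)
    lam = (σ - 1ℤ) * b * ((σ - 1ℤ) * a - 1ℤ) + (X - + 2)
    mu  = (σ - 1ℤ) * a * ((σ - 1ℤ) * b + 1ℤ)
    θ₁  = (T - 1ℤ) * σ * a
    θ₂  = θ₁ - σ * X

  -- The equation whose roots are the nontrivial eigenvalues of a strongly regular graph with these
  -- parameters; `quadratic₂` treats the other root.
  quadratic₁ : ∀ T σ a → let open Parameters T σ a in θ₁ * θ₁ ≡ (lam - mu) * θ₁ + (k - mu)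
  quadratic₁ = identity
    where
    identity : ∀ T σ a → (T - 1ℤ) * σ * a * ((T - 1ℤ) * σ * a) ≡
      ((σ - 1ℤ) * (1ℤ + T * σ * a) * ((σ - 1ℤ) * a - 1ℤ) + (1ℤ + (T * σ - 1ℤ) * a - + 2) - (σ - 1ℤ) * a * ((σ - 1ℤ) * (1ℤ + T * σ * a) + 1ℤ)) * ((T - 1ℤ) * σ * a)
      + ((1ℤ + (T * σ - 1ℤ) * a - 1ℤ) * (1ℤ + (σ - 1ℤ) * (1ℤ + T * σ * a)) - (σ - 1ℤ) * a * ((σ - 1ℤ) * (1ℤ + T * σ * a) + 1ℤ))
    identity = solve-∀

  quadratic₂ : ∀ T σ a → let open Parameters T σ a in θ₂ * θ₂ ≡ (lam - mu) * θ₂ + (k - mu)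
  quadratic₂ = identity
    where
    identity : ∀ T σ a → ((T - 1ℤ) * σ * a - σ * (1ℤ + (T * σ - 1ℤ) * a)) * ((T - 1ℤ) * σ * a - σ * (1ℤ + (T * σ - 1ℤ) * a)) ≡
      ((σ - 1ℤ) * (1ℤ + T * σ * a) * ((σ - 1ℤ) * a - 1ℤ) + (1ℤ + (T * σ - 1ℤ) * a - + 2) - (σ - 1ℤ) * a * ((σ - 1ℤ) * (1ℤ + T * σ * a) + 1ℤ)) * ((T - 1ℤ) * σ * a - σ * (1ℤ + (T * σ - 1ℤ) * a))
      + ((1ℤ + (T * σ - 1ℤ) * a - 1ℤ) * (1ℤ + (σ - 1ℤ) * (1ℤ + T * σ * a)) - (σ - 1ℤ) * a * ((σ - 1ℤ) * (1ℤ + T * σ * a) + 1ℤ))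
    identity = solve-∀

  -- Equivalent to k (k - λ - 1) = (v - k - 1) μ with v = |L| |E|: the trivial character also sees
  -- the constant function, whence the extra term μ v.
  counting : ∀ T σ a → let open Parameters T σ a in k * k ≡ (lam - mu) * k + mu * (X * (T * σ * X)) + (k - mu)
  counting = identity
    where
    identity : ∀ T σ a → (1ℤ + (T * σ - 1ℤ) * a - 1ℤ) * (1ℤ + (σ - 1ℤ) * (1ℤ + T * σ * a)) * ((1ℤ + (T * σ - 1ℤ) * a - 1ℤ) * (1ℤ + (σ - 1ℤ) * (1ℤ + T * σ * a))) ≡
      ((σ - 1ℤ) * (1ℤ + T * σ * a) * ((σ - 1ℤ) * a - 1ℤ) + (1ℤ + (T * σ - 1ℤ) * a - + 2) - (σ - 1ℤ) * a * ((σ - 1ℤ) * (1ℤ + T * σ * a) + 1ℤ)) * ((1ℤ + (T * σ - 1ℤ) * a - 1ℤ) * (1ℤ + (σ - 1ℤ) * (1ℤ + T * σ * a)))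
      + (σ - 1ℤ) * a * ((σ - 1ℤ) * (1ℤ + T * σ * a) + 1ℤ) * ((1ℤ + (T * σ - 1ℤ) * a) * (T * σ * (1ℤ + (T * σ - 1ℤ) * a)))
      + ((1ℤ + (T * σ - 1ℤ) * a - 1ℤ) * (1ℤ + (σ - 1ℤ) * (1ℤ + T * σ * a)) - (σ - 1ℤ) * a * ((σ - 1ℤ) * (1ℤ + T * σ * a) + 1ℤ))
    identity = solve-∀

  -- Character sums come out multiplied by T, so the closed forms are compared with them in that
  -- form; likewise `T*θ₁` and `T*θ₂`.
  T*k : ∀ T σ a → let open Parameters T σ a in T * k ≡ (X - 1ℤ) * (T * σ * X - (T - 1ℤ) * (T * σ * a))
  T*k = identity
    where
    identity : ∀ T σ a → T * ((1ℤ + (T * σ - 1ℤ) * a - 1ℤ) * (1ℤ + (σ - 1ℤ) * (1ℤ + T * σ * a))) ≡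
      (1ℤ + (T * σ - 1ℤ) * a - 1ℤ) * (T * σ * (1ℤ + (T * σ - 1ℤ) * a) - (T - 1ℤ) * (T * σ * a))
    identity = solve-∀

  T*θ₁ : ∀ T σ a → let open Parameters T σ a in T * θ₁ ≡ (T - 1ℤ) * (T * σ * a)
  T*θ₁ = identity
    where
    identity : ∀ T σ a → T * ((T - 1ℤ) * σ * a) ≡ (T - 1ℤ) * (T * σ * a)
    identity = solve-∀

  T*θ₂ : ∀ T σ a → let open Parameters T σ a in T * θ₂ ≡ (T - 1ℤ) * (T * σ * a) - T * σ * X
  T*θ₂ = identity
    where
    identity : ∀ T σ a → T * ((T - 1ℤ) * σ * a - σ * (1ℤ + (T * σ - 1ℤ) * a)) ≡ (T - 1ℤ) * (T * σ * a) - T * σ * (1ℤ + (T * σ - 1ℤ) * a)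
    identity = solve-∀

open ParameterIdentities

-- Integer-valued Fourier analysis on finite vector spaces.

module Characters (F : FiniteField) where
  open import Data.Integer.Tactic.RingSolver using (solve-∀)

  private
    module F where
      open FiniteField F public
      open FieldProperties F public
      open IntegerSolver commutativeRing public using (solve; _:=_; _:+_; _:*_; :-_; con)
    open ≡-Reasoning

  p : ℕ
  p = F.order

  p-1 : ℤ
  p-1 = ℤ.+ p ℤ.- 1ℤ

  ∑F : (F.Carrier → ℤ) → ℤ
  ∑F = ∑ (enum F.finite)

  -- The sum of all nontrivial additive characters of F.  Sums over sets that are stable under scaling
  -- by F* can be computed with it in place of a single character, so that everything stays in ℤ.
  e : F.Carrier → ℤ
  e c = ℤ.+ p ℤ.* 𝟙 (c F.≟ F.0#) ℤ.- 1ℤ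

  e-0 : e F.0# ≡ p-1
  e-0 = trans (cong (λ z → ℤ.+ p ℤ.* z ℤ.- 1ℤ) (𝟙-yes (F.0# F.≟ F.0#) refl)) (cong (ℤ._- 1ℤ) (ℤₚ.*-identityʳ (ℤ.+ p)))

  ∑F-e : ∑F e ≡ 0ℤ
  ∑F-e = begin
    ∑F e                                                   ≡⟨ ∑-- (enum F.finite) (λ c → ℤ.+ p ℤ.* 𝟙 (c F.≟ F.0#)) (λ _ → 1ℤ) ⟩
    ∑F (λ c → ℤ.+ p ℤ.* 𝟙 (c F.≟ F.0#)) ℤ.- ∑F (λ _ → 1ℤ)
      ≡⟨ cong₂ ℤ._-_ (trans (∑-*ˡ (ℤ.+ p) (enum F.finite) _) (trans (cong (ℤ.+ p ℤ.*_) (∑-δ₁ F.finite F.0#)) (ℤₚ.*-identityʳ (ℤ.+ p)))) (∑-1 (enum F.finite)) ⟩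
    ℤ.+ p ℤ.- ℤ.+ p                                        ≡⟨ ℤₚ.+-inverseʳ (ℤ.+ p) ⟩
    0ℤ ∎

  ∑F-shift : ∀ s (f : F.Carrier → ℤ) → ∑F (λ c → f (s F.+ c)) ≡ ∑F f
  ∑F-shift s f = ∑-reindex F.finite (s F.+_) (F.- s F.+_) (lem s) (lem′ s) f
    where
    lem : ∀ s c → F.- s F.+ (s F.+ c) ≡ c
    lem = F.solve 2 (λ s c → F.:- s F.:+ (s F.:+ c) F.:= c) refl
    lem′ : ∀ s c → s F.+ (F.- s F.+ c) ≡ c
    lem′ = F.solve 2 (λ s c → s F.:+ (F.:- s F.:+ c) F.:= c) refl

  ∑F-affine : ∀ s {a} → a ≢ F.0# → (f : F.Carrier → ℤ) → ∑F (λ c → f (s F.+ c F.* a)) ≡ ∑F f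
  ∑F-affine s {a} a≢0 f = trans
    (trans (∑-cong (enum F.finite) (λ c → cong (λ z → f (s F.+ z)) (F.*-comm c a)))
      (∑-reindex F.finite (a F.*_) (F.inv a F.*_) (F.inv-*-cancel a≢0) (F.*-inv-cancel a≢0) (λ z → f (s F.+ z))))
    (∑F-shift s f)

  ∑F* : (F.Carrier → ℤ) → ℤ
  ∑F* f = ∑F (λ c → 𝟙 (F.nonzero? c) ℤ.* f c)

  ∑F*-const : ∀ z → ∑F* (λ _ → z) ≡ p-1 ℤ.* z
  ∑F*-const z = trans (F.∑-nonzero (λ _ → z)) (trans (cong (ℤ._- z) (∑-const (enum F.finite) z)) (lem (ℤ.+ p) z))
    where
    lem : ∀ p z → p ℤ.* z ℤ.- z ≡ (p ℤ.- 1ℤ) ℤ.* z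
    lem = solve-∀

  ∑F*-cong : ∀ {f g} → (∀ c → c ≢ F.0# → f c ≡ g c) → ∑F* f ≡ ∑F* g
  ∑F*-cong eq = ∑-cong (enum F.finite) (λ c → 𝟙-*-cong (F.nonzero? c) (eq c))

  -- Expand both factors into nontrivial characters and write the second index as t times the first:
  -- the pairs with a fixed t make up e(c + t c′). In ℤ it is checked by separating c′ = 0 from c′ ≠
  -- 0.
  e-* : ∀ c c′ → e c ℤ.* e c′ ≡ ∑F* (λ t → e (c F.+ t F.* c′))
  e-* c c′ with c′ F.≟ F.0#
  ... | yes refl = begin
    e c ℤ.* (ℤ.+ p ℤ.* 1ℤ ℤ.- 1ℤ)               ≡⟨ ℤₚ.*-comm (e c) _ ⟩
    (ℤ.+ p ℤ.* 1ℤ ℤ.- 1ℤ) ℤ.* e c               ≡⟨ cong (λ z → (z ℤ.- 1ℤ) ℤ.* e c) (ℤₚ.*-identityʳ (ℤ.+ p)) ⟩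
    p-1 ℤ.* e c                                 ≡⟨ ∑F*-const (e c) ⟨
    ∑F* (λ _ → e c)                             ≡⟨ ∑F*-cong (λ t _ → cong e (sym (trans (cong (c F.+_) (F.zeroʳ t)) (F.+-identityʳ c)))) ⟩
    ∑F* (λ t → e (c F.+ t F.* F.0#)) ∎
  ... | no c′≢0 = begin
    e c ℤ.* (ℤ.+ p ℤ.* 0ℤ ℤ.- 1ℤ)               ≡⟨ cong (λ z → e c ℤ.* (z ℤ.- 1ℤ)) (ℤₚ.*-zeroʳ (ℤ.+ p)) ⟩
    e c ℤ.* (ℤ.- 1ℤ)                            ≡⟨ lem (e c) ⟩
    0ℤ ℤ.- e c                                  ≡⟨ cong₂ ℤ._-_ (trans (∑F-affine c c′≢0 e) ∑F-e) (cong e (trans (cong (c F.+_) (F.zeroˡ c′)) (F.+-identityʳ c))) ⟨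
    ∑F (λ t → e (c F.+ t F.* c′)) ℤ.- e (c F.+ F.0# F.* c′) ≡⟨ F.∑-nonzero (λ t → e (c F.+ t F.* c′)) ⟨
    ∑F* (λ t → e (c F.+ t F.* c′)) ∎
    where
    lem : ∀ z → z ℤ.* (ℤ.- 1ℤ) ≡ 0ℤ ℤ.- z
    lem = solve-∀

  2≤p : 2 ℕ.≤ p
  2≤p = Factorisation.2≤order F

  *-cancel-p-1 : ∀ {a b} → p-1 ℤ.* a ≡ p-1 ℤ.* b → a ≡ b
  *-cancel-p-1 {a} {b} eq with p | 2≤p
  ... | suc (suc r) | _ = ℤₚ.*-cancelˡ-≡ (ℤ.+ suc r) a b eq
  ... | suc zero | s≤s ()

  *-cancel-pos : ∀ n → 1 ℕ.≤ n → ∀ {a b} → ℤ.+ n ℤ.* a ≡ ℤ.+ n ℤ.* b → a ≡ b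
  *-cancel-pos (suc n) _ {a} {b} = ℤₚ.*-cancelˡ-≡ (ℤ.+ suc n) a b

  record Space : Set₁ where
    infixl 6 _+_
    infix  8 -_
    infixr 7 _·_
    field
      Carrier        : Set
      finite         : Finite Carrier
      _+_            : Carrier → Carrier → Carrier
      -_             : Carrier → Carrier
      0#             : Carrier
      isAbelianGroup : IsAbelianGroup _≡_ _+_ 0# -_
      _·_            : F.Carrier → Carrier → Carrier
      ·-+            : ∀ c x y → c · (x + y) ≡ c · x + c · y
      +-·            : ∀ a b x → (a F.+ b) · x ≡ a · x + b · x
      ·-·            : ∀ a b x → a · (b · x) ≡ (a F.* b) · x
      1-·            : ∀ x → F.1# · x ≡ x

    open IsAbelianGroup isAbelianGroup public
      using () renaming (assoc to +-assoc; comm to +-comm; identityˡ to +-identityˡ; identityʳ to +-identityʳ;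
                         inverseˡ to +-inverseˡ; inverseʳ to +-inverseʳ)

    size : ℤ
    size = ℤ.+ length (enum finite)

    open Finite finite public using (_≟_)

    +-cancelʳ′ : ∀ x y → x + y + - y ≡ x
    +-cancelʳ′ x y = trans (+-assoc x y (- y)) (trans (cong (x +_) (+-inverseʳ y)) (+-identityʳ x))

    +-cancelʳ″ : ∀ x y → x + - y + y ≡ x
    +-cancelʳ″ x y = trans (+-assoc x (- y) y) (trans (cong (x +_) (+-inverseˡ y)) (+-identityʳ x))

    +-idem⇒0 : ∀ {x} → x + x ≡ x → x ≡ 0#
    +-idem⇒0 {x} eq = trans (sym (+-cancelʳ′ x x)) (trans (cong (_+ - x) eq) (+-inverseʳ x))

    ·-0 : ∀ c → c · 0# ≡ 0#
    ·-0 c = +-idem⇒0 (trans (sym (·-+ c 0# 0#)) (cong (c ·_) (+-identityˡ 0#)))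

    0-· : ∀ x → F.0# · x ≡ 0#
    0-· x = +-idem⇒0 (trans (sym (+-· F.0# F.0# x)) (cong (_· x) (F.+-identityˡ F.0#)))

    -1-· : ∀ x → (F.- F.1#) · x ≡ - x
    -1-· x = inverseʳ-unique (begin
      x + (F.- F.1#) · x            ≡⟨ cong (_+ (F.- F.1#) · x) (1-· x) ⟨
      F.1# · x + (F.- F.1#) · x     ≡⟨ +-· F.1# (F.- F.1#) x ⟨
      (F.1# F.+ F.- F.1#) · x       ≡⟨ cong (_· x) (F.-‿inverseʳ F.1#) ⟩
      F.0# · x                      ≡⟨ 0-· x ⟩
      0# ∎)
      where
      inverseʳ-unique : ∀ {y} → x + y ≡ 0# → y ≡ - x
      inverseʳ-unique {y} eq = trans (sym (+-identityˡ y)) (trans (cong (_+ y) (sym (+-inverseˡ x)))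
        (trans (+-assoc (- x) x y) (trans (cong (- x +_) eq) (+-identityʳ (- x)))))

    ∑-translate : ∀ b (f : Carrier → ℤ) → ∑ (enum finite) (λ x → f (x + b)) ≡ ∑ (enum finite) f
    ∑-translate b f = ∑-reindex finite (_+ b) (_+ - b) (λ x → +-cancelʳ′ x b) (λ x → +-cancelʳ″ x b) f

    ∑-dilate : ∀ {c} → c ≢ F.0# → (f : Carrier → ℤ) → ∑ (enum finite) (λ x → f (c · x)) ≡ ∑ (enum finite) f
    ∑-dilate {c} c≢0 f = ∑-reindex finite (c ·_) (F.inv c ·_)
      (λ x → trans (·-· (F.inv c) c x) (trans (cong (_· x) (F.inverseˡ c c≢0)) (1-· x)))
      (λ x → trans (·-· c (F.inv c) x) (trans (cong (_· x) (F.inverseʳ c c≢0)) (1-· x))) f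

  record Functional (A : Space) : Set where
    open Space A
    field
      χ   : Carrier → F.Carrier
      χ-+ : ∀ x y → χ (x + y) ≡ χ x F.+ χ y
      χ-· : ∀ c x → χ (c · x) ≡ c F.* χ x

    χ-0 : χ 0# ≡ F.0#
    χ-0 = trans (cong χ (sym (0-· 0#))) (trans (χ-· F.0# 0#) (F.zeroˡ _))

    ∑-e-trivial : (∀ x → χ x ≡ F.0#) → ∑ (enum finite) (λ x → e (χ x)) ≡ size ℤ.* p-1
    ∑-e-trivial z = trans (∑-cong (enum finite) (λ x → trans (cong e (z x)) e-0)) (∑-const (enum finite) p-1)

    -- Translate by the multiples c · b of a vector on which the functional does not vanish and add
    -- over c: every x then contributes a sum of e over all of F, which is 0.
    ∑-e-nontrivial : (∃ λ x → χ x ≢ F.0#) → ∀ s → ∑ (enum finite) (λ x → e (s F.+ χ x)) ≡ 0ℤ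
    ∑-e-nontrivial (b , χb≢0) s = *-cancel-pos p (ℕₚ.<⇒≤ 2≤p) (begin
      ℤ.+ p ℤ.* S
        ≡⟨ ∑-const (enum F.finite) S ⟨
      ∑F (λ _ → S)
        ≡⟨ ∑-cong (enum F.finite) (λ c → sym (∑-translate (c · b) (λ x → e (s F.+ χ x)))) ⟩
      ∑F (λ c → ∑ (enum finite) (λ x → e (s F.+ χ (x + c · b))))
        ≡⟨ ∑-swap (enum F.finite) (enum finite) _ ⟩
      ∑ (enum finite) (λ x → ∑F (λ c → e (s F.+ χ (x + c · b))))
        ≡⟨ ∑-zero (enum finite) (λ x → trans (∑-cong (enum F.finite) (λ c → cong e (expand c x)))
             (trans (∑F-affine (s F.+ χ x) χb≢0 e) ∑F-e)) ⟩
      0ℤ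
        ≡⟨ ℤₚ.*-zeroʳ (ℤ.+ p) ⟨
      ℤ.+ p ℤ.* 0ℤ ∎)
      where
      S = ∑ (enum finite) (λ x → e (s F.+ χ x))
      expand : ∀ c x → s F.+ χ (x + c · b) ≡ (s F.+ χ x) F.+ c F.* χ b
      expand c x = trans (cong (s F.+_) (trans (χ-+ x (c · b)) (cong (χ x F.+_) (χ-· c b)))) (sym (F.+-assoc s _ _))

  record Form (A : Space) : Set where
    open Space A
    field
      B             : Carrier → Carrier → F.Carrier
      symmetric     : ∀ x y → B x y ≡ B y x
      B-+           : ∀ w x y → B w (x + y) ≡ B w x F.+ B w y
      B-·           : ∀ w c x → B w (c · x) ≡ c F.* B w x
      nondegenerate : ∀ w → w ≢ 0# → ∃ λ x → B w x ≢ F.0#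

    functional : Carrier → Functional A
    functional w = record { χ = B w ; χ-+ = B-+ w ; χ-· = B-· w }

    B-0 : ∀ x → B 0# x ≡ F.0#
    B-0 x = trans (symmetric 0# x) (Functional.χ-0 (functional x))

    -- On a function invariant under F* this is p - 1 times the Fourier coefficient at w, because
    -- dilating v carries each nontrivial character to any other.
    hat : (Carrier → ℤ) → Carrier → ℤ
    hat f w = ∑ (enum finite) (λ v → f v ℤ.* e (B w v))

    Invariant : (Carrier → ℤ) → Set
    Invariant f = ∀ c → c ≢ F.0# → ∀ v → f (c · v) ≡ f v

    ∑-e-B : ∀ w → ∑ (enum finite) (λ v → e (B w v)) ≡ 𝟙 (w ≟ 0#) ℤ.* (size ℤ.* p-1)
    ∑-e-B w with w ≟ 0#
    ... | yes refl = trans (Functional.∑-e-trivial (functional 0#) B-0) (sym (ℤₚ.*-identityˡ _))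
    ... | no w≢0   = trans (∑-cong (enum finite) (λ v → cong e (sym (F.+-identityˡ _))))
                       (trans (Functional.∑-e-nontrivial (functional w) (nondegenerate w w≢0) F.0#) (sym (ℤₚ.*-zeroˡ (size ℤ.* p-1))))

    -- Fourier inversion with two extra factors p - 1: one is the value e 0 in the orthogonality
    -- relation, the other the number of t produced by `e-*`, all of which give g u by invariance.
    hat-inversion : ∀ g → Invariant g → ∀ u →
      ∑ (enum finite) (λ w → hat g w ℤ.* e (B w u)) ≡ p-1 ℤ.* (p-1 ℤ.* (size ℤ.* g u))
    hat-inversion g inv u = begin
      ∑ V (λ w → ∑ V (λ v → g v ℤ.* e (B w v)) ℤ.* e (B w u))
        ≡⟨ ∑-cong V (λ w → sym (∑-*ʳ (e (B w u)) V _)) ⟩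
      ∑ V (λ w → ∑ V (λ v → g v ℤ.* e (B w v) ℤ.* e (B w u)))
        ≡⟨ ∑-swap V V _ ⟩
      ∑ V (λ v → ∑ V (λ w → g v ℤ.* e (B w v) ℤ.* e (B w u)))
        ≡⟨ ∑-cong V (λ v → trans (∑-cong V (λ w → trans (ℤₚ.*-assoc (g v) _ _) (cong (g v ℤ.*_) (e-* (B w v) (B w u))))) (∑-*ˡ (g v) V _)) ⟩
      ∑ V (λ v → g v ℤ.* ∑ V (λ w → ∑F* (λ t → e (B w v F.+ t F.* B w u))))
        ≡⟨ ∑-cong V (λ v → cong (g v ℤ.*_) (trans (∑-swap V (enum F.finite) _)
             (∑-cong (enum F.finite) (λ t → trans (∑-*ˡ (𝟙 (F.nonzero? t)) V _) (cong (𝟙 (F.nonzero? t) ℤ.*_) (inner v t)))))) ⟩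
      ∑ V (λ v → g v ℤ.* ∑F* (λ t → 𝟙 (v + t · u ≟ 0#) ℤ.* (size ℤ.* p-1)))
        ≡⟨ ∑-cong V (λ v → sym (∑-*ˡ (g v) (enum F.finite) _)) ⟩
      ∑ V (λ v → ∑F (λ t → g v ℤ.* (𝟙 (F.nonzero? t) ℤ.* (𝟙 (v + t · u ≟ 0#) ℤ.* (size ℤ.* p-1)))))
        ≡⟨ ∑-swap V (enum F.finite) _ ⟩
      ∑F (λ t → ∑ V (λ v → g v ℤ.* (𝟙 (F.nonzero? t) ℤ.* (𝟙 (v + t · u ≟ 0#) ℤ.* (size ℤ.* p-1)))))
        ≡⟨ ∑-cong (enum F.finite) (λ t → trans (∑-cong V (λ v → lem₁ (g v) (𝟙 (F.nonzero? t)) (𝟙 (v + t · u ≟ 0#)) (size ℤ.* p-1)))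
             (trans (∑-*ˡ (𝟙 (F.nonzero? t)) V _) (cong (𝟙 (F.nonzero? t) ℤ.*_)
               (trans (∑-cong V (λ v → cong (ℤ._* (g v ℤ.* (size ℤ.* p-1))) (𝟙-cong (v + t · u ≟ 0#) (v ≟ - (t · u)) (to v t) (from v t))))
                 (∑-δ finite (- (t · u)) (λ v → g v ℤ.* (size ℤ.* p-1))))))) ⟩
      ∑F* (λ t → g (- (t · u)) ℤ.* (size ℤ.* p-1))
        ≡⟨ ∑F*-cong (λ t t≢0 → cong (ℤ._* (size ℤ.* p-1)) (trans (cong g (trans (sym (-1-· (t · u))) (·-· _ t u)))
             (inv (F.- F.1# F.* t) (F.*-≢0 -1≢0 t≢0) u))) ⟩
      ∑F* (λ t → g u ℤ.* (size ℤ.* p-1))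
        ≡⟨ ∑F*-const _ ⟩
      p-1 ℤ.* (g u ℤ.* (size ℤ.* p-1))
        ≡⟨ lem₂ p-1 (g u) size ⟩
      p-1 ℤ.* (p-1 ℤ.* (size ℤ.* g u)) ∎
      where
      V = enum finite
      lem₁ : ∀ a b c d → a ℤ.* (b ℤ.* (c ℤ.* d)) ≡ b ℤ.* (c ℤ.* (a ℤ.* d))
      lem₁ = solve-∀
      lem₂ : ∀ a g s → a ℤ.* (g ℤ.* (s ℤ.* a)) ≡ a ℤ.* (a ℤ.* (s ℤ.* g))
      lem₂ = solve-∀
      -1≢0 : F.- F.1# ≢ F.0#
      -1≢0 eq = F.1≢0 (trans (lem F.1#) (trans (cong F.-_ eq) (lem₀)))
        where
        lem : ∀ a → a ≡ F.- F.- a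
        lem = F.solve 1 (λ a → a F.:= F.:- (F.:- a)) refl
        lem₀ : F.- F.0# ≡ F.0#
        lem₀ = trans (sym (F.+-identityˡ _)) (F.-‿inverseʳ F.0#)
      inner : ∀ v t → ∑ V (λ w → e (B w v F.+ t F.* B w u)) ≡ 𝟙 (v + t · u ≟ 0#) ℤ.* (size ℤ.* p-1)
      inner v t = trans (∑-cong V (λ w → cong e (trans (cong (B w v F.+_) (sym (B-· w t u)))
        (trans (sym (B-+ w v (t · u))) (symmetric w _))))) (∑-e-B (v + t · u))
      to : ∀ v t → v + t · u ≡ 0# → v ≡ - (t · u)
      to v t eq = trans (sym (+-cancelʳ′ v (t · u))) (trans (cong (_+ - (t · u)) eq) (+-identityˡ _))
      from : ∀ v t → v ≡ - (t · u) → v + t · u ≡ 0#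
      from v t refl = +-inverseˡ (t · u)

    hat-injective : ∀ g → Invariant g → 1 ℕ.≤ length (enum finite) → (∀ w → hat g w ≡ 0ℤ) → ∀ u → g u ≡ 0ℤ
    hat-injective g inv pos z u = *-cancel-pos (length (enum finite)) pos (*-cancel-p-1 (*-cancel-p-1 (begin
      p-1 ℤ.* (p-1 ℤ.* (size ℤ.* g u))                        ≡⟨ hat-inversion g inv u ⟨
      ∑ (enum finite) (λ w → hat g w ℤ.* e (B w u))           ≡⟨ ∑-zero (enum finite) (λ w → trans (cong (ℤ._* e (B w u)) (z w)) (ℤₚ.*-zeroˡ (e (B w u)))) ⟩
      0ℤ                                                      ≡⟨ lem p-1 size ⟩
      p-1 ℤ.* (p-1 ℤ.* (size ℤ.* 0ℤ)) ∎)))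
      where
      lem : ∀ a s → 0ℤ ≡ a ℤ.* (a ℤ.* (s ℤ.* 0ℤ))
      lem = solve-∀

    correlation : (Carrier → ℤ) → Carrier → ℤ
    correlation d v = ∑ (enum finite) (λ u → d u ℤ.* d (v + u))

    correlation-invariant : ∀ d → Invariant d → Invariant (correlation d)
    correlation-invariant d inv c c≢0 v = trans
      (sym (∑-dilate c≢0 (λ u → d u ℤ.* d (c · v + u))))
      (∑-cong (enum finite) (λ u → cong₂ ℤ._*_ (inv c c≢0 u) (trans (cong d (sym (·-+ c v u))) (inv c c≢0 (v + u)))))

    -- The convolution theorem. The product of two values of e spreads over p - 1 scalars t;
    -- invariance makes all these terms equal to the one with the difference of v and u, which
    -- accounts for the factor on the left.
    hat-correlation : ∀ d → Invariant d → ∀ w → p-1 ℤ.* hat (correlation d) w ≡ hat d w ℤ.* hat d w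
    hat-correlation d inv w = sym (begin
      hat d w ℤ.* hat d w
        ≡⟨ ∑-*ʳ (hat d w) V _ ⟨
      ∑ V (λ v → d v ℤ.* e (B w v) ℤ.* hat d w)
        ≡⟨ ∑-cong V (λ v → sym (∑-*ˡ (d v ℤ.* e (B w v)) V _)) ⟩
      ∑ V (λ v → ∑ V (λ u → d v ℤ.* e (B w v) ℤ.* (d u ℤ.* e (B w u))))
        ≡⟨ ∑-cong V (λ v → ∑-cong V (λ u → trans (lem₁ (d v) (e (B w v)) (d u) (e (B w u)))
             (cong (d v ℤ.* d u ℤ.*_) (e-* (B w v) (B w u))))) ⟩
      ∑ V (λ v → ∑ V (λ u → d v ℤ.* d u ℤ.* ∑F* (λ t → e (B w v F.+ t F.* B w u))))
        ≡⟨ ∑-cong V (λ v → trans (∑-cong V (λ u → sym (∑-*ˡ (d v ℤ.* d u) (enum F.finite) _))) (∑-swap V (enum F.finite) _)) ⟩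
      ∑ V (λ v → ∑F (λ t → ∑ V (λ u → d v ℤ.* d u ℤ.* (𝟙 (F.nonzero? t) ℤ.* e (B w v F.+ t F.* B w u)))))
        ≡⟨ ∑-cong V (λ v → ∑-cong (enum F.finite) (λ t → trans (∑-cong V (λ u → lem₂ (d v ℤ.* d u) (𝟙 (F.nonzero? t)) _))
             (trans (∑-*ˡ (𝟙 (F.nonzero? t)) V _) (𝟙-*-cong (F.nonzero? t) (absorb v t))))) ⟩
      ∑ V (λ v → ∑F* (λ t → ∑ V (λ u → d v ℤ.* d u ℤ.* e (B w v F.+ F.- B w u))))
        ≡⟨ ∑-cong V (λ v → ∑F*-const _) ⟩
      ∑ V (λ v → p-1 ℤ.* ∑ V (λ u → d v ℤ.* d u ℤ.* e (B w v F.+ F.- B w u)))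
        ≡⟨ trans (∑-*ˡ p-1 V _) (cong (p-1 ℤ.*_) (∑-swap V V _)) ⟩
      p-1 ℤ.* ∑ V (λ u → ∑ V (λ v → d v ℤ.* d u ℤ.* e (B w v F.+ F.- B w u)))
        ≡⟨ cong (p-1 ℤ.*_) (∑-cong V (λ u → trans (sym (∑-translate u (λ v → d v ℤ.* d u ℤ.* e (B w v F.+ F.- B w u))))
             (∑-cong V (λ v → trans (cong (λ c → d (v + u) ℤ.* d u ℤ.* e c) (difference v u)) (cong (ℤ._* e (B w v)) (ℤₚ.*-comm (d (v + u)) (d u))))))) ⟩
      p-1 ℤ.* ∑ V (λ u → ∑ V (λ v → d u ℤ.* d (v + u) ℤ.* e (B w v)))
        ≡⟨ cong (p-1 ℤ.*_) (trans (∑-swap V V _) (∑-cong V (λ v → ∑-*ʳ (e (B w v)) V _))) ⟩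
      p-1 ℤ.* hat (correlation d) w ∎)
      where
      V = enum finite
      lem₁ : ∀ a b c d → a ℤ.* b ℤ.* (c ℤ.* d) ≡ a ℤ.* c ℤ.* (b ℤ.* d)
      lem₁ = solve-∀
      lem₂ : ∀ a b c → a ℤ.* (b ℤ.* c) ≡ b ℤ.* (a ℤ.* c)
      lem₂ = solve-∀
      difference : ∀ v u → B w (v + u) F.+ F.- B w u ≡ B w v
      difference v u = trans (cong (F._+ F.- B w u) (B-+ w v u)) (lem (B w v) (B w u))
        where
        lem : ∀ a b → a F.+ b F.+ F.- b ≡ a
        lem = F.solve 2 (λ a b → a F.:+ b F.:+ F.:- b F.:= a) refl
      -- Dilating u by - 1/t turns t B w u into - B w u and leaves d unchanged.
      absorb : ∀ v t → t ≢ F.0# → ∑ V (λ u → d v ℤ.* d u ℤ.* e (B w v F.+ t F.* B w u)) ≡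
                                  ∑ V (λ u → d v ℤ.* d u ℤ.* e (B w v F.+ F.- B w u))
      absorb v t t≢0 = trans (sym (∑-dilate s≢0 (λ u → d v ℤ.* d u ℤ.* e (B w v F.+ t F.* B w u))))
        (∑-cong V (λ u → cong₂ (λ x y → d v ℤ.* x ℤ.* e (B w v F.+ y)) (inv s s≢0 u) (scaled u)))
        where
        s = F.- F.inv t
        s≢0 : s ≢ F.0#
        s≢0 eq = F.inv-≢0 t≢0 (trans (lem (F.inv t)) (trans (cong F.-_ eq) (trans (sym (F.+-identityˡ _)) (F.-‿inverseʳ F.0#))))
          where
          lem : ∀ a → a ≡ F.- F.- a
          lem = F.solve 1 (λ a → a F.:= F.:- (F.:- a)) refl
        scaled : ∀ u → t F.* B w (s · u) ≡ F.- B w u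
        scaled u = trans (cong (t F.*_) (B-· w s u)) (trans (lem t (F.inv t) (B w u)) (cong F.-_ (F.*-inv-cancel t≢0 (B w u))))
          where
          lem : ∀ t i b → t F.* (F.- i F.* b) ≡ F.- (t F.* (i F.* b))
          lem = F.solve 3 (λ t i b → t F.:* (F.:- i F.:* b) F.:= F.:- (t F.:* (i F.:* b))) refl

    -- At each w the transform of the difference of the two sides is a multiple of the quadratic
    -- equation for θ w, with the term in μ appearing only at 0. The difference is invariant and its
    -- transform vanishes, so it is zero by inversion.
    two-eigenvalues : ∀ d (θ : Carrier → ℤ) k lam mu → Invariant d → 1 ℕ.≤ length (enum finite) →
      (∀ w → hat d w ≡ p-1 ℤ.* θ w) →
      θ 0# ℤ.* θ 0# ≡ (lam ℤ.- mu) ℤ.* θ 0# ℤ.+ mu ℤ.* size ℤ.+ (k ℤ.- mu) →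
      (∀ w → w ≢ 0# → θ w ℤ.* θ w ≡ (lam ℤ.- mu) ℤ.* θ w ℤ.+ (k ℤ.- mu)) →
      ∀ v → correlation d v ≡ (lam ℤ.- mu) ℤ.* d v ℤ.+ mu ℤ.+ (k ℤ.- mu) ℤ.* 𝟙 (v ≟ 0#)
    two-eigenvalues d θ k lam mu inv pos spectrum at-0 at-≢0 v = ℤₚ.i-j≡0⇒i≡j (correlation d v) _
      (hat-injective g g-invariant pos (λ w → *-cancel-p-1 (trans (g-hat w) (sym (ℤₚ.*-zeroʳ p-1)))) v)
      where
      V = enum finite
      g : Carrier → ℤ
      g v = correlation d v ℤ.- ((lam ℤ.- mu) ℤ.* d v ℤ.+ mu ℤ.+ (k ℤ.- mu) ℤ.* 𝟙 (v ≟ 0#))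
      g-invariant : Invariant g
      g-invariant c c≢0 v = cong₂ (λ x y → x ℤ.- y) (correlation-invariant d inv c c≢0 v)
        (cong₂ (λ x y → (lam ℤ.- mu) ℤ.* x ℤ.+ mu ℤ.+ (k ℤ.- mu) ℤ.* y) (inv c c≢0 v)
          (𝟙-cong (c · v ≟ 0#) (v ≟ 0#)
            (λ eq → trans (sym (trans (·-· (F.inv c) c v) (trans (cong (_· v) (F.inverseˡ c c≢0)) (1-· v)))) (trans (cong (F.inv c ·_) eq) (·-0 _)))
            (λ eq → trans (cong (c ·_) eq) (·-0 c))))
      hat-g : ∀ w → hat g w ≡ hat (correlation d) w ℤ.- ((lam ℤ.- mu) ℤ.* hat d w ℤ.+ mu ℤ.* (𝟙 (w ≟ 0#) ℤ.* (size ℤ.* p-1)) ℤ.+ (k ℤ.- mu) ℤ.* p-1)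
      hat-g w = begin
        ∑ V (λ v → g v ℤ.* E v)
          ≡⟨ ∑-cong V (λ v → lem (correlation d v) (lam ℤ.- mu) (d v) mu (k ℤ.- mu) (𝟙 (v ≟ 0#)) (E v)) ⟩
        ∑ V (λ v → correlation d v ℤ.* E v ℤ.- ((lam ℤ.- mu) ℤ.* (d v ℤ.* E v) ℤ.+ mu ℤ.* E v ℤ.+ (k ℤ.- mu) ℤ.* (𝟙 (v ≟ 0#) ℤ.* E v)))
          ≡⟨ ∑-- V _ _ ⟩
        hat (correlation d) w ℤ.- ∑ V (λ v → (lam ℤ.- mu) ℤ.* (d v ℤ.* E v) ℤ.+ mu ℤ.* E v ℤ.+ (k ℤ.- mu) ℤ.* (𝟙 (v ≟ 0#) ℤ.* E v))
          ≡⟨ cong (λ z → hat (correlation d) w ℤ.- z) (trans (∑-+ V _ _) (cong₂ ℤ._+_ (trans (∑-+ V _ _)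
               (cong₂ ℤ._+_ (∑-*ˡ (lam ℤ.- mu) V _) (trans (∑-*ˡ mu V _) (cong (mu ℤ.*_) (∑-e-B w)))))
               (trans (∑-*ˡ (k ℤ.- mu) V _) (cong ((k ℤ.- mu) ℤ.*_) (trans (∑-δ finite 0# E)
                 (trans (cong e (Functional.χ-0 (functional w))) e-0)))))) ⟩
        _ ∎
        where
        E : Carrier → ℤ
        E v = e (B w v)
        lem : ∀ a b c d f g h → (a ℤ.- (b ℤ.* c ℤ.+ d ℤ.+ f ℤ.* g)) ℤ.* h ≡ a ℤ.* h ℤ.- (b ℤ.* (c ℤ.* h) ℤ.+ d ℤ.* h ℤ.+ f ℤ.* (g ℤ.* h))
        lem = solve-∀
      g-hat : ∀ w → p-1 ℤ.* hat g w ≡ 0ℤ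
      g-hat w = begin
        p-1 ℤ.* hat g w
          ≡⟨ cong (p-1 ℤ.*_) (hat-g w) ⟩
        p-1 ℤ.* (hat (correlation d) w ℤ.- R (hat d w))
          ≡⟨ lem₁ p-1 (hat (correlation d) w) (R (hat d w)) ⟩
        p-1 ℤ.* hat (correlation d) w ℤ.- p-1 ℤ.* R (hat d w)
          ≡⟨ cong (ℤ._- p-1 ℤ.* R (hat d w)) (hat-correlation d inv w) ⟩
        hat d w ℤ.* hat d w ℤ.- p-1 ℤ.* R (hat d w)
          ≡⟨ cong (λ h → h ℤ.* h ℤ.- p-1 ℤ.* R h) (spectrum w) ⟩
        p-1 ℤ.* θ w ℤ.* (p-1 ℤ.* θ w) ℤ.- p-1 ℤ.* R (p-1 ℤ.* θ w)
          ≡⟨ lem₂ p-1 (θ w) (lam ℤ.- mu) mu (𝟙 (w ≟ 0#)) size (k ℤ.- mu) ⟩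
        p-1 ℤ.* p-1 ℤ.* (θ w ℤ.* θ w ℤ.- ((lam ℤ.- mu) ℤ.* θ w ℤ.+ mu ℤ.* (𝟙 (w ≟ 0#) ℤ.* size) ℤ.+ (k ℤ.- mu)))
          ≡⟨ cong (λ z → p-1 ℤ.* p-1 ℤ.* z) (quadratic (w ≟ 0#)) ⟩
        p-1 ℤ.* p-1 ℤ.* 0ℤ
          ≡⟨ ℤₚ.*-zeroʳ (p-1 ℤ.* p-1) ⟩
        0ℤ ∎
        where
        R : ℤ → ℤ
        R h = (lam ℤ.- mu) ℤ.* h ℤ.+ mu ℤ.* (𝟙 (w ≟ 0#) ℤ.* (size ℤ.* p-1)) ℤ.+ (k ℤ.- mu) ℤ.* p-1
        lem₁ : ∀ a b c → a ℤ.* (b ℤ.- c) ≡ a ℤ.* b ℤ.- a ℤ.* c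
        lem₁ = solve-∀
        lem₂ : ∀ a t l m i s k → a ℤ.* t ℤ.* (a ℤ.* t) ℤ.- a ℤ.* (l ℤ.* (a ℤ.* t) ℤ.+ m ℤ.* (i ℤ.* (s ℤ.* a)) ℤ.+ k ℤ.* a) ≡
                                 a ℤ.* a ℤ.* (t ℤ.* t ℤ.- (l ℤ.* t ℤ.+ m ℤ.* (i ℤ.* s) ℤ.+ k))
        lem₂ = solve-∀
        quadratic : (D : Dec (w ≡ 0#)) → θ w ℤ.* θ w ℤ.- ((lam ℤ.- mu) ℤ.* θ w ℤ.+ mu ℤ.* (𝟙 D ℤ.* size) ℤ.+ (k ℤ.- mu)) ≡ 0ℤ
        quadratic (yes refl) = ℤₚ.i≡j⇒i-j≡0 (trans at-0 (cong (λ z → (lam ℤ.- mu) ℤ.* θ 0# ℤ.+ mu ℤ.* z ℤ.+ (k ℤ.- mu)) (sym (ℤₚ.*-identityˡ size))))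
        quadratic (no w≢0)   = ℤₚ.i≡j⇒i-j≡0 (trans (at-≢0 w w≢0) (lem (lam ℤ.- mu) (θ w) mu size (k ℤ.- mu)))
          where
          lem : ∀ a t m s b → a ℤ.* t ℤ.+ b ≡ a ℤ.* t ℤ.+ m ℤ.* (0ℤ ℤ.* s) ℤ.+ b
          lem = solve-∀

-- The difference set in L × E and its eigenvalues.

module Spectrum (F : FiniteField) where
  open import Data.Integer.Tactic.RingSolver using (solve-∀)
  open import Data.List.Relation.Unary.All.Properties using (¬All⇒Any¬)

  open Characters F

  module Full (G : FiniteField) where
    open FiniteField G public
    open FieldProperties G public
    open IntegerSolver commutativeRing public using (solve; _:=_; _:+_; _:*_; :-_; con)

    ∑G ∑G* : (Carrier → ℤ) → ℤ
    ∑G = ∑ (enum finite)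
    ∑G* f = ∑G (λ x → 𝟙 (nonzero? x) ℤ.* f x)

    ∑G-split : ∀ f → ∑G f ≡ f 0# ℤ.+ ∑G* f
    ∑G-split f = trans (lem (∑G f) (f 0#)) (cong (λ z → f 0# ℤ.+ z) (sym (∑-nonzero f)))
      where
      lem : ∀ a b → a ≡ b ℤ.+ (a ℤ.- b)
      lem = solve-∀

    ∑G*-cong : ∀ {f g} → (∀ x → x ≢ 0# → f x ≡ g x) → ∑G* f ≡ ∑G* g
    ∑G*-cong eq = ∑-cong (enum finite) (λ x → 𝟙-*-cong (nonzero? x) (eq x))

    ∑G*-*ˡ : ∀ c f → ∑G* (λ x → c ℤ.* f x) ≡ c ℤ.* ∑G* f
    ∑G*-*ˡ c f = trans (∑-cong (enum finite) (λ x → lem (𝟙 (nonzero? x)) c (f x))) (∑-*ˡ c (enum finite) _)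
      where
      lem : ∀ a c f → a ℤ.* (c ℤ.* f) ≡ c ℤ.* (a ℤ.* f)
      lem = solve-∀

    ∑G*-scale : ∀ {c} → c ≢ 0# → ∀ f → ∑G* (λ x → f (c * x)) ≡ ∑G* f
    ∑G*-scale {c} c≢0 f = trans
      (∑-cong (enum finite) (λ x → cong (ℤ._* f (c * x)) (𝟙-cong (nonzero? x) (nonzero? (c * x))
        (*-≢0 c≢0) (λ ne eq → ne (trans (cong (c *_) eq) (zeroʳ c))))))
      (∑-reindex finite (c *_) (inv c *_) (inv-*-cancel c≢0) (*-inv-cancel c≢0) (λ x → 𝟙 (nonzero? x) ℤ.* f x))

    ∑G*-inv : ∀ f → ∑G* (λ x → f (inv x)) ≡ ∑G* f
    ∑G*-inv f = trans (∑-cong (enum finite) step) (∑-reindex finite inv₀ inv₀ involutive involutive (λ x → 𝟙 (nonzero? x) ℤ.* f x))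
      where
      -- The value of `inv` at 0 is arbitrary. Setting it to 0 gives an involution of the whole
      -- field, as reindexing a sum requires.
      inv₀ : Carrier → Carrier
      inv₀ x with x ≟ 0#
      ... | yes _ = 0#
      ... | no _  = inv x
      inv-inv : ∀ {x} → x ≢ 0# → inv (inv x) ≡ x
      inv-inv {x} x≢0 = *-cancelˡ (inv-≢0 x≢0) (trans (inverseʳ (inv x) (inv-≢0 x≢0)) (sym (inverseˡ x x≢0)))
      involutive : ∀ x → inv₀ (inv₀ x) ≡ x
      involutive x with x ≟ 0#
      involutive x | yes refl with 0# ≟ 0#
      ... | yes _ = refl
      ... | no ne = ⊥-elim (ne refl)
      involutive x | no x≢0 with inv x ≟ 0#
      ... | yes z = ⊥-elim (inv-≢0 x≢0 z)
      ... | no _  = inv-inv x≢0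
      step : ∀ x → 𝟙 (nonzero? x) ℤ.* f (inv x) ≡ 𝟙 (nonzero? (inv₀ x)) ℤ.* f (inv₀ x)
      step x with x ≟ 0#
      ... | yes refl = sym (𝟙-no-* (nonzero? 0#) (λ ne → ne refl) _)
      ... | no x≢0   = cong (ℤ._* f (inv x)) (sym (𝟙-yes (nonzero? (inv x)) (inv-≢0 x≢0)))

  fieldSpace : (G : FiniteField) → Hom F (FiniteField.commutativeRing G) → Space
  fieldSpace G φ = record
    { finite = finite ; isAbelianGroup = IsCommutativeRing.+-isAbelianGroup isCommutativeRing
    ; _·_ = λ c x → ι c * x
    ; ·-+ = λ c x y → distribˡ (ι c) x y
    ; +-· = λ a b x → trans (cong (_* x) (+-hom a b)) (distribʳ x (ι a) (ι b))
    ; ·-· = λ a b x → trans (sym (*-assoc (ι a) (ι b) x)) (cong (_* x) (sym (*-hom a b)))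
    ; 1-· = λ x → trans (cong (_* x) 1-hom) (*-identityˡ x) }
    where
    open FiniteField G
    open Hom φ
    open import Algebra.Structures using (IsCommutativeRing)

  productSpace : Space → Space → Space
  productSpace A B = record
    { finite = finite-× A.finite B.finite
    ; _+_ = λ (a , b) (c , d) → a A.+ c , b B.+ d ; -_ = λ (a , b) → A.- a , B.- b ; 0# = A.0# , B.0#
    ; isAbelianGroup = record
      { isGroup = record
        { isMonoid = record
          { isSemigroup = record
            { isMagma = record { isEquivalence = isEquivalence ; ∙-cong = cong₂ _ }
            ; assoc = λ (a , b) (c , d) (e , f) → cong₂ _,_ (A.+-assoc a c e) (B.+-assoc b d f) }
          ; identity = (λ (a , b) → cong₂ _,_ (A.+-identityˡ a) (B.+-identityˡ b)) , (λ (a , b) → cong₂ _,_ (A.+-identityʳ a) (B.+-identityʳ b)) }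
        ; inverse = (λ (a , b) → cong₂ _,_ (A.+-inverseˡ a) (B.+-inverseˡ b)) , (λ (a , b) → cong₂ _,_ (A.+-inverseʳ a) (B.+-inverseʳ b))
        ; ⁻¹-cong = λ { refl → refl } }
      ; comm = λ (a , b) (c , d) → cong₂ _,_ (A.+-comm a c) (B.+-comm b d) }
    ; _·_ = λ c (a , b) → c A.· a , c B.· b
    ; ·-+ = λ c (a , b) (a′ , b′) → cong₂ _,_ (A.·-+ c a a′) (B.·-+ c b b′)
    ; +-· = λ c c′ (a , b) → cong₂ _,_ (A.+-· c c′ a) (B.+-· c c′ b)
    ; ·-· = λ c c′ (a , b) → cong₂ _,_ (A.·-· c c′ a) (B.·-· c c′ b)
    ; 1-· = λ (a , b) → cong₂ _,_ (A.1-· a) (B.1-· b) }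
    where
    module A = Space A
    module B = Space B

  _∘ʰ_ : ∀ {K L} → Hom K (FiniteField.commutativeRing L) → Hom F (FiniteField.commutativeRing K) → Hom F (FiniteField.commutativeRing L)
  φ ∘ʰ ψ = record
    { ι = φ.ι ∘ ψ.ι
    ; +-hom = λ a b → trans (cong φ.ι (ψ.+-hom a b)) (φ.+-hom _ _)
    ; *-hom = λ a b → trans (cong φ.ι (ψ.*-hom a b)) (φ.*-hom _ _)
    ; 1-hom = trans (cong φ.ι ψ.1-hom) φ.1-hom
    ; 0-hom = trans (cong φ.ι ψ.0-hom) φ.0-hom }
    where
    module φ = Hom φ
    module ψ = Hom ψ

  private module F = Full F

  -- D = {(x , y) : x ≠ 0, N y / N x ∈ R} where R ⊆ K is the annihilator of κ A under (s , t) ↦ π (s t).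
  module Construction
    (K L E : FiniteField) (φF : Hom F (FiniteField.commutativeRing K))
    (φ : Hom K (FiniteField.commutativeRing L)) (χ : Hom K (FiniteField.commutativeRing E))
    (ℓ′ : ℕ) (order-L : FiniteField.order L ≡ FiniteField.order K ℕ.^ suc ℓ′)
    (order-E : FiniteField.order E ≡ FiniteField.order K ℕ.^ suc (suc ℓ′))
    (π : Functional (fieldSpace K φF)) (π-nontrivial : ∃ λ c → Functional.χ π c ≢ F.0#)
    (A : Space) (κ : Space.Carrier A → FiniteField.Carrier K)
    (κ-+ : ∀ a b → κ (Space._+_ A a b) ≡ FiniteField._+_ K (κ a) (κ b))
    (κ-· : ∀ c a → κ (Space._·_ A c a) ≡ FiniteField._*_ K (Hom.ι φF c) (κ a))
    (κ-injective : ∀ {a b} → κ a ≡ κ b → a ≡ b)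
    where

    private
      module K = Full K
      module L = Full L
      module E = Full E
      module A = Space A
      module NL = NormTrace K L φ (suc ℓ′) (s≤s z≤n) order-L
      module NE = NormTrace K E χ (suc (suc ℓ′)) (s≤s z≤n) order-E
      module HD = HasseDavenport K L E φ χ ℓ′ order-L order-E
      module φF = Hom φF
      module φ = Hom φ
      module χ = Hom χ
      module π = Functional π
      open ≡-Reasoning

    q : ℕ
    q = K.order

    QL QE gA gB : ℤ
    QL = ℤ.+ (q ℕ.^ suc ℓ′)
    QE = ℤ.+ (q ℕ.^ suc (suc ℓ′))
    gA = ℤ.+ geo q (suc ℓ′)
    gB = ℤ.+ geo q (suc (suc ℓ′))

    gB≡1+qgA : gB ≡ 1ℤ ℤ.+ ℤ.+ q ℤ.* gA
    gB≡1+qgA = trans (cong ℤ.+_ (geo-suc q (suc ℓ′))) (cong (λ z → 1ℤ ℤ.+ z) (ℤₚ.pos-* q (geo q (suc ℓ′))))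

    QL≡1+[q-1]gA : QL ≡ 1ℤ ℤ.+ (ℤ.+ q ℤ.- 1ℤ) ℤ.* gA
    QL≡1+[q-1]gA = go q refl
      where
      go : ∀ m → m ≡ q → ℤ.+ (m ℕ.^ suc ℓ′) ≡ 1ℤ ℤ.+ (ℤ.+ m ℤ.- 1ℤ) ℤ.* ℤ.+ geo m (suc ℓ′)
      go zero    eq = ⊥-elim (ℕₚ.<⇒≢ (ℕₚ.<⇒≤ (Factorisation.2≤order K)) eq)
      go (suc m) _  = trans (cong ℤ.+_ (geo-closed m (suc ℓ′))) (cong (λ z → 1ℤ ℤ.+ z) (ℤₚ.pos-* m (geo (suc m) (suc ℓ′))))

    LS ES V : Space
    LS = fieldSpace L (_∘ʰ_ {K} {L} φ φF)
    ES = fieldSpace E (_∘ʰ_ {K} {E} χ φF)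
    V = productSpace LS ES
    module V = Space V

    ψL : Functional LS
    ψL = record
      { χ = π.χ ∘ NL.trace
      ; χ-+ = λ x y → trans (cong π.χ (NL.trace-+ x y)) (π.χ-+ _ _)
      ; χ-· = λ c x → trans (cong π.χ (NL.trace-ι* (φF.ι c) x)) (π.χ-· c _) }

    ψE : Functional ES
    ψE = record
      { χ = π.χ ∘ NE.trace
      ; χ-+ = λ x y → trans (cong π.χ (NE.trace-+ x y)) (π.χ-+ _ _)
      ; χ-· = λ c x → trans (cong π.χ (NE.trace-ι* (φF.ι c) x)) (π.χ-· c _) }

    private
      module ψL = Functional ψL
      module ψE = Functional ψE

    hits : ∀ {t} → t ≢ K.0# → ∃ λ c → π.χ (c K.* t) ≢ F.0#
    hits {t} t≢0 = c K.* K.inv t , λ z → πc≢0 (trans (cong π.χ (sym (trans (K.*-assoc c (K.inv t) t)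
        (trans (cong (c K.*_) (K.inverseˡ t t≢0)) (K.*-identityʳ c))))) z)
      where
      c = proj₁ π-nontrivial
      πc≢0 = proj₂ π-nontrivial

    ψL-nontrivial : ∃ λ x → ψL.χ x ≢ F.0#
    ψL-nontrivial = let (x , t≢0) = NL.trace-nonzero ; (c , ne) = hits t≢0 in
      φ.ι c L.* x , λ z → ne (trans (cong π.χ (sym (NL.trace-ι* c x))) z)

    ψE-nontrivial : ∃ λ x → ψE.χ x ≢ F.0#
    ψE-nontrivial = let (x , t≢0) = NE.trace-nonzero ; (c , ne) = hits t≢0 in
      χ.ι c E.* x , λ z → ne (trans (cong π.χ (sym (NE.trace-ι* c x))) z)

    ψLα : L.Carrier → Functional LS
    ψLα α = record
      { χ = λ x → ψL.χ (α L.* x)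
      ; χ-+ = λ x y → trans (cong ψL.χ (L.distribˡ α x y)) (ψL.χ-+ _ _)
      ; χ-· = λ c x → trans (cong ψL.χ (lem α _ x)) (ψL.χ-· c _) }
      where
      lem : ∀ a c x → a L.* (c L.* x) ≡ c L.* (a L.* x)
      lem = L.solve 3 (λ a c x → a L.:* (c L.:* x) L.:= c L.:* (a L.:* x)) refl

    ψEβ : E.Carrier → Functional ES
    ψEβ β = record
      { χ = λ x → ψE.χ (β E.* x)
      ; χ-+ = λ x y → trans (cong ψE.χ (E.distribˡ β x y)) (ψE.χ-+ _ _)
      ; χ-· = λ c x → trans (cong ψE.χ (lem β _ x)) (ψE.χ-· c _) }
      where
      lem : ∀ a c x → a E.* (c E.* x) ≡ c E.* (a E.* x)
      lem = E.solve 3 (λ a c x → a E.:* (c E.:* x) E.:= c E.:* (a E.:* x)) refl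

    ψLα-nontrivial : ∀ {α} → α ≢ L.0# → ∃ λ x → ψL.χ (α L.* x) ≢ F.0#
    ψLα-nontrivial {α} α≢0 = L.inv α L.* proj₁ ψL-nontrivial ,
      λ z → proj₂ ψL-nontrivial (trans (cong ψL.χ (sym (L.*-inv-cancel α≢0 _))) z)

    ψEβ-nontrivial : ∀ {β} → β ≢ E.0# → ∃ λ x → ψE.χ (β E.* x) ≢ F.0#
    ψEβ-nontrivial {β} β≢0 = E.inv β E.* proj₁ ψE-nontrivial ,
      λ z → proj₂ ψE-nontrivial (trans (cong ψE.χ (sym (E.*-inv-cancel β≢0 _))) z)

    -- The trace form π(Tr(ax) + Tr(by)). It indexes the characters of L × E by pairs (a, b), and
    -- its nondegeneracy rests on the trace maps and π not being identically zero.
    form : Form V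
    form = record
      { B = B
      ; symmetric = λ (a , b) (x , y) → cong₂ (λ u v → ψL.χ u F.+ ψE.χ v) (L.*-comm a x) (E.*-comm b y)
      ; B-+ = λ (a , b) (x , y) (x′ , y′) → trans (cong₂ F._+_ (Functional.χ-+ (ψLα a) x x′) (Functional.χ-+ (ψEβ b) y y′)) (lem _ _ _ _)
      ; B-· = λ (a , b) c (x , y) → trans (cong₂ F._+_ (Functional.χ-· (ψLα a) c x) (Functional.χ-· (ψEβ b) c y)) (sym (F.distribˡ c _ _))
      ; nondegenerate = nondegenerate }
      where
      B : V.Carrier → V.Carrier → F.Carrier
      B (a , b) (x , y) = ψL.χ (a L.* x) F.+ ψE.χ (b E.* y)
      lem : ∀ a b c d → a F.+ b F.+ (c F.+ d) ≡ a F.+ c F.+ (b F.+ d)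
      lem = F.solve 4 (λ a b c d → a F.:+ b F.:+ (c F.:+ d) F.:= a F.:+ c F.:+ (b F.:+ d)) refl
      nondegenerate : ∀ w → w ≢ V.0# → ∃ λ v → B w v ≢ F.0#
      nondegenerate (a , b) w≢0 with a L.≟ L.0#
      ... | no a≢0 = let (x , ne) = ψLα-nontrivial a≢0 in (x , E.0#) , λ z → ne
            (trans (sym (F.+-identityʳ _)) (trans (cong (ψL.χ (a L.* x) F.+_) (sym (trans (cong ψE.χ (E.zeroʳ b)) ψE.χ-0))) z))
      ... | yes refl with b E.≟ E.0#
      ...   | yes refl = ⊥-elim (w≢0 refl)
      ...   | no b≢0 = let (y , ne) = ψEβ-nontrivial b≢0 in (L.0# , y) , λ z → ne
            (trans (sym (F.+-identityˡ _)) (trans (cong (F._+ ψE.χ (b E.* y)) (sym (trans (cong ψL.χ (L.zeroʳ _)) ψL.χ-0))) z))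

    open Form form

    ∑L-ψ : ∀ {α} → α ≢ L.0# → ∀ s → L.∑G (λ x → e (s F.+ ψL.χ (α L.* x))) ≡ 0ℤ
    ∑L-ψ {α} α≢0 = Functional.∑-e-nontrivial (ψLα α) (ψLα-nontrivial α≢0)

    ∑L*-ψ : ∀ {α} → α ≢ L.0# → L.∑G* (λ x → e (ψL.χ (α L.* x))) ≡ ℤ.- p-1
    ∑L*-ψ {α} α≢0 = trans (L.∑-nonzero _) (trans (cong₂ ℤ._-_
        (trans (∑-cong (enum L.finite) (λ x → cong e (sym (F.+-identityˡ _)))) (∑L-ψ α≢0 F.0#))
        (trans (cong e (trans (cong ψL.χ (L.zeroʳ α)) ψL.χ-0)) e-0)) (ℤₚ.+-identityˡ _))

    ∑L*-1 : ∀ z → L.∑G* (λ _ → z) ≡ (QL ℤ.- 1ℤ) ℤ.* z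
    ∑L*-1 z = trans (L.∑-nonzero (λ _ → z)) (trans (cong (ℤ._- z) (trans (∑-const (enum L.finite) z) (cong (λ o → ℤ.+ o ℤ.* z) order-L)))
        (lem QL z))
      where
      lem : ∀ a z → a ℤ.* z ℤ.- z ≡ (a ℤ.- 1ℤ) ℤ.* z
      lem = solve-∀

    ∑E-ψ : ∀ {β} → β ≢ E.0# → ∀ s → E.∑G (λ y → e (s F.+ ψE.χ (β E.* y))) ≡ 0ℤ
    ∑E-ψ {β} β≢0 = Functional.∑-e-nontrivial (ψEβ β) (ψEβ-nontrivial β≢0)

    ∑E*-ψ : ∀ β → E.∑G* (λ y → e (ψE.χ (β E.* y))) ≡ QE ℤ.* p-1 ℤ.* 𝟙 (β E.≟ E.0#) ℤ.- p-1
    ∑E*-ψ β = trans (E.∑-nonzero _) (cong₂ ℤ._-_ (go (β E.≟ E.0#)) (trans (cong e (trans (cong ψE.χ (E.zeroʳ β)) ψE.χ-0)) e-0))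
      where
      go : (D : Dec (β ≡ E.0#)) → E.∑G (λ y → e (ψE.χ (β E.* y))) ≡ QE ℤ.* p-1 ℤ.* 𝟙 D
      go (yes refl) = trans (∑-cong (enum E.finite) (λ y → trans (cong e (trans (cong ψE.χ (E.zeroˡ y)) ψE.χ-0)) e-0))
        (trans (∑-const (enum E.finite) p-1) (trans (cong (λ o → ℤ.+ o ℤ.* p-1) order-E) (sym (ℤₚ.*-identityʳ _))))
      go (no β≢0) = trans (∑-cong (enum E.finite) (λ x → cong e (sym (F.+-identityˡ _)))) (trans (∑E-ψ β≢0 F.0#) (sym (ℤₚ.*-zeroʳ (QE ℤ.* p-1))))

    ∑K-π : ∀ s → K.∑G (λ c → e (s F.+ π.χ c)) ≡ 0ℤ
    ∑K-π = π.∑-e-nontrivial π-nontrivial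

    ∑K*-π : ∀ s → K.∑G* (λ c → e (s F.+ π.χ c)) ≡ ℤ.- e s
    ∑K*-π s = trans (K.∑-nonzero _) (trans (cong₂ ℤ._-_ (∑K-π s) (cong e (trans (cong (s F.+_) π.χ-0) (F.+-identityʳ s)))) (ℤₚ.+-identityˡ _))

    -- For x = 0 this involves the arbitrary value `K.inv K.0#`; membership in D and the sums over
    -- nonzero x exclude that case.
    ratio : V.Carrier → K.Carrier
    ratio (x , y) = NE.norm y K.* K.inv (NL.norm x)

    module _ (α : L.Carrier) (β : E.Carrier) (τ : K.Carrier) where
      phase : L.Carrier → E.Carrier → F.Carrier
      phase x y = B (α , β) (x , y) F.+ π.χ (τ K.* ratio (x , y))

      -- `H` is the contribution of one τ to the eigenvalue at (α, β). `Z` leaves out y = 0, where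
      -- the ratio vanishes and the phase does not see τ.
      H Z : ℤ
      H = L.∑G* (λ x → E.∑G (λ y → e (phase x y)))
      Z = L.∑G* (λ x → E.∑G* (λ y → e (phase x y)))

      phase-y0 : ∀ x → phase x E.0# ≡ ψL.χ (α L.* x)
      phase-y0 x = begin
        ψL.χ (α L.* x) F.+ ψE.χ (β E.* E.0#) F.+ π.χ (τ K.* (NE.norm E.0# K.* K.inv (NL.norm x)))
          ≡⟨ cong₂ (λ u v → ψL.χ (α L.* x) F.+ u F.+ v) (trans (cong ψE.χ (E.zeroʳ β)) ψE.χ-0)
               (trans (cong π.χ (trans (cong (τ K.*_) (trans (cong (K._* K.inv (NL.norm x)) NE.norm-0) (K.zeroˡ _))) (K.zeroʳ τ))) π.χ-0) ⟩
        ψL.χ (α L.* x) F.+ F.0# F.+ F.0#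
          ≡⟨ trans (F.+-identityʳ _) (F.+-identityʳ _) ⟩
        ψL.χ (α L.* x) ∎

      H-split : H ≡ L.∑G* (λ x → e (ψL.χ (α L.* x))) ℤ.+ Z
      H-split = trans (∑-cong (enum L.finite) (λ x → trans (cong (𝟙 (L.nonzero? x) ℤ.*_) (trans (E.∑G-split _)
          (cong (λ c → e c ℤ.+ E.∑G* (λ y → e (phase x y))) (phase-y0 x)))) (ℤₚ.*-distribˡ-+ (𝟙 (L.nonzero? x)) _ _)))
        (∑-+ (enum L.finite) _ _)

    -- With α = 0 the phase depends on x only through N(x), which takes each nonzero value `gA`
    -- times. Inverting and scaling that value leaves the sum of e(s + π c) over c ≠ 0, which is - e
    -- s.
    Z-α0 : ∀ β {τ} → τ ≢ K.0# → Z L.0# β τ ≡ ℤ.- gA ℤ.* E.∑G* (λ y → e (ψE.χ (β E.* y)))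
    Z-α0 β {τ} τ≢0 = begin
      L.∑G* (λ x → E.∑G* (λ y → e (phase L.0# β τ x y)))
        ≡⟨ ∑-cong (enum L.finite) (λ x → sym (∑-*ˡ (𝟙 (L.nonzero? x)) (enum E.finite) _)) ⟩
      L.∑G (λ x → E.∑G (λ y → 𝟙 (L.nonzero? x) ℤ.* (𝟙 (E.nonzero? y) ℤ.* e (phase L.0# β τ x y))))
        ≡⟨ ∑-swap (enum L.finite) (enum E.finite) _ ⟩
      E.∑G (λ y → L.∑G (λ x → 𝟙 (L.nonzero? x) ℤ.* (𝟙 (E.nonzero? y) ℤ.* e (phase L.0# β τ x y))))
        ≡⟨ ∑-cong (enum E.finite) (λ y → L.∑G*-*ˡ (𝟙 (E.nonzero? y)) (λ x → e (phase L.0# β τ x y))) ⟩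
      E.∑G* (λ y → L.∑G* (λ x → e (phase L.0# β τ x y)))
        ≡⟨ E.∑G*-cong inner ⟩
      E.∑G* (λ y → ℤ.- gA ℤ.* e (ψE.χ (β E.* y)))
        ≡⟨ E.∑G*-*ˡ (ℤ.- gA) _ ⟩
      ℤ.- gA ℤ.* E.∑G* (λ y → e (ψE.χ (β E.* y))) ∎
      where
      inner : ∀ y → y ≢ E.0# → L.∑G* (λ x → e (phase L.0# β τ x y)) ≡ ℤ.- gA ℤ.* e (ψE.χ (β E.* y))
      inner y y≢0 = begin
        L.∑G* (λ x → e (phase L.0# β τ x y))
          ≡⟨ L.∑G*-cong (λ x _ → cong e (cong₂ F._+_
               (trans (cong (F._+ s) (trans (cong ψL.χ (L.zeroˡ x)) ψL.χ-0)) (F.+-identityˡ s)) (cong π.χ (sym (K.*-assoc τ _ _))))) ⟩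
        L.∑G* (λ x → G (K.inv (NL.norm x)))
          ≡⟨ NL.∑-nonzero-norm (λ c → G (K.inv c)) ⟩
        gA ℤ.* K.∑G* (λ c → G (K.inv c))
          ≡⟨ cong (gA ℤ.*_) (trans (K.∑G*-inv G) (trans (K.∑G*-scale (K.*-≢0 τ≢0 (NE.norm-≢0 y≢0)) (λ c → e (s F.+ π.χ c))) (∑K*-π s))) ⟩
        gA ℤ.* ℤ.- e s
          ≡⟨ lem gA (e s) ⟩
        ℤ.- gA ℤ.* e s ∎
        where
        s = ψE.χ (β E.* y)
        G : K.Carrier → ℤ
        G c = e (s F.+ π.χ (τ K.* NE.norm y K.* c))
        lem : ∀ a b → a ℤ.* ℤ.- b ≡ ℤ.- a ℤ.* b
        lem = solve-∀

    -- The mirror image: for fixed x the sum over y sees only N(y), whose nonzero fibres have `gB`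
    -- elements.
    Z-β0 : ∀ α {τ} → τ ≢ K.0# → Z α E.0# τ ≡ ℤ.- gB ℤ.* L.∑G* (λ x → e (ψL.χ (α L.* x)))
    Z-β0 α {τ} τ≢0 = trans (L.∑G*-cong inner) (L.∑G*-*ˡ (ℤ.- gB) _)
      where
      inner : ∀ x → x ≢ L.0# → E.∑G* (λ y → e (phase α E.0# τ x y)) ≡ ℤ.- gB ℤ.* e (ψL.χ (α L.* x))
      inner x x≢0 = begin
        E.∑G* (λ y → e (phase α E.0# τ x y))
          ≡⟨ E.∑G*-cong (λ y _ → cong e (cong₂ F._+_
               (trans (cong (s F.+_) (trans (cong ψE.χ (E.zeroˡ y)) ψE.χ-0)) (F.+-identityʳ s)) (cong π.χ (lem₁ τ (NE.norm y) _)))) ⟩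
        E.∑G* (λ y → e (s F.+ π.χ (τ K.* K.inv (NL.norm x) K.* NE.norm y)))
          ≡⟨ NE.∑-nonzero-norm (λ c → e (s F.+ π.χ (τ K.* K.inv (NL.norm x) K.* c))) ⟩
        gB ℤ.* K.∑G* (λ c → e (s F.+ π.χ (τ K.* K.inv (NL.norm x) K.* c)))
          ≡⟨ cong (gB ℤ.*_) (trans (K.∑G*-scale (K.*-≢0 τ≢0 (K.inv-≢0 (NL.norm-≢0 x≢0))) (λ c → e (s F.+ π.χ c))) (∑K*-π s)) ⟩
        gB ℤ.* ℤ.- e s
          ≡⟨ lem gB (e s) ⟩
        ℤ.- gB ℤ.* e s ∎
        where
        s = ψL.χ (α L.* x)
        lem₁ : ∀ t n i → t K.* (n K.* i) ≡ t K.* i K.* n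
        lem₁ = K.solve 3 (λ t n i → t K.:* (n K.:* i) K.:= t K.:* i K.:* n) refl
        lem : ∀ a b → a ℤ.* ℤ.- b ≡ ℤ.- a ℤ.* b
        lem = solve-∀

    -- Here the relation between L × K and E turns the sum over x into a sum over y′ ∈ E.
    twisted-Kloosterman : ∀ s {b} → b ≢ K.0# →
      L.∑G* (λ x → e (s F.+ π.χ (NL.trace x K.+ b K.* K.inv (NL.norm x)))) ≡
      ℤ.- E.∑G (λ y → 𝟙 (NE.norm y K.≟ b) ℤ.* e (s F.+ ψE.χ y))
    twisted-Kloosterman s {b} b≢0 = begin
      L.∑G* (λ x → G (value x))
        ≡⟨ ∑-cong (enum L.finite) (λ x → cong (𝟙 (L.nonzero? x) ℤ.*_) (sym (∑-δ K.finite (value x) G))) ⟩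
      L.∑G (λ x → 𝟙 (L.nonzero? x) ℤ.* K.∑G (λ a → 𝟙 (a K.≟ value x) ℤ.* G a))
        ≡⟨ ∑-cong (enum L.finite) (λ x → sym (∑-*ˡ (𝟙 (L.nonzero? x)) (enum K.finite) _)) ⟩
      L.∑G (λ x → K.∑G (λ a → 𝟙 (L.nonzero? x) ℤ.* (𝟙 (a K.≟ value x) ℤ.* G a)))
        ≡⟨ ∑-swap (enum L.finite) (enum K.finite) _ ⟩
      K.∑G (λ a → L.∑G (λ x → 𝟙 (L.nonzero? x) ℤ.* (𝟙 (a K.≟ value x) ℤ.* G a)))
        ≡⟨ ∑-cong (enum K.finite) (λ a → trans (∑-cong (enum L.finite) (λ x → trans (sym (ℤₚ.*-assoc (𝟙 (L.nonzero? x)) _ (G a)))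
             (cong (ℤ._* G a) (sym (count-t a x))))) (∑-*ʳ (G a) (enum L.finite) _)) ⟩
      K.∑G (λ a → SL a ℤ.* G a)
        ≡⟨ ∑-cong (enum K.finite) (λ a → cong (ℤ._* G a) (trans (lem₁ (SE a) (SL a)) (cong (ℤ._- SE a) (HD.hasse-davenport a b≢0)))) ⟩
      K.∑G (λ a → (HD.total ℤ.- SE a) ℤ.* G a)
        ≡⟨ trans (∑-cong (enum K.finite) (λ a → lem₂ HD.total (SE a) (G a))) (∑-- (enum K.finite) _ _) ⟩
      K.∑G (λ a → HD.total ℤ.* G a) ℤ.- K.∑G (λ a → SE a ℤ.* G a)
        -- The constant `HD.total` drops out because e(s + π a) sums to 0 over a ∈ K.
        ≡⟨ cong₂ ℤ._-_ (trans (∑-*ˡ HD.total (enum K.finite) G) (trans (cong (HD.total ℤ.*_) (∑K-π s)) (ℤₚ.*-zeroʳ HD.total))) back ⟩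
      0ℤ ℤ.- E.∑G (λ y → 𝟙 (NE.norm y K.≟ b) ℤ.* e (s F.+ ψE.χ y))
        ≡⟨ ℤₚ.+-identityˡ _ ⟩
      ℤ.- E.∑G (λ y → 𝟙 (NE.norm y K.≟ b) ℤ.* e (s F.+ ψE.χ y)) ∎
      where
      G : K.Carrier → ℤ
      G a = e (s F.+ π.χ a)
      value : L.Carrier → K.Carrier
      value x = NL.trace x K.+ b K.* K.inv (NL.norm x)
      SE SL : K.Carrier → ℤ
      SE a = E.∑G (λ y → 𝟙 (NE.trace y K.≟ a) ℤ.* 𝟙 (NE.norm y K.≟ b))
      SL a = L.∑G (λ x → K.∑G (λ t → 𝟙 (NL.trace x K.+ t K.≟ a) ℤ.* 𝟙 (NL.norm x K.* t K.≟ b)))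
      lem₁ : ∀ a b → b ≡ a ℤ.+ b ℤ.- a
      lem₁ = solve-∀
      lem₂ : ∀ a b c → (a ℤ.- b) ℤ.* c ≡ a ℤ.* c ℤ.- b ℤ.* c
      lem₂ = solve-∀
      count-t : ∀ a x → K.∑G (λ t → 𝟙 (NL.trace x K.+ t K.≟ a) ℤ.* 𝟙 (NL.norm x K.* t K.≟ b)) ≡ 𝟙 (L.nonzero? x) ℤ.* 𝟙 (a K.≟ value x)
      count-t a x with x L.≟ L.0#
      ... | yes refl = trans (∑-zero (enum K.finite) (λ t → trans (cong (𝟙 (NL.trace x K.+ t K.≟ a) ℤ.*_)
              (𝟙-no (NL.norm x K.* t K.≟ b) (λ eq → b≢0 (trans (sym eq) (trans (cong (K._* t) NL.norm-0) (K.zeroˡ t))))))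
              (ℤₚ.*-zeroʳ (𝟙 (NL.trace x K.+ t K.≟ a))))) (sym (ℤₚ.*-zeroˡ (𝟙 (a K.≟ value x))))
      ... | no x≢0 = begin
        K.∑G (λ t → 𝟙 (NL.trace x K.+ t K.≟ a) ℤ.* 𝟙 (NL.norm x K.* t K.≟ b))
          ≡⟨ ∑-cong (enum K.finite) (λ t → trans (ℤₚ.*-comm (𝟙 (NL.trace x K.+ t K.≟ a)) _) (cong (ℤ._* 𝟙 (NL.trace x K.+ t K.≟ a))
               (𝟙-cong (NL.norm x K.* t K.≟ b) (t K.≟ t₀)
                 (λ eq → trans (sym (K.inv-*-cancel N≢0 t)) (trans (cong (K.inv (NL.norm x) K.*_) eq) (K.*-comm _ b)))
                 (λ eq → trans (cong (NL.norm x K.*_) (trans eq (K.*-comm b _))) (K.*-inv-cancel N≢0 b))))) ⟩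
        K.∑G (λ t → 𝟙 (t K.≟ t₀) ℤ.* 𝟙 (NL.trace x K.+ t K.≟ a))
          ≡⟨ ∑-δ K.finite t₀ (λ t → 𝟙 (NL.trace x K.+ t K.≟ a)) ⟩
        𝟙 (NL.trace x K.+ t₀ K.≟ a)
          ≡⟨ 𝟙-cong (NL.trace x K.+ t₀ K.≟ a) (a K.≟ value x) sym sym ⟩
        𝟙 (a K.≟ value x)
          ≡⟨ ℤₚ.*-identityˡ _ ⟨
        1ℤ ℤ.* 𝟙 (a K.≟ value x) ∎
        where
        N≢0 = NL.norm-≢0 x≢0
        t₀ = b K.* K.inv (NL.norm x)
      back : K.∑G (λ a → SE a ℤ.* G a) ≡ E.∑G (λ y → 𝟙 (NE.norm y K.≟ b) ℤ.* e (s F.+ ψE.χ y))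
      back = begin
        K.∑G (λ a → SE a ℤ.* G a)
          ≡⟨ ∑-cong (enum K.finite) (λ a → sym (∑-*ʳ (G a) (enum E.finite) _)) ⟩
        K.∑G (λ a → E.∑G (λ y → 𝟙 (NE.trace y K.≟ a) ℤ.* 𝟙 (NE.norm y K.≟ b) ℤ.* G a))
          ≡⟨ ∑-swap (enum K.finite) (enum E.finite) _ ⟩
        E.∑G (λ y → K.∑G (λ a → 𝟙 (NE.trace y K.≟ a) ℤ.* 𝟙 (NE.norm y K.≟ b) ℤ.* G a))
          ≡⟨ ∑-cong (enum E.finite) (λ y → trans (∑-cong (enum K.finite) (λ a → trans (lem₃ (𝟙 (NE.trace y K.≟ a)) (𝟙 (NE.norm y K.≟ b)) (G a))
               (cong (ℤ._* (𝟙 (NE.norm y K.≟ b) ℤ.* G a)) (𝟙-cong (NE.trace y K.≟ a) (a K.≟ NE.trace y) sym sym))))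
               (∑-δ K.finite (NE.trace y) (λ a → 𝟙 (NE.norm y K.≟ b) ℤ.* G a))) ⟩
        E.∑G (λ y → 𝟙 (NE.norm y K.≟ b) ℤ.* e (s F.+ ψE.χ y)) ∎
        where
        lem₃ : ∀ a b c → a ℤ.* b ℤ.* c ≡ a ℤ.* (b ℤ.* c)
        lem₃ = solve-∀

    -- Replacing x by x/α and y by y/β normalises both traces and moves α and β into γ. For fixed y
    -- the sum over x becomes a sum over elements of norm γ N(y), that is, over y u with N(u) = γ.
    -- Summing e(ψ((1 + u) y)) over y then singles out u = - 1, while `gB` counts all u of norm γ.
    Z-generic : ∀ {α β τ} → α ≢ L.0# → β ≢ E.0# → τ ≢ K.0# → let γ = τ K.* ratio (L.inv α , E.inv β) in
      Z α β τ ≡ p-1 ℤ.* (gB ℤ.- QE ℤ.* 𝟙 (NE.norm (E.- E.1#) K.≟ γ))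
    Z-generic {α} {β} {τ} α≢0 β≢0 τ≢0 = begin
      L.∑G* (λ x → E.∑G* (λ y → e (phase α β τ x y)))
        ≡⟨ L.∑G*-scale (L.inv-≢0 α≢0) (λ x → E.∑G* (λ y → e (phase α β τ x y))) ⟨
      L.∑G* (λ x → E.∑G* (λ y → e (phase α β τ (L.inv α L.* x) y)))
        ≡⟨ L.∑G*-cong (λ x x≢0 → trans (sym (E.∑G*-scale (E.inv-≢0 β≢0) (λ y → e (phase α β τ (L.inv α L.* x) y))))
             (E.∑G*-cong (λ y _ → cong e (normal x y x≢0)))) ⟩
      L.∑G* (λ x → E.∑G* (λ y → e (ψE.χ y F.+ π.χ (NL.trace x K.+ γ K.* NE.norm y K.* K.inv (NL.norm x)))))
        ≡⟨ ∑-cong (enum L.finite) (λ x → sym (∑-*ˡ (𝟙 (L.nonzero? x)) (enum E.finite) _)) ⟩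
      L.∑G (λ x → E.∑G (λ y → 𝟙 (L.nonzero? x) ℤ.* (𝟙 (E.nonzero? y) ℤ.* P x y)))
        ≡⟨ ∑-swap (enum L.finite) (enum E.finite) _ ⟩
      E.∑G (λ y → L.∑G (λ x → 𝟙 (L.nonzero? x) ℤ.* (𝟙 (E.nonzero? y) ℤ.* P x y)))
        ≡⟨ ∑-cong (enum E.finite) (λ y → L.∑G*-*ˡ (𝟙 (E.nonzero? y)) (λ x → P x y)) ⟩
      E.∑G* (λ y → L.∑G* (λ x → P x y))
        ≡⟨ E.∑G*-cong (λ y y≢0 → trans (twisted-Kloosterman (ψE.χ y) (K.*-≢0 γ≢0 (NE.norm-≢0 y≢0))) (cong ℤ.-_ (to-u y y≢0))) ⟩
      E.∑G* (λ y → ℤ.- E.∑G (λ u → 𝟙 (NE.norm u K.≟ γ) ℤ.* e (ψE.χ ((E.1# E.+ u) E.* y))))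
        ≡⟨ trans (∑-cong (enum E.finite) (λ y → trans (lem₁ (𝟙 (E.nonzero? y)) _) (cong ℤ.-_ (sym (∑-*ˡ (𝟙 (E.nonzero? y)) (enum E.finite) _)))))
             (∑-neg (enum E.finite) _) ⟩
      ℤ.- E.∑G (λ y → E.∑G (λ u → 𝟙 (E.nonzero? y) ℤ.* (𝟙 (NE.norm u K.≟ γ) ℤ.* e (ψE.χ ((E.1# E.+ u) E.* y)))))
        ≡⟨ cong ℤ.-_ (trans (∑-swap (enum E.finite) (enum E.finite) _)
             (∑-cong (enum E.finite) (λ u → trans (E.∑G*-*ˡ (𝟙 (NE.norm u K.≟ γ)) (λ y → e (ψE.χ ((E.1# E.+ u) E.* y))))
               (cong (𝟙 (NE.norm u K.≟ γ) ℤ.*_) (∑E*-ψ (E.1# E.+ u)))))) ⟩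
      ℤ.- E.∑G (λ u → 𝟙 (NE.norm u K.≟ γ) ℤ.* (QE ℤ.* p-1 ℤ.* 𝟙 (E.1# E.+ u E.≟ E.0#) ℤ.- p-1))
        ≡⟨ cong ℤ.-_ (trans (∑-cong (enum E.finite) (λ u → trans (lem₂ (𝟙 (NE.norm u K.≟ γ)) (QE ℤ.* p-1) (𝟙 (E.1# E.+ u E.≟ E.0#)) p-1)
             (cong (λ z → z ℤ.* (QE ℤ.* p-1 ℤ.* 𝟙 (NE.norm u K.≟ γ)) ℤ.- 𝟙 (NE.norm u K.≟ γ) ℤ.* p-1)
               (𝟙-cong (E.1# E.+ u E.≟ E.0#) (u E.≟ E.- E.1#) to-1 from-1)))) (∑-- (enum E.finite) _ _)) ⟩
      ℤ.- (E.∑G (λ u → 𝟙 (u E.≟ E.- E.1#) ℤ.* (QE ℤ.* p-1 ℤ.* 𝟙 (NE.norm u K.≟ γ))) ℤ.- E.∑G (λ u → 𝟙 (NE.norm u K.≟ γ) ℤ.* p-1))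
        ≡⟨ cong ℤ.-_ (cong₂ ℤ._-_ (∑-δ E.finite (E.- E.1#) _) (trans (∑-*ʳ p-1 (enum E.finite) _) (cong (ℤ._* p-1) (NE.norm-fibre γ≢0)))) ⟩
      ℤ.- (QE ℤ.* p-1 ℤ.* 𝟙 (NE.norm (E.- E.1#) K.≟ γ) ℤ.- gB ℤ.* p-1)
        ≡⟨ lem₃ QE p-1 (𝟙 (NE.norm (E.- E.1#) K.≟ γ)) gB ⟩
      p-1 ℤ.* (gB ℤ.- QE ℤ.* 𝟙 (NE.norm (E.- E.1#) K.≟ γ)) ∎
      where
      γ = τ K.* ratio (L.inv α , E.inv β)
      γ≢0 : γ ≢ K.0#
      γ≢0 = K.*-≢0 τ≢0 (K.*-≢0 (NE.norm-≢0 (E.inv-≢0 β≢0)) (K.inv-≢0 (NL.norm-≢0 (L.inv-≢0 α≢0))))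
      P : L.Carrier → E.Carrier → ℤ
      P x y = e (ψE.χ y F.+ π.χ (NL.trace x K.+ γ K.* NE.norm y K.* K.inv (NL.norm x)))
      inv-* : ∀ a b → a ≢ K.0# → b ≢ K.0# → K.inv (a K.* b) ≡ K.inv a K.* K.inv b
      inv-* a b a≢0 b≢0 = K.*-cancelˡ (K.*-≢0 a≢0 b≢0) (trans (K.inverseʳ _ (K.*-≢0 a≢0 b≢0))
        (sym (trans (lem a b (K.inv a) (K.inv b)) (trans (cong₂ K._*_ (K.inverseʳ a a≢0) (K.inverseʳ b b≢0)) (K.*-identityˡ _)))))
        where
        lem : ∀ a b c d → a K.* b K.* (c K.* d) ≡ a K.* c K.* (b K.* d)
        lem = K.solve 4 (λ a b c d → a K.:* b K.:* (c K.:* d) K.:= a K.:* c K.:* (b K.:* d)) refl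
      normal : ∀ x y → x ≢ L.0# → phase α β τ (L.inv α L.* x) (E.inv β E.* y) ≡ ψE.χ y F.+ π.χ (NL.trace x K.+ γ K.* NE.norm y K.* K.inv (NL.norm x))
      normal x y x≢0 = begin
        ψL.χ (α L.* (L.inv α L.* x)) F.+ ψE.χ (β E.* (E.inv β E.* y)) F.+ π.χ (τ K.* (NE.norm (E.inv β E.* y) K.* K.inv (NL.norm (L.inv α L.* x))))
          ≡⟨ cong₂ F._+_ (cong₂ (λ u v → ψL.χ u F.+ ψE.χ v) (L.*-inv-cancel α≢0 x) (E.*-inv-cancel β≢0 y)) (cong π.χ quotient) ⟩
        ψL.χ x F.+ ψE.χ y F.+ π.χ (γ K.* NE.norm y K.* K.inv (NL.norm x))
          ≡⟨ lem (ψL.χ x) (ψE.χ y) _ ⟩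
        ψE.χ y F.+ (ψL.χ x F.+ π.χ (γ K.* NE.norm y K.* K.inv (NL.norm x)))
          ≡⟨ cong (ψE.χ y F.+_) (π.χ-+ (NL.trace x) _) ⟨
        ψE.χ y F.+ π.χ (NL.trace x K.+ γ K.* NE.norm y K.* K.inv (NL.norm x)) ∎
        where
        lem : ∀ a b c → a F.+ b F.+ c ≡ b F.+ (a F.+ c)
        lem = F.solve 3 (λ a b c → a F.:+ b F.:+ c F.:= b F.:+ (a F.:+ c)) refl
        lem′ : ∀ t u n v m → t K.* (u K.* n K.* (v K.* m)) ≡ t K.* (u K.* v) K.* n K.* m
        lem′ = K.solve 5 (λ t u n v m → t K.:* (u K.:* n K.:* (v K.:* m)) K.:= t K.:* (u K.:* v) K.:* n K.:* m) refl
        quotient : τ K.* (NE.norm (E.inv β E.* y) K.* K.inv (NL.norm (L.inv α L.* x))) ≡ γ K.* NE.norm y K.* K.inv (NL.norm x)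
        quotient = trans (cong₂ (λ u v → τ K.* (u K.* v)) (NE.norm-* (E.inv β) y)
            (trans (cong K.inv (NL.norm-* (L.inv α) x)) (inv-* _ _ (NL.norm-≢0 (L.inv-≢0 α≢0)) (NL.norm-≢0 x≢0))))
            (lem′ τ (NE.norm (E.inv β)) (NE.norm y) _ _)
      to-u : ∀ y → y ≢ E.0# → E.∑G (λ y′ → 𝟙 (NE.norm y′ K.≟ γ K.* NE.norm y) ℤ.* e (ψE.χ y F.+ ψE.χ y′)) ≡
                              E.∑G (λ u → 𝟙 (NE.norm u K.≟ γ) ℤ.* e (ψE.χ ((E.1# E.+ u) E.* y)))
      to-u y y≢0 = trans (sym (∑-reindex E.finite (y E.*_) (E.inv y E.*_) (E.inv-*-cancel y≢0) (E.*-inv-cancel y≢0) _))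
        (∑-cong (enum E.finite) (λ u → cong₂ ℤ._*_ (𝟙-cong (NE.norm (y E.* u) K.≟ γ K.* NE.norm y) (NE.norm u K.≟ γ)
            (λ eq → K.*-cancelˡ (NE.norm-≢0 y≢0) (trans (sym (NE.norm-* y u)) (trans eq (K.*-comm γ _))))
            (λ eq → trans (NE.norm-* y u) (trans (cong (NE.norm y K.*_) eq) (K.*-comm _ γ))))
          (cong e (trans (sym (ψE.χ-+ y (y E.* u))) (cong ψE.χ (lem y u))))))
        where
        lem : ∀ y u → y E.+ y E.* u ≡ (E.1# E.+ u) E.* y
        lem = E.solve 2 (λ y u → y E.:+ y E.:* u E.:= (E.con 1ℤ E.:+ u) E.:* y) refl
      lem₁ : ∀ a b → a ℤ.* ℤ.- b ≡ ℤ.- (a ℤ.* b)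
      lem₁ = solve-∀
      lem₂ : ∀ a c b d → a ℤ.* (c ℤ.* b ℤ.- d) ≡ b ℤ.* (c ℤ.* a) ℤ.- a ℤ.* d
      lem₂ = solve-∀
      lem₃ : ∀ a p i b → ℤ.- (a ℤ.* p ℤ.* i ℤ.- b ℤ.* p) ≡ p ℤ.* (b ℤ.- a ℤ.* i)
      lem₃ = solve-∀
      to-1 : ∀ {u} → E.1# E.+ u ≡ E.0# → u ≡ E.- E.1#
      to-1 {u} eq = trans (lem E.1# u) (trans (cong (E.- E.1# E.+_) eq) (E.+-identityʳ _))
        where
        lem : ∀ a u → u ≡ E.- a E.+ (a E.+ u)
        lem = E.solve 2 (λ a u → u E.:= E.:- a E.:+ (a E.:+ u)) refl
      from-1 : ∀ {u} → u ≡ E.- E.1# → E.1# E.+ u ≡ E.0#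
      from-1 refl = E.-‿inverseʳ E.1#

    Annihilates : K.Carrier → Set
    Annihilates t = ∀ a → π.χ (κ a K.* t) ≡ F.0#

    annihilates? : ∀ t → Dec (Annihilates t)
    annihilates? t = map′ (λ p a → All.lookup p (complete A.finite a)) (λ p → All.universal p _)
                          (all? (λ a → π.χ (κ a K.* t) F.≟ F.0#) (enum A.finite))

    D? : ∀ v → Dec (proj₁ v ≢ L.0# × Annihilates (ratio v))
    D? v = L.nonzero? (proj₁ v) ×-dec annihilates? (ratio v)

    d : V.Carrier → ℤ
    d v = 𝟙 (D? v)

    ∑A : (A.Carrier → ℤ) → ℤ
    ∑A = ∑ (enum A.finite)

    κ-0 : κ A.0# ≡ K.0#
    κ-0 = K.+-cancelˡ (κ A.0#) (trans (sym (κ-+ A.0# A.0#)) (trans (cong κ (A.+-identityˡ A.0#)) (sym (K.+-identityʳ _))))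

    κ-≢0 : ∀ {a} → a ≢ A.0# → κ a ≢ K.0#
    κ-≢0 a≢0 eq = a≢0 (κ-injective (trans eq (sym κ-0)))

    -- Orthogonality on A: a ↦ π(κ a · t) is a linear functional, and it vanishes identically
    -- exactly when t lies in R. This expands the indicator of R.
    ∑A-e : ∀ s t → ∑A (λ a → e (s F.+ π.χ (κ a K.* t))) ≡ A.size ℤ.* (𝟙 (annihilates? t) ℤ.* e s)
    ∑A-e s t with annihilates? t
    ... | yes z = trans (∑-cong (enum A.finite) (λ a → cong e (trans (cong (s F.+_) (z a)) (F.+-identityʳ s))))
                    (trans (∑-const (enum A.finite) (e s)) (cong (A.size ℤ.*_) (sym (ℤₚ.*-identityˡ (e s)))))
    ... | no ¬z = trans (Functional.∑-e-nontrivial functionalA nontrivial s)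
                    (sym (trans (cong (A.size ℤ.*_) (ℤₚ.*-zeroˡ (e s))) (ℤₚ.*-zeroʳ A.size)))
      where
      functionalA : Functional A
      functionalA = record
        { χ = λ a → π.χ (κ a K.* t)
        ; χ-+ = λ a b → trans (cong π.χ (trans (cong (K._* t) (κ-+ a b)) (K.distribʳ t _ _))) (π.χ-+ _ _)
        ; χ-· = λ c a → trans (cong π.χ (trans (cong (K._* t) (κ-· c a)) (K.*-assoc _ _ t))) (π.χ-· c _) }
      nontrivial : ∃ λ a → π.χ (κ a K.* t) ≢ F.0#
      nontrivial with all? (λ a → π.χ (κ a K.* t) F.≟ F.0#) (enum A.finite)
      ... | yes p = ⊥-elim (¬z (λ a → All.lookup p (complete A.finite a)))
      ... | no ¬p = let (a , _ , ne) = find (¬All⇒Any¬ (λ a → π.χ (κ a K.* t) F.≟ F.0#) (enum A.finite) ¬p) in a , ne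

    size-hat : ∀ α β → A.size ℤ.* hat d (α , β) ≡ ∑A (λ a → H α β (κ a))
    size-hat α β = sym (begin
      ∑A (λ a → L.∑G (λ x → 𝟙 (L.nonzero? x) ℤ.* E.∑G (λ y → e (phase α β (κ a) x y))))
        ≡⟨ ∑-swap (enum A.finite) (enum L.finite) _ ⟩
      L.∑G (λ x → ∑A (λ a → 𝟙 (L.nonzero? x) ℤ.* E.∑G (λ y → e (phase α β (κ a) x y))))
        ≡⟨ ∑-cong (enum L.finite) (λ x → trans (∑-*ˡ (𝟙 (L.nonzero? x)) (enum A.finite) _) (cong (𝟙 (L.nonzero? x) ℤ.*_)
             (trans (∑-swap (enum A.finite) (enum E.finite) _) (∑-cong (enum E.finite) (λ y → ∑A-e (B (α , β) (x , y)) (ratio (x , y))))))) ⟩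
      L.∑G (λ x → 𝟙 (L.nonzero? x) ℤ.* E.∑G (λ y → A.size ℤ.* (𝟙 (annihilates? (ratio (x , y))) ℤ.* e (B (α , β) (x , y)))))
        ≡⟨ ∑-cong (enum L.finite) (λ x → trans (sym (∑-*ˡ (𝟙 (L.nonzero? x)) (enum E.finite) _)) (trans (∑-cong (enum E.finite) (λ y →
             trans (lem (𝟙 (L.nonzero? x)) A.size (𝟙 (annihilates? (ratio (x , y)))) (e (B (α , β) (x , y))))
               (cong (λ z → A.size ℤ.* (z ℤ.* e (B (α , β) (x , y)))) (sym (𝟙-× (L.nonzero? x) (annihilates? (ratio (x , y))))))))
             (∑-*ˡ A.size (enum E.finite) _))) ⟩
      L.∑G (λ x → A.size ℤ.* E.∑G (λ y → d (x , y) ℤ.* e (B (α , β) (x , y))))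
        ≡⟨ ∑-*ˡ A.size (enum L.finite) _ ⟩
      A.size ℤ.* L.∑G (λ x → E.∑G (λ y → d (x , y) ℤ.* e (B (α , β) (x , y))))
        ≡⟨ cong (A.size ℤ.*_) (sym (∑-cartesianProduct (enum L.finite) (enum E.finite) (λ v → d v ℤ.* e (B (α , β) v)))) ⟩
      A.size ℤ.* hat d (α , β) ∎)
      where
      lem : ∀ a s b c → a ℤ.* (s ℤ.* (b ℤ.* c)) ≡ s ℤ.* (a ℤ.* b ℤ.* c)
      lem = solve-∀

    ∑A-split : ∀ f → ∑A f ≡ f A.0# ℤ.+ ∑A (λ a → 𝟙 (¬? (a A.≟ A.0#)) ℤ.* f a)
    ∑A-split f = begin
      ∑A f
        ≡⟨ ∑-cong (enum A.finite) (λ a → trans (lem (𝟙 (a A.≟ A.0#)) (f a)) (cong (λ z → 𝟙 (a A.≟ A.0#) ℤ.* f a ℤ.+ z ℤ.* f a) (sym (𝟙-¬ (a A.≟ A.0#))))) ⟩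
      ∑A (λ a → 𝟙 (a A.≟ A.0#) ℤ.* f a ℤ.+ 𝟙 (¬? (a A.≟ A.0#)) ℤ.* f a)
        ≡⟨ ∑-+ (enum A.finite) _ _ ⟩
      ∑A (λ a → 𝟙 (a A.≟ A.0#) ℤ.* f a) ℤ.+ ∑A (λ a → 𝟙 (¬? (a A.≟ A.0#)) ℤ.* f a)
        ≡⟨ cong (ℤ._+ ∑A (λ a → 𝟙 (¬? (a A.≟ A.0#)) ℤ.* f a)) (∑-δ A.finite A.0# f) ⟩
      f A.0# ℤ.+ ∑A (λ a → 𝟙 (¬? (a A.≟ A.0#)) ℤ.* f a) ∎
      where
      lem : ∀ i f → f ≡ i ℤ.* f ℤ.+ (1ℤ ℤ.- i) ℤ.* f
      lem = solve-∀

    ∑A-nonzero-const : ∀ c → ∑A (λ a → 𝟙 (¬? (a A.≟ A.0#)) ℤ.* c) ≡ (A.size ℤ.- 1ℤ) ℤ.* c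
    ∑A-nonzero-const c = trans (lem₁ c _) (trans (cong (ℤ._- c) (sym (∑A-split (λ _ → c)))) (trans (cong (ℤ._- c) (∑-const (enum A.finite) c)) (lem₂ A.size c)))
      where
      lem₁ : ∀ a b → b ≡ a ℤ.+ b ℤ.- a
      lem₁ = solve-∀
      lem₂ : ∀ s c → s ℤ.* c ℤ.- c ≡ (s ℤ.- 1ℤ) ℤ.* c
      lem₂ = solve-∀

    size-hat-split : ∀ α β → A.size ℤ.* hat d (α , β) ≡ H α β K.0# ℤ.+ ∑A (λ a → 𝟙 (¬? (a A.≟ A.0#)) ℤ.* H α β (κ a))
    size-hat-split α β = trans (size-hat α β) (trans (∑A-split _)
      (cong (λ t → H α β t ℤ.+ ∑A (λ a → 𝟙 (¬? (a A.≟ A.0#)) ℤ.* H α β (κ a))) κ-0))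

    phase-τ0 : ∀ α β x y → phase α β K.0# x y ≡ ψL.χ (α L.* x) F.+ ψE.χ (β E.* y)
    phase-τ0 α β x y = trans (cong (B (α , β) (x , y) F.+_) (trans (cong π.χ (K.zeroˡ _)) π.χ-0)) (F.+-identityʳ _)

    H-τ0-β≢0 : ∀ α {β} → β ≢ E.0# → H α β K.0# ≡ 0ℤ
    H-τ0-β≢0 α {β} β≢0 = ∑-zero (enum L.finite) (λ x → trans (cong (𝟙 (L.nonzero? x) ℤ.*_)
      (trans (∑-cong (enum E.finite) (λ y → cong e (phase-τ0 α β x y))) (∑E-ψ β≢0 _))) (ℤₚ.*-zeroʳ (𝟙 (L.nonzero? x))))

    H-τ0-β0 : ∀ α → H α E.0# K.0# ≡ QE ℤ.* L.∑G* (λ x → e (ψL.χ (α L.* x)))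
    H-τ0-β0 α = trans (L.∑G*-cong (λ x _ → trans (∑-cong (enum E.finite) (λ y → cong e (trans (phase-τ0 α E.0# x y)
        (trans (cong (ψL.χ (α L.* x) F.+_) (trans (cong ψE.χ (E.zeroˡ y)) ψE.χ-0)) (F.+-identityʳ _)))))
        (trans (∑-const (enum E.finite) _) (cong (λ o → ℤ.+ o ℤ.* e (ψL.χ (α L.* x))) order-E)))) (L.∑G*-*ˡ QE _)

    ∑L*-ψ0 : L.∑G* (λ x → e (ψL.χ (L.0# L.* x))) ≡ (QL ℤ.- 1ℤ) ℤ.* p-1
    ∑L*-ψ0 = trans (L.∑G*-cong (λ x _ → trans (cong e (trans (cong ψL.χ (L.zeroˡ x)) ψL.χ-0)) e-0)) (∑L*-1 p-1)

    private
      Q T : ℤ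
      Q = ℤ.+ q
      T = A.size

    -- At the trivial character the τ = 0 term sees all of (L minus 0) × E; each τ ≠ 0 adds the same
    -- amount, once for the pairs with y = 0 and once, through `Z-β0`, for the others.
    hat-0 : T ℤ.* hat d V.0# ≡ p-1 ℤ.* ((QL ℤ.- 1ℤ) ℤ.* (QE ℤ.- (T ℤ.- 1ℤ) ℤ.* (Q ℤ.* gA)))
    hat-0 = begin
      T ℤ.* hat d V.0#
        ≡⟨ size-hat-split L.0# E.0# ⟩
      H L.0# E.0# K.0# ℤ.+ ∑A (λ a → 𝟙 (¬? (a A.≟ A.0#)) ℤ.* H L.0# E.0# (κ a))
        ≡⟨ cong₂ ℤ._+_ (trans (H-τ0-β0 L.0#) (cong (QE ℤ.*_) ∑L*-ψ0))
             (trans (∑-cong (enum A.finite) (λ a → 𝟙-*-cong (¬? (a A.≟ A.0#)) (λ a≢0 → value (κ-≢0 a≢0)))) (∑A-nonzero-const _)) ⟩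
      QE ℤ.* ((QL ℤ.- 1ℤ) ℤ.* p-1) ℤ.+ (T ℤ.- 1ℤ) ℤ.* ((QL ℤ.- 1ℤ) ℤ.* p-1 ℤ.+ ℤ.- gB ℤ.* ((QL ℤ.- 1ℤ) ℤ.* p-1))
        ≡⟨ cong (λ b → QE ℤ.* ((QL ℤ.- 1ℤ) ℤ.* p-1) ℤ.+ (T ℤ.- 1ℤ) ℤ.* ((QL ℤ.- 1ℤ) ℤ.* p-1 ℤ.+ ℤ.- b ℤ.* ((QL ℤ.- 1ℤ) ℤ.* p-1))) gB≡1+qgA ⟩
      QE ℤ.* ((QL ℤ.- 1ℤ) ℤ.* p-1) ℤ.+ (T ℤ.- 1ℤ) ℤ.* ((QL ℤ.- 1ℤ) ℤ.* p-1 ℤ.+ ℤ.- (1ℤ ℤ.+ Q ℤ.* gA) ℤ.* ((QL ℤ.- 1ℤ) ℤ.* p-1))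
        ≡⟨ lem QE (QL ℤ.- 1ℤ) p-1 T (Q ℤ.* gA) ⟩
      p-1 ℤ.* ((QL ℤ.- 1ℤ) ℤ.* (QE ℤ.- (T ℤ.- 1ℤ) ℤ.* (Q ℤ.* gA))) ∎
      where
      value : ∀ {τ} → τ ≢ K.0# → H L.0# E.0# τ ≡ (QL ℤ.- 1ℤ) ℤ.* p-1 ℤ.+ ℤ.- gB ℤ.* ((QL ℤ.- 1ℤ) ℤ.* p-1)
      value {τ} τ≢0 = trans (H-split L.0# E.0# τ) (cong₂ ℤ._+_ ∑L*-ψ0 (trans (Z-β0 L.0# τ≢0) (cong (ℤ.- gB ℤ.*_) ∑L*-ψ0)))
      lem : ∀ E l p t g → E ℤ.* (l ℤ.* p) ℤ.+ (t ℤ.- 1ℤ) ℤ.* (l ℤ.* p ℤ.+ ℤ.- (1ℤ ℤ.+ g) ℤ.* (l ℤ.* p)) ≡ p ℤ.* (l ℤ.* (E ℤ.- (t ℤ.- 1ℤ) ℤ.* g))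
      lem = solve-∀

    hat-β0 : ∀ {α} → α ≢ L.0# → T ℤ.* hat d (α , E.0#) ≡ p-1 ℤ.* ((T ℤ.- 1ℤ) ℤ.* (Q ℤ.* gA) ℤ.- QE)
    hat-β0 {α} α≢0 = begin
      T ℤ.* hat d (α , E.0#)
        ≡⟨ size-hat-split α E.0# ⟩
      H α E.0# K.0# ℤ.+ ∑A (λ a → 𝟙 (¬? (a A.≟ A.0#)) ℤ.* H α E.0# (κ a))
        ≡⟨ cong₂ ℤ._+_ (trans (H-τ0-β0 α) (cong (QE ℤ.*_) (∑L*-ψ α≢0)))
             (trans (∑-cong (enum A.finite) (λ a → 𝟙-*-cong (¬? (a A.≟ A.0#)) (λ a≢0 → value (κ-≢0 a≢0)))) (∑A-nonzero-const _)) ⟩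
      QE ℤ.* ℤ.- p-1 ℤ.+ (T ℤ.- 1ℤ) ℤ.* (ℤ.- p-1 ℤ.+ ℤ.- gB ℤ.* ℤ.- p-1)
        ≡⟨ cong (λ b → QE ℤ.* ℤ.- p-1 ℤ.+ (T ℤ.- 1ℤ) ℤ.* (ℤ.- p-1 ℤ.+ ℤ.- b ℤ.* ℤ.- p-1)) gB≡1+qgA ⟩
      QE ℤ.* ℤ.- p-1 ℤ.+ (T ℤ.- 1ℤ) ℤ.* (ℤ.- p-1 ℤ.+ ℤ.- (1ℤ ℤ.+ Q ℤ.* gA) ℤ.* ℤ.- p-1)
        ≡⟨ lem QE p-1 T (Q ℤ.* gA) ⟩
      p-1 ℤ.* ((T ℤ.- 1ℤ) ℤ.* (Q ℤ.* gA) ℤ.- QE) ∎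
      where
      value : ∀ {τ} → τ ≢ K.0# → H α E.0# τ ≡ ℤ.- p-1 ℤ.+ ℤ.- gB ℤ.* ℤ.- p-1
      value {τ} τ≢0 = trans (H-split α E.0# τ) (cong₂ ℤ._+_ (∑L*-ψ α≢0) (trans (Z-β0 α τ≢0) (cong (ℤ.- gB ℤ.*_) (∑L*-ψ α≢0))))
      lem : ∀ E p t g → E ℤ.* ℤ.- p ℤ.+ (t ℤ.- 1ℤ) ℤ.* (ℤ.- p ℤ.+ ℤ.- (1ℤ ℤ.+ g) ℤ.* ℤ.- p) ≡ p ℤ.* ((t ℤ.- 1ℤ) ℤ.* g ℤ.- E)
      lem = solve-∀

    hat-α0 : ∀ {β} → β ≢ E.0# → T ℤ.* hat d (L.0# , β) ≡ p-1 ℤ.* ((T ℤ.- 1ℤ) ℤ.* (Q ℤ.* gA))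
    hat-α0 {β} β≢0 = begin
      T ℤ.* hat d (L.0# , β)
        ≡⟨ size-hat-split L.0# β ⟩
      H L.0# β K.0# ℤ.+ ∑A (λ a → 𝟙 (¬? (a A.≟ A.0#)) ℤ.* H L.0# β (κ a))
        ≡⟨ cong₂ ℤ._+_ (H-τ0-β≢0 L.0# β≢0)
             (trans (∑-cong (enum A.finite) (λ a → 𝟙-*-cong (¬? (a A.≟ A.0#)) (λ a≢0 → value (κ-≢0 a≢0)))) (∑A-nonzero-const _)) ⟩
      0ℤ ℤ.+ (T ℤ.- 1ℤ) ℤ.* ((QL ℤ.- 1ℤ) ℤ.* p-1 ℤ.+ ℤ.- gA ℤ.* (QE ℤ.* p-1 ℤ.* 0ℤ ℤ.- p-1))
        ≡⟨ cong (λ l → 0ℤ ℤ.+ (T ℤ.- 1ℤ) ℤ.* ((l ℤ.- 1ℤ) ℤ.* p-1 ℤ.+ ℤ.- gA ℤ.* (QE ℤ.* p-1 ℤ.* 0ℤ ℤ.- p-1))) QL≡1+[q-1]gA ⟩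
      0ℤ ℤ.+ (T ℤ.- 1ℤ) ℤ.* ((1ℤ ℤ.+ (Q ℤ.- 1ℤ) ℤ.* gA ℤ.- 1ℤ) ℤ.* p-1 ℤ.+ ℤ.- gA ℤ.* (QE ℤ.* p-1 ℤ.* 0ℤ ℤ.- p-1))
        ≡⟨ lem QE p-1 T Q gA ⟩
      p-1 ℤ.* ((T ℤ.- 1ℤ) ℤ.* (Q ℤ.* gA)) ∎
      where
      value : ∀ {τ} → τ ≢ K.0# → H L.0# β τ ≡ (QL ℤ.- 1ℤ) ℤ.* p-1 ℤ.+ ℤ.- gA ℤ.* (QE ℤ.* p-1 ℤ.* 0ℤ ℤ.- p-1)
      value {τ} τ≢0 = trans (H-split L.0# β τ) (cong₂ ℤ._+_ ∑L*-ψ0 (trans (Z-α0 β τ≢0) (cong (ℤ.- gA ℤ.*_) (trans (∑E*-ψ β)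
        (cong (λ i → QE ℤ.* p-1 ℤ.* i ℤ.- p-1) (𝟙-no (β E.≟ E.0#) β≢0))))))
      lem : ∀ E p t q g → 0ℤ ℤ.+ (t ℤ.- 1ℤ) ℤ.* ((1ℤ ℤ.+ (q ℤ.- 1ℤ) ℤ.* g ℤ.- 1ℤ) ℤ.* p ℤ.+ ℤ.- g ℤ.* (E ℤ.* p ℤ.* 0ℤ ℤ.- p)) ≡ p ℤ.* ((t ℤ.- 1ℤ) ℤ.* (q ℤ.* g))
      lem = solve-∀

    -- κ is injective, so the condition on τ = κ a met by a generic eigenvalue holds for at most one a.
    hat-generic : ∀ {α β} → α ≢ L.0# → β ≢ E.0# →
      T ℤ.* hat d (α , β) ≡ p-1 ℤ.* ((T ℤ.- 1ℤ) ℤ.* (Q ℤ.* gA)) ⊎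
      T ℤ.* hat d (α , β) ≡ p-1 ℤ.* ((T ℤ.- 1ℤ) ℤ.* (Q ℤ.* gA) ℤ.- QE)
    hat-generic {α} {β} α≢0 β≢0 = decide (any? hit? (enum A.finite))
      where
      δ = ratio (L.inv α , E.inv β)
      δ≢0 : δ ≢ K.0#
      δ≢0 = K.*-≢0 (NE.norm-≢0 (E.inv-≢0 β≢0)) (K.inv-≢0 (NL.norm-≢0 (L.inv-≢0 α≢0)))
      N₋₁ = NE.norm (E.- E.1#)
      hit? : ∀ a → Dec (N₋₁ ≡ κ a K.* δ)
      hit? a = N₋₁ K.≟ κ a K.* δ
      -1≢0 : E.- E.1# ≢ E.0#
      -1≢0 eq = E.1≢0 (trans (lem E.1#) (trans (cong E.-_ eq) (trans (sym (E.+-identityˡ _)) (E.-‿inverseʳ E.0#))))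
        where
        lem : ∀ a → a ≡ E.- E.- a
        lem = E.solve 1 (λ a → a E.:= E.:- (E.:- a)) refl
      hit≢0 : ∀ {a} → N₋₁ ≡ κ a K.* δ → a ≢ A.0#
      hit≢0 eq refl = NE.norm-≢0 -1≢0 (trans eq (trans (cong (K._* δ) κ-0) (K.zeroˡ δ)))
      value : ∀ {τ} → τ ≢ K.0# → H α β τ ≡ p-1 ℤ.* (Q ℤ.* gA ℤ.- QE ℤ.* 𝟙 (N₋₁ K.≟ τ K.* δ))
      value {τ} τ≢0 = trans (H-split α β τ) (trans (cong₂ ℤ._+_ (∑L*-ψ α≢0) (trans (Z-generic α≢0 β≢0 τ≢0)
        (cong (λ b → p-1 ℤ.* (b ℤ.- QE ℤ.* 𝟙 (N₋₁ K.≟ τ K.* δ))) gB≡1+qgA))) (lem p-1 (Q ℤ.* gA) (QE ℤ.* 𝟙 (N₋₁ K.≟ τ K.* δ))))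
        where
        lem : ∀ p g x → ℤ.- p ℤ.+ p ℤ.* (1ℤ ℤ.+ g ℤ.- x) ≡ p ℤ.* (g ℤ.- x)
        lem = solve-∀
      hits-count : ℤ
      hits-count = ∑A (λ a → 𝟙 (hit? a))
      formula : T ℤ.* hat d (α , β) ≡ p-1 ℤ.* ((T ℤ.- 1ℤ) ℤ.* (Q ℤ.* gA) ℤ.- QE ℤ.* hits-count)
      formula = begin
        T ℤ.* hat d (α , β)
          ≡⟨ size-hat-split α β ⟩
        H α β K.0# ℤ.+ ∑A (λ a → 𝟙 (¬? (a A.≟ A.0#)) ℤ.* H α β (κ a))
          ≡⟨ cong₂ ℤ._+_ (H-τ0-β≢0 α β≢0) (∑-cong (enum A.finite) (λ a → trans (𝟙-*-cong (¬? (a A.≟ A.0#)) (λ a≢0 → value (κ-≢0 a≢0)))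
               (trans (lem₁ (𝟙 (¬? (a A.≟ A.0#))) p-1 (Q ℤ.* gA) QE (𝟙 (hit? a)))
                 (cong (λ z → 𝟙 (¬? (a A.≟ A.0#)) ℤ.* (p-1 ℤ.* (Q ℤ.* gA)) ℤ.- p-1 ℤ.* QE ℤ.* z) (absorb a))))) ⟩
        0ℤ ℤ.+ ∑A (λ a → 𝟙 (¬? (a A.≟ A.0#)) ℤ.* (p-1 ℤ.* (Q ℤ.* gA)) ℤ.- p-1 ℤ.* QE ℤ.* 𝟙 (hit? a))
          ≡⟨ cong (λ z → 0ℤ ℤ.+ z) (trans (∑-- (enum A.finite) _ _) (cong₂ ℤ._-_ (∑A-nonzero-const _) (∑-*ˡ (p-1 ℤ.* QE) (enum A.finite) _))) ⟩
        0ℤ ℤ.+ ((T ℤ.- 1ℤ) ℤ.* (p-1 ℤ.* (Q ℤ.* gA)) ℤ.- p-1 ℤ.* QE ℤ.* hits-count)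
          ≡⟨ lem₂ (T ℤ.- 1ℤ) p-1 (Q ℤ.* gA) QE hits-count ⟩
        p-1 ℤ.* ((T ℤ.- 1ℤ) ℤ.* (Q ℤ.* gA) ℤ.- QE ℤ.* hits-count) ∎
        where
        lem₁ : ∀ i p g E h → i ℤ.* (p ℤ.* (g ℤ.- E ℤ.* h)) ≡ i ℤ.* (p ℤ.* g) ℤ.- p ℤ.* E ℤ.* (i ℤ.* h)
        lem₁ = solve-∀
        lem₂ : ∀ t p g E h → 0ℤ ℤ.+ (t ℤ.* (p ℤ.* g) ℤ.- p ℤ.* E ℤ.* h) ≡ p ℤ.* (t ℤ.* g ℤ.- E ℤ.* h)
        lem₂ = solve-∀
        -- The equation N(-1) = κ a · δ never holds for a = 0, since norms of nonzero elements are
        -- nonzero; the restriction to a ≠ 0 may therefore be dropped in the count of solutions.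
        absorb : ∀ a → 𝟙 (¬? (a A.≟ A.0#)) ℤ.* 𝟙 (hit? a) ≡ 𝟙 (hit? a)
        absorb a = trans (ℤₚ.*-comm (𝟙 (¬? (a A.≟ A.0#))) (𝟙 (hit? a))) (trans (𝟙-*-cong (hit? a) (λ h → 𝟙-yes (¬? (a A.≟ A.0#)) (hit≢0 h))) (ℤₚ.*-identityʳ _))
      decide : Dec (Any (λ a → N₋₁ ≡ κ a K.* δ) (enum A.finite)) →
        T ℤ.* hat d (α , β) ≡ p-1 ℤ.* ((T ℤ.- 1ℤ) ℤ.* (Q ℤ.* gA)) ⊎
        T ℤ.* hat d (α , β) ≡ p-1 ℤ.* ((T ℤ.- 1ℤ) ℤ.* (Q ℤ.* gA) ℤ.- QE)
      decide (no ¬h) = inj₁ (trans formula (trans (cong (λ h → p-1 ℤ.* ((T ℤ.- 1ℤ) ℤ.* (Q ℤ.* gA) ℤ.- QE ℤ.* h))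
          (∑-zero (enum A.finite) (λ a → 𝟙-no (hit? a) (λ h → ¬h (lose (complete A.finite a) h))))) (lem p-1 ((T ℤ.- 1ℤ) ℤ.* (Q ℤ.* gA)) QE)))
        where
        lem : ∀ p g E → p ℤ.* (g ℤ.- E ℤ.* 0ℤ) ≡ p ℤ.* g
        lem = solve-∀
      decide (yes h) = inj₂ (trans formula (cong (λ h → p-1 ℤ.* ((T ℤ.- 1ℤ) ℤ.* (Q ℤ.* gA) ℤ.- h)) (trans (cong (QE ℤ.*_) once) (ℤₚ.*-identityʳ QE))))
        where
        a₀ = proj₁ (find h)
        hit₀ : N₋₁ ≡ κ a₀ K.* δ
        hit₀ = proj₂ (proj₂ (find h))
        once : hits-count ≡ 1ℤ
        once = trans (∑-point A.finite a₀ (λ a → 𝟙 (hit? a)) (λ a ne → 𝟙-no (hit? a) (λ h → ne (κ-injective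
          (K.*-cancelˡ δ≢0 (trans (K.*-comm δ _) (trans (sym h) (trans hit₀ (K.*-comm _ δ))))))))) (𝟙-yes (hit? a₀) hit₀)

    module Result (σ : ℤ) (q≡Tσ : Q ≡ T ℤ.* σ) (1≤T : 1 ℕ.≤ length (enum A.finite)) where
      open Parameters T σ gA

      QL≡X : QL ≡ X
      QL≡X = trans QL≡1+[q-1]gA (cong (λ z → 1ℤ ℤ.+ (z ℤ.- 1ℤ) ℤ.* gA) q≡Tσ)

      QE≡TσX : QE ≡ T ℤ.* σ ℤ.* X
      QE≡TσX = trans (ℤₚ.pos-* q (q ℕ.^ suc ℓ′)) (cong₂ ℤ._*_ q≡Tσ QL≡X)

      private
        cancel-T : ∀ {a b} → T ℤ.* a ≡ T ℤ.* b → a ≡ b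
        cancel-T = *-cancel-pos (length (enum A.finite)) 1≤T

        shift-T : ∀ {h x y} → T ℤ.* h ≡ p-1 ℤ.* x → T ℤ.* y ≡ x → h ≡ p-1 ℤ.* y
        shift-T {h} {x} {y} eq eq′ = cancel-T (trans eq (trans (cong (p-1 ℤ.*_) (sym eq′)) (lem p-1 T y)))
          where
          lem : ∀ a t y → a ℤ.* (t ℤ.* y) ≡ t ℤ.* (a ℤ.* y)
          lem = solve-∀

      hat-d-0 : hat d V.0# ≡ p-1 ℤ.* k
      hat-d-0 = shift-T hat-0 (trans (T*k T σ gA) (sym (cong₂ (λ l m → l ℤ.* m) (cong (ℤ._- 1ℤ) QL≡X)
        (cong₂ (λ u v → u ℤ.- (T ℤ.- 1ℤ) ℤ.* (v ℤ.* gA)) QE≡TσX q≡Tσ))))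

      is-θ₁ : ∀ {w} → T ℤ.* hat d w ≡ p-1 ℤ.* ((T ℤ.- 1ℤ) ℤ.* (Q ℤ.* gA)) → hat d w ≡ p-1 ℤ.* θ₁
      is-θ₁ eq = shift-T eq (trans (T*θ₁ T σ gA) (cong (λ v → (T ℤ.- 1ℤ) ℤ.* (v ℤ.* gA)) (sym q≡Tσ)))

      is-θ₂ : ∀ {w} → T ℤ.* hat d w ≡ p-1 ℤ.* ((T ℤ.- 1ℤ) ℤ.* (Q ℤ.* gA) ℤ.- QE) → hat d w ≡ p-1 ℤ.* θ₂
      is-θ₂ eq = shift-T eq (trans (T*θ₂ T σ gA) (cong₂ (λ u v → (T ℤ.- 1ℤ) ℤ.* (v ℤ.* gA) ℤ.- u) (sym QE≡TσX) (sym q≡Tσ)))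

      Root : ℤ → Set
      Root t = t ℤ.* t ≡ (lam ℤ.- mu) ℤ.* t ℤ.+ (k ℤ.- mu)

      eigenvalue : ∀ w → ∃ λ t → hat d w ≡ p-1 ℤ.* t × (w ≡ V.0# → t ≡ k) × (w ≢ V.0# → Root t)
      eigenvalue (α , β) with α L.≟ L.0# | β E.≟ E.0#
      ... | yes refl | yes refl = k , hat-d-0 , (λ _ → refl) , λ ne → ⊥-elim (ne refl)
      ... | yes refl | no β≢0   = θ₁ , is-θ₁ {L.0# , β} (hat-α0 β≢0) , (λ eq → ⊥-elim (β≢0 (cong proj₂ eq))) , λ _ → quadratic₁ T σ gA
      ... | no α≢0   | yes refl = θ₂ , is-θ₂ {α , E.0#} (hat-β0 α≢0) , (λ eq → ⊥-elim (α≢0 (cong proj₁ eq))) , λ _ → quadratic₂ T σ gA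
      ... | no α≢0   | no β≢0 with hat-generic α≢0 β≢0
      ...   | inj₁ eq = θ₁ , is-θ₁ {α , β} eq , (λ eq → ⊥-elim (α≢0 (cong proj₁ eq))) , λ _ → quadratic₁ T σ gA
      ...   | inj₂ eq = θ₂ , is-θ₂ {α , β} eq , (λ eq → ⊥-elim (α≢0 (cong proj₁ eq))) , λ _ → quadratic₂ T σ gA

      size-V : V.size ≡ X ℤ.* (T ℤ.* σ ℤ.* X)
      size-V = trans (cong ℤ.+_ (trans (length-cartesianProductWith _,_ (enum L.finite) (enum E.finite)) (cong₂ ℕ._*_ order-L order-E)))
        (trans (ℤₚ.pos-* (q ℕ.^ suc ℓ′) _) (cong₂ ℤ._*_ QL≡X QE≡TσX))

      annihilates-· : ∀ c {t} → Annihilates t → Annihilates (φF.ι c K.* t)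
      annihilates-· c {t} z a = trans (cong π.χ (lem (κ a) (φF.ι c) t)) (trans (π.χ-· c _) (trans (cong (c F.*_) (z a)) (F.zeroʳ c)))
        where
        lem : ∀ k c t → k K.* (c K.* t) ≡ c K.* (k K.* t)
        lem = K.solve 3 (λ k c t → k K.:* (c K.:* t) K.:= c K.:* (k K.:* t)) refl

      -- N y / N x is homogeneous of degree (ℓ + 1) − ℓ = 1.
      ratio-· : ∀ c → c ≢ F.0# → ∀ v → proj₁ v ≢ L.0# → ratio (c V.· v) ≡ φF.ι c K.* ratio v
      ratio-· c c≢0 (x , y) x≢0 = begin
        NE.norm (χ.ι u E.* y) K.* K.inv (NL.norm (φ.ι u L.* x))
          ≡⟨ cong₂ (λ m n → m K.* K.inv n) (trans (NE.norm-* _ y) (cong (K._* NE.norm y) (NE.norm-ι u)))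
                   (trans (NL.norm-* _ x) (cong (K._* NL.norm x) (NL.norm-ι u))) ⟩
        u K.* (u K.^ suc ℓ′) K.* NE.norm y K.* K.inv (u K.^ suc ℓ′ K.* NL.norm x)
          ≡⟨ lem u (u K.^ suc ℓ′) (NE.norm y) _ ⟩
        u K.* (NE.norm y K.* (u K.^ suc ℓ′ K.* K.inv (u K.^ suc ℓ′ K.* NL.norm x)))
          ≡⟨ cong (λ z → u K.* (NE.norm y K.* z)) (K.*-cancelˡ (NL.norm-≢0 x≢0) (trans (lem′ (NL.norm x) (u K.^ suc ℓ′) _)
               (trans (K.inverseʳ _ (K.*-≢0 (K.^-≢0 u≢0 (suc ℓ′)) (NL.norm-≢0 x≢0))) (sym (K.inverseʳ _ (NL.norm-≢0 x≢0)))))) ⟩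
        u K.* ratio (x , y) ∎
        where
        u = φF.ι c
        u≢0 : u ≢ K.0#
        u≢0 = MapHom.ι-≢0 {F} {K} φF c≢0
        lem : ∀ u w n i → u K.* w K.* n K.* i ≡ u K.* (n K.* (w K.* i))
        lem = K.solve 4 (λ u w n i → u K.:* w K.:* n K.:* i K.:= u K.:* (n K.:* (w K.:* i))) refl
        lem′ : ∀ n w i → n K.* (w K.* i) ≡ w K.* n K.* i
        lem′ = K.solve 3 (λ n w i → n K.:* (w K.:* i) K.:= w K.:* n K.:* i) refl

      -- The ratio is multiplied by c ∈ F* and R is closed under scalars; the converse uses c⁻¹.
      -- This is the property that entitles e to stand for a single character.
      d-invariant : Invariant d
      d-invariant c c≢0 v = 𝟙-cong (D? (c V.· v)) (D? v)
        (λ (cx≢0 , z) → let x≢0 = λ eq → cx≢0 (trans (cong (φ.ι u L.*_) eq) (L.zeroʳ _)) in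
          x≢0 , subst Annihilates (trans (cong (φF.ι (F.inv c) K.*_) (ratio-· c c≢0 v x≢0)) (undo (ratio v))) (annihilates-· (F.inv c) z))
        (λ (x≢0 , z) → L.*-≢0 (MapHom.ι-≢0 {K} {L} φ u≢0) x≢0 , subst Annihilates (sym (ratio-· c c≢0 v x≢0)) (annihilates-· c z))
        where
        u = φF.ι c
        u≢0 : u ≢ K.0#
        u≢0 = MapHom.ι-≢0 {F} {K} φF c≢0
        undo : ∀ t → φF.ι (F.inv c) K.* (φF.ι c K.* t) ≡ t
        undo t = trans (sym (K.*-assoc _ _ t)) (trans (cong (K._* t) (trans (sym (φF.*-hom (F.inv c) c))
          (trans (cong φF.ι (F.inverseˡ c c≢0)) φF.1-hom))) (K.*-identityˡ t))

      1≤size-V : 1 ℕ.≤ length (enum V.finite)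
      1≤size-V = nonempty (complete V.finite V.0#)
        where
        nonempty : ∀ {x} {xs} → x ∈ xs → 1 ℕ.≤ length xs
        nonempty (here _)  = s≤s z≤n
        nonempty (there _) = s≤s z≤n

      correlation-d : ∀ v → correlation d v ≡ (lam ℤ.- mu) ℤ.* d v ℤ.+ mu ℤ.+ (k ℤ.- mu) ℤ.* 𝟙 (v V.≟ V.0#)
      correlation-d = two-eigenvalues d (λ w → proj₁ (eigenvalue w)) k lam mu d-invariant 1≤size-V
        (λ w → proj₁ (proj₂ (eigenvalue w)))
        (subst (λ t → t ℤ.* t ≡ (lam ℤ.- mu) ℤ.* t ℤ.+ mu ℤ.* V.size ℤ.+ (k ℤ.- mu)) (sym (proj₁ (proj₂ (proj₂ (eigenvalue V.0#))) refl))
          (trans (counting T σ gA) (cong (λ s → (lam ℤ.- mu) ℤ.* k ℤ.+ mu ℤ.* s ℤ.+ (k ℤ.- mu)) (sym size-V))))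
        (λ w w≢0 → proj₂ (proj₂ (proj₂ (eigenvalue w))) w≢0)

      -- At w = 0 every value of e is p - 1, so the transform is (p - 1)|D|: the size of D is its
      -- trivial eigenvalue.
      ∑-d : ∑ (enum V.finite) d ≡ k
      ∑-d = *-cancel-p-1 (trans (trans (ℤₚ.*-comm p-1 _) (trans (sym (∑-*ʳ p-1 (enum V.finite) d))
        (∑-cong (enum V.finite) (λ v → cong (d v ℤ.*_) (sym (trans (cong e (B-0 v)) e-0)))))) hat-d-0)

-- Field extensions of given degree and their coordinates over the prime field.

module Extensions where
  open import Data.Vec using (_++_; take; drop)

  record Extension (K : FiniteField) (n : ℕ) : Set₁ where
    private module K = FiniteField K
    field
      field′ : FiniteField
      hom    : Hom K (FiniteField.commutativeRing field′)
    open FiniteField field′ using (Carrier; _+_; _*_; order)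
    open Hom hom using (ι)
    open VecSpace K n using (V; _+ᵛ_; _·ᵛ_)
    field
      order-field′ : order ≡ K.order ℕ.^ n
      to           : Carrier → V
      from         : V → Carrier
      to-from      : ∀ v → to (from v) ≡ v
      from-to      : ∀ x → from (to x) ≡ x
      to-+         : ∀ x y → to (x + y) ≡ to x +ᵛ to y
      to-ι*        : ∀ c x → to (ι c * x) ≡ c ·ᵛ to x

    from-+ : ∀ u v → from (u +ᵛ v) ≡ from u + from v
    from-+ u v = trans (cong from (trans (cong₂ _+ᵛ_ (sym (to-from u)) (sym (to-from v))) (sym (to-+ _ _)))) (from-to _)

    from-· : ∀ c v → from (c ·ᵛ v) ≡ ι c * from v
    from-· c v = trans (cong from (trans (cong (c ·ᵛ_) (sym (to-from v))) (sym (to-ι* c _)))) (from-to _)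

  private
    -- K[X]/(P) is built on coefficient vectors, so its coordinates are the identity, and the scalar
    -- c acts as multiplication by c times the unit.
    quotientExtension : ∀ K n → (∃ λ P → Irreducible K P × length P ≡ n) → Extension K n
    quotientExtension K n (P , i , refl) = record
      { field′ = field′
      ; hom = scalars
      ; order-field′ = order-field′
      ; to = λ x → x ; from = λ x → x ; to-from = λ _ → refl ; from-to = λ _ → refl
      ; to-+ = λ _ _ → refl
      ; to-ι* = λ c x → trans (*ᵛ-comm (c ·ᵛ e₀) x)
          (trans (act-· (Vec.toList x) c e₀) (cong (c ·ᵛ_) (act-toList x))) }
      where open QuotientField K P i

  abstract
    extension : ∀ K n → 1 ℕ.≤ n → Extension K n
    extension K n 1≤n = quotientExtension K n (Factorisation.irreducible-exists K n 1≤n)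

  -- An isomorphism of additive groups onto F^n. The theorem lives in the group, and this is the
  -- structure by which D and its counts are carried there.
  record Coordinates (F : FiniteField) {X : Set} (_+_ : X → X → X) (n : ℕ) : Set where
    field
      to      : X → Vec (FiniteField.Carrier F) n
      from    : Vec (FiniteField.Carrier F) n → X
      to-from : ∀ v → to (from v) ≡ v
      from-to : ∀ x → from (to x) ≡ x
      to-+    : ∀ x y → to (x + y) ≡ zipWith (FiniteField._+_ F) (to x) (to y)

    from-+ : ∀ u v → from (zipWith (FiniteField._+_ F) u v) ≡ from u + from v
    from-+ u v = trans (cong from (trans (cong₂ (zipWith (FiniteField._+_ F)) (sym (to-from u)) (sym (to-from v))) (sym (to-+ _ _)))) (from-to _)

  module _ {F : FiniteField} where
    private module F = FiniteField F

    take-++ : ∀ {A : Set} m {n} (u : Vec A m) (v : Vec A n) → take m (u ++ v) ≡ u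
    take-++ zero    []      v = refl
    take-++ (suc m) (x ∷ u) v = cong (x ∷_) (take-++ m u v)

    drop-++ : ∀ {A : Set} m {n} (u : Vec A m) (v : Vec A n) → drop m (u ++ v) ≡ v
    drop-++ zero    []      v = refl
    drop-++ (suc m) (x ∷ u) v = drop-++ m u v

    coordinates-× : ∀ {X Y : Set} {_+ˣ_ : X → X → X} {_+ʸ_ : Y → Y → Y} {m n} →
      Coordinates F _+ˣ_ m → Coordinates F _+ʸ_ n →
      Coordinates F {X × Y} (λ (a , b) (c , d) → (a +ˣ c) , (b +ʸ d)) (m ℕ.+ n)
    coordinates-× {m = m} α β = record
      { to      = λ (x , y) → α.to x ++ β.to y
      ; from    = λ v → α.from (take m v) , β.from (drop m v)
      ; to-from = λ v → trans (cong₂ _++_ (α.to-from (take m v)) (β.to-from (drop m v))) (Vecₚ.take++drop≡id m v)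
      ; from-to = λ (x , y) → cong₂ _,_ (trans (cong α.from (take-++ m (α.to x) _)) (α.from-to x))
                                        (trans (cong β.from (drop-++ m (α.to x) _)) (β.from-to y))
      ; to-+    = λ (a , b) (c , d) → trans (cong₂ _++_ (α.to-+ a c) (β.to-+ b d)) (sym (Vecₚ.zipWith-++ F._+_ (α.to a) (β.to b) (α.to c) (β.to d))) }
      where
      module α = Coordinates α
      module β = Coordinates β

    coordinates-Vec : ∀ {X : Set} {_+ˣ_ : X → X → X} {m} → Coordinates F _+ˣ_ m → ∀ n →
      Coordinates F {Vec X n} (zipWith _+ˣ_) (n ℕ.* m)
    coordinates-Vec α zero = record
      { to = λ _ → [] ; from = λ _ → [] ; to-from = λ { [] → refl } ; from-to = λ { [] → refl } ; to-+ = λ _ _ → refl }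
    coordinates-Vec {X} {_+ˣ_} α (suc n) = record
      { to      = λ { (x ∷ xs) → γ.to (x , xs) }
      ; from    = λ v → proj₁ (γ.from v) ∷ proj₂ (γ.from v)
      ; to-from = γ.to-from
      ; from-to = λ { (x ∷ xs) → cong (λ p → proj₁ p ∷ proj₂ p) (γ.from-to (x , xs)) }
      ; to-+    = λ { (x ∷ xs) (y ∷ ys) → γ.to-+ (x , xs) (y , ys) } }
      where
      module γ = Coordinates (coordinates-× α (coordinates-Vec α n))

    coordinates-base : ∀ {n} (K : Extension F n) → Coordinates F (FiniteField._+_ (Extension.field′ K)) n
    coordinates-base K = record { to = to ; from = from ; to-from = to-from ; from-to = from-to ; to-+ = to-+ }
      where open Extension K

    coordinates-extension : ∀ {m n} {K : FiniteField} (L : Extension K n) → Coordinates F (FiniteField._+_ K) m →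
      Coordinates F (FiniteField._+_ (Extension.field′ L)) (n ℕ.* m)
    coordinates-extension {n = n} L α = record
      { to      = γ.to ∘ L.to
      ; from    = L.from ∘ γ.from
      ; to-from = λ v → trans (cong γ.to (L.to-from _)) (γ.to-from v)
      ; from-to = λ x → trans (cong L.from (γ.from-to _)) (L.from-to x)
      ; to-+    = λ x y → trans (cong γ.to (L.to-+ x y)) (γ.to-+ _ _) }
      where
      module γ = Coordinates (coordinates-Vec α n)
      module L = Extension L

open Extensions

open import Defs

-- From integer sums to partial difference sets and strongly regular graphs.

module DifferenceSet (p′ : ℕ) (1<p : 1 ℕ.< suc p′) (p-prime : Prime (suc p′)) where
  open import Data.Integer.Tactic.RingSolver using (solve-∀)
  open import Data.List using (concatMap)
  open import Data.Vec.Relation.Unary.All using ([]; _∷_)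

  F : FiniteField
  F = ℤ/.primeField p′ 1<p p-prime

  open Characters F using (Space)

  private
    p = suc p′
    open ≡-Reasoning

  [_] : Bool → ℤ
  [ true ]  = 1ℤ
  [ false ] = 0ℤ

  []-∧ : ∀ a b → [ a ∧ b ] ≡ [ a ] ℤ.* [ b ]
  []-∧ true  b = sym (ℤₚ.*-identityˡ [ b ])
  []-∧ false b = sym (ℤₚ.*-zeroˡ [ b ])

  []-injective : ∀ {a b} → [ a ] ≡ [ b ] → a ≡ b
  []-injective {true}  {true}  _ = refl
  []-injective {false} {false} _ = refl

  [does] : ∀ {P : Set} (P? : Dec P) → [ does P? ] ≡ 𝟙 P?
  [does] (yes _) = refl
  [does] (no _)  = refl

  countB-∑ : ∀ {A : Set} (P : A → Bool) xs → ℤ.+ countB P xs ≡ ∑ xs (λ x → [ P x ])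
  countB-∑ P []       = refl
  countB-∑ P (x ∷ xs) with P x
  ... | true  = trans (ℤₚ.pos-+ 1 (countB P xs)) (cong (λ z → 1ℤ ℤ.+ z) (countB-∑ P xs))
  ... | false = trans (countB-∑ P xs) (sym (ℤₚ.+-identityˡ _))

  elems-enum : ∀ n → elems p n ≡ enum (finite-Vec (finite-Fin p) n)
  elems-enum zero    = refl
  elems-enum (suc n) = trans (cong (λ ys → concatMap (λ x → List.map (x ∷_) ys) (allFin p)) (elems-enum n))
                             (go (allFin p) (enum (finite-Vec (finite-Fin p) n)))
    where
    go : ∀ (xs : List (Fin p)) (ys : List (Vec (Fin p) n)) → concatMap (λ x → List.map (x ∷_) ys) xs ≡ cartesianProductWith _∷_ xs ys
    go []       ys = refl
    go (x ∷ xs) ys = cong (List.map (x ∷_) ys List.++_) (go xs ys)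

  zero-vector : ∀ {n} {x : G p n} → IsZero x → x ≡ VecSpace.0ᵛ F n
  zero-vector []       = refl
  zero-vector (e ∷ es) = cong₂ _∷_ (Finₚ.toℕ-injective e) (zero-vector es)

  isZero : ∀ n → IsZero (VecSpace.0ᵛ F n)
  isZero zero    = []
  isZero (suc n) = refl ∷ isZero n

  length-elems : ∀ n → length (elems p n) ≡ p ℕ.^ n
  length-elems n = trans (cong length (elems-enum n)) (trans (length-finite-Vec (finite-Fin p) n)
    (cong (ℕ._^ n) (ℤ/.order-primeField p′ 1<p p-prime)))

  -- The autocorrelation of the indicator of D at v equals λ for v ∈ D and μ for v ∉ D, v ≠ 0. Both
  -- conclusions are this one identity: differences in D and common neighbours in the Cayley graph
  -- are counted by the autocorrelation.
  module Transfer (V : Space) {n : ℕ} (coordinates : Coordinates F (Space._+_ V) n) (D : Space.Carrier V → Bool)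
    (k lam mu : ℕ)
    (D-0 : D (Space.0# V) ≡ false)
    (D-neg : ∀ v → D (Space.-_ V v) ≡ D v)
    (∑-D : ∑ (enum (Space.finite V)) (λ v → [ D v ]) ≡ ℤ.+ k)
    (correlation-D : ∀ v → ∑ (enum (Space.finite V)) (λ u → [ D u ] ℤ.* [ D (Space._+_ V v u) ]) ≡
      (ℤ.+ lam ℤ.- ℤ.+ mu) ℤ.* [ D v ] ℤ.+ ℤ.+ mu ℤ.+ (ℤ.+ k ℤ.- ℤ.+ mu) ℤ.* 𝟙 (Space._≟_ V v (Space.0# V)))
    where
    private
      module V = Space V
      module C = Coordinates coordinates
      open VecSpace F n using (_+ᵛ_; -ᵛ_; 0ᵛ; +ᵛ-assoc; +ᵛ-comm; +ᵛ-identityˡ; +ᵛ-identityʳ; +ᵛ-inverseˡ; +ᵛ-inverseʳ)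
      Gₙ = finite-Vec (finite-Fin p) n
      E = elems p n

    set : Subset p n
    set x = D (C.from x)

    from-0 : C.from 0ᵛ ≡ V.0#
    from-0 = V.+-idem⇒0 (trans (sym (C.from-+ 0ᵛ 0ᵛ)) (cong C.from (+ᵛ-identityˡ 0ᵛ)))

    from-≢0 : ∀ {x} → x ≢ 0ᵛ → C.from x ≢ V.0#
    from-≢0 {x} x≢0 e = x≢0 (trans (sym (C.to-from x)) (trans (cong C.to (trans e (sym from-0))) (C.to-from 0ᵛ)))

    from-neg : ∀ x → C.from (⊖ x) ≡ V.- C.from x
    from-neg x = begin
      C.from (⊖ x)                                         ≡⟨ V.+-identityˡ _ ⟨
      V.0# V.+ C.from (⊖ x)                                ≡⟨ cong (V._+ C.from (⊖ x)) (V.+-inverseˡ (C.from x)) ⟨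
      V.- C.from x V.+ C.from x V.+ C.from (⊖ x)           ≡⟨ V.+-assoc _ _ _ ⟩
      V.- C.from x V.+ (C.from x V.+ C.from (⊖ x))         ≡⟨ cong (V.- C.from x V.+_) (trans (sym (C.from-+ x (⊖ x))) (trans (cong C.from (+ᵛ-inverseʳ x)) from-0)) ⟩
      V.- C.from x V.+ V.0#                                ≡⟨ V.+-identityʳ _ ⟩
      V.- C.from x ∎

    symmetric : Symmetric set
    symmetric x = trans (cong D (from-neg x)) (D-neg (C.from x))

    ∑-elems : ∀ f → ∑ E f ≡ ∑ (enum Gₙ) f
    ∑-elems f = cong (λ xs → ∑ xs f) (elems-enum n)

    ∑-from : ∀ f → ∑ E (f ∘ C.from) ≡ ∑ (enum V.finite) f
    ∑-from f = trans (∑-elems (f ∘ C.from)) (∑-bij Gₙ V.finite C.from C.to C.to-from C.from-to f)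

    card-set : card set ≡ k
    card-set = ℤₚ.+-injective (trans (countB-∑ set E) (trans (∑-from (λ v → [ D v ])) ∑-D))

    correlation-set : ∀ x → ∑ E (λ h → [ set h ] ℤ.* [ set (x ⊕ h) ]) ≡
      (ℤ.+ lam ℤ.- ℤ.+ mu) ℤ.* [ set x ] ℤ.+ ℤ.+ mu ℤ.+ (ℤ.+ k ℤ.- ℤ.+ mu) ℤ.* 𝟙 (C.from x V.≟ V.0#)
    correlation-set x = trans (∑-cong E (λ h → cong (λ v → [ set h ] ℤ.* [ D v ]) (C.from-+ x h)))
      (trans (∑-from (λ u → [ D u ] ℤ.* [ D (C.from x V.+ u) ])) (correlation-D (C.from x)))

    set-zero : ∀ {x} → x ≡ 0ᵛ → set x ≡ false
    set-zero refl = trans (cong D from-0) D-0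

    correlation-in : ∀ x → set x ≡ true → ∑ E (λ h → [ set h ] ℤ.* [ set (x ⊕ h) ]) ≡ ℤ.+ lam
    correlation-in x x∈D = trans (correlation-set x) (trans
      (cong₂ (λ b i → (ℤ.+ lam ℤ.- ℤ.+ mu) ℤ.* [ b ] ℤ.+ ℤ.+ mu ℤ.+ (ℤ.+ k ℤ.- ℤ.+ mu) ℤ.* i) x∈D
        (𝟙-no (C.from x V.≟ V.0#) (from-≢0 λ x≡0 → false≢true (trans (sym (set-zero x≡0)) x∈D))))
      (lem (ℤ.+ lam) (ℤ.+ mu) (ℤ.+ k)))
      where
      false≢true : false ≢ true
      false≢true ()
      lem : ∀ l m k → (l ℤ.- m) ℤ.* 1ℤ ℤ.+ m ℤ.+ (k ℤ.- m) ℤ.* 0ℤ ≡ l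
      lem = solve-∀

    correlation-out : ∀ x → x ≢ 0ᵛ → set x ≡ false → ∑ E (λ h → [ set h ] ℤ.* [ set (x ⊕ h) ]) ≡ ℤ.+ mu
    correlation-out x x≢0 x∉D = trans (correlation-set x) (trans
      (cong₂ (λ b i → (ℤ.+ lam ℤ.- ℤ.+ mu) ℤ.* [ b ] ℤ.+ ℤ.+ mu ℤ.+ (ℤ.+ k ℤ.- ℤ.+ mu) ℤ.* i) x∉D
        (𝟙-no (C.from x V.≟ V.0#) (from-≢0 x≢0)))
      (lem (ℤ.+ lam) (ℤ.+ mu) (ℤ.+ k)))
      where
      lem : ∀ l m k → (l ℤ.- m) ℤ.* 0ℤ ℤ.+ m ℤ.+ (k ℤ.- m) ℤ.* 0ℤ ≡ m
      lem = solve-∀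

    _≟ᵍ_ : (x y : G p n) → Dec (x ≡ y)
    _≟ᵍ_ = Vecₚ.≡-dec Finₚ._≟_

    ⊖-⊕ : ∀ g h → (g ⊖ h) ⊕ h ≡ g
    ⊖-⊕ g h = trans (+ᵛ-assoc g (⊖ h) h) (trans (cong (g ⊕_) (+ᵛ-inverseˡ h)) (+ᵛ-identityʳ g))

    ⊕-⊖ : ∀ g h → (g ⊕ h) ⊖ h ≡ g
    ⊕-⊖ g h = trans (+ᵛ-assoc g h (⊖ h)) (trans (cong (g ⊕_) (+ᵛ-inverseʳ h)) (+ᵛ-identityʳ g))

    -- Once g - h = x with x ≠ 0, the demand g ≠ h holds by itself, so the whole condition says that
    -- g = x + h and that both lie in D.
    difference-term : ∀ x → x ≢ 0ᵛ → ∀ g h → [ set g ∧ set h ∧ not (g == h) ∧ ((g ⊖ h) == x) ] ≡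
                      𝟙 (g ≟ᵍ (x ⊕ h)) ℤ.* ([ set h ] ℤ.* [ set g ])
    difference-term x x≢0 g h with g ≟ᵍ (x ⊕ h)
    ... | yes refl = begin
      [ set g ∧ set h ∧ not (g == h) ∧ ((g ⊖ h) == x) ]
        ≡⟨ cong₂ (λ a b → [ set g ∧ set h ∧ not a ∧ b ]) (dec-false (g ≟ᵍ h) distinct) (dec-true ((g ⊖ h) ≟ᵍ x) (⊕-⊖ x h)) ⟩
      [ set g ∧ set h ∧ true ]
        ≡⟨ trans ([]-∧ (set g) _) (cong ([ set g ] ℤ.*_) (trans ([]-∧ (set h) true) (ℤₚ.*-identityʳ _))) ⟩
      [ set g ] ℤ.* [ set h ]
        ≡⟨ trans (ℤₚ.*-comm [ set g ] [ set h ]) (sym (ℤₚ.*-identityˡ _)) ⟩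
      1ℤ ℤ.* ([ set h ] ℤ.* [ set g ]) ∎
      where
      distinct : x ⊕ h ≢ h
      distinct e = x≢0 (trans (sym (⊕-⊖ x h)) (trans (cong (_⊖ h) e) (+ᵛ-inverseʳ h)))
    ... | no ne = begin
      [ set g ∧ set h ∧ not (g == h) ∧ ((g ⊖ h) == x) ]
        ≡⟨ cong (λ b → [ set g ∧ set h ∧ not (g == h) ∧ b ]) (dec-false ((g ⊖ h) ≟ᵍ x) (λ e → ne (trans (sym (⊖-⊕ g h)) (cong (_⊕ h) e)))) ⟩
      [ set g ∧ set h ∧ not (g == h) ∧ false ]
        ≡⟨ lem (set g) (set h) (not (g == h)) ⟩
      0ℤ
        ≡⟨ ℤₚ.*-zeroˡ ([ set h ] ℤ.* [ set g ]) ⟨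
      0ℤ ℤ.* ([ set h ] ℤ.* [ set g ]) ∎
      where
      lem : ∀ a b c → [ a ∧ b ∧ c ∧ false ] ≡ 0ℤ
      lem false b     c     = refl
      lem true  false c     = refl
      lem true  true  false = refl
      lem true  true  true  = refl

    diffCount-correlation : ∀ x → x ≢ 0ᵛ → ℤ.+ diffCount set x ≡ ∑ E (λ h → [ set h ] ℤ.* [ set (x ⊕ h) ])
    diffCount-correlation x x≢0 = begin
      ℤ.+ diffCount set x
        ≡⟨ countB-∑ _ (List.cartesianProduct E E) ⟩
      ∑ (List.cartesianProduct E E) (λ gh → [ set (proj₁ gh) ∧ set (proj₂ gh) ∧ not (proj₁ gh == proj₂ gh) ∧ ((proj₁ gh ⊖ proj₂ gh) == x) ])
        ≡⟨ ∑-cartesianProduct E E _ ⟩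
      ∑ E (λ g → ∑ E (λ h → [ set g ∧ set h ∧ not (g == h) ∧ ((g ⊖ h) == x) ]))
        ≡⟨ ∑-cong E (λ g → ∑-cong E (difference-term x x≢0 g)) ⟩
      ∑ E (λ g → ∑ E (λ h → 𝟙 (g ≟ᵍ (x ⊕ h)) ℤ.* ([ set h ] ℤ.* [ set g ])))
        ≡⟨ ∑-swap E E _ ⟩
      ∑ E (λ h → ∑ E (λ g → 𝟙 (g ≟ᵍ (x ⊕ h)) ℤ.* ([ set h ] ℤ.* [ set g ])))
        ≡⟨ ∑-cong E (λ h → trans (∑-elems _) (trans (∑-cong (enum Gₙ) (λ g → cong (ℤ._* ([ set h ] ℤ.* [ set g ]))
             (𝟙-cong (g ≟ᵍ (x ⊕ h)) (Finite._≟_ Gₙ g (x ⊕ h)) (λ e → e) (λ e → e))))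
             (∑-δ Gₙ (x ⊕ h) (λ g → [ set h ] ℤ.* [ set g ])))) ⟩
      ∑ E (λ h → [ set h ] ℤ.* [ set (x ⊕ h) ]) ∎

    isPDS : ∀ {v} → p ℕ.^ n ≡ v → IsPDS set v k lam mu
    isPDS e = record
      { order   = trans (length-elems n) e
      ; zero∉D  = λ x z → set-zero (zero-vector z)
      ; size    = card-set
      ; inD     = λ x x∈D → ℤₚ.+-injective (trans (diffCount-correlation x λ x≡0 → false≢true (trans (sym (set-zero x≡0)) x∈D)) (correlation-in x x∈D))
      ; notInD  = λ x x≢0 x∉D → let x≢0′ = λ x≡0 → x≢0 (subst IsZero (sym x≡0) (isZero n)) in
                    ℤₚ.+-injective (trans (diffCount-correlation x x≢0′) (correlation-out x x≢0′ x∉D)) }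
      where
      false≢true : false ≢ true
      false≢true ()

    neg-difference : ∀ x y → ⊖ (x ⊖ y) ≡ y ⊖ x
    neg-difference x y = begin
      ⊖ (x ⊖ y)                             ≡⟨ +ᵛ-identityˡ _ ⟨
      0ᵛ ⊕ (⊖ (x ⊖ y))                      ≡⟨ cong (_⊕ (⊖ (x ⊖ y))) (+ᵛ-inverseʳ y) ⟨
      (y ⊖ y) ⊕ (⊖ (x ⊖ y))                 ≡⟨ cong (λ z → (z ⊖ y) ⊕ (⊖ (x ⊖ y))) (⊖-⊕ y x) ⟨
      (((y ⊖ x) ⊕ x) ⊖ y) ⊕ (⊖ (x ⊖ y))     ≡⟨ cong (_⊕ (⊖ (x ⊖ y))) (+ᵛ-assoc (y ⊖ x) x (⊖ y)) ⟩
      ((y ⊖ x) ⊕ (x ⊖ y)) ⊖ (x ⊖ y)         ≡⟨ ⊕-⊖ (y ⊖ x) (x ⊖ y) ⟩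
      y ⊖ x ∎

    ∑-reflect : ∀ x f → ∑ E (λ y → f (x ⊖ y)) ≡ ∑ E f
    ∑-reflect x f = trans (∑-elems (λ y → f (x ⊖ y)))
      (trans (∑-reindex Gₙ (λ y → x ⊖ y) (λ y → x ⊖ y) involutive involutive f) (sym (∑-elems f)))
      where
      involutive : ∀ y → x ⊖ (x ⊖ y) ≡ y
      involutive y = trans (cong (x ⊕_) (neg-difference x y)) (trans (+ᵛ-comm x (y ⊖ x)) (⊖-⊕ y x))

    -- Put h = y - z. Then x - z = (x - y) + h, and common neighbours z of x and y become pairs of
    -- elements of D with difference x - y.
    commonNeighbours : ∀ x y → ℤ.+ countB (λ z → Cay set x z ∧ Cay set y z) E ≡ ∑ E (λ h → [ set h ] ℤ.* [ set ((x ⊖ y) ⊕ h) ])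
    commonNeighbours x y = begin
      ℤ.+ countB (λ z → set (x ⊖ z) ∧ set (y ⊖ z)) E
        ≡⟨ countB-∑ _ E ⟩
      ∑ E (λ z → [ set (x ⊖ z) ∧ set (y ⊖ z) ])
        ≡⟨ ∑-cong E (λ z → trans ([]-∧ (set (x ⊖ z)) _) (trans (ℤₚ.*-comm [ set (x ⊖ z) ] _)
             (cong (λ u → [ set (y ⊖ z) ] ℤ.* [ set u ]) (through z)))) ⟩
      ∑ E (λ z → [ set (y ⊖ z) ] ℤ.* [ set ((x ⊖ y) ⊕ (y ⊖ z)) ])
        ≡⟨ ∑-reflect y (λ h → [ set h ] ℤ.* [ set ((x ⊖ y) ⊕ h) ]) ⟩
      ∑ E (λ h → [ set h ] ℤ.* [ set ((x ⊖ y) ⊕ h) ]) ∎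
      where
      through : ∀ z → x ⊖ z ≡ (x ⊖ y) ⊕ (y ⊖ z)
      through z = trans (cong (_⊖ z) (sym (⊖-⊕ x y))) (+ᵛ-assoc (x ⊖ y) y (⊖ z))

    isSRG : ∀ {v} → p ℕ.^ n ≡ v → IsSRG (Cay set) v k lam mu
    isSRG e = record
      { order        = trans (length-elems n) e
      ; irreflexive  = λ x → set-zero (+ᵛ-inverseʳ x)
      ; symmetric    = λ x y → trans (sym (symmetric (x ⊖ y))) (cong set (neg-difference x y))
      ; regular      = λ x → ℤₚ.+-injective (trans (countB-∑ (Cay set x) E) (trans (∑-reflect x (λ z → [ set z ]))
                         (trans (sym (countB-∑ set E)) (cong ℤ.+_ card-set))))
      ; adjCommon    = λ x y a → ℤₚ.+-injective (trans (commonNeighbours x y) (correlation-in (x ⊖ y) a))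
      ; nonadjCommon = λ x y x≢y a → ℤₚ.+-injective (trans (commonNeighbours x y) (correlation-out (x ⊖ y)
                         (λ z → x≢y (trans (sym (⊖-⊕ x y)) (trans (cong (_⊕ y) z) (+ᵛ-identityˡ y)))) a)) }

open import Data.Nat using (_+_; _*_; _∸_; _^_; _≤_; _≥_)
open import Data.Nat.DivMod using (m*n/n≡m)
open import Data.Vec using (_++_; lookup)

-- The parameters in natural numbers, with floor division and truncated subtraction, as integer
-- polynomials.

module Arithmetic (Q m ℓ r T σ q′ : ℕ) (1≤q′ : 1 ≤ q′) (Q^m : Q ^ m ≡ suc q′) (Q^r : Q ^ r ≡ σ) (1≤σ : 1 ≤ σ) (1≤ℓ : 1 ≤ ℓ)
  (q≡Tσ : suc q′ ≡ T * σ) where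

  private
    a b ρ : ℕ
    a = geo (suc q′) ℓ
    b = geo (suc q′) (suc ℓ)
    ρ = σ ∸ 1

  open Parameters (ℤ.+ T) (ℤ.+ σ) (ℤ.+ a) using (k; lam; mu)

  private
    b≡ : ℤ.+ b ≡ 1ℤ ℤ.+ (1ℤ ℤ.+ ℤ.+ q′) ℤ.* ℤ.+ a
    b≡ = trans (cong ℤ.+_ (geo-suc (suc q′) ℓ)) (cong (λ z → 1ℤ ℤ.+ z) (ℤₚ.pos-* (suc q′) a))

    1≤a : 1 ≤ a
    1≤a = go ℓ 1≤ℓ
      where
      go : ∀ ℓ → 1 ≤ ℓ → 1 ≤ geo (suc q′) ℓ
      go (suc ℓ) _ = subst (1 ≤_) (sym (geo-suc (suc q′) ℓ)) (s≤s z≤n)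

    Q^mℓ : Q ^ (m * ℓ) ≡ suc (q′ * a)
    Q^mℓ = trans (sym (ℕₚ.^-*-assoc Q m ℓ)) (trans (cong (_^ ℓ) Q^m) (geo-closed q′ ℓ))

    Q^m[ℓ+1] : Q ^ (m * (ℓ + 1)) ≡ suc (q′ * b)
    Q^m[ℓ+1] = trans (sym (ℕₚ.^-*-assoc Q m (ℓ + 1))) (trans (cong (_^ (ℓ + 1)) Q^m)
      (trans (cong (suc q′ ^_) (ℕₚ.+-comm ℓ 1)) (geo-closed q′ (suc ℓ))))

    exact : ∀ n {d} → 1 ≤ d → (n * d) /' d ≡ n
    exact n {suc d} _ = m*n/n≡m n (suc d)

    pos-∸ : ∀ {m n} → n ≤ m → ℤ.+ (m ∸ n) ≡ ℤ.+ m ℤ.- ℤ.+ n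
    pos-∸ {m} {n} n≤m = trans (sym (ℤₚ.⊖-≥ n≤m)) (sym (ℤₚ.m-n≡m⊖n m n))

    ρ≡ : ℤ.+ ρ ≡ ℤ.+ σ ℤ.- 1ℤ
    ρ≡ = pos-∸ 1≤σ

    Tσ : ℤ.+ T ℤ.* ℤ.+ σ ≡ 1ℤ ℤ.+ ℤ.+ q′
    Tσ = trans (sym (ℤₚ.pos-* T σ)) (cong ℤ.+_ (sym q≡Tσ))

    ρb : ((Q ^ r ∸ 1) * (Q ^ (m * (ℓ + 1)) ∸ 1)) /' (Q ^ m ∸ 1) ≡ ρ * b
    ρb = trans (cong₂ _/'_ (cong₂ _*_ (cong (_∸ 1) Q^r) (cong (_∸ 1) Q^m[ℓ+1])) (cong (_∸ 1) Q^m))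
      (trans (cong (_/' q′) (lem ρ q′ b)) (exact (ρ * b) 1≤q′))
      where
      lem : ∀ r q b → r * (q * b) ≡ r * b * q
      lem = ℕ-Solver.solve-∀

    ρa : ((Q ^ r ∸ 1) * (Q ^ (m * ℓ) ∸ 1)) /' (Q ^ m ∸ 1) ≡ ρ * a
    ρa = trans (cong₂ _/'_ (cong₂ _*_ (cong (_∸ 1) Q^r) (cong (_∸ 1) Q^mℓ)) (cong (_∸ 1) Q^m))
      (trans (cong (_/' q′) (lem ρ q′ a)) (exact (ρ * a) 1≤q′))
      where
      lem : ∀ r q b → r * (q * b) ≡ r * b * q
      lem = ℕ-Solver.solve-∀

  kR≡k : ℤ.+ kR Q m ℓ r ≡ k
  kR≡k = begin
    ℤ.+ kR Q m ℓ r
      ≡⟨ cong ℤ.+_ (cong₂ _+_ (trans (cong₂ _/'_ (cong₂ _*_ (cong₂ _*_ (cong (_∸ 1) Q^r) (cong (_∸ 1) Q^mℓ)) (cong (_∸ 1) Q^m[ℓ+1])) (cong (_∸ 1) Q^m))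
           -- Both Q^(mℓ) - 1 = q′ a and Q^(m(ℓ+1)) - 1 = q′ b contain the divisor q′, so the
           -- division is exact and one factor q′ remains.
           (trans (cong (_/' q′) (lem ρ q′ a b)) (exact (ρ * a * b * q′) 1≤q′))) (cong (_∸ 1) Q^mℓ)) ⟩
    ℤ.+ (ρ * a * b * q′ + q′ * a)
      ≡⟨ trans (ℤₚ.pos-+ (ρ * a * b * q′) (q′ * a)) (cong₂ ℤ._+_ (trans (ℤₚ.pos-* (ρ * a * b) q′) (cong (ℤ._* ℤ.+ q′) (trans (ℤₚ.pos-* (ρ * a) b) (cong (ℤ._* ℤ.+ b) (ℤₚ.pos-* ρ a))))) (ℤₚ.pos-* q′ a)) ⟩
    ℤ.+ ρ ℤ.* ℤ.+ a ℤ.* ℤ.+ b ℤ.* ℤ.+ q′ ℤ.+ ℤ.+ q′ ℤ.* ℤ.+ a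
      ≡⟨ cong₂ (λ x y → x ℤ.* ℤ.+ a ℤ.* y ℤ.* ℤ.+ q′ ℤ.+ ℤ.+ q′ ℤ.* ℤ.+ a) ρ≡ b≡ ⟩
    (ℤ.+ σ ℤ.- 1ℤ) ℤ.* ℤ.+ a ℤ.* (1ℤ ℤ.+ (1ℤ ℤ.+ ℤ.+ q′) ℤ.* ℤ.+ a) ℤ.* ℤ.+ q′ ℤ.+ ℤ.+ q′ ℤ.* ℤ.+ a
      ≡⟨ identity (ℤ.+ σ) (ℤ.+ q′) (ℤ.+ a) ⟩
    (1ℤ ℤ.+ (1ℤ ℤ.+ ℤ.+ q′ ℤ.- 1ℤ) ℤ.* ℤ.+ a ℤ.- 1ℤ) ℤ.* (1ℤ ℤ.+ (ℤ.+ σ ℤ.- 1ℤ) ℤ.* (1ℤ ℤ.+ (1ℤ ℤ.+ ℤ.+ q′) ℤ.* ℤ.+ a))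
      ≡⟨ cong (λ u → (1ℤ ℤ.+ (u ℤ.- 1ℤ) ℤ.* ℤ.+ a ℤ.- 1ℤ) ℤ.* (1ℤ ℤ.+ (ℤ.+ σ ℤ.- 1ℤ) ℤ.* (1ℤ ℤ.+ u ℤ.* ℤ.+ a))) Tσ ⟨
    k ∎
    where
    open ≡-Reasoning
    lem : ∀ r q a b → r * (q * a) * (q * b) ≡ r * a * b * q * q
    lem = ℕ-Solver.solve-∀
    identity : ∀ s q a → (s ℤ.- 1ℤ) ℤ.* a ℤ.* (1ℤ ℤ.+ (1ℤ ℤ.+ q) ℤ.* a) ℤ.* q ℤ.+ q ℤ.* a ≡
                         (1ℤ ℤ.+ (1ℤ ℤ.+ q ℤ.- 1ℤ) ℤ.* a ℤ.- 1ℤ) ℤ.* (1ℤ ℤ.+ (s ℤ.- 1ℤ) ℤ.* (1ℤ ℤ.+ (1ℤ ℤ.+ q) ℤ.* a))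
    identity = ℤ-Solver.solve-∀

  λR≡lam : ℤ.+ λR Q m ℓ r ≡ lam
  λR≡lam = begin
    ℤ.+ λR Q m ℓ r
      ≡⟨ cong ℤ.+_ (cong₂ _+_ (cong₂ (λ x y → x * (y ∸ 1)) ρb ρa) (cong (_∸ 2) Q^mℓ)) ⟩
    ℤ.+ (ρ * b * (ρ * a ∸ 1) + (suc (q′ * a) ∸ 2))
      ≡⟨ trans (ℤₚ.pos-+ (ρ * b * (ρ * a ∸ 1)) _) (cong₂ ℤ._+_ (truncated ρ)
           -- Q^(mℓ) = 1 + q′ a is at least 2, so subtracting 2 does not truncate.
           (trans (pos-∸ (s≤s (ℕₚ.*-mono-≤ 1≤q′ 1≤a))) (cong (λ z → 1ℤ ℤ.+ z ℤ.- ℤ.+ 2) (ℤₚ.pos-* q′ a)))) ⟩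
    ℤ.+ ρ ℤ.* ℤ.+ b ℤ.* (ℤ.+ ρ ℤ.* ℤ.+ a ℤ.- 1ℤ) ℤ.+ (1ℤ ℤ.+ ℤ.+ q′ ℤ.* ℤ.+ a ℤ.- ℤ.+ 2)
      ≡⟨ cong₂ (λ x y → x ℤ.* y ℤ.* (x ℤ.* ℤ.+ a ℤ.- 1ℤ) ℤ.+ (1ℤ ℤ.+ ℤ.+ q′ ℤ.* ℤ.+ a ℤ.- ℤ.+ 2)) ρ≡ b≡ ⟩
    (ℤ.+ σ ℤ.- 1ℤ) ℤ.* (1ℤ ℤ.+ (1ℤ ℤ.+ ℤ.+ q′) ℤ.* ℤ.+ a) ℤ.* ((ℤ.+ σ ℤ.- 1ℤ) ℤ.* ℤ.+ a ℤ.- 1ℤ) ℤ.+ (1ℤ ℤ.+ ℤ.+ q′ ℤ.* ℤ.+ a ℤ.- ℤ.+ 2)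
      ≡⟨ cong (λ z → (ℤ.+ σ ℤ.- 1ℤ) ℤ.* (1ℤ ℤ.+ (1ℤ ℤ.+ ℤ.+ q′) ℤ.* ℤ.+ a) ℤ.* ((ℤ.+ σ ℤ.- 1ℤ) ℤ.* ℤ.+ a ℤ.- 1ℤ) ℤ.+ (1ℤ ℤ.+ z ℤ.* ℤ.+ a ℤ.- ℤ.+ 2)) (cancel (ℤ.+ q′)) ⟩
    (ℤ.+ σ ℤ.- 1ℤ) ℤ.* (1ℤ ℤ.+ (1ℤ ℤ.+ ℤ.+ q′) ℤ.* ℤ.+ a) ℤ.* ((ℤ.+ σ ℤ.- 1ℤ) ℤ.* ℤ.+ a ℤ.- 1ℤ) ℤ.+ (1ℤ ℤ.+ (1ℤ ℤ.+ ℤ.+ q′ ℤ.- 1ℤ) ℤ.* ℤ.+ a ℤ.- ℤ.+ 2)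
      ≡⟨ cong (λ u → (ℤ.+ σ ℤ.- 1ℤ) ℤ.* (1ℤ ℤ.+ u ℤ.* ℤ.+ a) ℤ.* ((ℤ.+ σ ℤ.- 1ℤ) ℤ.* ℤ.+ a ℤ.- 1ℤ) ℤ.+ (1ℤ ℤ.+ (u ℤ.- 1ℤ) ℤ.* ℤ.+ a ℤ.- ℤ.+ 2)) Tσ ⟨
    lam ∎
    where
    open ≡-Reasoning
    cancel : ∀ q → q ≡ 1ℤ ℤ.+ q ℤ.- 1ℤ
    cancel = ℤ-Solver.solve-∀
    -- For ρ = 0 the subtraction in ρ a ∸ 1 truncates, but the factor ρ b vanishes.
    truncated : ∀ ρ → ℤ.+ (ρ * b * (ρ * a ∸ 1)) ≡ ℤ.+ ρ ℤ.* ℤ.+ b ℤ.* (ℤ.+ ρ ℤ.* ℤ.+ a ℤ.- 1ℤ)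
    truncated zero    = sym (trans (cong (ℤ._* (0ℤ ℤ.* ℤ.+ a ℤ.- 1ℤ)) (ℤₚ.*-zeroˡ (ℤ.+ b))) (ℤₚ.*-zeroˡ (0ℤ ℤ.* ℤ.+ a ℤ.- 1ℤ)))
    truncated (suc ρ) = trans (ℤₚ.pos-* (suc ρ * b) _) (cong₂ ℤ._*_ (ℤₚ.pos-* (suc ρ) b)
      (trans (pos-∸ (ℕₚ.*-mono-≤ (s≤s (z≤n {ρ})) 1≤a)) (cong (ℤ._- 1ℤ) (ℤₚ.pos-* (suc ρ) a))))

  μR≡mu : ℤ.+ μR Q m ℓ r ≡ mu
  μR≡mu = begin
    ℤ.+ μR Q m ℓ r
      ≡⟨ cong ℤ.+_ (cong₂ (λ x y → x * (y + 1)) ρa ρb) ⟩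
    ℤ.+ (ρ * a * (ρ * b + 1))
      ≡⟨ trans (ℤₚ.pos-* (ρ * a) _) (cong₂ ℤ._*_ (ℤₚ.pos-* ρ a) (trans (ℤₚ.pos-+ (ρ * b) 1) (cong (ℤ._+ 1ℤ) (ℤₚ.pos-* ρ b)))) ⟩
    ℤ.+ ρ ℤ.* ℤ.+ a ℤ.* (ℤ.+ ρ ℤ.* ℤ.+ b ℤ.+ 1ℤ)
      ≡⟨ cong₂ (λ x y → x ℤ.* ℤ.+ a ℤ.* (x ℤ.* y ℤ.+ 1ℤ)) ρ≡ b≡ ⟩
    (ℤ.+ σ ℤ.- 1ℤ) ℤ.* ℤ.+ a ℤ.* ((ℤ.+ σ ℤ.- 1ℤ) ℤ.* (1ℤ ℤ.+ (1ℤ ℤ.+ ℤ.+ q′) ℤ.* ℤ.+ a) ℤ.+ 1ℤ)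
      ≡⟨ cong (λ u → (ℤ.+ σ ℤ.- 1ℤ) ℤ.* ℤ.+ a ℤ.* ((ℤ.+ σ ℤ.- 1ℤ) ℤ.* (1ℤ ℤ.+ u ℤ.* ℤ.+ a) ℤ.+ 1ℤ)) Tσ ⟨
    mu ∎
    where open ≡-Reasoning

-- Choice of fields, functional and subspace, and assembly of the result.

module Solution (p′ : ℕ) (1<p : 1 ℕ.< suc p′) (p-prime : Prime (suc p′)) (s m ℓ′ r : ℕ) (1≤s : 1 ≤ s) (1≤m : 1 ≤ m) (r≤m : r ≤ m) where
  private
    p = suc p′
    ℓ = suc ℓ′
    N = s * m * (2 * ℓ + 1)
  open DifferenceSet p′ 1<p p-prime using (F; module Transfer; [_]; [does]; []-injective)
  open Characters F using (Space; Functional)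
  open Spectrum F using (fieldSpace; productSpace; module Construction)
  private module F = FiniteField F

  -- M = s m, in the form that lets pad typecheck without a cast.
  private
    j M : ℕ
    j = s * (m ∸ r)
    M = s * r + j

    M≡sm : M ≡ s * m
    M≡sm = trans (sym (ℕₚ.*-distribˡ-+ s r (m ∸ r))) (cong (s *_) (ℕₚ.m+[n∸m]≡n r≤m))

    1≤M : 1 ≤ M
    1≤M = subst (1 ≤_) (sym M≡sm) (ℕₚ.*-mono-≤ 1≤s 1≤m)

    module K = Extension (extension F M 1≤M)
    Kᶠ = K.field′
    module L = Extension (extension Kᶠ ℓ (s≤s z≤n))
    module E = Extension (extension Kᶠ (suc ℓ) (s≤s z≤n))
    module KF = FiniteField Kᶠ

    i₀ : Fin M
    i₀ = Fin.fromℕ< 1≤M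

  -- A coordinate of K over F serves as a nonzero functional. Since K is a field, (s, t) ↦ π(s t) is
  -- then a nondegenerate pairing, under which R is the annihilator of the image of A.
  π : Functional (fieldSpace Kᶠ K.hom)
  π = record
    { χ   = λ x → lookup (K.to x) i₀
    ; χ-+ = λ x y → trans (cong (λ v → lookup v i₀) (K.to-+ x y)) (Vecₚ.lookup-zipWith F._+_ i₀ (K.to x) (K.to y))
    ; χ-· = λ c x → trans (cong (λ v → lookup v i₀) (K.to-ι* c x)) (Vecₚ.lookup-map i₀ (c F.*_) (K.to x)) }

  π-nontrivial : ∃ λ x → Functional.χ π x ≢ F.0#
  π-nontrivial = K.from (Vec.replicate M F.1#) , λ z → F.1≢0 (trans (sym (Vecₚ.lookup-replicate i₀ F.1#))
    (trans (cong (λ v → lookup v i₀) (sym (K.to-from _))) z))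

  -- Its dimension j = s (m - r) gives it T = p^(s(m-r)) elements, so T · p^(sr) = |K| and R, being
  -- its annihilator in K, has order p^(sr).
  A : Space
  A = record
    { finite = finite-Vec F.finite j ; isAbelianGroup = VecSpace.isAbelianGroup F j
    ; _·_ = VecSpace._·ᵛ_ F j ; ·-+ = ·ᵛ-+ᵛ F ; +-· = +-·ᵛ F ; ·-· = ·ᵛ-· F ; 1-· = 1-·ᵛ F }

  pad : Vec F.Carrier j → Vec F.Carrier M
  pad v = VecSpace.0ᵛ F (s * r) ++ v

  κ : Vec F.Carrier j → KF.Carrier
  κ v = K.from (pad v)

  κ-+ : ∀ u v → κ (VecSpace._+ᵛ_ F j u v) ≡ κ u KF.+ κ v
  κ-+ u v = trans (cong K.from (sym (trans (Vecₚ.zipWith-++ F._+_ (VecSpace.0ᵛ F (s * r)) u (VecSpace.0ᵛ F (s * r)) v)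
    (cong (_++ VecSpace._+ᵛ_ F j u v) (VecSpace.+ᵛ-identityˡ F (s * r) _))))) (K.from-+ (pad u) (pad v))

  κ-· : ∀ c v → κ (VecSpace._·ᵛ_ F j c v) ≡ Hom.ι K.hom c KF.* κ v
  κ-· c v = trans (cong K.from (sym (trans (Vecₚ.map-++ (c F.*_) (VecSpace.0ᵛ F (s * r)) v)
    (cong (_++ VecSpace._·ᵛ_ F j c v) (·ᵛ-0 F (s * r) c))))) (K.from-· c (pad v))

  κ-injective : ∀ {u v} → κ u ≡ κ v → u ≡ v
  κ-injective {u} {v} e = Vecₚ.++-injectiveʳ (VecSpace.0ᵛ F (s * r)) (VecSpace.0ᵛ F (s * r))
    (trans (sym (K.to-from (pad u))) (trans (cong K.to e) (K.to-from (pad v))))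

  private
    module C = Construction Kᶠ L.field′ E.field′ K.hom L.hom E.hom ℓ′ L.order-field′ E.order-field′
                 π π-nontrivial A κ κ-+ κ-· (λ {u} {v} → κ-injective {u} {v})
    module V = Space C.V

    order-F : F.order ≡ p
    order-F = ℤ/.order-primeField p′ 1<p p-prime

    T σ : ℕ
    T = p ^ j
    σ = p ^ (s * r)

    size-A : length (enum (Space.finite A)) ≡ T
    size-A = trans (length-finite-Vec F.finite j) (cong (_^ j) order-F)

    order-K : KF.order ≡ p ^ M
    order-K = trans K.order-field′ (cong (_^ M) order-F)

    q≡Tσ : KF.order ≡ T * σ
    q≡Tσ = trans order-K (trans (ℕₚ.^-distribˡ-+-* p (s * r) j) (ℕₚ.*-comm σ T))

    1≤p^ : ∀ n → 1 ≤ p ^ n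
    1≤p^ n = ℕₚ.m^n>0 p n

    module R = C.Result (ℤ.+ σ) (trans (cong ℤ.+_ (trans q≡Tσ (cong (_* σ) (sym size-A)))) (ℤₚ.pos-* (length (enum (Space.finite A))) σ))
                        (subst (1 ≤_) (sym size-A) (1≤p^ j))

    Q : ℕ
    Q = p ^ s

    order-predecessor : ∃ λ q′ → 1 ≤ q′ × KF.order ≡ suc q′
    order-predecessor = go KF.order (Factorisation.2≤order Kᶠ)
      where
      go : ∀ n → 2 ≤ n → ∃ λ q′ → 1 ≤ q′ × n ≡ suc q′
      go (suc q′) (s≤s l) = q′ , l , refl

    q′ = proj₁ order-predecessor
    q≡1+q′ = proj₂ (proj₂ order-predecessor)

    module Ar = Arithmetic Q m ℓ r T σ q′ (proj₁ (proj₂ order-predecessor))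
      (trans (ℕₚ.^-*-assoc p s m) (trans (cong (p ^_) (sym M≡sm)) (trans (sym order-K) q≡1+q′)))
      (ℕₚ.^-*-assoc p s r) (1≤p^ (s * r)) (s≤s z≤n) (trans (sym q≡1+q′) q≡Tσ)

    same : ∀ (f : ℤ → ℤ → ℤ) → f (ℤ.+ T) (ℤ.+ geo (suc q′) ℓ) ≡ f (Space.size A) (ℤ.+ geo KF.order ℓ)
    same f = cong₂ (λ t q → f (ℤ.+ t) (ℤ.+ geo q ℓ)) (sym size-A) (sym q≡1+q′)

    k≡ : ℤ.+ kR Q m ℓ r ≡ Parameters.k (Space.size A) (ℤ.+ σ) (ℤ.+ geo KF.order ℓ)
    k≡ = trans Ar.kR≡k (same (λ t a → Parameters.k t (ℤ.+ σ) a))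

    lam≡ : ℤ.+ λR Q m ℓ r ≡ Parameters.lam (Space.size A) (ℤ.+ σ) (ℤ.+ geo KF.order ℓ)
    lam≡ = trans Ar.λR≡lam (same (λ t a → Parameters.lam t (ℤ.+ σ) a))

    mu≡ : ℤ.+ μR Q m ℓ r ≡ Parameters.mu (Space.size A) (ℤ.+ σ) (ℤ.+ geo KF.order ℓ)
    mu≡ = trans Ar.μR≡mu (same (λ t a → Parameters.mu t (ℤ.+ σ) a))

    D : V.Carrier → Bool
    D v = does (C.D? v)

    -- Negation is multiplication by the scalar - 1, a special case of invariance under F*.
    D-neg : ∀ v → D (V.- v) ≡ D v
    D-neg v = []-injective (trans ([does] (C.D? (V.- v))) (trans (cong C.d (sym (V.-1-· v)))
      (trans (R.d-invariant (F.- F.1#) -1≢0 v) (sym ([does] (C.D? v))))))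
      where
      -1≢0 : F.- F.1# ≢ F.0#
      -1≢0 e = F.1≢0 (trans (sym (F.+-identityʳ F.1#)) (trans (cong (F.1# F.+_) (sym e)) (F.-‿inverseʳ F.1#)))

    ∑-D : ∑ (enum V.finite) (λ v → [ D v ]) ≡ ℤ.+ kR Q m ℓ r
    ∑-D = trans (∑-cong (enum V.finite) (λ v → [does] (C.D? v))) (trans R.∑-d (sym k≡))

    correlation-D : ∀ v → ∑ (enum V.finite) (λ u → [ D u ] ℤ.* [ D (v V.+ u) ]) ≡
      (ℤ.+ λR Q m ℓ r ℤ.- ℤ.+ μR Q m ℓ r) ℤ.* [ D v ] ℤ.+ ℤ.+ μR Q m ℓ r ℤ.+ (ℤ.+ kR Q m ℓ r ℤ.- ℤ.+ μR Q m ℓ r) ℤ.* 𝟙 (v V.≟ V.0#)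
    correlation-D v = trans (∑-cong (enum V.finite) (λ u → cong₂ ℤ._*_ ([does] (C.D? u)) ([does] (C.D? (v V.+ u)))))
      (trans (R.correlation-d v) (sym (trans
        (cong₂ (λ l d → (l ℤ.- ℤ.+ μR Q m ℓ r) ℤ.* d ℤ.+ ℤ.+ μR Q m ℓ r ℤ.+ (ℤ.+ kR Q m ℓ r ℤ.- ℤ.+ μR Q m ℓ r) ℤ.* 𝟙 (v V.≟ V.0#)) lam≡ ([does] (C.D? v)))
        (cong₂ (λ k μ → (Parameters.lam (Space.size A) (ℤ.+ σ) (ℤ.+ geo KF.order ℓ) ℤ.- μ) ℤ.* C.d v ℤ.+ μ ℤ.+ (k ℤ.- μ) ℤ.* 𝟙 (v V.≟ V.0#)) k≡ mu≡))))

    coordinates : Coordinates F V._+_ N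
    coordinates = subst (Coordinates F V._+_) dimension
      (coordinates-× (coordinates-extension (extension Kᶠ ℓ (s≤s z≤n)) base) (coordinates-extension (extension Kᶠ (suc ℓ) (s≤s z≤n)) base))
      where
      base = coordinates-base (extension F M 1≤M)
      -- L and E have dimensions ℓ and ℓ + 1 over K, and K has dimension M = s m over the prime
      -- field.
      dimension : ℓ * M + suc ℓ * M ≡ N
      dimension = trans (lem ℓ M) (cong (_* (2 * ℓ + 1)) M≡sm)
        where
        lem : ∀ l m → l * m + (1 + l) * m ≡ m * (2 * l + 1)
        lem = ℕ-Solver.solve-∀

    module Tr = Transfer C.V coordinates D (kR Q m ℓ r) (λR Q m ℓ r) (μR Q m ℓ r)
      (dec-false (C.D? V.0#) (λ z → proj₁ z refl)) D-neg ∑-D correlation-D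

    order-V : p ^ N ≡ vR Q m ℓ
    order-V = trans (cong (p ^_) (ℕₚ.*-assoc s m (2 * ℓ + 1))) (sym (ℕₚ.^-*-assoc p s (m * (2 * ℓ + 1))))

  solution : Σ (Subset p N) (λ D →
      IsPDS D (vR Q m ℓ) (kR Q m ℓ r) (λR Q m ℓ r) (μR Q m ℓ r)
    × Symmetric D
    × IsSRG (Cay D) (vR Q m ℓ) (kR Q m ℓ r) (λR Q m ℓ r) (μR Q m ℓ r))
  solution = Tr.set , Tr.isPDS order-V , Tr.symmetric , Tr.isSRG order-V

theorem1p10 : (p s m ℓ : ℕ) → Prime p → s ≥ 1 → m ≥ 1 → ℓ ≥ 1 →
    (r : ℕ) → r ≤ m →
    Σ (Subset p (s * m * (2 * ℓ + 1))) (λ D →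
    IsPDS D (vR (p ^ s) m ℓ) (kR (p ^ s) m ℓ r) (λR (p ^ s) m ℓ r) (μR (p ^ s) m ℓ r)
    × Symmetric D
    × IsSRG (Cay D) (vR (p ^ s) m ℓ) (kR (p ^ s) m ℓ r) (λR (p ^ s) m ℓ r) (μR (p ^ s) m ℓ r))
theorem1p10 zero    s m ℓ        p-prime _   _   _ r _   = ⊥-elim (¬prime[0] p-prime)
theorem1p10 (suc p′) s m (suc ℓ′) p-prime 1≤s 1≤m _ r r≤m =
  Solution.solution p′ (ℕ.nonTrivial⇒n>1 (suc p′) {{prime⇒nonTrivial p-prime}}) p-prime s m ℓ′ r 1≤s 1≤m r≤m
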